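{- Let $G=(V,E)$ be a finite simple connected graph. Then for any vertex $w$ of $G$, $$\beth^{3}(G/w)\le \beth^{3}(G),$$ where $G/w$ is a graph obtained from $G$ by vertex compression of $w$.
   Context: All graphs are finite and simple. A nonedge contraction of a pair $u,v$ of distinct nonadjacent vertices identifies $u$ and $v$ to a single vertex adjacent to exactly those other vertices that are adjacent to $u$ or $v$ (no loops or multiple edges). Vertex compression: for a vertex $w$ of $G$, let $G_w$ be the induced subgraph of $G$ with vertex set $\Gamma_G(w)\cup\{w\}$, where $\Gamma_G(w)$ is the set of neighbours of $w$. $G/w$ denotes the graph obtained from $G$ by successive nonedge contractions on (pairs of vertices of) $G_w$ so that $G_w$ becomes the complete graph $K_w:=K^{\chi(G_w)}$ on $\chi(G_w)$ vertices in $G/w$; the operation is called the vertex compression of $w$. Equivalently, one takes a proper colouring of $G_w$ with $\chi(G_w)$ colours and identifies, in $G$, the vertices within each colour class. The assertion is for any such choice. $C(G)$ is the set of all induced cycles in $G$ (of length at least 3). Solid graphs are the graphs of the following four kinds. (1) Pyramid: a graph consisting of a cycle $C$ and a vertex $a\notin V(C)$ together with at least three edges between $a$ and $C$. (2) Trihedron: the union of three paths $P_1,P_2,P_3$, each of length at least 2, having the same two (distinct) endpoints, such that no interior vertex of any of the paths is used in another of the paths. (3) Stamp: the union of a triangle $T$ and three paths $P_1,P_2,P_3$ of length $\ge 1$ that start at the three different vertices of $T$ and all end at the same vertex $x\notin V(T)$, such that the $P_i-x$ are pairwise vertex-disjoint and each $P_i$ meets $T$ only in its starting vertex. (4) Prism: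 $T\cup T'\cup P_1\cup P_2\cup P_3$ where $T,T'$ are vertex-disjoint triangles with vertices $x_1,x_2,x_3$ and $y_1,y_2,y_3$ respectively, and the $P_i$ are pairwise vertex-disjoint paths from $x_i$ to $y_i$ (so $P_i$ meets $T\cup T'$ only in $x_i,y_i$). A solid in $G$ is an induced subgraph of $G$ that is isomorphic to a solid graph; $S(G)$ is the set of all solids in $G$. The third graph characteristic is $\beth^{3}(G)=|S(G)|-|C(G)|+|E(G)|-|V(G)|$. -}

module Defs where

open import Data.Fin using (Fin; zero; suc; _<_; _<?_)
open import Data.Fin.Properties using (_≟_; any?; all?; injective⇒≤)
open import Data.Fin.Subset using (Subset; inside; outside; _∈_; ∣_∣)
open import Data.Fin.Subset.Properties using (_∈?_; anySubset?)
open import Data.Integer using (ℤ; +_; _+_; _-_)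
open import Data.List using (List; []; _∷_; _++_; [_]; map; length; filter; allFin; cartesianProduct; lookup)
import Data.List.Membership.Propositional as List
import Data.List.Membership.DecPropositional as DecList
open import Data.List.Membership.Propositional.Properties using (∈-lookup)
open import Data.List.Properties using (length-++-≤ˡ; length-++-≤ʳ)
open import Data.List.Relation.Binary.Infix.Heterogeneous using (Infix)
open import Data.List.Relation.Binary.Infix.Heterogeneous.Properties using (infix?)
open import Data.List.Relation.Unary.All as All using ()
open import Data.List.Relation.Unary.AllPairs using (_∷_)
open import Data.List.Relation.Unary.Unique.Propositional using (Unique)
import Data.List.Relation.Unary.Unique.DecPropositional as DecUnique
open import Data.Nat as ℕ using (ℕ; zero; suc; z≤n; s≤s)
import Data.Nat.Properties as ℕ
open import Data.Product using (_×_; _,_; ∃; ∃-syntax)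
open import Data.Sum using (_⊎_; inj₁; inj₂)
open import Data.Vec using (tabulate; []; _∷_)
open import Function using (_⇔_; mk⇔; Equivalence)
open import Function.Definitions using (StrictlySurjective)
open import Level using (0ℓ)
open import Relation.Binary using (Rel; Decidable; Symmetric; Irreflexive)
open import Relation.Binary.Construct.Closure.ReflexiveTransitive using (Star)
open import Relation.Binary.PropositionalEquality using (_≡_; _≢_; refl; cong; ≢-sym)
open import Relation.Nullary using (Dec; yes; no; does; ¬_; contradiction)
open import Relation.Nullary.Decidable using (map′; _×-dec_; _⊎-dec_; _→-dec_; ¬?)
open import Relation.Unary as Unary using (Pred)

record Graph (n : ℕ) : Set₁ where
  field
    Adj    : Rel (Fin n) 0ℓ
    adj?   : Decidable Adj
    sym    : Symmetric Adj
    irrefl : Irreflexive _≡_ Adj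

Connected : ∀ {n} → Graph n → Set
Connected G = ∀ u v → Star (Graph.Adj G) u v

∣V∣ : ∀ {n} → Graph n → ℕ
∣V∣ {n} _ = n

∣E∣ : ∀ {n} → Graph n → ℕ
∣E∣ {n} G = length (filter edge? (cartesianProduct (allFin n) (allFin n)))
  where
  edge? : ((u , v) : Fin n × Fin n) → Dec (u < v × Graph.Adj G u v)
  edge? (u , v) = (u <? v) ×-dec Graph.adj? G u v

-- Graphs whose vertices are some of the elements of Fin n.  They carry
-- their own edges, so that one can speak of unions of paths and triangles
-- and compare these with an induced subgraph.

record PartialGraph (n : ℕ) : Set₁ where
  field
    Vertex  : Pred (Fin n) 0ℓ
    vertex? : Unary.Decidable Vertex
    Edge    : Rel (Fin n) 0ℓ
    edge?   : Decidable Edge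

open PartialGraph

infix  4 _≐_ _≐?_
infixl 6 _∪_

record _≐_ {n} (X Y : PartialGraph n) : Set where
  constructor equal
  field
    vertices : ∀ x → Vertex X x ⇔ Vertex Y x
    edges    : ∀ x y → Edge X x y ⇔ Edge Y x y

_∪_ : ∀ {n} → PartialGraph n → PartialGraph n → PartialGraph n
X ∪ Y = record
  { Vertex  = λ x → Vertex X x ⊎ Vertex Y x
  ; vertex? = λ x → vertex? X x ⊎-dec vertex? Y x
  ; Edge    = λ x y → Edge X x y ⊎ Edge Y x y
  ; edge?   = λ x y → edge? X x y ⊎-dec edge? Y x y
  }

induced : ∀ {n} → Graph n → Subset n → PartialGraph n
induced G S = record
  { Vertex  = _∈ S
  ; vertex? = _∈? S
  ; Edge    = λ x y → x ∈ S × y ∈ S × Adj x y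
  ; edge?   = λ x y → (x ∈? S) ×-dec (y ∈? S) ×-dec adj? x y
  }
  where open Graph G

walk : ∀ {n} → List (Fin n) → PartialGraph n
walk xs = record
  { Vertex  = List._∈ xs
  ; vertex? = λ x → DecList._∈?_ _≟_ x xs
  ; Edge    = λ x y → Infix _≡_ (x ∷ y ∷ []) xs ⊎ Infix _≡_ (y ∷ x ∷ []) xs
  ; edge?   = λ x y → infix? _≟_ (x ∷ y ∷ []) xs ⊎-dec infix? _≟_ (y ∷ x ∷ []) xs
  }

-- The path with ends a and b and interior vertices I, in this order; it has
-- length 1 + length I.
path : ∀ {n} → Fin n → List (Fin n) → Fin n → PartialGraph n
path a I b = walk (a ∷ I ++ [ b ])

-- The cycle passing through c and then through the vertices cs.
cycle : ∀ {n} → Fin n → List (Fin n) → PartialGraph n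
cycle c cs = path c cs c

triangle : ∀ {n} → Fin n → Fin n → Fin n → PartialGraph n
triangle a b c = cycle a (b ∷ c ∷ [])

star : ∀ {n} → Fin n → Subset n → PartialGraph n
star a N = record
  { Vertex  = λ x → x ≡ a ⊎ x ∈ N
  ; vertex? = λ x → (x ≟ a) ⊎-dec (x ∈? N)
  ; Edge    = λ x y → (x ≡ a × y ∈ N) ⊎ (y ≡ a × x ∈ N)
  ; edge?   = λ x y → ((x ≟ a) ×-dec (y ∈? N)) ⊎-dec ((y ≟ a) ×-dec (x ∈? N))
  }

-- In IsCycle and the four kinds of solid graph, one Unique condition expresses
-- both that the paths and cycles do not repeat vertices and that they meet
-- only where they should.

IsCycle : ∀ {n} → PartialGraph n → Set
IsCycle X = ∃[ c ] ∃[ cs ]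
  Unique (c ∷ cs) × 3 ℕ.≤ length (c ∷ cs) × X ≐ cycle c cs

IsPyramid : ∀ {n} → PartialGraph n → Set
IsPyramid {n} X = ∃[ a ] ∃[ c ] ∃[ cs ]
  Unique (a ∷ c ∷ cs) × 3 ℕ.≤ length (c ∷ cs) ×
  ∃ λ (N : Subset n) →
    (∀ x → x ∈ N → x List.∈ c ∷ cs) × 3 ℕ.≤ ∣ N ∣ × X ≐ cycle c cs ∪ star a N

IsTrihedron : ∀ {n} → PartialGraph n → Set
IsTrihedron X = ∃[ a ] ∃[ b ] ∃[ I₁ ] ∃[ I₂ ] ∃[ I₃ ]
  Unique (a ∷ b ∷ I₁ ++ I₂ ++ I₃) ×
  1 ℕ.≤ length I₁ × 1 ℕ.≤ length I₂ × 1 ℕ.≤ length I₃ ×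
  X ≐ path a I₁ b ∪ path a I₂ b ∪ path a I₃ b

IsStamp : ∀ {n} → PartialGraph n → Set
IsStamp X = ∃[ t₁ ] ∃[ t₂ ] ∃[ t₃ ] ∃[ x ] ∃[ I₁ ] ∃[ I₂ ] ∃[ I₃ ]
  Unique (t₁ ∷ t₂ ∷ t₃ ∷ x ∷ I₁ ++ I₂ ++ I₃) ×
  X ≐ triangle t₁ t₂ t₃ ∪ path t₁ I₁ x ∪ path t₂ I₂ x ∪ path t₃ I₃ x

IsPrism : ∀ {n} → PartialGraph n → Set
IsPrism X = ∃[ x₁ ] ∃[ x₂ ] ∃[ x₃ ] ∃[ y₁ ] ∃[ y₂ ] ∃[ y₃ ] ∃[ I₁ ] ∃[ I₂ ] ∃[ I₃ ]
  Unique (x₁ ∷ x₂ ∷ x₃ ∷ y₁ ∷ y₂ ∷ y₃ ∷ I₁ ++ I₂ ++ I₃) ×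
  X ≐ triangle x₁ x₂ x₃ ∪ triangle y₁ y₂ y₃
        ∪ path x₁ I₁ y₁ ∪ path x₂ I₂ y₂ ∪ path x₃ I₃ y₃

IsSolid : ∀ {n} → PartialGraph n → Set
IsSolid X = IsPyramid X ⊎ IsTrihedron X ⊎ IsStamp X ⊎ IsPrism X

_≐?_ : ∀ {n} (X Y : PartialGraph n) → Dec (X ≐ Y)
X ≐? Y = map′ (λ (v , e) → equal v e) (λ (equal v e) → v , e)
  (all? (λ x → vertex? X x ⇔-dec vertex? Y x) ×-dec
   all? (λ x → all? λ y → edge? X x y ⇔-dec edge? Y x y))
  where
  _⇔-dec_ : {A B : Set} → Dec A → Dec B → Dec (A ⇔ B)
  a? ⇔-dec b? = map′ (λ (f , g) → mk⇔ f g)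
                     (λ e → Equivalence.to e , Equivalence.from e)
                     ((a? →-dec b?) ×-dec (b? →-dec a?))

unique? : ∀ {n} (xs : List (Fin n)) → Dec (Unique xs)
unique? = DecUnique.unique? _≟_

lookup-injective : ∀ {n} {xs : List (Fin n)} → Unique xs → ∀ i j →
                   lookup xs i ≡ lookup xs j → i ≡ j
lookup-injective (_ ∷ _)  zero    zero    _  = refl
lookup-injective (x∉ ∷ _) zero    (suc j) eq = contradiction eq (All.lookup x∉ (∈-lookup j))
lookup-injective (x∉ ∷ _) (suc i) zero    eq = contradiction eq (≢-sym (All.lookup x∉ (∈-lookup i)))
lookup-injective (_ ∷ u)  (suc i) (suc j) eq = cong suc (lookup-injective u i j eq)

unique⇒length≤ : ∀ {n} {xs : List (Fin n)} → Unique xs → length xs ℕ.≤ n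
unique⇒length≤ u = injective⇒≤ (λ {i} {j} → lookup-injective u i j)

anyList≤? : ∀ {n} {P : Pred (List (Fin n)) 0ℓ} → Unary.Decidable P →
            ∀ b → Dec (∃[ xs ] length xs ℕ.≤ b × P xs)
anyList≤? P? zero = map′ (λ p → [] , z≤n , p) (λ { ([] , _ , p) → p }) (P? [])
anyList≤? {P = P} P? (suc b) = map′ to from
  (P? [] ⊎-dec any? (λ x → anyList≤? (λ xs → P? (x ∷ xs)) b))
  where
  to : P [] ⊎ (∃[ x ] ∃[ xs ] length xs ℕ.≤ b × P (x ∷ xs)) →
       ∃[ xs ] length xs ℕ.≤ suc b × P xs
  to (inj₁ p)                = [] , z≤n , p
  to (inj₂ (x , xs , l , p)) = x ∷ xs , s≤s l , p

  from : (∃[ xs ] length xs ℕ.≤ suc b × P xs) →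
         P [] ⊎ (∃[ x ] ∃[ xs ] length xs ℕ.≤ b × P (x ∷ xs))
  from ([]     , _     , p) = inj₁ p
  from (x ∷ xs , s≤s l , p) = inj₂ (x , xs , l , p)

anyList? : ∀ {n} {P : Pred (List (Fin n)) 0ℓ} → Unary.Decidable P →
           (∀ xs → P xs → length xs ℕ.≤ n) → Dec (∃ P)
anyList? {n} P? bound =
  map′ (λ (xs , _ , p) → xs , p) (λ (xs , p) → xs , bound xs p , p) (anyList≤? P? n)

any³List? : ∀ {n} (ps : List (Fin n)) {Q : (I₁ I₂ I₃ : List (Fin n)) → Set} →
            (∀ I₁ I₂ I₃ → Dec (Q I₁ I₂ I₃)) →
            Dec (∃[ I₁ ] ∃[ I₂ ] ∃[ I₃ ] Unique (ps ++ I₁ ++ I₂ ++ I₃) × Q I₁ I₂ I₃)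
any³List? {n} ps Q? =
  anyList? (λ I₁ → anyList? (λ I₂ → anyList? (λ I₃ →
    unique? (ps ++ I₁ ++ I₂ ++ I₃) ×-dec Q? I₁ I₂ I₃)
    (λ I₃ (u , _) → ℕ.≤-trans (length-++-≤ʳ I₃ {I₂}) (bound I₁ u)))
    (λ I₂ (I₃ , u , _) → ℕ.≤-trans (length-++-≤ˡ I₂) (bound I₁ u)))
    (λ I₁ (_ , _ , u , _) →
      ℕ.≤-trans (length-++-≤ˡ I₁)
        (ℕ.≤-trans (length-++-≤ʳ _ {ps}) (unique⇒length≤ u)))
  where
  bound : ∀ I {J} → Unique (ps ++ I ++ J) → length J ℕ.≤ n
  bound I {J} u = ℕ.≤-trans (length-++-≤ʳ J {I})
    (ℕ.≤-trans (length-++-≤ʳ (I ++ J) {ps}) (unique⇒length≤ u))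

isCycle? : ∀ {n} (X : PartialGraph n) → Dec (IsCycle X)
isCycle? X = any? λ c → anyList?
  (λ cs → unique? (c ∷ cs) ×-dec (3 ℕ.≤? length (c ∷ cs)) ×-dec (X ≐? cycle c cs))
  (λ _ (u , _) → ℕ.<⇒≤ (unique⇒length≤ u))

isPyramid? : ∀ {n} (X : PartialGraph n) → Dec (IsPyramid X)
isPyramid? X = any? λ a → any? λ c → anyList?
  (λ cs → unique? (a ∷ c ∷ cs) ×-dec (3 ℕ.≤? length (c ∷ cs)) ×-dec
    anySubset? λ N →
      all? (λ x → (x ∈? N) →-dec DecList._∈?_ _≟_ x (c ∷ cs)) ×-dec
      (3 ℕ.≤? ∣ N ∣) ×-dec (X ≐? cycle c cs ∪ star a N))
  (λ _ (u , _) → ℕ.<⇒≤ (ℕ.<⇒≤ (unique⇒length≤ u)))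

isTrihedron? : ∀ {n} (X : PartialGraph n) → Dec (IsTrihedron X)
isTrihedron? X = any? λ a → any? λ b → any³List? (a ∷ b ∷ []) λ I₁ I₂ I₃ →
  (1 ℕ.≤? length I₁) ×-dec (1 ℕ.≤? length I₂) ×-dec (1 ℕ.≤? length I₃) ×-dec
  (X ≐? path a I₁ b ∪ path a I₂ b ∪ path a I₃ b)

isStamp? : ∀ {n} (X : PartialGraph n) → Dec (IsStamp X)
isStamp? X = any? λ t₁ → any? λ t₂ → any? λ t₃ → any? λ x →
  any³List? (t₁ ∷ t₂ ∷ t₃ ∷ x ∷ []) λ I₁ I₂ I₃ →
    X ≐? triangle t₁ t₂ t₃ ∪ path t₁ I₁ x ∪ path t₂ I₂ x ∪ path t₃ I₃ x

isPrism? : ∀ {n} (X : PartialGraph n) → Dec (IsPrism X)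
isPrism? X = any? λ x₁ → any? λ x₂ → any? λ x₃ → any? λ y₁ → any? λ y₂ → any? λ y₃ →
  any³List? (x₁ ∷ x₂ ∷ x₃ ∷ y₁ ∷ y₂ ∷ y₃ ∷ []) λ I₁ I₂ I₃ →
    X ≐? triangle x₁ x₂ x₃ ∪ triangle y₁ y₂ y₃
           ∪ path x₁ I₁ y₁ ∪ path x₂ I₂ y₂ ∪ path x₃ I₃ y₃

isSolid? : ∀ {n} (X : PartialGraph n) → Dec (IsSolid X)
isSolid? X = isPyramid? X ⊎-dec isTrihedron? X ⊎-dec isStamp? X ⊎-dec isPrism? X

subsets : ∀ n → List (Subset n)
subsets zero    = [ [] ]
subsets (suc n) = map (inside ∷_) (subsets n) ++ map (outside ∷_) (subsets n)

-- An induced subgraph is determined by its vertex set, so induced cycles and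
-- solids are counted as vertex sets.

inducedCycles : ∀ {n} → Graph n → List (Subset n)
inducedCycles {n} G = filter (λ S → isCycle? (induced G S)) (subsets n)

solids : ∀ {n} → Graph n → List (Subset n)
solids {n} G = filter (λ S → isSolid? (induced G S)) (subsets n)

ℶ³ : ∀ {n} → Graph n → ℤ
ℶ³ G = + length (solids G) - + length (inducedCycles G) + + ∣E∣ G - + ∣V∣ G

-- H is obtained from G by contracting the nonedge u v, and q maps each vertex
-- of G to the vertex of H it becomes.
record NonedgeContraction {n m} (G : Graph n) (u v : Fin n)
                          (H : Graph m) (q : Fin n → Fin m) : Set where
  field
    distinct    : u ≢ v
    nonadjacent : ¬ Graph.Adj G u v
    surjective  : StrictlySurjective _≡_ q
    identified  : ∀ x y → q x ≡ q y ⇔ (x ≡ y ⊎ (x ≡ u × y ≡ v) ⊎ (x ≡ v × y ≡ u))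
    adjacency   : ∀ a b → Graph.Adj H a b ⇔
                  (∃[ x ] ∃[ y ] q x ≡ a × q y ≡ b × Graph.Adj G x y)

image : ∀ {n m} → (Fin n → Fin m) → Subset n → Subset m
image q W = tabulate λ a → does (any? λ x → (x ∈? W) ×-dec (q x ≟ a))

-- Successive nonedge contractions on pairs of vertices of W, starting from G;
-- W′ is what has become of W in the resulting graph H.
data Contractions : ∀ {n m} (G : Graph n) (W : Subset n) (H : Graph m) (W′ : Subset m) → Set₁ where
  done : ∀ {n} {G : Graph n} {W} → Contractions G W G W
  step : ∀ {n m k} {G : Graph n} {W} {u v} {H : Graph m} {q} {K : Graph k} {W′} →
         u ∈ W → v ∈ W → NonedgeContraction G u v H q →
         Contractions H (image q W) K W′ → Contractions G W K W′

-- Colours are natural numbers below k; values outside X are irrelevant.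
Colourable : ∀ {n} → PartialGraph n → ℕ → Set
Colourable {n} X k = ∃ λ (c : Fin n → ℕ) →
  (∀ x → Vertex X x → c x ℕ.< k) × (∀ x y → Edge X x y → c x ≢ c y)

IsChromaticNumber : ∀ {n} → PartialGraph n → ℕ → Set
IsChromaticNumber X k = Colourable X k × (∀ j → Colourable X j → k ℕ.≤ j)

IsClique : ∀ {n} → Graph n → Subset n → Set
IsClique G W = ∀ x y → x ∈ W → y ∈ W → x ≢ y → Graph.Adj G x y

closedNeighbourhood : ∀ {n} → Graph n → Fin n → Subset n
closedNeighbourhood G w = tabulate λ x → does ((x ≟ w) ⊎-dec Graph.adj? G w x)

-- The graph G/w depends on choices, hence a relation: W, the image of the closed
-- neighbourhood of w, has become a complete graph on χ(G_w) vertices.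
IsVertexCompression : ∀ {n m} → Graph n → Fin n → Graph m → Set₁
IsVertexCompression {m = m} G w H = ∃ λ (W : Subset m) →
  Contractions G (closedNeighbourhood G w) H W ×
  IsClique H W ×
  IsChromaticNumber (induced G (closedNeighbourhood G w)) ∣ W ∣

{-# OPTIONS --safe #-}
-- Over the field with two elements, solids behave like spheres whose faces are
-- their induced cycles, and every relation between induced cycles is a sum of
-- boundaries of solids. Hence, in the parts of G and G/w outside the neighbourhood
-- N[w] and its image K_w, solids, cycles and edges are compared by pushing
-- chains forward and lifting them back: the resulting maps combine to an
-- injection of F₂-vector spaces. Inside N[w], coning with apex w matches solids
-- through w with cycles of N(w), and what remains is that N(w) has at least
-- as many solids as its compression to a complete graph. This follows by compressing
-- the vertices of N(w) in turn, since a disjoint union of complete graphs is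
-- optimally coloured.

module Submission where

import Algebra.Solver.CommutativeMonoid as MonoidSolver
open import Data.Bool as Bool using (Bool; true; false; _∧_; _∨_; not; _xor_)
import Data.Bool.Properties as Bool
open import Data.Empty using (⊥)
open import Data.Fin as Fin using (Fin; zero; suc)
open import Data.Fin.Properties as Fin using (_≟_)
open import Data.Fin.Patterns using (1F; 2F)
open import Data.Fin.Subset as Subset using (Subset; inside; outside; ∣_∣; _⊆_)
 renaming (_∈_ to _∊_; _∉_ to _∉ₛ_)
import Data.Fin.Subset.Properties as Subset
open import Data.Integer as ℤ using (ℤ) renaming (+_ to pos)
import Data.Integer.Properties as ℤ
import Data.Integer.Solver as IntegerSolver
import Data.List
open import Data.List using (List; []; _∷_; _++_; [_]; map; upTo; concatMap; filter; length; allFin; reverse; fromMaybe; cartesianProduct; lookup)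
import Data.List.Properties as List
open import Data.List.Membership.Propositional using (_∈_; _∉_; find; lose)
open import Data.List.Membership.Propositional.Properties using (∈-++⁺ˡ; ∈-++⁺ʳ; ∈-++⁻; ∈-map⁺; ∈-map⁻; ∈-filter⁺; ∈-filter⁻; ∈-allFin; ∈-∃++; ∈-cartesianProduct⁺; ∈-upTo⁺)
import Data.List.Membership.DecPropositional as DecMembership
open import Data.List.Relation.Binary.Disjoint.Propositional using (Disjoint)
open import Data.List.Relation.Binary.Permutation.Propositional as Perm using (_↭_)
import Data.List.Relation.Binary.Permutation.Propositional.Properties as Perm
open import Data.List.Relation.Unary.All as All using (All; []; _∷_)
import Data.List.Relation.Unary.All.Properties as All
open import Data.List.Relation.Unary.AllPairs using ([]; _∷_)
open import Data.List.Relation.Unary.Any as Any using (Any; here; there)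
import Data.List.Relation.Unary.Any.Properties as Any
open import Data.List.Relation.Binary.Infix.Heterogeneous using (Infix; here; there)
open import Data.List.Relation.Binary.Prefix.Heterogeneous using ([]; _∷_)
open import Data.List.Relation.Unary.Unique.Propositional using (Unique)
import Data.List.Relation.Unary.Unique.Propositional.Properties as Unique
open import Data.Maybe as Maybe using (Maybe; just; nothing)
open import Data.Nat as ℕ using (ℕ; zero; suc; z≤n; s≤s; _+_; _≤_; _<_)
import Data.Nat.Properties as ℕ
import Data.Nat.Solver as NaturalSolver
open import Data.Product using (Σ; _×_; _,_; ∃; ∃-syntax; proj₁; proj₂)
import Data.Product.Properties as Product
open import Data.Sum using (_⊎_; inj₁; inj₂; [_,_]′)
open import Data.Vec as Vec using ([]; _∷_; here; there)
import Data.Vec.Properties as Vec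
open import Function using (_∘_; id; _⇔_; mk⇔; Equivalence; case_of_)
open import Relation.Binary.Definitions using (DecidableEquality; tri<; tri≈; tri>)
open import Relation.Binary.PropositionalEquality using (_≡_; _≢_; refl; sym; trans; cong; cong₂; subst; ≢-sym; module ≡-Reasoning)
open import Relation.Nullary using (Dec; yes; no; does; ¬_; contradiction)
open import Relation.Nullary.Decidable using (dec-true; dec-false; decidable-stable; map′; _×-dec_; _⊎-dec_; ¬?)
open import Defs

pattern 1st = Any.here refl
pattern 2nd = Any.there 1st
pattern 3rd = Any.there 2nd

-- Chains over the field with two elements are lists, taken up to the parity
-- of the number of occurrences of each element.

par : {A : Set} → (A → Bool) → List A → Bool
par p [] = false
par p (x ∷ xs) = p x xor par p xs

xor-swap : ∀ a b c d → (a xor b) xor (c xor d) ≡ (a xor c) xor (b xor d)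
xor-swap false false c d = refl
xor-swap false true false d = refl
xor-swap false true true d = refl
xor-swap true false false d = refl
xor-swap true false true d = Bool.not-involutive d
xor-swap true true false d = sym (Bool.not-involutive d)
xor-swap true true true d = refl

xor≡false⇒≡ : ∀ {a b} → a xor b ≡ false → a ≡ b
xor≡false⇒≡ {false} {false} _ = refl
xor≡false⇒≡ {true} {true} _ = refl

≡⇒xor≡false : ∀ {a b} → a ≡ b → a xor b ≡ false
≡⇒xor≡false {a} refl = Bool.xor-same a

xor-cancelˡ : ∀ a b → a xor (a xor b) ≡ b
xor-cancelˡ false b = refl
xor-cancelˡ true b = Bool.not-involutive b

module _ {A : Set} where

 par-++ : ∀ (p : A → Bool) xs ys → par p (xs ++ ys) ≡ par p xs xor par p ys
 par-++ p [] ys = refl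
 par-++ p (x ∷ xs) ys =
  trans (cong (p x xor_) (par-++ p xs ys)) (sym (Bool.xor-assoc (p x) _ _))

 par-cong : ∀ {p q : A → Bool} xs → (∀ {x} → x ∈ xs → p x ≡ q x) → par p xs ≡ par q xs
 par-cong [] eq = refl
 par-cong (x ∷ xs) eq = cong₂ _xor_ (eq 1st) (par-cong xs (eq ∘ there))

 par-const-false : ∀ (xs : List A) → par (λ _ → false) xs ≡ false
 par-const-false [] = refl
 par-const-false (x ∷ xs) = par-const-false xs

 par-false : ∀ {p : A → Bool} xs → (∀ {x} → x ∈ xs → p x ≡ false) → par p xs ≡ false
 par-false xs eq = trans (par-cong xs eq) (par-const-false xs)

 par-xor : ∀ (p q : A → Bool) xs → par (λ x → p x xor q x) xs ≡ par p xs xor par q xs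
 par-xor p q [] = refl
 par-xor p q (x ∷ xs) =
  trans (cong ((p x xor q x) xor_) (par-xor p q xs)) (xor-swap (p x) (q x) _ _)

 par-∧ : ∀ b (p : A → Bool) xs → par (λ x → b ∧ p x) xs ≡ b ∧ par p xs
 par-∧ false p xs = par-const-false xs
 par-∧ true p xs = refl

 par-∧ʳ : ∀ (p : A → Bool) b xs → par (λ x → p x ∧ b) xs ≡ par p xs ∧ b
 par-∧ʳ p b xs = trans (par-cong xs (λ {x} _ → Bool.∧-comm (p x) b))
  (trans (par-∧ b p xs) (Bool.∧-comm b _))

 par-filter : ∀ {P : A → Set} (P? : ∀ x → Dec (P x)) (p : A → Bool) xs →
  par p (filter P? xs) ≡ par (λ x → does (P? x) ∧ p x) xs
 par-filter P? p [] = refl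
 par-filter P? p (x ∷ xs) with does (P? x)
 ... | true = cong (p x xor_) (par-filter P? p xs)
 ... | false = par-filter P? p xs

 par-true⇒∃ : ∀ {p : A → Bool} xs → par p xs ≡ true → ∃[ x ] x ∈ xs × p x ≡ true
 par-true⇒∃ {p} (x ∷ xs) eq with p x in px
 ... | true = x , here refl , px
 ... | false = let y , y∈ , py = par-true⇒∃ xs eq in y , there y∈ , py

module _ {A B : Set} where

 par-concatMap : ∀ (p : B → Bool) (f : A → List B) xs →
  par p (concatMap f xs) ≡ par (λ x → par p (f x)) xs
 par-concatMap p f [] = refl
 par-concatMap p f (x ∷ xs) =
  trans (par-++ p (f x) _) (cong (par p (f x) xor_) (par-concatMap p f xs))

 par-swap : ∀ (f : A → B → Bool) xs ys →
  par (λ x → par (f x) ys) xs ≡ par (λ y → par (λ x → f x y) xs) ys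
 par-swap f [] ys = sym (par-const-false ys)
 par-swap f (x ∷ xs) ys =
  trans (cong (par (f x) ys xor_) (par-swap f xs ys))
   (sym (par-xor (f x) (λ y → par (λ x → f x y) xs) ys))

module _ {A : Set} (_≟_ : DecidableEquality A) where

 par-δ-∉ : ∀ (f : A → Bool) {a} xs → a ∉ xs →
  par (λ x → does (x ≟ a) ∧ f x) xs ≡ false
 par-δ-∉ f {a} xs a∉ = par-false xs λ {x} x∈ →
  cong (_∧ f x) (dec-false (x ≟ a) λ { refl → a∉ x∈ })

 par-δ : ∀ (f : A → Bool) {a} {xs} → Unique xs → a ∈ xs →
  par (λ x → does (x ≟ a) ∧ f x) xs ≡ f a
 par-δ f {a} {_ ∷ xs} (a∉ ∷ _) 1st =
  trans (cong₂ _xor_ (cong (_∧ f a) (dec-true (a ≟ a) refl))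
   (par-δ-∉ f xs (λ a∈ → All.lookup a∉ a∈ refl)))
   (Bool.xor-identityʳ (f a))
 par-δ f {a} {x ∷ _} (x∉ ∷ u) (there a∈) =
  trans (cong (_xor _) (cong (_∧ f x) (dec-false (x ≟ a) (All.lookup x∉ a∈))))
   (par-δ f u a∈)

handshake : ∀ {A : Set} (f : A → A → Bool) xs → (∀ x → f x x ≡ false) →
 (∀ x y → f x y ≡ f y x) → par (λ x → par (f x) xs) xs ≡ false
handshake f [] diag symm = refl
handshake f (x ∷ xs) diag symm = begin
 (f x x xor par (f x) xs) xor par (λ y → f y x xor par (f y) xs) xs
 ≡⟨ cong₂ _xor_ (cong (_xor par (f x) xs) (diag x)) (par-xor (λ y → f y x) (λ y → par (f y) xs) xs) ⟩
  par (f x) xs xor (par (λ y → f y x) xs xor par (λ y → par (f y) xs) xs)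
 ≡⟨ cong₂ (λ a b → par (f x) xs xor (a xor b)) (par-cong xs λ {y} _ → symm y x) (handshake f xs diag symm) ⟩
  par (f x) xs xor (par (f x) xs xor false)
 ≡⟨ xor-cancelˡ (par (f x) xs) false ⟩
  false ∎
 where open ≡-Reasoning

_≟ₛ_ : ∀ {n} → DecidableEquality (Subset n)
_≟ₛ_ = Vec.≡-dec Bool._≟_

mem : ∀ {n} → Subset n → Fin n → Bool
mem = Vec.lookup

∈⇒mem : ∀ {n} {c : Subset n} {x} → x ∊ c → mem c x ≡ true
∈⇒mem = Vec.[]=⇒lookup

mem⇒∈ : ∀ {n} {c : Subset n} {x} → mem c x ≡ true → x ∊ c
mem⇒∈ {c = c} {x} = Vec.lookup⇒[]= x c

∉⇒mem : ∀ {n} {c : Subset n} {x} → x ∉ₛ c → mem c x ≡ false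
∉⇒mem {c = c} {x} x∉ with mem c x in eq
... | true = contradiction (mem⇒∈ eq) x∉
... | false = refl

∈-subsets : ∀ {n} (S : Subset n) → S ∈ subsets n
∈-subsets [] = here refl
∈-subsets (true ∷ S) = ∈-++⁺ˡ (∈-map⁺ _ (∈-subsets S))
∈-subsets {suc n} (false ∷ S) = ∈-++⁺ʳ (map (inside ∷_) (subsets n)) (∈-map⁺ _ (∈-subsets S))

subsets-unique : ∀ n → Unique (subsets n)
subsets-unique zero = [] ∷ []
subsets-unique (suc n) = Unique.++⁺
 (Unique.map⁺ Vec.∷-injectiveʳ (subsets-unique n))
 (Unique.map⁺ Vec.∷-injectiveʳ (subsets-unique n))
 λ (∈in , ∈out) → case (∈-map⁻ _ ∈in , ∈-map⁻ _ ∈out) of λ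
  { ((_ , _ , refl) , (_ , _ , ())) }

infix 4 _≈_

coef : ∀ {n} → List (Subset n) → Subset n → Bool
coef z c = par (λ d → does (d ≟ₛ c)) z

_≈_ : ∀ {n} → List (Subset n) → List (Subset n) → Set
z ≈ z' = ∀ c → coef z c ≡ coef z' c

par-via-coef : ∀ {n} (p : Subset n → Bool) z →
 par p z ≡ par (λ c → coef z c ∧ p c) (subsets n)
par-via-coef {n} p z = sym (begin
 par (λ c → coef z c ∧ p c) (subsets n)
 ≡⟨ par-cong (subsets n) (λ {c} _ → sym (par-∧ʳ (λ d → does (d ≟ₛ c)) (p c) z)) ⟩
  par (λ c → par (λ d → does (d ≟ₛ c) ∧ p c) z) (subsets n)
 ≡⟨ par-swap (λ c d → does (d ≟ₛ c) ∧ p c) (subsets n) z ⟩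
  par (λ d → par (λ c → does (d ≟ₛ c) ∧ p c) (subsets n)) z
 ≡⟨ par-cong z (λ {d} _ → trans
  (par-cong (subsets n) (λ {c} _ → cong (_∧ p c) (≟-sym d c)))
  (par-δ _≟ₛ_ p (subsets-unique n) (∈-subsets d))) ⟩
  par p z ∎)
 where
 open ≡-Reasoning
 ≟-sym : ∀ (c d : Subset n) → does (c ≟ₛ d) ≡ does (d ≟ₛ c)
 ≟-sym c d with c ≟ₛ d
 ... | yes refl = sym (dec-true (d ≟ₛ d) refl)
 ... | no c≢d = sym (dec-false (d ≟ₛ c) (c≢d ∘ sym))

≈⇒par : ∀ {n} {z z' : List (Subset n)} (p : Subset n → Bool) → z ≈ z' → par p z ≡ par p z'
≈⇒par {n} {z} {z'} p eq =
 trans (par-via-coef p z)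
  (trans (par-cong (subsets n) (λ {c} _ → cong (_∧ p c) (eq c)))
   (sym (par-via-coef p z')))

coef-filter-subsets : ∀ {n} {P : Subset n → Set} (P? : ∀ c → Dec (P c)) c →
 coef (filter P? (subsets n)) c ≡ does (P? c)
coef-filter-subsets {n} P? c =
 trans (par-filter P? _ (subsets n))
  (trans (par-cong (subsets n) (λ {d} _ → Bool.∧-comm (does (P? d)) (does (d ≟ₛ c))))
   (par-δ _≟ₛ_ (does ∘ P?) (subsets-unique n) (∈-subsets c)))

≈-concatMap : ∀ {n m} (F : Subset n → List (Subset m)) {z z'} → z ≈ z' → concatMap F z ≈ concatMap F z'
≈-concatMap F {z} {z'} eq c =
 trans (par-concatMap _ F z) (trans (≈⇒par {z = z} {z'} (λ d → coef (F d) c) eq) (sym (par-concatMap _ F z')))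

coef-∉ : ∀ {n} {z : List (Subset n)} {c} → c ∉ z → coef z c ≡ false
coef-∉ {z = z} {c} c∉ = par-false z λ {d} d∈ → dec-false (d ≟ₛ c) λ { refl → c∉ d∈ }

coef-++ : ∀ {n} (z z' : List (Subset n)) c → coef (z ++ z') c ≡ coef z c xor coef z' c
coef-++ z z' c = par-++ _ z z'

coef-concatMap-++ : ∀ {n m} (F : Subset n → List (Subset m)) z z' c →
 coef (concatMap F (z ++ z')) c ≡ coef (concatMap F z) c xor coef (concatMap F z') c
coef-concatMap-++ F z z' c = trans (cong (λ y → coef y c) (List.concatMap-++ F z z')) (coef-++ (concatMap F z) _ c)

module _ {A : Set} (_≟_ : DecidableEquality A) where

 par-other : ∀ (p : A → Bool) {a xs} → Unique xs → a ∈ xs → p a ≡ true → par p xs ≡ false →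
  ∃[ b ] b ∈ xs × b ≢ a × p b ≡ true
 par-other p {a} {xs} u a∈ pa even =
  let b , b∈ , eq = par-true⇒∃ xs odd in b , b∈ , split (b ≟ a) eq
  where
  open ≡-Reasoning
  case-split : ∀ d b → b ≡ (d ∧ b) xor (not d ∧ b)
  case-split false b = refl
  case-split true b = sym (Bool.xor-identityʳ b)

  odd : par (λ x → not (does (x ≟ a)) ∧ p x) xs ≡ true
  odd = trans (sym (xor≡false⇒≡ (begin
   p a xor par (λ x → not (does (x ≟ a)) ∧ p x) xs
   ≡⟨ cong (_xor par (λ x → not (does (x ≟ a)) ∧ p x) xs) (sym (par-δ _≟_ p u a∈)) ⟩
    par (λ x → does (x ≟ a) ∧ p x) xs xor par (λ x → not (does (x ≟ a)) ∧ p x) xs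
   ≡⟨ sym (trans (par-cong xs λ {x} _ → case-split (does (x ≟ a)) (p x)) (par-xor _ _ xs)) ⟩
    par p xs
   ≡⟨ even ⟩
    false ∎))) pa

  split : ∀ {b} (d : Dec (b ≡ a)) → not (does d) ∧ p b ≡ true → b ≢ a × p b ≡ true
  split (no b≢a) eq = b≢a , eq

∧-true : ∀ {a b} → a ∧ b ≡ true → a ≡ true × b ≡ true
∧-true {true} {true} _ = refl , refl

does-true : ∀ {P : Set} (p? : Dec P) → does p? ≡ true → P
does-true (yes p) _ = p

bool-ext : ∀ {a b} → (a ≡ true → b ≡ true) → (b ≡ true → a ≡ true) → a ≡ b
bool-ext {false} {false} f g = refl
bool-ext {false} {true} f g = case g refl of λ ()
bool-ext {true} {false} f g = case f refl of λ ()
bool-ext {true} {true} f g = refl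

x∈p─q⇒x∉q : ∀ {n} (p q : Subset n) {x} → x ∊ p Subset.─ q → x ∉ₛ q
x∈p─q⇒x∉q (inside ∷ p) (outside ∷ q) (there x∈) (there x∈q) = x∈p─q⇒x∉q p q x∈ x∈q
x∈p─q⇒x∉q (outside ∷ p) (outside ∷ q) (there x∈) (there x∈q) = x∈p─q⇒x∉q p q x∈ x∈q
x∈p─q⇒x∉q (_ ∷ p) (inside ∷ q) (there x∈) (there x∈q) = x∈p─q⇒x∉q p q x∈ x∈q

∈-remove⁻ : ∀ {n} (p : Subset n) v {x} → x ∊ p Subset.- v → x ∊ p × x ≢ v
∈-remove⁻ p v x∈ = Subset.p─q⊆p p _ x∈ , λ { refl → x∈p─q⇒x∉q p _ x∈ (Subset.x∈⁅x⁆ v) }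

xor-true : ∀ a {b} → a xor b ≡ true → a ≡ true ⊎ b ≡ true
xor-true false e = inj₂ e
xor-true true e = inj₁ refl

snoc : ∀ {A : Set} (x : A) xs → ∃[ l ] ∃[ b ] x ∷ xs ≡ l ++ [ b ]
snoc x [] = [] , x , refl
snoc x (y ∷ xs) = let l , b , eq = snoc y xs in x ∷ l , b , cong (x ∷_) eq

unique-head : ∀ {A : Set} {x y : A} {xs} → Unique (x ∷ xs) → y ∈ xs → x ≢ y
unique-head (x∉ ∷ _) = All.lookup x∉

Head Last : {A : Set} → A → List A → Set
Head x xs = ∃[ ys ] xs ≡ x ∷ ys
Last x xs = ∃[ ys ] xs ≡ ys ++ [ x ]

module _ {A : Set} where

 head-∈ : ∀ {x : A} {xs} → Head x xs → x ∈ xs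
 head-∈ (_ , refl) = here refl

 last-∈ : ∀ {x : A} {xs} → Last x xs → x ∈ xs
 last-∈ (ys , refl) = ∈-++⁺ʳ ys 1st

 head-unique : ∀ {x y : A} {xs} → Head x xs → Head y xs → x ≡ y
 head-unique (_ , refl) (_ , refl) = refl

 last-unique : ∀ {x y : A} {xs} → Last x xs → Last y xs → x ≡ y
 last-unique (ys , refl) (zs , eq) = List.∷ʳ-injectiveʳ ys zs eq

 head⇒last : ∀ {x : A} {xs} → Head x xs → Last x (reverse xs)
 head⇒last {x} (ys , refl) = reverse ys , List.unfold-reverse x ys

 last⇒head : ∀ {x : A} {xs} → Last x xs → Head x (reverse xs)
 last⇒head {x} (ys , refl) = reverse ys , List.reverse-++ ys [ x ]

 last-∷ : ∀ {x y : A} {xs} → Last x xs → Last x (y ∷ xs)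
 last-∷ {y = y} (ys , refl) = y ∷ ys , refl

 has-head : ∀ {xs : List A} → 1 ≤ length xs → ∃[ x ] Head x xs
 has-head {x ∷ xs} _ = x , xs , refl

 has-last : ∀ {xs : List A} → 1 ≤ length xs → ∃[ x ] Last x xs
 has-last {x ∷ xs} _ = let l , b , eq = snoc x xs in b , l , eq

 unique-last : ∀ l {x : A} → Unique (l ++ [ x ]) → x ∉ l
 unique-last (y ∷ l) u 1st = unique-head u (∈-++⁺ʳ l 1st) refl
 unique-last (y ∷ l) (_ ∷ u) (there x∈) = unique-last l u x∈

 unique-disjoint : ∀ {xs ys : List A} → Unique (xs ++ ys) → Disjoint xs ys
 unique-disjoint {x ∷ xs} u (here refl , y∈) = unique-head u (∈-++⁺ʳ xs y∈) refl
 unique-disjoint {x ∷ xs} (_ ∷ u) (there x∈ , y∈) = unique-disjoint u (x∈ , y∈)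

 unique-++ˡ : ∀ {xs ys : List A} → Unique (xs ++ ys) → Unique xs
 unique-++ˡ {[]} _ = []
 unique-++ˡ {x ∷ xs} (p ∷ u) = All.++⁻ˡ xs p ∷ unique-++ˡ u

 unique-++ʳ : ∀ xs {ys : List A} → Unique (xs ++ ys) → Unique ys
 unique-++ʳ [] u = u
 unique-++ʳ (x ∷ xs) (_ ∷ u) = unique-++ʳ xs u

unique-↭ : ∀ {A : Set} {xs ys : List A} → xs ↭ ys → Unique xs → Unique ys
unique-↭ Perm.refl u = u
unique-↭ (Perm.prep x p) (x∉ ∷ u) = Perm.All-resp-↭ p x∉ ∷ unique-↭ p u
unique-↭ (Perm.swap x y p) ((x≢y ∷ x∉) ∷ (y∉ ∷ u)) =
 (≢-sym x≢y ∷ Perm.All-resp-↭ p y∉) ∷ (Perm.All-resp-↭ p x∉ ∷ unique-↭ p u)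
unique-↭ (Perm.trans p q) u = unique-↭ q (unique-↭ p u)

three : {A : Set} → A → A → A → Fin 3 → A
three a b c zero = a
three a b c 1F = b
three a b c 2F = c

pick : ∀ {n} (p : Subset n) {k} → suc k ≤ ∣ p ∣ → ∃[ x ] ∃[ p' ] x ∊ p × p' ⊆ p × x ∉ₛ p' × k ≤ ∣ p' ∣
pick (inside ∷ p) (s≤s le) = zero , outside ∷ p , here , (λ { (there x∈) → there x∈ }) , (λ ()) , le
pick (outside ∷ p) le with pick p le
... | x , p' , x∈ , p'⊆ , x∉ , le' =
 suc x , outside ∷ p' , there x∈ , (λ { (there y∈) → there (p'⊆ y∈) }) , (λ { (there x∈') → x∉ x∈' }) , le'

three-of : ∀ {n} (p : Subset n) → 3 ≤ ∣ p ∣ →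
 ∃[ s ] ∃[ t ] ∃[ u ] s ∊ p × t ∊ p × u ∊ p × s ≢ t × s ≢ u × t ≢ u
three-of p le with pick p le
... | s , p₁ , s∈ , ⊆₁ , s∉ , le₁ with pick p₁ le₁
... | t , p₂ , t∈ , ⊆₂ , t∉ , le₂ with pick p₂ le₂
... | u , _ , u∈ , _ , _ , _ = s , t , u , s∈ , ⊆₁ t∈ , ⊆₁ (⊆₂ u∈) ,
 (λ { refl → s∉ t∈ }) , (λ { refl → s∉ (⊆₂ u∈) }) , (λ { refl → t∉ u∈ })

of-three : ∀ {n} {p : Subset n} {s t u} → s ∊ p → t ∊ p → u ∊ p → s ≢ t → s ≢ u → t ≢ u → 3 ≤ ∣ p ∣
of-three {p = p} {s} {t} {u} s∈ t∈ u∈ s≢t s≢u t≢u =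
 ℕ.≤-trans (s≤s (ℕ.≤-trans (s≤s (ℕ.≤-trans (s≤s z≤n) (Subset.x∈p⇒∣p-x∣<∣p∣ u∈₂)))
  (Subset.x∈p⇒∣p-x∣<∣p∣ t∈₁))) (Subset.x∈p⇒∣p-x∣<∣p∣ s∈)
 where
 t∈₁ : t ∊ p Subset.- s
 t∈₁ = Subset.x∈p∧x≢y⇒x∈p-y t∈ (s≢t ∘ sym)
 u∈₂ : u ∊ (p Subset.- s) Subset.- t
 u∈₂ = Subset.x∈p∧x≢y⇒x∈p-y (Subset.x∈p∧x≢y⇒x∈p-y u∈ (s≢u ∘ sym)) (t≢u ∘ sym)

module GraphTheory {n : ℕ} (G : Graph n) where

 open Graph G public using (Adj; adj?)

 V : Set
 V = Fin n

 Adj-sym : ∀ {x y} → Adj x y → Adj y x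
 Adj-sym = Graph.sym G

 Adj⇒≢ : ∀ {x y} → Adj x y → x ≢ y
 Adj⇒≢ a refl = Graph.irrefl G refl a

 Far : V → V → Set
 Far x y = x ≢ y × ¬ Adj x y

 Far-sym : ∀ {x y} → Far x y → Far y x
 Far-sym (x≢y , na) = x≢y ∘ sym , na ∘ Adj-sym

 Near : V → V → Set
 Near x y = x ≡ y ⊎ Adj x y

 near? : ∀ x y → Dec (Near x y)
 near? x y = (x ≟ y) ⊎-dec adj? x y

 Near-sym : ∀ {x y} → Near x y → Near y x
 Near-sym (inj₁ refl) = inj₁ refl
 Near-sym (inj₂ a) = inj₂ (Adj-sym a)

 ¬Near⇒Far : ∀ {x y} → ¬ Near x y → Far x y
 ¬Near⇒Far ¬n = ¬n ∘ inj₁ , ¬n ∘ inj₂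

 Far⇒¬Near : ∀ {x y} → Far x y → ¬ Near x y
 Far⇒¬Near (x≢y , _) (inj₁ eq) = x≢y eq
 Far⇒¬Near (_ , na) (inj₂ a) = na a

 Anti : List V → List V → Set
 Anti xs ys = ∀ {x y} → x ∈ xs → y ∈ ys → Far x y

 Anti-sym : ∀ {xs ys} → Anti xs ys → Anti ys xs
 Anti-sym an y∈ x∈ = Far-sym (an x∈ y∈)

 data IPath : List V → Set where
  [] : IPath []
  [-] : ∀ {x} → IPath (x ∷ [])
  link : ∀ {x y zs} → Adj x y → All (Far x) zs → IPath (y ∷ zs) → IPath (x ∷ y ∷ zs)

 ipath-tail : ∀ {x xs} → IPath (x ∷ xs) → IPath xs
 ipath-tail [-] = []
 ipath-tail (link _ _ p) = p

 ipath-unique : ∀ {xs} → IPath xs → Unique xs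
 ipath-unique [] = []
 ipath-unique [-] = [] ∷ []
 ipath-unique (link a far p) =
  (Adj⇒≢ a ∷ All.map proj₁ far) ∷ ipath-unique p

 ipath-suffix : ∀ xs {ys} → IPath (xs ++ ys) → IPath ys
 ipath-suffix [] p = p
 ipath-suffix (_ ∷ xs) p = ipath-suffix xs (ipath-tail p)

 ipath-prefix : ∀ xs {ys} → IPath (xs ++ ys) → IPath xs
 ipath-prefix [] _ = []
 ipath-prefix (x ∷ []) _ = [-]
 ipath-prefix (x ∷ y ∷ xs) (link a far p) =
  link a (All.++⁻ˡ xs far) (ipath-prefix (y ∷ xs) p)

 ipath-join : ∀ xs {x y ys} → IPath (xs ++ [ x ]) → IPath (y ∷ ys) → Adj x y →
  Anti xs (y ∷ ys) → All (Far x) ys → IPath (xs ++ x ∷ y ∷ ys)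
 ipath-join [] p q a an far = link a far q
 ipath-join (u ∷ []) (link b _ p) q a an far =
  link b (All.tabulate (an 1st)) (link a far q)
 ipath-join (u ∷ w ∷ xs) (link b fu p) q a an far =
  link b
   (All.++⁺ (All.++⁻ˡ xs fu) (All.head (All.++⁻ʳ xs fu) ∷ All.tabulate (an 1st)))
   (ipath-join (w ∷ xs) p q a (an ∘ there) far)

 ipath-cut : ∀ xs {x y ys} → IPath (xs ++ x ∷ y ∷ ys) →
  Adj x y × Anti xs (y ∷ ys) × All (Far x) ys
 ipath-cut [] (link a far p) = a , (λ ()) , far
 ipath-cut (u ∷ []) (link _ fu (link a far p)) =
  a , (λ { 1st y∈ → All.lookup fu y∈ }) , far
 ipath-cut (u ∷ w ∷ xs) (link _ fu p) =
  let a , an , far = ipath-cut (w ∷ xs) p in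
  a , (λ { 1st y∈ → All.lookup fu (∈-++⁺ʳ xs (there y∈)) ; (there u∈) → an u∈ }) , far

 ipath-far : ∀ xs {x ys} → IPath (xs ++ x ∷ ys) → Anti xs ys
 ipath-far xs {ys = y ∷ ys} p = proj₁ (proj₂ (ipath-cut xs p))

 ∈-reverse⁻ : ∀ {A : Set} {x : A} {xs} → x ∈ reverse xs → x ∈ xs
 ∈-reverse⁻ = Any.reverse⁻

 ∈-reverse⁺ : ∀ {A : Set} {x : A} {xs} → x ∈ xs → x ∈ reverse xs
 ∈-reverse⁺ = Any.reverse⁺

 ipath-reverse : ∀ {xs} → IPath xs → IPath (reverse xs)
 ipath-reverse [] = []
 ipath-reverse [-] = [-]
 ipath-reverse {x ∷ y ∷ zs} (link a far p) = subst IPath eq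
  (ipath-join (reverse zs) (subst IPath (List.unfold-reverse y zs) (ipath-reverse p)) [-]
   (Adj-sym a) (λ { z∈ 1st → Far-sym (All.lookup far (∈-reverse⁻ z∈)) }) [])
  where
  eq : reverse zs ++ y ∷ x ∷ [] ≡ reverse (x ∷ y ∷ zs)
  eq = sym (trans (List.unfold-reverse x (y ∷ zs))
   (trans (cong (_++ [ x ]) (List.unfold-reverse y zs)) (List.++-assoc (reverse zs) _ _)))

 data Consec (x y : V) : List V → Set where
  here : ∀ {zs} → Consec x y (x ∷ y ∷ zs)
  there : ∀ {z zs} → Consec x y zs → Consec x y (z ∷ zs)

 Consec± : V → V → List V → Set
 Consec± x y xs = Consec x y xs ⊎ Consec y x xs

 consec-∈ˡ : ∀ {x y xs} → Consec x y xs → x ∈ xs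
 consec-∈ˡ here = here refl
 consec-∈ˡ (there c) = there (consec-∈ˡ c)

 consec-∈ʳ : ∀ {x y xs} → Consec x y xs → y ∈ xs
 consec-∈ʳ here = there 1st
 consec-∈ʳ (there c) = there (consec-∈ʳ c)

 consec±-∈ˡ : ∀ {x y xs} → Consec± x y xs → x ∈ xs
 consec±-∈ˡ = [ consec-∈ˡ , consec-∈ʳ ]′

 consec±-∈ʳ : ∀ {x y xs} → Consec± x y xs → y ∈ xs
 consec±-∈ʳ = [ consec-∈ʳ , consec-∈ˡ ]′

 consec±-sym : ∀ {x y xs} → Consec± x y xs → Consec± y x xs
 consec±-sym = [ inj₂ , inj₁ ]′

 consec-++ʳ : ∀ xs {x y ys} → Consec x y ys → Consec x y (xs ++ ys)
 consec-++ʳ [] c = c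
 consec-++ʳ (_ ∷ xs) c = there (consec-++ʳ xs c)

 consec-++ˡ : ∀ {x y xs} ys → Consec x y xs → Consec x y (xs ++ ys)
 consec-++ˡ ys here = here
 consec-++ˡ ys (there c) = there (consec-++ˡ ys c)

 consec-adj : ∀ {x y xs} → IPath xs → Consec x y xs → Adj x y
 consec-adj (link a _ p) here = a
 consec-adj p (there c) = consec-adj (ipath-tail p) c

 consec±-adj : ∀ {x y xs} → IPath xs → Consec± x y xs → Adj x y
 consec±-adj p (inj₁ c) = consec-adj p c
 consec±-adj p (inj₂ c) = Adj-sym (consec-adj p c)

 adj-consec : ∀ {x y xs} → IPath xs → x ∈ xs → y ∈ xs → Adj x y → Consec± x y xs
 adj-consec _ 1st 1st a = contradiction refl (Adj⇒≢ a)
 adj-consec (link _ far p) 1st 2nd a = inj₁ here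
 adj-consec (link _ far p) 1st (there (there y∈)) a = contradiction a (proj₂ (All.lookup far y∈))
 adj-consec (link _ far p) 2nd 1st a = inj₂ here
 adj-consec (link _ far p) (there (there x∈)) 1st a =
  contradiction (Adj-sym a) (proj₂ (All.lookup far x∈))
 adj-consec p (there x∈) (there y∈) a with adj-consec (ipath-tail p) x∈ y∈ a
 ... | inj₁ c = inj₁ (there c)
 ... | inj₂ c = inj₂ (there c)

 -- Walk a xs b: a walk from a to b, where xs lists its vertices after a.
 data Walk : V → List V → V → Set where
  stop : ∀ {a} → Walk a [] a
  step : ∀ {a x xs b} → Adj a x → Walk x xs b → Walk a (x ∷ xs) b

 walk-++ : ∀ {a xs b ys c} → Walk a xs b → Walk b ys c → Walk a (xs ++ ys) c
 walk-++ stop w' = w'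
 walk-++ (step a w) w' = step a (walk-++ w w')

 walk-end : ∀ {a xs b} → Walk a xs b → b ∈ a ∷ xs
 walk-end stop = here refl
 walk-end (step _ w) = there (walk-end w)

 walk-snoc : ∀ {a x xs b} → Walk a (x ∷ xs) b → ∃[ l ] x ∷ xs ≡ l ++ [ b ]
 walk-snoc (step _ stop) = [] , refl
 walk-snoc {x = x} (step _ w@(step _ _)) = let l , eq = walk-snoc w in x ∷ l , cong (x ∷_) eq

 walk-split : ∀ {a xs b} l {u r} → Walk a xs b → a ∷ xs ≡ l ++ u ∷ r → Walk u r b
 walk-split [] w refl = w
 walk-split (_ ∷ []) (step a w) refl = w
 walk-split (_ ∷ x ∷ l) (step a w) eq = walk-split (x ∷ l) w (List.∷-injectiveʳ eq)

 ipath-walk : ∀ xs {x b} → IPath (x ∷ xs ++ [ b ]) → Walk x (xs ++ [ b ]) b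
 ipath-walk [] (link a _ _) = step a stop
 ipath-walk (y ∷ xs) (link a _ p) = step a (ipath-walk xs p)

 private
  attach : ∀ a {x ys b} → Walk x ys b → IPath (x ∷ ys) → Any (Near a) (x ∷ ys) →
   ∃[ zs ] Walk a zs b × IPath (a ∷ zs) × (∀ {u} → u ∈ zs → u ∈ x ∷ ys) ×
    length zs ≤ length (x ∷ ys)
  attach a {x} {ys} w p near with Any.any? (near? a) ys
  attach a {x} {_ ∷ _} (step _ w) p near | yes near' =
   let zs , w' , p' , sub , le = attach a w (ipath-tail p) near' in
   zs , w' , p' , there ∘ sub , ℕ.≤-trans le (ℕ.n≤1+n _)
  attach a {x} {ys} w p (there near) | no ¬near = contradiction near ¬near
  attach a {x} {ys} w p (here (inj₁ refl)) | no ¬near = ys , w , p , there , ℕ.n≤1+n _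
  attach a {x} {ys} w p (here (inj₂ adj)) | no ¬near =
   x ∷ ys , step adj w , link adj (All.map ¬Near⇒Far (All.¬Any⇒All¬ ys ¬near)) p , id , ℕ.≤-refl

 shorten : ∀ {a xs b} → Walk a xs b →
  ∃[ ys ] Walk a ys b × IPath (a ∷ ys) × (∀ {u} → u ∈ a ∷ ys → u ∈ a ∷ xs) ×
   length ys ≤ length xs
 shorten stop = [] , stop , [-] , id , z≤n
 shorten {a} {x ∷ xs} (step adj w) =
  let ys , w₁ , p₁ , sub₁ , le₁ = shorten w
      zs , w₂ , p₂ , sub₂ , le₂ = attach a w₁ p₁ (here (inj₂ adj))
  in zs , w₂ , p₂ , (λ { (here eq) → here eq ; (there u∈) → there (sub₁ (sub₂ u∈)) }) ,
   ℕ.≤-trans le₂ (s≤s le₁)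

 walk-closed : ∀ {a xs b} {P : V → Set} → Walk a xs b → P a →
  (∀ {x y} → x ∈ a ∷ xs → y ∈ xs → P x → Adj x y → P y) → All P xs
 walk-closed stop pa closed = []
 walk-closed (step adj w) pa closed =
  let px = closed 1st 1st pa adj in
  px ∷ walk-closed w px (λ x∈ y∈ → closed (there x∈) (there y∈))

 infix 8 ⟦_⟧

 opaque
  ⟦_⟧ : List V → Subset n
  ⟦ xs ⟧ = Vec.tabulate λ x → does (DecMembership._∈?_ _≟_ x xs)

  ∈⟦⟧⁺ : ∀ {x xs} → x ∈ xs → x ∊ ⟦ xs ⟧
  ∈⟦⟧⁺ {x} {xs} x∈ = mem⇒∈ (trans (Vec.lookup∘tabulate _ x) (dec-true (DecMembership._∈?_ _≟_ x xs) x∈))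

  ∈⟦⟧⁻ : ∀ {x xs} → x ∊ ⟦ xs ⟧ → x ∈ xs
  ∈⟦⟧⁻ {x} {xs} x∈ with DecMembership._∈?_ _≟_ x xs
   | trans (sym (Vec.lookup∘tabulate (λ x → does (DecMembership._∈?_ _≟_ x xs)) x)) (∈⇒mem x∈)
  ... | yes x∈' | _ = x∈'

 Cyc : Subset n → Set
 Cyc c = IsCycle (induced G c)

 opaque
  cyc? : ∀ c → Dec (Cyc c)
  cyc? c = isCycle? (induced G c)

 consec⇒infix : ∀ {x y xs} → Consec x y xs → Infix _≡_ (x ∷ y ∷ []) xs
 consec⇒infix here = here (refl ∷ refl ∷ [])
 consec⇒infix (there c) = there (consec⇒infix c)

 infix⇒consec : ∀ {x y xs} → Infix _≡_ (x ∷ y ∷ []) xs → Consec x y xs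
 infix⇒consec (here (refl ∷ refl ∷ [])) = here
 infix⇒consec (there i) = there (infix⇒consec i)

 edge⇒consec : ∀ {x y} xs → PartialGraph.Edge (walk xs) x y → Consec± x y xs
 edge⇒consec xs (inj₁ i) = inj₁ (infix⇒consec i)
 edge⇒consec xs (inj₂ i) = inj₂ (infix⇒consec i)

 consec⇒edge : ∀ {x y} xs → Consec± x y xs → PartialGraph.Edge (walk xs) x y
 consec⇒edge xs (inj₁ c) = inj₁ (consec⇒infix c)
 consec⇒edge xs (inj₂ c) = inj₂ (consec⇒infix c)

 consec-snoc : ∀ xs {x y b v} → Consec x y (xs ++ b ∷ v ∷ []) →
  Consec x y (xs ++ [ b ]) ⊎ x ≡ b × y ≡ v
 consec-snoc [] here = inj₂ (refl , refl)
 consec-snoc [] (there (there ()))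
 consec-snoc (u ∷ []) here = inj₁ here
 consec-snoc (u ∷ w ∷ xs) here = inj₁ here
 consec-snoc (u ∷ []) (there c) with consec-snoc [] c
 ... | inj₁ c' = inj₁ (there c')
 ... | inj₂ eq = inj₂ eq
 consec-snoc (u ∷ w ∷ xs) (there c) with consec-snoc (w ∷ xs) c
 ... | inj₁ c' = inj₁ (there c')
 ... | inj₂ eq = inj₂ eq

 consec-last : ∀ xs {b v} → Consec b v (xs ++ b ∷ v ∷ [])
 consec-last [] = here
 consec-last (_ ∷ xs) = there (consec-last xs)

 linked⇒ipath : ∀ {xs} → Unique xs → (∀ {x y} → Consec x y xs → Adj x y) →
  (∀ {x y} → x ∈ xs → y ∈ xs → Adj x y → Consec± x y xs) → IPath xs
 linked⇒ipath {[]} _ _ _ = []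
 linked⇒ipath {_ ∷ []} _ _ _ = [-]
 linked⇒ipath {x ∷ y ∷ zs} ((x≢y ∷ x≢) ∷ u) adj chordless =
  link (adj here) (All.tabulate far) (linked⇒ipath u (adj ∘ there) chordless')
  where
  x∉ : ∀ {w} → w ∈ y ∷ zs → x ≢ w
  x∉ = All.lookup (x≢y ∷ x≢)

  far : ∀ {z} → z ∈ zs → Far x z
  far z∈ = x∉ (there z∈) , λ a → case chordless 1st (there (there z∈)) a of λ
   { (inj₁ here) → unique-head u z∈ refl
   ; (inj₁ (there c)) → x∉ (consec-∈ˡ c) refl
   ; (inj₂ here) → x≢y refl
   ; (inj₂ (there c)) → x∉ (consec-∈ʳ c) refl }

  chordless' : ∀ {u w} → u ∈ y ∷ zs → w ∈ y ∷ zs → Adj u w → Consec± u w (y ∷ zs)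
  chordless' u∈ w∈ a with chordless (there u∈) (there w∈) a
  ... | inj₁ here = contradiction refl (x∉ u∈)
  ... | inj₁ (there c) = inj₁ c
  ... | inj₂ here = contradiction refl (x∉ w∈)
  ... | inj₂ (there c) = inj₂ c

 record Rooted (v a : V) (mid : List V) (b : V) : Set where
  constructor rooted
  field
   va : Adj v a
   vb : Adj v b
   far : All (Far v) mid
   arc : IPath (a ∷ mid ++ [ b ])

  arc-∉ : ∀ {x} → x ∈ a ∷ mid ++ [ b ] → v ≢ x
  arc-∉ 1st = Adj⇒≢ va
  arc-∉ (there x∈) with ∈-++⁻ mid x∈
  ... | inj₁ x∈mid = proj₁ (All.lookup far x∈mid)
  ... | inj₂ 1st = Adj⇒≢ vb

  list : List V
  list = v ∷ a ∷ mid ++ [ b ]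

  unique : Unique list
  unique = All.tabulate arc-∉ ∷ ipath-unique arc

  a≢b : a ≢ b
  a≢b = unique-head (ipath-unique arc) (∈-++⁺ʳ mid 1st)

  nbr : ∀ {x} → x ∈ list → Adj v x → x ≡ a ⊎ x ≡ b
  nbr 1st adj = contradiction refl (Adj⇒≢ adj)
  nbr 2nd adj = inj₁ refl
  nbr (there (there x∈)) adj with ∈-++⁻ mid x∈
  ... | inj₁ x∈mid = contradiction adj (proj₂ (All.lookup far x∈mid))
  ... | inj₂ 1st = inj₂ refl

 closure-eq : ∀ (a : V) mid b v → (a ∷ mid ++ [ b ]) ++ [ v ] ≡ (a ∷ mid) ++ b ∷ v ∷ []
 closure-eq a mid b v = List.++-assoc (a ∷ mid) [ b ] [ v ]

 rooted⇒cyc : ∀ {v a mid b} (r : Rooted v a mid b) → Cyc ⟦ Rooted.list r ⟧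
 rooted⇒cyc {v} {a} {mid} {b} r =
  v , a ∷ mid ++ [ b ] , unique ,
  s≤s (s≤s (subst (1 ≤_) (sym (List.length-++ mid)) (ℕ.m≤n+m 1 (length mid)))) ,
  equal (λ x → mk⇔ (∈-closure ∘ ∈⟦⟧⁻) (∈⟦⟧⁺ ∘ ∈-list))
   (λ x y → mk⇔ (λ (x∈ , y∈ , adj) → consec⇒edge closure (to (∈⟦⟧⁻ x∈) (∈⟦⟧⁻ y∈) adj))
    (λ e → let c = edge⇒consec closure e in
     ∈⟦⟧⁺ (∈-list (consec±-∈ˡ c)) , ∈⟦⟧⁺ (∈-list (consec±-∈ʳ c)) , from c))
  where
  open Rooted r
  closure : List V
  closure = v ∷ (a ∷ mid ++ [ b ]) ++ [ v ]

  ∈-closure : ∀ {x} → x ∈ list → x ∈ closure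
  ∈-closure = ∈-++⁺ˡ

  ∈-list : ∀ {x} → x ∈ closure → x ∈ list
  ∈-list x∈ with ∈-++⁻ list x∈
  ... | inj₁ x∈' = x∈'
  ... | inj₂ 1st = here refl

  last-consec : Consec b v closure
  last-consec = there (subst (Consec b v) (sym (closure-eq a mid b v)) (consec-last (a ∷ mid)))

  from-v : ∀ {y} → y ∈ list → Adj v y → Consec± v y closure
  from-v y∈ adj with nbr y∈ adj
  ... | inj₁ refl = inj₁ here
  ... | inj₂ refl = inj₂ last-consec

  to : ∀ {x y} → x ∈ list → y ∈ list → Adj x y → Consec± x y closure
  to 1st y∈ adj = from-v y∈ adj
  to (there x∈) 1st adj = consec±-sym (from-v (there x∈) (Adj-sym adj))
  to (there x∈) (there y∈) adj with adj-consec arc x∈ y∈ adj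
  ... | inj₁ c = inj₁ (there (consec-++ˡ [ v ] c))
  ... | inj₂ c = inj₂ (there (consec-++ˡ [ v ] c))

  from₁ : ∀ {x y} → Consec x y closure → Adj x y
  from₁ here = va
  from₁ (there c) with consec-snoc (a ∷ mid) (subst (Consec _ _) (closure-eq a mid b v) c)
  ... | inj₁ c' = consec-adj arc c'
  ... | inj₂ (refl , refl) = Adj-sym vb

  from : ∀ {x y} → Consec± x y closure → Adj x y
  from (inj₁ c) = from₁ c
  from (inj₂ c) = Adj-sym (from₁ c)

 CycList : List V → Set
 CycList xs = ∃[ v ] ∃[ a ] ∃[ mid ] ∃[ b ] xs ≡ v ∷ a ∷ mid ++ [ b ] × Rooted v a mid b

 cycle⇒list : ∀ {c} v a mid b → Unique (v ∷ a ∷ mid ++ [ b ]) →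
  induced G c ≐ cycle v (a ∷ mid ++ [ b ]) →
  ∃[ xs ] CycList xs × (∀ x → x ∊ c ⇔ x ∈ xs)
 cycle⇒list {c} v a mid b u@(_ ∷ u') eq = list ,
  (v , a , mid , b , refl , record
   { va = from here
   ; vb = Adj-sym (from last-consec)
   ; far = All.tabulate λ {z} z∈ → v∉ (there (∈-++⁺ˡ z∈)) , λ adj →
    case nbr (there (∈-++⁺ˡ z∈)) adj of λ
     { (inj₁ refl) → unique-head u' (∈-++⁺ˡ z∈) refl
     ; (inj₂ refl) → disjoint-last u' z∈ }
   ; arc = linked⇒ipath u' (λ c → from (there (consec-++ˡ [ v ] c))) chordless }) ,
  λ x → mk⇔ (λ x∈ → ∈-list (Equivalence.to (vertices x) x∈))
   (λ x∈ → Equivalence.from (vertices x) (∈-++⁺ˡ x∈))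
  where
  open _≐_ eq
  list closure : List V
  list = v ∷ a ∷ mid ++ [ b ]
  closure = list ++ [ v ]

  ∈-list : ∀ {x} → x ∈ closure → x ∈ list
  ∈-list x∈ with ∈-++⁻ list x∈
  ... | inj₁ x∈' = x∈'
  ... | inj₂ 1st = here refl

  last-consec : Consec b v closure
  last-consec = there (subst (Consec b v) (sym (closure-eq a mid b v)) (consec-last (a ∷ mid)))

  v∉ : ∀ {x} → x ∈ a ∷ mid ++ [ b ] → v ≢ x
  v∉ = unique-head u

  disjoint-last : ∀ {z mid} → Unique (a ∷ mid ++ [ z ]) → z ∉ mid
  disjoint-last (_ ∷ u) z∈ = go _ u z∈
   where
   go : ∀ mid {z : V} → Unique (mid ++ [ z ]) → z ∉ mid
   go (m ∷ mid) u 1st = unique-head u (∈-++⁺ʳ mid 1st) refl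
   go (m ∷ mid) (_ ∷ u) (there z∈) = go mid u z∈

  ∈c : ∀ {x} → x ∈ list → x ∊ c
  ∈c x∈ = Equivalence.from (vertices _) (∈-++⁺ˡ x∈)

  from : ∀ {x y} → Consec x y closure → Adj x y
  from c = proj₂ (proj₂ (Equivalence.from (edges _ _) (consec⇒edge closure (inj₁ c))))

  to : ∀ {x y} → x ∈ list → y ∈ list → Adj x y → Consec± x y closure
  to x∈ y∈ adj = edge⇒consec closure (Equivalence.to (edges _ _) (∈c x∈ , ∈c y∈ , adj))

  path-consec : ∀ {x y} → x ∈ a ∷ mid ++ [ b ] → y ∈ a ∷ mid ++ [ b ] →
   Consec x y closure → Consec x y (a ∷ mid ++ [ b ])
  path-consec x∈ y∈ here = contradiction refl (v∉ x∈)
  path-consec x∈ y∈ (there c) with consec-snoc (a ∷ mid) (subst (Consec _ _) (closure-eq a mid b v) c)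
  ... | inj₁ c' = c'
  ... | inj₂ (refl , refl) = contradiction refl (v∉ y∈)

  chordless : ∀ {x y} → x ∈ a ∷ mid ++ [ b ] → y ∈ a ∷ mid ++ [ b ] → Adj x y →
   Consec± x y (a ∷ mid ++ [ b ])
  chordless x∈ y∈ adj with to (there x∈) (there y∈) adj
  ... | inj₁ c = inj₁ (path-consec x∈ y∈ c)
  ... | inj₂ c = inj₂ (path-consec y∈ x∈ c)

  nbr : ∀ {x} → x ∈ a ∷ mid ++ [ b ] → Adj v x → x ≡ a ⊎ x ≡ b
  nbr x∈ adj with to 1st (there x∈) adj
  ... | inj₁ here = inj₁ refl
  ... | inj₂ here = contradiction refl (v∉ x∈)
  ... | inj₁ (there c) with consec-snoc (a ∷ mid) (subst (Consec _ _) (closure-eq a mid b v) c)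
  ... | inj₁ c' = contradiction refl (v∉ (consec-∈ˡ c'))
  ... | inj₂ (refl , refl) = contradiction refl (v∉ (∈-++⁺ʳ (a ∷ mid) 1st))
  nbr x∈ adj | inj₂ (there c) with consec-snoc (a ∷ mid) (subst (Consec _ _) (closure-eq a mid b v) c)
  ... | inj₁ c' = contradiction refl (v∉ (consec-∈ʳ c'))
  ... | inj₂ (refl , refl) = inj₂ refl

 cyc⇒list : ∀ {c} → Cyc c → ∃[ xs ] CycList xs × (∀ x → x ∊ c ⇔ x ∈ xs)
 cyc⇒list (v , [] , _ , s≤s () , _)
 cyc⇒list (v , _ ∷ [] , _ , s≤s (s≤s ()) , _)
 cyc⇒list {c} (v , a ∷ x ∷ xs , u , _ , eq) =
  let mid , b , e = snoc x xs in
  cycle⇒list v a mid b (subst (λ l → Unique (v ∷ a ∷ l)) e u)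
   (subst (λ l → induced G c ≐ cycle v (a ∷ l)) e eq)

 rotate : ∀ {x xs} → CycList (x ∷ xs) → CycList (xs ++ [ x ])
 rotate (v , a , [] , b , refl , r) =
  a , b , [] , v , refl , record
   { va = adj₁ arc ; vb = Adj-sym va ; far = [] ; arc = link (Adj-sym vb) [] [-] }
  where
  open Rooted r
  adj₁ : ∀ {a b ys} → IPath (a ∷ b ∷ ys) → Adj a b
  adj₁ (link a _ _) = a
 rotate (v , a , m ∷ mid , b , refl , r@(rooted va vb (fm ∷ far) (link am fa p))) =
  a , m , mid ++ [ b ] , v , refl , record
   { va = am
   ; vb = Adj-sym va
   ; far = fa
   ; arc = subst IPath (sym (List.++-assoc (m ∷ mid) [ b ] [ v ]))
    (ipath-join (m ∷ mid) p [-] (Adj-sym vb)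
     (λ { x∈ 1st → Far-sym (All.lookup (fm ∷ far) x∈) }) []) }

 rotate-to : ∀ l {x r} → CycList (l ++ x ∷ r) → CycList (x ∷ r ++ l)
 rotate-to [] {x} {r} c = subst CycList (cong (x ∷_) (sym (List.++-identityʳ r))) c
 rotate-to (y ∷ l) {x} {r} c =
  subst CycList (cong (x ∷_) (List.++-assoc r [ y ] l))
   (rotate-to l (subst CycList (List.++-assoc l (x ∷ r) [ y ]) (rotate c)))

 record RootedIn (v : V) (c : Subset n) : Set where
  field
   {a b} : V
   {mid} : List V
   root : Rooted v a mid b
   ⊆list : ∀ {x} → x ∊ c → x ∈ v ∷ a ∷ mid ++ [ b ]
   list⊆ : ∀ {x} → x ∈ v ∷ a ∷ mid ++ [ b ] → x ∊ c
  open Rooted root public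

 opaque
  cyc⇒rooted : ∀ {c v} → Cyc c → v ∊ c → RootedIn v c
  cyc⇒rooted {c} {v} cyc v∈ with cyc⇒list cyc
  ... | xs , cl , eq with ∈-∃++ (Equivalence.to (eq v) v∈)
  ... | l , r , refl with rotate-to l cl
  ... | _ , a , mid , b , eq' , root with List.∷-injectiveˡ eq'
  ... | refl = record
   { root = root
   ; ⊆list = λ {x} x∈ → subst (x ∈_) eq' (swap l (v ∷ r) (Equivalence.to (eq x) x∈))
   ; list⊆ = λ {x} x∈ → Equivalence.from (eq x) (swap (v ∷ r) l (subst (x ∈_) (sym eq') x∈)) }
   where
   swap : ∀ {x : V} xs ys → x ∈ xs ++ ys → x ∈ ys ++ xs
   swap xs ys x∈ with ∈-++⁻ xs x∈
   ... | inj₁ x∈xs = ∈-++⁺ʳ ys x∈xs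
   ... | inj₂ x∈ys = ∈-++⁺ˡ x∈ys

 cyc-nonempty : ∀ {c} → Cyc c → ∃[ v ] v ∊ c
 cyc-nonempty (v , cs , _ , _ , eq) = v , Equivalence.from (_≐_.vertices eq v) 1st

 record Two (x : V) (c : Subset n) : Set where
  field
   {u w} : V
   u≢w : u ≢ w
   u∈ : u ∊ c
   w∈ : w ∊ c
   xu : Adj x u
   xw : Adj x w
   only : ∀ {z} → z ∊ c → Adj x z → z ≡ u ⊎ z ≡ w

 opaque
  cyc-two : ∀ {c x} → Cyc c → x ∊ c → Two x c
  cyc-two cyc x∈ = record
   { u≢w = a≢b ; u∈ = list⊆ 2nd ; w∈ = list⊆ (there (there (∈-++⁺ʳ mid 1st)))
   ; xu = va ; xw = vb ; only = λ z∈ → nbr (⊆list z∈) }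
   where open RootedIn (cyc⇒rooted cyc x∈)

 cyc-closed : ∀ {c} {P : V → Set} {v} → Cyc c → v ∊ c → P v →
  (∀ {x y} → x ∊ c → y ∊ c → P x → Adj x y → P y) → ∀ {x} → x ∊ c → P x
 cyc-closed {P = P} {v} cyc v∈ pv closed {x} x∈ = All.lookup (pv ∷ all) (⊆list x∈)
  where
  open RootedIn (cyc⇒rooted cyc v∈)
  pa : P a
  pa = closed v∈ (list⊆ 2nd) pv va
  all : All P (a ∷ mid ++ [ b ])
  all = pa ∷ walk-closed (ipath-walk mid arc) pa λ x∈ y∈ →
   closed (list⊆ (there x∈)) (list⊆ (there (there y∈)))

 two-⊆ : ∀ {c d x y} → Cyc c → Cyc d → (∀ {z} → z ∊ d → Adj x z → z ∊ c) →
  x ∊ c → x ∊ d → y ∊ c → Adj x y → y ∊ d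
 two-⊆ cc cd sub xc xd yc adj = go (C.only yc adj) (C.only (sub D.u∈ D.xu) D.xu) (C.only (sub D.w∈ D.xw) D.xw)
  where
  module C = Two (cyc-two cc xc)
  module D = Two (cyc-two cd xd)
  go : ∀ {y} → y ≡ C.u ⊎ y ≡ C.w → D.u ≡ C.u ⊎ D.u ≡ C.w → D.w ≡ C.u ⊎ D.w ≡ C.w → y ∊ _
  go (inj₁ refl) (inj₁ eq) _ = subst (_∊ _) eq D.u∈
  go (inj₁ refl) _ (inj₁ eq) = subst (_∊ _) eq D.w∈
  go (inj₂ refl) (inj₂ eq) _ = subst (_∊ _) eq D.u∈
  go (inj₂ refl) _ (inj₂ eq) = subst (_∊ _) eq D.w∈
  go _ (inj₁ eq) (inj₁ eq') = contradiction (trans eq (sym eq')) D.u≢w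
  go _ (inj₂ eq) (inj₂ eq') = contradiction (trans eq (sym eq')) D.u≢w

 cyc-antichain : ∀ {c d} → Cyc c → Cyc d → d ⊆ c → d ≡ c
 cyc-antichain {c} {d} cc cd d⊆c with cyc-nonempty cd
 ... | v , v∈ = Subset.⊆-antisym d⊆c
  (cyc-closed {P = _∊ d} cc (d⊆c v∈) v∈ λ x∈ y∈ xd adj → two-⊆ cc cd (λ z∈ _ → d⊆c z∈) x∈ xd y∈ adj)

 adjᵇ : V → V → Bool
 adjᵇ x y = does (adj? x y)

 adjᵇ⇒ : ∀ {x y} → adjᵇ x y ≡ true → Adj x y
 adjᵇ⇒ = does-true (adj? _ _)

 ⇒adjᵇ : ∀ {x y} → Adj x y → adjᵇ x y ≡ true
 ⇒adjᵇ = dec-true (adj? _ _)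

 adjᵇ-sym : ∀ x y → adjᵇ x y ≡ adjᵇ y x
 adjᵇ-sym x y = bool-ext (λ e → ⇒adjᵇ (Adj-sym (adjᵇ⇒ e))) (λ e → ⇒adjᵇ (Adj-sym (adjᵇ⇒ e)))

 -- The boundary of a chain of induced cycles, meaningful at adjacent x and y.
 ∂ : List (Subset n) → V → V → Bool
 ∂ z x y = par (λ c → mem c x ∧ mem c y) z

 ∂-sym : ∀ z x y → ∂ z x y ≡ ∂ z y x
 ∂-sym z x y = par-cong z λ {c} _ → Bool.∧-comm (mem c x) (mem c y)

 ∂-++ : ∀ z z' x y → ∂ (z ++ z') x y ≡ ∂ z x y xor ∂ z' x y
 ∂-++ z z' x y = par-++ _ z z'

 ∂-≈ : ∀ {z z'} → z ≈ z' → ∀ x y → ∂ z x y ≡ ∂ z' x y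
 ∂-≈ {z} {z'} eq x y = ≈⇒par {z = z} {z'} _ eq

 CycsIn : Subset n → List (Subset n) → Set
 CycsIn U = All (λ c → Cyc c × c ⊆ U)

 cycsIn-mono : ∀ {U U' z} → U ⊆ U' → CycsIn U z → CycsIn U' z
 cycsIn-mono sub [] = []
 cycsIn-mono sub ((cyc , c⊆) ∷ cs) = (cyc , λ x∈ → sub (c⊆ x∈)) ∷ cycsIn-mono sub cs

 allFin-unique : Unique (allFin n)
 allFin-unique = Unique.allFin⁺ n

 par-δ-fin : ∀ (f : V → Bool) u → par (λ x → does (x ≟ u) ∧ f x) (allFin n) ≡ f u
 par-δ-fin f u = par-δ _≟_ f allFin-unique (∈-allFin u)

 cyc-even : ∀ {c} → Cyc c → ∀ x → par (λ y → (mem c x ∧ mem c y) ∧ adjᵇ x y) (allFin n) ≡ false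
 cyc-even {c} cyc x with mem c x in eq
 ... | false = par-const-false (allFin n)
 ... | true = begin
  par (λ y → mem c y ∧ adjᵇ x y) (allFin n)
  ≡⟨ par-cong (allFin n) (λ {y} _ → pointwise y) ⟩
   par (λ y → (does (y ≟ u) ∧ true) xor (does (y ≟ w) ∧ true)) (allFin n)
  ≡⟨ par-xor _ _ (allFin n) ⟩
   par (λ y → does (y ≟ u) ∧ true) (allFin n) xor par (λ y → does (y ≟ w) ∧ true) (allFin n)
  ≡⟨ cong₂ _xor_ (par-δ-fin (λ _ → true) u) (par-δ-fin (λ _ → true) w) ⟩
   false ∎
  where
  open ≡-Reasoning
  open Two (cyc-two cyc (mem⇒∈ eq))
  pointwise : ∀ y → mem c y ∧ adjᵇ x y ≡ (does (y ≟ u) ∧ true) xor (does (y ≟ w) ∧ true)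
  pointwise y with y ≟ u | y ≟ w
  ... | yes y≡u | yes y≡w = contradiction (trans (sym y≡u) y≡w) u≢w
  ... | yes refl | no _ = cong₂ _∧_ (∈⇒mem u∈) (⇒adjᵇ xu)
  ... | no _ | yes refl = cong₂ _∧_ (∈⇒mem w∈) (⇒adjᵇ xw)
  ... | no y≢u | no y≢w with mem c y in my | adjᵇ x y in ay
  ... | false | _ = refl
  ... | true | false = refl
  ... | true | true = contradiction (only (mem⇒∈ my) (adjᵇ⇒ ay)) [ y≢u , y≢w ]′

 record EvenSet (U : Subset n) (ε : V → V → Bool) : Set where
  field
   symm : ∀ x y → ε x y ≡ ε y x
   supp : ∀ {x y} → ε x y ≡ true → Adj x y × x ∊ U
   even : ∀ x → par (ε x) (allFin n) ≡ false

  diag : ∀ x → ε x x ≡ false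
  diag x with ε x x in eq
  ... | false = refl
  ... | true = contradiction refl (Adj⇒≢ (proj₁ (supp eq)))

  supp' : ∀ {x y} → ε x y ≡ true → Adj x y × y ∊ U
  supp' {x} {y} e = let a , y∈ = supp (trans (symm y x) e) in Adj-sym a , y∈

 cyc-evenSet : ∀ {U z} → CycsIn U z → EvenSet U (λ x y → ∂ z x y ∧ adjᵇ x y)
 cyc-evenSet {U} {z} cs = record
  { symm = λ x y → cong₂ _∧_ (∂-sym z x y) (adjᵇ-sym x y)
  ; supp = λ {x} {y} e → let e₁ , e₂ = ∧-true e
                             c , c∈ , e₃ = par-true⇒∃ z e₁ in
   adjᵇ⇒ e₂ , proj₂ (All.lookup cs c∈) (mem⇒∈ (proj₁ (∧-true e₃)))
  ; even = λ x → begin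
   par (λ y → ∂ z x y ∧ adjᵇ x y) (allFin n)
   ≡⟨ par-cong (allFin n) (λ {y} _ → sym (par-∧ʳ (λ c → mem c x ∧ mem c y) (adjᵇ x y) z)) ⟩
    par (λ y → par (λ c → (mem c x ∧ mem c y) ∧ adjᵇ x y) z) (allFin n)
   ≡⟨ par-swap (λ y c → (mem c x ∧ mem c y) ∧ adjᵇ x y) (allFin n) z ⟩
    par (λ c → par (λ y → (mem c x ∧ mem c y) ∧ adjᵇ x y) (allFin n)) z
   ≡⟨ par-false z (λ {c} c∈ → cyc-even (proj₁ (All.lookup cs c∈)) x) ⟩
    false ∎ }
  where open ≡-Reasoning

 evenSet-xor : ∀ {U ε η} → EvenSet U ε → EvenSet U η → EvenSet U (λ x y → ε x y xor η x y)
 evenSet-xor {U} {ε} {η} E F = record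
  { symm = λ x y → cong₂ _xor_ (E.symm x y) (F.symm x y)
  ; supp = supp
  ; even = λ x → trans (par-xor (ε x) (η x) (allFin n)) (cong₂ _xor_ (E.even x) (F.even x)) }
  where
  module E = EvenSet E
  module F = EvenSet F
  supp : ∀ {x y} → ε x y xor η x y ≡ true → Adj x y × x ∊ U
  supp {x} {y} e with ε x y in eq
  ... | true = E.supp eq
  ... | false = F.supp e

 -- Filling U ε: ε is the boundary of a chain of induced cycles inside U.
 Filling : Subset n → (V → V → Bool) → Set
 Filling U ε = ∃[ z ] CycsIn U z × (∀ x y → Adj x y → ∂ z x y ≡ ε x y)

 Reach : (V → Set) → V → V → Set
 Reach P a b = ∃[ xs ] Walk a xs b × All P (a ∷ xs)

 record Component (P : V → Set) (a : V) : Set where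
  field
   S : Subset n
   a∈ : a ∊ S
   reach : ∀ {s} → s ∊ S → Reach P a s
   closed : ∀ {s t} → s ∊ S → P t → Adj s t → t ∊ S

  sound : ∀ {s} → s ∊ S → P s
  sound s∈ = let _ , w , all = reach s∈ in All.lookup all (walk-end w)

  complete : ∀ {s} → Reach P a s → s ∊ S
  complete (xs , w , all) =
   All.lookup (a∈ ∷ walk-closed {P = _∊ S} w a∈ λ _ y∈ x∈S → closed x∈S (All.lookup all (there y∈)))
    (walk-end w)

 reach-step : ∀ {P a s t} → Reach P a s → Adj s t → P t → Reach P a t
 reach-step (xs , w , pa ∷ all) adj pt =
  xs ++ [ _ ] , walk-++ w (step adj stop) , pa ∷ All.++⁺ all (pt ∷ [])

 opaque
  component : ∀ {P : V → Set} → (∀ x → Dec (P x)) → ∀ {a} → P a → Component P a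
  component {P} P? {a} pa =
   grow n Subset.⁅ a ⁆ (ℕ.m≤m+n n _) (Subset.x∈⁅x⁆ a)
    (λ s∈ → subst (Reach P a) (sym (Subset.x∈⁅y⁆⇒x≡y a s∈)) ([] , stop , pa ∷ []))
   where
   grow : ∀ k S → n ≤ k + ∣ S ∣ → a ∊ S → (∀ {s} → s ∊ S → Reach P a s) → Component P a
   grow k S bound a∈ reach
    with Fin.any? (λ s → Fin.any? (λ t → (s Subset.∈? S) ×-dec ¬? (t Subset.∈? S) ×-dec P? t ×-dec adj? s t))
   ... | no none = record
    { S = S ; a∈ = a∈ ; reach = reach
    ; closed = λ {s} {t} s∈ pt adj → decidable-stable (t Subset.∈? S) λ t∉ →
     none (s , t , s∈ , t∉ , pt , adj) }
   ... | yes (s , t , s∈ , t∉ , pt , adj) = extend k bound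
    where
    S' : Subset n
    S' = S Subset.∪ Subset.⁅ t ⁆

    larger : ∣ S ∣ < ∣ S' ∣
    larger = Subset.p⊂q⇒∣p∣<∣q∣ (Subset.p⊆p∪q _ , t , Subset.q⊆p∪q S _ (Subset.x∈⁅x⁆ t) , t∉)

    reach' : ∀ {u} → u ∊ S' → Reach P a u
    reach' u∈ with Subset.x∈p∪q⁻ S _ u∈
    ... | inj₁ u∈S = reach u∈S
    ... | inj₂ u∈t = subst (Reach P a) (sym (Subset.x∈⁅y⁆⇒x≡y t u∈t)) (reach-step (reach s∈) adj pt)

    extend : ∀ k → n ≤ k + ∣ S ∣ → Component P a
    extend zero bound = contradiction (ℕ.<-≤-trans (ℕ.≤-<-trans bound larger) (Subset.∣p∣≤n S')) (ℕ.<-irrefl refl)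
    extend (suc k) bound = grow k S'
     (ℕ.≤-trans bound (subst (_≤ k + ∣ S' ∣) (ℕ.+-suc k ∣ S ∣) (ℕ.+-monoʳ-≤ k larger)))
     (Subset.p⊆p∪q _ a∈) reach'

 Fan : V → V → V → (V → Set) → Set
 Fan v a b P = ∃[ z ] All (λ c → Cyc c × (∀ {u} → u ∊ c → P u)) z ×
  (∀ u → Adj v u → ∂ z v u ≡ does (u ≟ a) xor does (u ≟ b))

 opaque
  -- An induced path between two neighbours of v is cut at the neighbours of v
  -- into arcs, each of which forms an induced cycle with v.
  fan : ∀ {v a b x} {P : V → Set} mid rest → Adj v a → All (Far v) mid → IPath (a ∷ mid ++ x ∷ rest) →
   Walk x rest b → Adj v b → All (v ≢_) (x ∷ rest) → All P (v ∷ a ∷ mid ++ x ∷ rest) →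
   Fan v a b P
  fan {v} {x = x} mid rest va far path w vb (v≢x ∷ v≢) (pv ∷ ps) with adj? v x
  fan {v} {a} {b} {x} {P} mid rest va far path w vb (v≢x ∷ v≢) (pv ∷ ps) | yes vx = continue rest path w v≢ ps
   where
   arc : IPath (a ∷ mid ++ [ x ])
   arc = ipath-prefix (a ∷ mid ++ [ x ])
    (subst IPath (sym (List.++-assoc (a ∷ mid) [ x ] rest)) path)

   r : Rooted v a mid x
   r = rooted va vx far arc

   ps' : All P (a ∷ mid ++ [ x ])
   ps' = All.++⁻ˡ (a ∷ mid ++ [ x ]) (subst (All P) (sym (List.++-assoc (a ∷ mid) [ x ] rest)) ps)

   c : Subset n
   c = ⟦ Rooted.list r ⟧

   good : Cyc c × (∀ {u} → u ∊ c → P u)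
   good = rooted⇒cyc r , λ u∈ → All.lookup (pv ∷ ps') (∈⟦⟧⁻ u∈)

   at-v : ∀ u → Adj v u → mem c v ∧ mem c u ≡ does (u ≟ a) xor does (u ≟ x)
   at-v u vu rewrite ∈⇒mem (∈⟦⟧⁺ {xs = Rooted.list r} 1st) with u ≟ a | u ≟ x
   ... | yes u≡a | yes u≡x = contradiction (trans (sym u≡a) u≡x) (Rooted.a≢b r)
   ... | yes refl | no _ = ∈⇒mem (∈⟦⟧⁺ {xs = Rooted.list r} 2nd)
   ... | no _ | yes refl = ∈⇒mem (∈⟦⟧⁺ {xs = Rooted.list r} (there (∈-++⁺ʳ (a ∷ mid) 1st)))
   ... | no u≢a | no u≢x = ∉⇒mem {c = c} λ u∈ → [ u≢a , u≢x ]′ (Rooted.nbr r (∈⟦⟧⁻ u∈) vu)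

   continue : ∀ rest → IPath (a ∷ mid ++ x ∷ rest) → Walk x rest b → All (v ≢_) rest →
    All P (a ∷ mid ++ x ∷ rest) → Fan v a b P
   continue [] path stop [] ps = c ∷ [] , good ∷ [] ,
    λ u vu → trans (Bool.xor-identityʳ (mem c v ∧ mem c u)) (at-v u vu)
   continue (y ∷ ys) path (step _ w) (v≢y ∷ v≢) ps =
    let z , cs , eq = fan [] ys vx [] (ipath-suffix (a ∷ mid) path) w vb (v≢y ∷ v≢) (pv ∷ All.++⁻ʳ (a ∷ mid) ps)
    in c ∷ z , good ∷ cs , λ u vu → trans (cong₂ _xor_ (at-v u vu) (eq u vu))
     (trans (Bool.xor-assoc (does (u ≟ a)) (does (u ≟ x)) (does (u ≟ x) xor does (u ≟ b)))
      (cong (does (u ≟ a) xor_) (xor-cancelˡ (does (u ≟ x)) (does (u ≟ b)))))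
  fan mid [] va far path stop vb _ _ | no ¬vx = contradiction vb ¬vx
  fan {a = a} {x = x} {P} mid (y ∷ ys) va far path (step _ w) vb (v≢x ∷ v≢y) (pv ∷ ps) | no ¬vx =
   let eq = List.++-assoc (a ∷ mid) [ x ] (y ∷ ys)
       z , cs , e = fan (mid ++ [ x ]) ys va (All.++⁺ far ((v≢x , ¬vx) ∷ []))
        (subst IPath (sym eq) path) w vb v≢y (pv ∷ subst (All P) (sym eq) ps)
   in z , cs , e

 private opaque
  partner : ∀ {U ε v a} → EvenSet U ε → ε v a ≡ true →
   ∃[ b ] b ≢ a × ε v b ≡ true × Reach (λ x → x ∊ U × x ≢ v) a b
  partner {U} {ε} {v} {a} E va =
   let b , _ , b≢a , eq = par-other _≟_ (λ x → mem C.S x ∧ ε v x) allFin-unique (∈-allFin a)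
        (cong₂ _∧_ (∈⇒mem C.a∈) va) even-at-v
       b∈ , vb = ∧-true eq
   in b , b≢a , vb , C.reach (mem⇒∈ b∈)
   where
   open EvenSet E
   open ≡-Reasoning
   P : V → Set
   P x = x ∊ U × x ≢ v
   a∈P : P a
   a∈P = proj₂ (supp' va) , λ { refl → Adj⇒≢ (proj₁ (supp va)) refl }
   module C = Component (component {P} (λ x → (x Subset.∈? U) ×-dec ¬? (x ≟ v)) a∈P)

   inner : V → V → Bool
   inner x y = (mem C.S x ∧ mem C.S y) ∧ ε x y

   mem-v : mem C.S v ≡ false
   mem-v = ∉⇒mem λ v∈ → proj₂ (C.sound v∈) refl

   bool-split : ∀ m k d e → (d ≡ true → k ≡ false) → (d ≡ false → m ≡ true → e ≡ true → k ≡ true) →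
    m ∧ e ≡ (d ∧ (m ∧ e)) xor ((m ∧ k) ∧ e)
   bool-split false k false e _ _ = refl
   bool-split false k true e _ _ = refl
   bool-split true false false false _ _ = refl
   bool-split true false false true _ f = sym (f refl refl refl)
   bool-split true true false e _ _ = refl
   bool-split true false true e _ _ = sym (Bool.xor-identityʳ e)
   bool-split true true true e f _ = case f refl of λ ()

   split : ∀ x y → mem C.S x ∧ ε x y ≡ (does (y ≟ v) ∧ (mem C.S x ∧ ε x y)) xor inner x y
   split x y = bool-split (mem C.S x) (mem C.S y) (does (y ≟ v)) (ε x y)
    (λ e → trans (cong (mem C.S) (does-true (y ≟ v) e)) mem-v)
    (λ y≢v mx xy → ∈⇒mem (C.closed (mem⇒∈ mx)
     (proj₂ (supp' xy) , λ y≡v → case trans (sym y≢v) (dec-true (y ≟ v) y≡v) of λ ())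
     (proj₁ (supp xy))))

   all : List V
   all = allFin n

   row : V → V → Bool
   row x y = mem C.S x ∧ ε x y

   at-v : V → V → Bool
   at-v x y = does (y ≟ v) ∧ row x y

   rows : par (λ x → par (row x) all) all ≡ false
   rows = par-false all λ {x} _ → trans (par-∧ (mem C.S x) (ε x) all)
    (trans (cong (mem C.S x ∧_) (even x)) (Bool.∧-zeroʳ (mem C.S x)))

   inners : par (λ x → par (inner x) all) all ≡ false
   inners = handshake inner all
    (λ x → trans (cong ((mem C.S x ∧ mem C.S x) ∧_) (diag x)) (Bool.∧-zeroʳ (mem C.S x ∧ mem C.S x)))
    (λ x y → cong₂ _∧_ (Bool.∧-comm (mem C.S x) (mem C.S y)) (symm x y))

   even-at-v : par (λ x → mem C.S x ∧ ε v x) all ≡ false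
   even-at-v = begin
    par (λ x → mem C.S x ∧ ε v x) all
    ≡⟨ par-cong all (λ {x} _ → trans (cong (mem C.S x ∧_) (symm v x)) (sym (par-δ-fin (row x) v))) ⟩
     par (λ x → par (at-v x) all) all
    ≡⟨ xor≡false⇒≡ {par (λ x → par (at-v x) all) all} {par (λ x → par (inner x) all) all} (begin
     par (λ x → par (at-v x) all) all xor par (λ x → par (inner x) all) all
     ≡⟨ sym (par-xor (λ x → par (at-v x) all) (λ x → par (inner x) all) all) ⟩
      par (λ x → par (at-v x) all xor par (inner x) all) all
     ≡⟨ par-cong all (λ {x} _ → trans (sym (par-xor (at-v x) (inner x) all))
      (par-cong all (λ {y} _ → sym (split x y)))) ⟩
      par (λ x → par (row x) all) all
     ≡⟨ rows ⟩
      false ∎) ⟩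
     par (λ x → par (inner x) all) all
    ≡⟨ inners ⟩
     false ∎

  chord-fan : ∀ {U v a b} → v ∊ U → Adj v a → Adj v b → a ≢ b → Reach (λ x → x ∊ U × x ≢ v) a b →
   ∃[ z ] CycsIn U z × (∀ u → Adj v u → ∂ z v u ≡ does (u ≟ a) xor does (u ≟ b))
  chord-fan {U} {v} {a} {b} v∈ va vb a≢b (xs , w , ps) with shorten w
  ... | [] , stop , _ , _ , _ = contradiction refl a≢b
  ... | y ∷ ys , step _ w' , path , sub , _ =
   fan {P = _∊ U} [] ys va [] path w' vb
    (All.tabulate λ y∈ eq → proj₂ (All.lookup ps (sub (there y∈))) (sym eq))
    (v∈ ∷ All.tabulate λ y∈ → proj₁ (All.lookup ps (sub y∈)))

 opaque
  fill : ∀ {U ε} → EvenSet U ε → Filling U ε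
  fill {U} = go (∣ U ∣) ℕ.≤-refl
   where
   extend : ∀ {U ε z} → CycsIn U z → Filling U (λ x y → ε x y xor (∂ z x y ∧ adjᵇ x y)) → Filling U ε
   extend {ε = ε} {z} cs (z' , cs' , eq) = z ++ z' , All.++⁺ cs cs' , λ x y adj →
    trans (∂-++ z z' x y) (trans (cong (∂ z x y xor_) (trans (eq x y adj)
     (trans (cong (λ b → ε x y xor (∂ z x y ∧ b)) (⇒adjᵇ adj))
      (trans (cong (ε x y xor_) (Bool.∧-identityʳ _)) (Bool.xor-comm (ε x y) _)))))
     (xor-cancelˡ (∂ z x y) (ε x y)))

   go : ∀ k {U ε} → ∣ U ∣ ≤ k → EvenSet U ε → Filling U ε
   clear : ∀ k {U ε v} → v ∊ U → ∣ U ∣ ≤ suc k → ∀ us → (∀ {u} → ε v u ≡ true → u ∈ us) →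
    EvenSet U ε → Filling U ε

   go k {U} {ε} le E with Subset.nonempty? U
   ... | no empty = [] , [] , λ x y _ → sym (Bool.¬-not λ e → empty (x , proj₂ (EvenSet.supp E e)))
   go zero le E | yes (v , v∈) = contradiction (ℕ.≤-<-trans z≤n (Subset.x∈p⇒∣p-x∣<∣p∣ v∈)) (ℕ.≤⇒≯ le)
   go (suc k) le E | yes (v , v∈) = clear k v∈ le (allFin n) (λ {u} _ → ∈-allFin u) E

   clear k {U} {ε} {v} v∈ le [] none E =
    let z , cs , eq = go k (ℕ.≤-pred (ℕ.<-≤-trans (Subset.x∈p⇒∣p-x∣<∣p∣ v∈) le)) E'
    in z , cycsIn-mono (λ x∈ → proj₁ (∈-remove⁻ U v x∈)) cs , eq
    where
    open EvenSet E
    E' : EvenSet (U Subset.- v) ε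
    E' = record
     { symm = symm
     ; supp = λ {x} {y} e → proj₁ (supp e) , Subset.x∈p∧x≢y⇒x∈p-y (proj₂ (supp e))
      λ { refl → case none e of λ () }
     ; even = even }
   clear k {U} {ε} {v} v∈ le (u ∷ us) sub E with ε v u in vu
   ... | false = clear k v∈ le us (λ {w} e → case sub e of λ
    { 1st → case trans (sym vu) e of λ () ; (there w∈) → w∈ }) E
   ... | true = extend {ε = ε} cs (clear k v∈ le us sub' (evenSet-xor E (cyc-evenSet cs)))
    where
    open EvenSet E
    b : V
    b = proj₁ (partner E vu)
    b≢u : b ≢ u
    b≢u = proj₁ (proj₂ (partner E vu))
    vb : ε v b ≡ true
    vb = proj₁ (proj₂ (proj₂ (partner E vu)))
    f : ∃[ z ] CycsIn U z × (∀ w → Adj v w → ∂ z v w ≡ does (w ≟ u) xor does (w ≟ b))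
    f = chord-fan v∈ (proj₁ (supp vu)) (proj₁ (supp vb)) (b≢u ∘ sym) (proj₂ (proj₂ (proj₂ (partner E vu))))
    z : List (Subset n)
    z = proj₁ f
    cs : CycsIn U z
    cs = proj₁ (proj₂ f)

    old : ∀ {w} → ε v w ≡ true → w ≢ u → w ∈ us
    old e w≢u with sub e
    ... | here refl = contradiction refl w≢u
    ... | there w∈ = w∈

    value : ∀ w → Adj v w → ε v w xor (∂ z v w ∧ adjᵇ v w) ≡ ε v w xor (does (w ≟ u) xor does (w ≟ b))
    value w vw = cong (ε v w xor_) (trans (cong (∂ z v w ∧_) (⇒adjᵇ vw))
     (trans (Bool.∧-identityʳ (∂ z v w)) (proj₂ (proj₂ f) w vw)))

    cases : ∀ {w} (w≟u : Dec (w ≡ u)) (w≟b : Dec (w ≡ b)) →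
     ε v w xor (does w≟u xor does w≟b) ≡ true → w ∈ us
    cases (yes w≡u) (yes w≡b) e = contradiction (trans (sym w≡b) w≡u) b≢u
    cases (yes refl) (no _) e = case trans (sym (cong (_xor true) vu)) e of λ ()
    cases (no _) (yes refl) e = case trans (sym (cong (_xor true) vb)) e of λ ()
    cases (no w≢u) (no _) e = old (trans (sym (Bool.xor-identityʳ _)) e) w≢u

    sub' : ∀ {w} → ε v w xor (∂ z v w ∧ adjᵇ v w) ≡ true → w ∈ us
    sub' {w} e = cases (w ≟ u) (w ≟ b) (trans (sym (value w (adjacent (ε v w) refl))) e)
     where
     adjacent : ∀ d → d ≡ ε v w → Adj v w
     adjacent true eq = proj₁ (supp (sym eq))
     adjacent false eq = adjᵇ⇒ (proj₂ (∧-true {∂ z v w} (trans (cong (_xor (∂ z v w ∧ adjᵇ v w)) eq) e)))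

 consec-succ : ∀ {x y z xs} → Unique xs → Consec x y xs → Consec x z xs → y ≡ z
 consec-succ u here here = refl
 consec-succ u here (there c) = contradiction refl (unique-head u (consec-∈ˡ c))
 consec-succ u (there c) here = contradiction refl (unique-head u (consec-∈ˡ c))
 consec-succ (_ ∷ u) (there c) (there d) = consec-succ u c d

 no-pred : ∀ {x z zs} → Unique (x ∷ zs) → ¬ Consec z x (x ∷ zs)
 no-pred u here = unique-head u 1st refl
 no-pred u (there c) = unique-head u (consec-∈ʳ c) refl

 no-succ : ∀ l {x z} → Unique (l ++ [ x ]) → ¬ Consec x z (l ++ [ x ])
 no-succ [] u (there ())
 no-succ (y ∷ []) u here = unique-head u 1st refl
 no-succ (y ∷ w ∷ l) u here = unique-head u (there (∈-++⁺ʳ l 1st)) refl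
 no-succ (y ∷ l) (_ ∷ u) (there c) = no-succ l u c

 consec-pred : ∀ {x y z xs} → Unique xs → Consec y x xs → Consec z x xs → y ≡ z
 consec-pred u here here = refl
 consec-pred (_ ∷ u) here (there c) = contradiction c (no-pred u)
 consec-pred (_ ∷ u) (there c) here = contradiction c (no-pred u)
 consec-pred (_ ∷ u) (there c) (there d) = consec-pred u c d

 ring : ∀ {x p P q Q} → IPath (x ∷ p ∷ P) → IPath (q ∷ Q) → Adj x q →
  (∀ {u w} → Last u (p ∷ P) → Last w (q ∷ Q) → Adj u w) →
  (∀ {u w} → u ∈ x ∷ p ∷ P → w ∈ q ∷ Q → u ≢ w) →
  (∀ {u w} → u ∈ x ∷ p ∷ P → w ∈ q ∷ Q → Adj u w →
   (u ≡ x × w ≡ q) ⊎ (Last u (p ∷ P) × Last w (q ∷ Q))) →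
  Rooted x p (P ++ reverse Q) q
 ring {x} {p} {P} {q} {Q} pathP@(link xp farP pathP') pathQ xq joined disj cross
  with snoc p P | snoc q Q
 ... | A , l , eqA | B , m , eqB = rooted xp xq (All.++⁺ farP (All.tabulate λ w∈ → farQ (∈-reverse⁻ w∈)))
  (subst IPath list-eq
   (ipath-join A (subst IPath eqA pathP') (subst IPath rev-eq (ipath-reverse pathQ))
    (joined (A , eqA) (B , eqB)) anti (All.tabulate λ w∈ → far-l (∈-reverse⁻ w∈))))
  where
  x∉ : ∀ {u} → u ∈ p ∷ P → x ≢ u
  x∉ = unique-head (ipath-unique pathP)
  q∉ : ∀ {w} → w ∈ Q → q ≢ w
  q∉ = unique-head (ipath-unique pathQ)
  l∉ : l ∉ A
  l∉ = unique-last A (subst Unique eqA (ipath-unique pathP'))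
  m∉ : m ∉ B
  m∉ = unique-last B (subst Unique eqB (ipath-unique pathQ))

  ∈P : ∀ {u} → u ∈ A ++ [ l ] → u ∈ p ∷ P
  ∈P = subst (_ ∈_) (sym eqA)
  ∈Q : ∀ {w} → w ∈ B ++ [ m ] → w ∈ q ∷ Q
  ∈Q = subst (_ ∈_) (sym eqB)

  rev-eq : reverse (q ∷ Q) ≡ m ∷ reverse B
  rev-eq = trans (cong reverse eqB) (List.reverse-++ B [ m ])

  list-eq : A ++ l ∷ m ∷ reverse B ≡ p ∷ (P ++ reverse Q) ++ [ q ]
  list-eq = trans (sym (List.++-assoc A [ l ] (m ∷ reverse B)))
   (trans (cong₂ _++_ (sym eqA) (sym rev-eq))
    (trans (cong ((p ∷ P) ++_) (List.unfold-reverse q Q)) (sym (List.++-assoc (p ∷ P) (reverse Q) [ q ]))))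

  farQ : ∀ {w} → w ∈ Q → Far x w
  farQ w∈ = disj 1st (there w∈) , λ adj → case cross 1st (there w∈) adj of λ
   { (inj₁ (_ , refl)) → q∉ w∈ refl
   ; (inj₂ (lastx , _)) → x∉ (last-∈ lastx) refl }

  anti : Anti A (m ∷ reverse B)
  anti {u} {w} u∈ w∈ = disj (there u∈P) w∈Q , λ adj → case cross (there u∈P) w∈Q adj of λ
   { (inj₁ (refl , _)) → x∉ u∈P refl
   ; (inj₂ (lastu , _)) → l∉ (subst (_∈ A) (last-unique lastu (A , eqA)) u∈) }
   where
   u∈P : u ∈ p ∷ P
   u∈P = ∈P (∈-++⁺ˡ u∈)
   w∈Q : w ∈ q ∷ Q
   w∈Q = ∈-reverse⁻ (subst (w ∈_) (sym rev-eq) w∈)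

  far-l : ∀ {w} → w ∈ B → Far l w
  far-l {w} w∈ = disj (there l∈P) w∈Q , λ adj → case cross (there l∈P) w∈Q adj of λ
   { (inj₁ (refl , _)) → x∉ l∈P refl
   ; (inj₂ (_ , lastw)) → m∉ (subst (_∈ B) (last-unique lastw (B , eqB)) w∈) }
   where
   l∈P : l ∈ p ∷ P
   l∈P = ∈P (∈-++⁺ʳ A 1st)
   w∈Q : w ∈ q ∷ Q
   w∈Q = ∈Q (∈-++⁺ˡ w∈)

 _∈?_ : ∀ (x : V) xs → Dec (x ∈ xs)
 _∈?_ = DecMembership._∈?_ _≟_

 ext-head : ∀ ao {x : V} {xs ys} → Head x xs → Head (Maybe.fromMaybe x ao) (fromMaybe ao ++ xs ++ ys)
 ext-head nothing (zs , refl) = _ , refl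
 ext-head (just a) _ = _ , refl

 ext-last : ∀ bo {x : V} {xs} ys → Last x xs → Last (Maybe.fromMaybe x bo) (ys ++ xs ++ fromMaybe bo)
 ext-last nothing {x} ys (zs , refl) = ys ++ zs ,
  trans (cong (ys ++_) (List.++-identityʳ _)) (sym (List.++-assoc ys zs [ x ]))
 ext-last (just b) {xs = xs} ys _ = ys ++ xs , sym (List.++-assoc ys xs [ b ])

 ext-reverse : ∀ ao bo (xs : List V) →
  fromMaybe bo ++ reverse xs ++ fromMaybe ao ≡ reverse (fromMaybe ao ++ xs ++ fromMaybe bo)
 ext-reverse ao bo xs = sym (begin
  reverse (fromMaybe ao ++ xs ++ fromMaybe bo)
  ≡⟨ List.reverse-++ (fromMaybe ao) _ ⟩
   reverse (xs ++ fromMaybe bo) ++ reverse (fromMaybe ao)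
  ≡⟨ cong₂ _++_ (List.reverse-++ xs _) (rev ao) ⟩
   (reverse (fromMaybe bo) ++ reverse xs) ++ fromMaybe ao
  ≡⟨ cong (λ l → (l ++ reverse xs) ++ fromMaybe ao) (rev bo) ⟩
   (fromMaybe bo ++ reverse xs) ++ fromMaybe ao
  ≡⟨ List.++-assoc (fromMaybe bo) _ _ ⟩
   fromMaybe bo ++ reverse xs ++ fromMaybe ao ∎)
  where
  open ≡-Reasoning
  rev : ∀ (m : Maybe V) → reverse (fromMaybe m) ≡ fromMaybe m
  rev nothing = refl
  rev (just _) = refl

 ∈-fromMaybe⁻ : ∀ {m} {x : V} → x ∈ fromMaybe m → m ≡ just x
 ∈-fromMaybe⁻ {just _} 1st = refl

 data Distinct : (i j k : Fin 3) → Set where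
  distinct : ∀ {i j k} → i ≢ j → i ≢ k → j ≢ k → Distinct i j k

 third : ∀ {i j : Fin 3} → i ≢ j → ∃[ k ] Distinct i j k
 third {zero} {zero} i≢j = contradiction refl i≢j
 third {zero} {suc zero} i≢j = 2F , distinct (λ ()) (λ ()) (λ ())
 third {zero} {2F} i≢j = suc zero , distinct (λ ()) (λ ()) (λ ())
 third {suc zero} {zero} i≢j = 2F , distinct (λ ()) (λ ()) (λ ())
 third {suc zero} {suc zero} i≢j = contradiction refl i≢j
 third {suc zero} {2F} i≢j = zero , distinct (λ ()) (λ ()) (λ ())
 third {2F} {zero} i≢j = suc zero , distinct (λ ()) (λ ()) (λ ())
 third {2F} {suc zero} i≢j = zero , distinct (λ ()) (λ ()) (λ ())
 third {2F} {2F} i≢j = contradiction refl i≢j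

 others : ∀ i → ∃[ j ] ∃[ k ] Distinct i j k
 others zero = suc zero , 2F , distinct (λ ()) (λ ()) (λ ())
 others 1F = zero , 2F , distinct (λ ()) (λ ()) (λ ())
 others 2F = zero , suc zero , distinct (λ ()) (λ ()) (λ ())

 exhaust : ∀ {i j k} → Distinct i j k → ∀ l → l ≡ i ⊎ l ≡ j ⊎ l ≡ k
 exhaust {i} {j} {k} (distinct i≢j i≢k j≢k) l with l ≟ i | l ≟ j | l ≟ k
 ... | yes l≡i | _ | _ = inj₁ l≡i
 ... | no _ | yes l≡j | _ = inj₂ (inj₁ l≡j)
 ... | no _ | no _ | yes l≡k = inj₂ (inj₂ l≡k)
 ... | no l≢i | no l≢j | no l≢k = contradiction (Fin.injective⇒≤ {f = f} inj) (λ { (s≤s (s≤s (s≤s ()))) })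
  where
  f : Fin 4 → Fin 3
  f zero = i
  f 1F = j
  f 2F = k
  f (suc 2F) = l
  inj : ∀ {x y} → f x ≡ f y → x ≡ y
  inj {zero} {zero} _ = refl
  inj {zero} {suc zero} eq = contradiction eq i≢j
  inj {zero} {2F} eq = contradiction eq i≢k
  inj {zero} {suc 2F} eq = contradiction (sym eq) l≢i
  inj {suc zero} {zero} eq = contradiction (sym eq) i≢j
  inj {suc zero} {suc zero} _ = refl
  inj {suc zero} {2F} eq = contradiction eq j≢k
  inj {suc zero} {suc 2F} eq = contradiction (sym eq) l≢j
  inj {2F} {zero} eq = contradiction (sym eq) i≢k
  inj {2F} {suc zero} eq = contradiction (sym eq) j≢k
  inj {2F} {2F} _ = refl
  inj {2F} {suc 2F} eq = contradiction (sym eq) l≢k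
  inj {suc 2F} {zero} eq = contradiction eq l≢i
  inj {suc 2F} {suc zero} eq = contradiction eq l≢j
  inj {suc 2F} {2F} eq = contradiction eq l≢k
  inj {suc 2F} {suc 2F} _ = refl

 -- Three paths L i between two ends. An end is a vertex joined to the three
 -- end vertices of the paths, or (nothing) these three form a triangle.
 record ThreePath (ao bo : Maybe V) (L : Fin 3 → List V) : Set where
  ext : Fin 3 → List V
  ext i = fromMaybe ao ++ L i ++ fromMaybe bo
  field
   h t : Fin 3 → V
   hd : ∀ i → Head (h i) (L i)
   tl : ∀ i → Last (t i) (L i)
   len : ∀ i → 2 ≤ length (ext i)
   pathL : ∀ i → IPath (ext i)
   disj : ∀ {i j u w} → i ≢ j → u ∈ L i → w ∈ L j → u ≢ w
   cross : ∀ {i j u w} → i ≢ j → u ∈ L i → w ∈ L j → Adj u w →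
    (ao ≡ nothing × u ≡ h i × w ≡ h j) ⊎ (bo ≡ nothing × u ≡ t i × w ≡ t j)
   joinᵃ : ∀ {i j} → ao ≡ nothing → i ≢ j → Adj (h i) (h j)
   joinᵇ : ∀ {i j} → bo ≡ nothing → i ≢ j → Adj (t i) (t j)

  h∈ : ∀ i → h i ∈ L i
  h∈ i = head-∈ (hd i)
  t∈ : ∀ i → t i ∈ L i
  t∈ i = last-∈ (tl i)

  ∈ext : ∀ {i u} → u ∈ L i → u ∈ ext i
  ∈ext u∈ = ∈-++⁺ʳ (fromMaybe ao) (∈-++⁺ˡ u∈)
  a∈ext : ∀ {i u} → u ∈ fromMaybe ao → u ∈ ext i
  a∈ext = ∈-++⁺ˡ
  b∈ext : ∀ {i u} → u ∈ fromMaybe bo → u ∈ ext i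
  b∈ext {i} u∈ = ∈-++⁺ʳ (fromMaybe ao) (∈-++⁺ʳ (L i) u∈)

  ∈ext⁻ : ∀ {i u} → u ∈ ext i → u ∈ fromMaybe ao ⊎ u ∈ L i ⊎ u ∈ fromMaybe bo
  ∈ext⁻ {i} u∈ with ∈-++⁻ (fromMaybe ao) u∈
  ... | inj₁ u∈a = inj₁ u∈a
  ... | inj₂ u∈' = inj₂ (∈-++⁻ (L i) u∈')

  ext-unique : ∀ i → Unique (ext i)
  ext-unique i = ipath-unique (pathL i)

  a∉L : ∀ {i u w} → u ∈ fromMaybe ao → w ∈ L i → u ≢ w
  a∉L {i} u∈ w∈ refl = unique-disjoint (ext-unique i) (u∈ , ∈-++⁺ˡ w∈)
  a∉b : ∀ {u w} → u ∈ fromMaybe ao → w ∈ fromMaybe bo → u ≢ w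
  a∉b u∈ w∈ refl = unique-disjoint (ext-unique zero) (u∈ , ∈-++⁺ʳ (L zero) w∈)
  b∉L : ∀ {i u w} → u ∈ fromMaybe bo → w ∈ L i → u ≢ w
  b∉L {i} u∈ w∈ refl = unique-disjoint (unique-++ʳ (fromMaybe ao) (ext-unique i)) (w∈ , u∈)

  verts : List V
  verts = fromMaybe ao ++ fromMaybe bo ++ L zero ++ L 1F ++ L 2F

  T : Subset n
  T = ⟦ verts ⟧

  C : Fin 3 → Subset n
  C k = ⟦ filter (λ u → ¬? (u ∈? L k)) verts ⟧

  L⊆verts : ∀ i {u} → u ∈ L i → u ∈ verts
  L⊆verts zero u∈ = ∈-++⁺ʳ (fromMaybe ao) (∈-++⁺ʳ (fromMaybe bo) (∈-++⁺ˡ u∈))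
  L⊆verts 1F u∈ = ∈-++⁺ʳ (fromMaybe ao) (∈-++⁺ʳ (fromMaybe bo) (∈-++⁺ʳ (L zero) (∈-++⁺ˡ u∈)))
  L⊆verts 2F u∈ = ∈-++⁺ʳ (fromMaybe ao) (∈-++⁺ʳ (fromMaybe bo) (∈-++⁺ʳ (L zero) (∈-++⁺ʳ (L 1F) u∈)))

  ext⊆verts : ∀ i {u} → u ∈ ext i → u ∈ verts
  ext⊆verts i u∈ with ∈ext⁻ u∈
  ... | inj₁ u∈a = ∈-++⁺ˡ u∈a
  ... | inj₂ (inj₁ u∈L) = L⊆verts i u∈L
  ... | inj₂ (inj₂ u∈b) = ∈-++⁺ʳ (fromMaybe ao) (∈-++⁺ˡ u∈b)

  data Place (u : V) : Set where
   at-a : u ∈ fromMaybe ao → Place u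
   at-b : u ∈ fromMaybe bo → Place u
   in-L : ∀ i → u ∈ L i → Place u

  place : ∀ {u} → u ∈ verts → Place u
  place u∈ with ∈-++⁻ (fromMaybe ao) u∈
  ... | inj₁ u∈a = at-a u∈a
  ... | inj₂ u∈₁ with ∈-++⁻ (fromMaybe bo) u∈₁
  ... | inj₁ u∈b = at-b u∈b
  ... | inj₂ u∈₂ with ∈-++⁻ (L zero) u∈₂
  ... | inj₁ u∈0 = in-L zero u∈0
  ... | inj₂ u∈₃ with ∈-++⁻ (L 1F) u∈₃
  ... | inj₁ u∈1 = in-L 1F u∈1
  ... | inj₂ u∈2 = in-L 2F u∈2

  placeT : ∀ {u} → u ∊ T → Place u
  placeT u∈ = place (∈⟦⟧⁻ u∈)

  L⊆T : ∀ i {u} → u ∈ L i → u ∊ T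
  L⊆T i u∈ = ∈⟦⟧⁺ (L⊆verts i u∈)

  ext⊆T : ∀ i {u} → u ∈ ext i → u ∊ T
  ext⊆T i u∈ = ∈⟦⟧⁺ (ext⊆verts i u∈)

  ∈C⁺ : ∀ {k u} → u ∊ T → u ∉ L k → u ∊ C k
  ∈C⁺ {k} u∈ u∉ = ∈⟦⟧⁺ (∈-filter⁺ (λ u → ¬? (u ∈? L k)) (∈⟦⟧⁻ u∈) u∉)

  C⊆T : ∀ {k u} → u ∊ C k → u ∊ T
  C⊆T {k} u∈ = ∈⟦⟧⁺ (proj₁ (∈-filter⁻ (λ u → ¬? (u ∈? L k)) (∈⟦⟧⁻ u∈)))

  C∌L : ∀ {k u} → u ∊ C k → u ∉ L k
  C∌L {k} u∈ = proj₂ (∈-filter⁻ (λ u → ¬? (u ∈? L k)) {xs = verts} (∈⟦⟧⁻ u∈))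

  ext∉L : ∀ {i j u} → i ≢ j → u ∈ ext i → u ∉ L j
  ext∉L i≢j u∈ u∈j with ∈ext⁻ u∈
  ... | inj₁ u∈a = a∉L u∈a u∈j refl
  ... | inj₂ (inj₁ u∈L) = disj i≢j u∈L u∈j refl
  ... | inj₂ (inj₂ u∈b) = b∉L u∈b u∈j refl

  C⊆ext∪L : ∀ {i j k u} → Distinct i j k → u ∊ C k → u ∈ ext i ⊎ u ∈ L j
  C⊆ext∪L d u∈ with placeT (C⊆T u∈)
  ... | at-a u∈a = inj₁ (a∈ext u∈a)
  ... | at-b u∈b = inj₁ (b∈ext u∈b)
  ... | in-L l u∈L with exhaust d l
  ... | inj₁ refl = inj₁ (∈ext u∈L)
  ... | inj₂ (inj₁ refl) = inj₂ u∈L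
  ... | inj₂ (inj₂ refl) = contradiction u∈L (C∌L u∈)

  first final : Fin 3 → V
  first i = Maybe.fromMaybe (h i) ao
  final i = Maybe.fromMaybe (t i) bo

  first-hd : ∀ i → Head (first i) (ext i)
  first-hd i = ext-head ao (hd i)
  final-tl : ∀ i → Last (final i) (ext i)
  final-tl i = ext-last bo (fromMaybe ao) (tl i)

  a-h : ∀ {i a} → ao ≡ just a → Consec a (h i) (ext i)
  a-h {i} refl with hd i
  ... | _ , eq rewrite eq = here
  t-b : ∀ {i b} → bo ≡ just b → Consec (t i) b (ext i)
  t-b {i} {b} refl with tl i
  ... | l , eq = consec-++ʳ (fromMaybe ao) (subst (λ xs → Consec (t i) b (xs ++ [ b ])) (sym eq)
   (subst (Consec (t i) b) (sym (List.++-assoc l [ t i ] [ b ])) (consec-last l)))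

  first-adj : ∀ {i j} → i ≢ j → Adj (first i) (h j)
  first-adj {i} {j} i≢j = go ao refl
   where
   go : ∀ m → ao ≡ m → Adj (Maybe.fromMaybe (h i) m) (h j)
   go nothing eq = joinᵃ eq i≢j
   go (just a) eq = consec-adj (pathL j) (a-h eq)
  final-adj : ∀ {i j} → i ≢ j → Adj (final i) (t j)
  final-adj {i} {j} i≢j = go bo refl
   where
   go : ∀ m → bo ≡ m → Adj (Maybe.fromMaybe (t i) m) (t j)
   go nothing eq = joinᵇ eq i≢j
   go (just b) eq = Adj-sym (consec-adj (pathL j) (t-b eq))

  ext-cross : ∀ {i j u w} → i ≢ j → u ∈ ext i → w ∈ L j → Adj u w →
   (u ≡ first i × w ≡ h j) ⊎ (u ≡ final i × w ≡ t j)
  ext-cross {i} {j} {u} {w} i≢j u∈ w∈ adj with ∈ext⁻ u∈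
  ... | inj₂ (inj₁ u∈L) with cross i≢j u∈L w∈ adj
  ... | inj₁ (refl , u≡h , w≡h) = inj₁ (u≡h , w≡h)
  ... | inj₂ (refl , u≡t , w≡t) = inj₂ (u≡t , w≡t)
  ext-cross {i} {j} {u} {w} i≢j u∈ w∈ adj | inj₁ u∈a
   with ∈-fromMaybe⁻ u∈a | adj-consec (pathL j) (a∈ext u∈a) (∈ext w∈) adj
  ... | refl | inj₁ c = inj₁ (refl , consec-succ (ext-unique j) c (a-h refl))
  ... | refl | inj₂ c = contradiction c (no-pred (ext-unique j))
  ext-cross {i} {j} {u} {w} i≢j u∈ w∈ adj | inj₂ (inj₂ u∈b)
   with ∈-fromMaybe⁻ u∈b | adj-consec (pathL j) (b∈ext u∈b) (∈ext w∈) adj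
  ... | refl | inj₂ c = inj₂ (refl , consec-pred (ext-unique j) c (t-b refl))
  ... | refl | inj₁ c = contradiction (subst (Consec u w) eq c) (no-succ (fromMaybe ao ++ L j) (subst Unique eq (ext-unique j)))
   where
   eq : fromMaybe ao ++ L j ++ [ u ] ≡ (fromMaybe ao ++ L j) ++ [ u ]
   eq = sym (List.++-assoc (fromMaybe ao) (L j) [ u ])

  C-cyc : ∀ k → Cyc (C k)
  C-cyc k with others k
  ... | i , j , distinct k≢i k≢j i≢j with ext i in exteq | len i | hd j in hdeq
  ... | x ∷ [] | s≤s () | _
  ... | x ∷ p ∷ P | _ | Q , eqQ = subst Cyc (sym (Subset.⊆-antisym C⊆ ⊆C)) (rooted⇒cyc r)
   where
   P∈ : ∀ {u} → u ∈ x ∷ p ∷ P → u ∈ ext i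
   P∈ = subst (_ ∈_) (sym exteq)
   Q∈ : ∀ {w} → w ∈ h j ∷ Q → w ∈ L j
   Q∈ = subst (_ ∈_) (sym eqQ)

   x≡ : first i ≡ x
   x≡ = head-unique (first-hd i) (p ∷ P , exteq)

   final-last : ∀ {u} → Last u (p ∷ P) → final i ≡ u
   final-last lu = last-unique (final-tl i) (subst (Last _) (sym exteq) (last-∷ lu))

   last-final : ∀ {u} → u ∈ x ∷ p ∷ P → u ≡ final i → Last u (p ∷ P)
   last-final u∈ refl = last-tail (subst (Last (final i)) exteq (final-tl i))
    where
    last-tail : ∀ {u} → Last u (x ∷ p ∷ P) → Last u (p ∷ P)
    last-tail ([] , ())
    last-tail (_ ∷ ys , eq) = ys , List.∷-injectiveʳ eq

   r : Rooted x p (P ++ reverse Q) (h j)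
   r = ring (subst IPath exteq (pathL i))
    (subst IPath eqQ (ipath-prefix (L j) (ipath-suffix (fromMaybe ao) (pathL j))))
    (subst (λ v → Adj v (h j)) x≡ (first-adj i≢j))
    (λ lu lw → subst (λ v → Adj v _) (final-last lu)
     (subst (Adj (final i)) (last-unique (tl j) (subst (Last _) (sym eqQ) lw)) (final-adj i≢j)))
    (λ { u∈ w∈ refl → ext∉L i≢j (P∈ u∈) (Q∈ w∈) })
    (λ u∈ w∈ adj → case ext-cross i≢j (P∈ u∈) (Q∈ w∈) adj of λ
     { (inj₁ (u≡ , w≡)) → inj₁ (trans u≡ x≡ , w≡)
     ; (inj₂ (u≡ , w≡)) → inj₂ (last-final u∈ u≡ , subst (λ w → Last w _) (sym w≡) (subst (Last (t j)) eqQ (tl j))) })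

   ∈r : ∀ {u} → u ∈ ext i ⊎ u ∈ L j → u ∈ Rooted.list r
   ∈r (inj₁ u∈) with subst (_ ∈_) exteq u∈
   ... | here refl = here refl
   ... | there 1st = there 1st
   ... | there (there u∈P) = there (there (∈-++⁺ˡ (∈-++⁺ˡ u∈P)))
   ∈r (inj₂ u∈) with subst (_ ∈_) eqQ u∈
   ... | here refl = there (there (∈-++⁺ʳ (P ++ reverse Q) 1st))
   ... | there u∈Q = there (there (∈-++⁺ˡ (∈-++⁺ʳ P (∈-reverse⁺ u∈Q))))

   r∈ : ∀ {u} → u ∈ Rooted.list r → u ∈ ext i ⊎ u ∈ L j
   r∈ 1st = inj₁ (P∈ 1st)
   r∈ 2nd = inj₁ (P∈ 2nd)
   r∈ (there (there u∈)) with ∈-++⁻ (P ++ reverse Q) u∈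
   ... | inj₂ 1st = inj₂ (h∈ j)
   ... | inj₁ u∈' with ∈-++⁻ P u∈'
   ... | inj₁ u∈P = inj₁ (P∈ (there (there u∈P)))
   ... | inj₂ u∈Q = inj₂ (Q∈ (there (∈-reverse⁻ u∈Q)))

   C⊆ : C k ⊆ ⟦ Rooted.list r ⟧
   C⊆ u∈ = ∈⟦⟧⁺ (∈r (C⊆ext∪L (distinct i≢j (k≢i ∘ sym) (k≢j ∘ sym)) u∈))

   ⊆C : ⟦ Rooted.list r ⟧ ⊆ C k
   ⊆C u∈ with r∈ (∈⟦⟧⁻ u∈)
   ... | inj₁ u∈i = ∈C⁺ (ext⊆T i u∈i) (ext∉L (k≢i ∘ sym) u∈i)
   ... | inj₂ u∈j = ∈C⁺ (L⊆T j u∈j) λ u∈k → disj k≢j u∈k u∈j refl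

 module Spheres where

  _⊆?_ : ∀ (c d : Subset n) → Dec (c ⊆ d)
  _⊆?_ = Subset._⊆?_

  opaque
   cycs : Subset n → List (Subset n)
   cycs T = filter (λ c → cyc? c ×-dec (c ⊆? T)) (subsets n)

   cycs-in : ∀ T → CycsIn T (cycs T)
   cycs-in T = All.all-filter (λ c → cyc? c ×-dec (c ⊆? T)) (subsets n)

   coef-cycs : ∀ {T c} → Cyc c → c ⊆ T → coef (cycs T) c ≡ true
   coef-cycs {T} {c} cyc c⊆ = trans (coef-filter-subsets (λ c → cyc? c ×-dec (c ⊆? T)) c)
    (dec-true (cyc? c ×-dec (c ⊆? T)) (cyc , c⊆))

   ∈-cycs : ∀ {T c} → Cyc c → c ⊆ T → c ∈ cycs T
   ∈-cycs {T} cyc c⊆ = ∈-filter⁺ (λ c → cyc? c ×-dec (c ⊆? T)) (∈-subsets _) (cyc , c⊆)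

   cycs-unique : ∀ T → Unique (cycs T)
   cycs-unique T = Unique.filter⁺ (λ c → cyc? c ×-dec (c ⊆? T)) (subsets-unique n)

  Closed : List (Subset n) → Set
  Closed z = ∀ x y → Adj x y → ∂ z x y ≡ false

  -- The induced cycles inside T are the faces of a sphere.
  record Sphere (T : Subset n) : Set where
   field
    closed : Closed (cycs T)
    same : ∀ {z} → CycsIn T z → Closed z → ∀ {c d} → Cyc c → c ⊆ T → Cyc d → d ⊆ T → coef z c ≡ coef z d
    cover : ∀ {x} → x ∊ T → ∃[ c ] Cyc c × c ⊆ T × x ∊ c

  record Thin (T : Subset n) (x y : V) (c d : Subset n) : Set where
   field
    c≢d : c ≢ d
    cycᶜ : Cyc c
    cycᵈ : Cyc d
    c⊆ : c ⊆ T
    d⊆ : d ⊆ T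
    xc : x ∊ c
    yc : y ∊ c
    xd : x ∊ d
    yd : y ∊ d
    only : ∀ {e} → Cyc e → e ⊆ T → x ∊ e → y ∊ e → e ≡ c ⊎ e ≡ d

   ∂-thin : ∀ {z} → CycsIn T z → ∂ z x y ≡ coef z c xor coef z d
   ∂-thin {z} cs = trans (par-cong z pointwise) (par-xor _ _ z)
    where
    pointwise : ∀ {e} → e ∈ z → mem e x ∧ mem e y ≡ does (e ≟ₛ c) xor does (e ≟ₛ d)
    pointwise {e} e∈ with e ≟ₛ c | e ≟ₛ d
    ... | yes e≡c | yes e≡d = contradiction (trans (sym e≡c) e≡d) c≢d
    ... | yes refl | no _ = cong₂ _∧_ (∈⇒mem xc) (∈⇒mem yc)
    ... | no _ | yes refl = cong₂ _∧_ (∈⇒mem xd) (∈⇒mem yd)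
    ... | no e≢c | no e≢d with mem e x in ex | mem e y in ey
    ... | false | _ = refl
    ... | true | false = refl
    ... | true | true = contradiction
     (only (proj₁ (All.lookup cs e∈)) (proj₂ (All.lookup cs e∈)) (mem⇒∈ ex) (mem⇒∈ ey))
     [ e≢c , e≢d ]′

   thin-same : ∀ {z} → CycsIn T z → Adj x y → Closed z → coef z c ≡ coef z d
   thin-same {z} cs adj cl = xor≡false⇒≡ (trans (sym (∂-thin {z} cs)) (cl x y adj))

  open ThreePath

  flip : ∀ {ao bo L} → ThreePath ao bo L → ThreePath bo ao (λ i → reverse (L i))
  flip {ao} {bo} {L} S = record
   { h = t S
   ; t = h S
   ; hd = λ i → last⇒head (tl S i)
   ; tl = λ i → head⇒last (hd S i)
   ; len = λ i → subst (2 ≤_) (sym (trans (cong length (ext-reverse ao bo (L i))) (List.length-reverse (ext S i)))) (len S i)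
   ; pathL = λ i → subst IPath (sym (ext-reverse ao bo (L i))) (ipath-reverse (pathL S i))
   ; disj = λ i≢j u∈ w∈ → disj S i≢j (∈-reverse⁻ u∈) (∈-reverse⁻ w∈)
   ; cross = λ i≢j u∈ w∈ adj → [ inj₂ , inj₁ ]′ (cross S i≢j (∈-reverse⁻ u∈) (∈-reverse⁻ w∈) adj)
   ; joinᵃ = joinᵇ S
   ; joinᵇ = joinᵃ S }

  flip-T : ∀ {ao bo L} (S : ThreePath ao bo L) → T S ⊆ T (flip S)
  flip-T S u∈ with placeT S u∈
  ... | at-a u∈a = ext⊆T (flip S) zero (b∈ext (flip S) {zero} u∈a)
  ... | at-b u∈b = ext⊆T (flip S) zero (a∈ext (flip S) {zero} u∈b)
  ... | in-L i u∈L = L⊆T (flip S) i (∈-reverse⁺ u∈L)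

  flip-T⁻ : ∀ {ao bo L} (S : ThreePath ao bo L) → T (flip S) ⊆ T S
  flip-T⁻ S u∈ with placeT (flip S) u∈
  ... | at-a u∈a = ext⊆T S zero (b∈ext S {zero} u∈a)
  ... | at-b u∈b = ext⊆T S zero (a∈ext S {zero} u∈b)
  ... | in-L i u∈L = L⊆T S i (∈-reverse⁻ u∈L)

  flip-C : ∀ {ao bo L} (S : ThreePath ao bo L) k → C (flip S) k ≡ C S k
  flip-C S k = Subset.⊆-antisym
   (λ u∈ → ∈C⁺ S (flip-T⁻ S (C⊆T (flip S) u∈)) (C∌L (flip S) u∈ ∘ ∈-reverse⁺))
   (λ u∈ → ∈C⁺ (flip S) (flip-T S (C⊆T S u∈)) (C∌L S u∈ ∘ ∈-reverse⁻))

  tri : ∀ {ao bo L} → ThreePath ao bo L → Subset n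
  tri S = ⟦ h S zero ∷ h S 1F ∷ h S 2F ∷ [] ⟧

  module _ {ao bo : Maybe V} {L : Fin 3 → List V} (S : ThreePath ao bo L) where

   h∈tri : ∀ i → h S i ∊ tri S
   h∈tri zero = ∈⟦⟧⁺ 1st
   h∈tri 1F = ∈⟦⟧⁺ 2nd
   h∈tri 2F = ∈⟦⟧⁺ 3rd

   tri⁻ : ∀ {u} → u ∊ tri S → ∃[ i ] u ≡ h S i
   tri⁻ u∈ with ∈⟦⟧⁻ u∈
   ... | here eq = zero , eq
   ... | there (here eq) = suc zero , eq
   ... | there (there (here eq)) = 2F , eq

   tri-cyc : ao ≡ nothing → Cyc (tri S)
   tri-cyc eq = rooted⇒cyc (rooted {mid = []}
    (joinᵃ S {zero} {suc zero} eq (λ ())) (joinᵃ S {zero} {2F} eq (λ ())) []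
    (link (joinᵃ S {suc zero} {2F} eq (λ ())) [] [-]))

   tri⊆T : tri S ⊆ T S
   tri⊆T u∈ with tri⁻ u∈
   ... | i , refl = L⊆T S i (h∈ S i)

   data Nbr (i : Fin 3) (x u : V) : Set where
    along : Consec± x u (ext S i) → Nbr i x u
    acrossᵃ : ∀ j → i ≢ j → ao ≡ nothing → x ≡ h S i → u ≡ h S j → Nbr i x u
    acrossᵇ : ∀ j → i ≢ j → bo ≡ nothing → x ≡ t S i → u ≡ t S j → Nbr i x u

   nbr-type : ∀ {i x u} → x ∈ L i → u ∊ T S → Adj x u → Nbr i x u
   nbr-type {i} x∈ u∈ adj with placeT S u∈
   ... | at-a u∈a = along (adj-consec (pathL S i) (∈ext S x∈) (a∈ext S u∈a) adj)
   ... | at-b u∈b = along (adj-consec (pathL S i) (∈ext S x∈) (b∈ext S u∈b) adj)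
   ... | in-L j u∈L with i ≟ j
   ... | yes refl = along (adj-consec (pathL S i) (∈ext S x∈) (∈ext S u∈L) adj)
   ... | no i≢j with cross S i≢j x∈ u∈L adj
   ... | inj₁ (eq , x≡ , u≡) = acrossᵃ j i≢j eq x≡ u≡
   ... | inj₂ (eq , x≡ , u≡) = acrossᵇ j i≢j eq x≡ u≡

   private
    first≡h : ∀ {m} i → m ≡ nothing → Maybe.fromMaybe (h S i) m ≡ h S i
    first≡h i refl = refl

    final≡t : ∀ {m} i → m ≡ nothing → Maybe.fromMaybe (t S i) m ≡ t S i
    final≡t i refl = refl

   no-pred-h : ∀ {i u} → ao ≡ nothing → ¬ Consec u (h S i) (ext S i)
   no-pred-h {i} {u} eq c with subst (λ x → Head x (ext S i)) (first≡h i eq) (first-hd S i)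
   ... | ys , e = no-pred (subst Unique e (ext-unique S i)) (subst (Consec _ _) e c)

   no-succ-t : ∀ {i u} → bo ≡ nothing → ¬ Consec (t S i) u (ext S i)
   no-succ-t {i} {u} eq c with subst (λ x → Last x (ext S i)) (final≡t i eq) (final-tl S i)
   ... | ys , e = no-succ ys (subst Unique e (ext-unique S i)) (subst (Consec _ _) e c)

   module _ {e : Subset n} (cyc : Cyc e) (e⊆ : e ⊆ T S) (¬tri : ao ≡ nothing → e ≢ tri S) where

    forward : ∀ {i x y} → x ∈ L i → Consec x y (ext S i) → x ∊ e → y ∊ e
    forward {i} {x} {y} x∈ c x∈e = decidable-stable (y Subset.∈? e) λ y∉ →
     absurd y∉ (kind y∉ (nbr-type x∈ (e⊆ E.u∈) E.xu) E.u∈) (kind y∉ (nbr-type x∈ (e⊆ E.w∈) E.xw) E.w∈)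
     where
     module E = Two (cyc-two cyc x∈e)

     Kind : V → Set
     Kind u = Consec u x (ext S i) ⊎ ∃[ j ] i ≢ j × ao ≡ nothing × x ≡ h S i × u ≡ h S j

     kind : y ∉ₛ e → ∀ {u} → Nbr i x u → u ∊ e → Kind u
     kind y∉ (along (inj₁ c')) u∈ = contradiction (subst (_∊ e) (consec-succ (ext-unique S i) c' c) u∈) y∉
     kind y∉ (along (inj₂ c')) u∈ = inj₁ c'
     kind y∉ (acrossᵃ j i≢j eq x≡ u≡) u∈ = inj₂ (j , i≢j , eq , x≡ , u≡)
     kind y∉ (acrossᵇ j i≢j eq refl u≡) u∈ = contradiction c (no-succ-t eq)

     absurd : y ∉ₛ e → Kind E.u → Kind E.w → ⊥
     absurd y∉ (inj₁ c₁) (inj₁ c₂) = E.u≢w (consec-pred (ext-unique S i) c₁ c₂)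
     absurd y∉ (inj₁ c₁) (inj₂ (j , _ , eq , refl , _)) = no-pred-h eq c₁
     absurd y∉ (inj₂ (j , _ , eq , refl , _)) (inj₁ c₂) = no-pred-h eq c₂
     absurd y∉ (inj₂ (j , i≢j , eq , x≡ , u≡)) (inj₂ (k , i≢k , _ , _ , w≡)) =
      ¬tri eq (sym (cyc-antichain cyc (tri-cyc eq) tri⊆e))
      where
      d : Distinct i j k
      d = distinct i≢j i≢k λ { refl → E.u≢w (trans u≡ (sym w≡)) }
      tri⊆e : tri S ⊆ e
      tri⊆e v∈ with tri⁻ v∈
      ... | l , refl with exhaust d l
      ... | inj₁ refl = subst (_∊ e) x≡ x∈e
      ... | inj₂ (inj₁ refl) = subst (_∊ e) u≡ E.u∈
      ... | inj₂ (inj₂ refl) = subst (_∊ e) w≡ E.w∈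

    forward-all : ∀ {i} l {x} r → L i ≡ l ++ x ∷ r → x ∊ e → All (_∊ e) (r ++ fromMaybe bo)
    forward-all {i} l {x} [] eq x∈e = go bo refl
     where
     go : ∀ m → bo ≡ m → All (_∊ e) (fromMaybe m)
     go nothing _ = []
     go (just b) eqb = forward (subst (x ∈_) (sym eq) (∈-++⁺ʳ l 1st))
      (subst (λ v → Consec v b (ext S i)) (last-unique (tl S i) (l , eq)) (t-b S eqb)) x∈e ∷ []
    forward-all {i} l {x} (y ∷ r) eq x∈e =
     y∈e ∷ forward-all (l ++ [ x ]) r (trans eq (sym (List.++-assoc l [ x ] (y ∷ r)))) y∈e
     where
     y∈e : y ∊ e
     y∈e = forward (subst (x ∈_) (sym eq) (∈-++⁺ʳ l 1st))
      (consec-++ʳ (fromMaybe ao) (consec-++ˡ (fromMaybe bo)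
       (subst (Consec x y) (sym eq) (consec-++ʳ l here)))) x∈e

  triᵇ : ∀ {ao bo L} → ThreePath ao bo L → Subset n
  triᵇ S = tri (flip S)

  module ThreePathSphere {ao bo : Maybe V} {L : Fin 3 → List V} (S : ThreePath ao bo L) where

   spread : ∀ {e} → Cyc e → e ⊆ T S → (ao ≡ nothing → e ≢ tri S) → (bo ≡ nothing → e ≢ triᵇ S) →
    ∀ {i x} → x ∈ L i → x ∊ e → ∀ {u} → u ∈ ext S i → u ∊ e
   spread {e} cyc e⊆ ¬a ¬b {i} {x} x∈ x∈e u∈ with ∈-∃++ x∈
   ... | l , r , eq = go (∈ext⁻ S u∈)
    where
    fwd : All (_∊ e) (r ++ fromMaybe bo)
    fwd = forward-all S cyc e⊆ ¬a l r eq x∈e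

    rev-eq : reverse (L i) ≡ reverse r ++ x ∷ reverse l
    rev-eq = trans (cong reverse eq) (trans (List.reverse-++ l (x ∷ r))
     (trans (cong (_++ reverse l) (List.unfold-reverse x r)) (List.++-assoc (reverse r) [ x ] (reverse l))))

    bwd : All (_∊ e) (reverse l ++ fromMaybe ao)
    bwd = forward-all (flip S) cyc (λ u∈ → flip-T S (e⊆ u∈)) ¬b (reverse r) (reverse l) rev-eq x∈e

    go : ∀ {u} → u ∈ fromMaybe ao ⊎ u ∈ L i ⊎ u ∈ fromMaybe bo → u ∊ e
    go (inj₁ u∈a) = All.lookup bwd (∈-++⁺ʳ (reverse l) u∈a)
    go (inj₂ (inj₂ u∈b)) = All.lookup fwd (∈-++⁺ʳ r u∈b)
    go (inj₂ (inj₁ u∈L)) with ∈-++⁻ l (subst (_ ∈_) eq u∈L)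
    ... | inj₁ u∈l = All.lookup bwd (∈-++⁺ˡ (∈-reverse⁺ u∈l))
    ... | inj₂ 1st = x∈e
    ... | inj₂ (there u∈r) = All.lookup fwd (∈-++⁺ˡ u∈r)

   data Class (e : Subset n) : Set where
    is-a : ao ≡ nothing → e ≡ tri S → Class e
    is-b : bo ≡ nothing → e ≡ triᵇ S → Class e
    is-C : ∀ k → e ≡ C S k → Class e

   private
    tri? : ∀ m (e d : Subset n) → Dec (m ≡ nothing {A = V} × e ≡ d)
    tri? nothing e d = map′ (refl ,_) proj₂ (e ≟ₛ d)
    tri? (just _) e d = no λ ()

    missing : ∀ {e} → Cyc e → e ⊆ T S → ∀ {i} → ¬ Any (_∊ e) (L i) → Class e
    missing cyc e⊆ {i} none = is-C i
     (cyc-antichain (C-cyc S i) cyc λ u∈ → ∈C⁺ S (e⊆ u∈) λ u∈L → none (lose u∈L u∈))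

   classify : ∀ {e} → Cyc e → e ⊆ T S → Class e
   classify {e} cyc e⊆ with tri? ao e (tri S) | tri? bo e (triᵇ S)
    | Any.any? (λ u → u Subset.∈? e) (L zero) | Any.any? (λ u → u Subset.∈? e) (L 1F)
   ... | yes (p , q) | _ | _ | _ = is-a p q
   ... | no _ | yes (p , q) | _ | _ = is-b p q
   ... | no _ | no _ | no ¬m | _ = missing cyc e⊆ ¬m
   ... | no _ | no _ | yes _ | no ¬m = missing cyc e⊆ ¬m
   ... | no ¬a | no ¬b | yes m₀ | yes m₁ =
    is-C 2F (sym (cyc-antichain cyc (C-cyc S _) λ u∈ →
     case C⊆ext∪L S {zero} {suc zero} {2F} (distinct (λ ()) (λ ()) (λ ())) u∈ of λ
      { (inj₁ u∈ext) → spread' m₀ u∈ext ; (inj₂ u∈L) → spread' m₁ (∈ext S u∈L) }))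
    where
    spread' : ∀ {i} → Any (_∊ e) (L i) → ∀ {u} → u ∈ ext S i → u ∊ e
    spread' m = let _ , x∈ , x∈e = find m in
     spread cyc e⊆ (λ p q → ¬a (p , q)) (λ p q → ¬b (p , q)) x∈ x∈e

   C≢C : ∀ {i j} → i ≢ j → C S i ≢ C S j
   C≢C {i} {j} i≢j eq = C∌L S (subst (h S i ∊_) (sym eq) h∈Cj) (h∈ S i)
    where
    h∈Cj : h S i ∊ C S j
    h∈Cj = ∈C⁺ S (L⊆T S i (h∈ S i)) (λ u∈ → disj S i≢j (h∈ S i) u∈ refl)

   tri∩L : ∀ {i u} → u ∊ tri S → u ∈ ext S i → u ≡ h S i
   tri∩L {i} u∈ u∈ext with tri⁻ S u∈
   ... | j , refl with i ≟ j
   ... | yes refl = refl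
   ... | no i≢j = contradiction (h∈ S j) (ext∉L S i≢j u∈ext)

  module _ {ao bo : Maybe V} {L : Fin 3 → List V} (S : ThreePath ao bo L) where
   open ThreePathSphere S

   triᵇ∩L : ∀ {i u} → u ∊ triᵇ S → u ∈ ext S i → u ≡ t S i
   triᵇ∩L {i} u∈ u∈ext = ThreePathSphere.tri∩L (flip S) u∈
    (subst (_ ∈_) (sym (ext-reverse ao bo (L i))) (∈-reverse⁺ u∈ext))

   thin-along : ∀ {i j k x y} → Distinct i j k → x ∈ L i → y ∈ ext S i → Adj x y → Thin (T S) x y (C S j) (C S k)
   thin-along {i} {j} {k} {x} {y} (distinct i≢j i≢k j≢k) x∈ y∈ adj = record
    { c≢d = C≢C j≢k ; cycᶜ = C-cyc S j ; cycᵈ = C-cyc S k ; c⊆ = C⊆T S ; d⊆ = C⊆T S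
    ; xc = ∈C i≢j (∈ext S x∈) ; yc = ∈C i≢j y∈ ; xd = ∈C i≢k (∈ext S x∈) ; yd = ∈C i≢k y∈
    ; only = λ cyc e⊆ x∈e y∈e → go (classify cyc e⊆) x∈e y∈e }
    where
    ∈C : ∀ {l u} → i ≢ l → u ∈ ext S i → u ∊ C S l
    ∈C i≢l u∈ = ∈C⁺ S (ext⊆T S i u∈) (ext∉L S i≢l u∈)

    go : ∀ {e} → Class e → x ∊ e → y ∊ e → e ≡ C S j ⊎ e ≡ C S k
    go (is-a _ refl) x∈e y∈e = contradiction
     (trans (tri∩L x∈e (∈ext S x∈)) (sym (tri∩L y∈e y∈))) (Adj⇒≢ adj)
    go (is-b _ refl) x∈e y∈e = contradiction
     (trans (triᵇ∩L x∈e (∈ext S x∈)) (sym (triᵇ∩L y∈e y∈))) (Adj⇒≢ adj)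
    go (is-C l refl) x∈e y∈e with exhaust (distinct i≢j i≢k j≢k) l
    ... | inj₁ refl = contradiction x∈ (C∌L S x∈e)
    ... | inj₂ (inj₁ refl) = inj₁ refl
    ... | inj₂ (inj₂ refl) = inj₂ refl

   thin-across : ∀ {i j k} → Distinct i j k → ao ≡ nothing → Thin (T S) (h S i) (h S j) (tri S) (C S k)
   thin-across {i} {j} {k} d@(distinct i≢j i≢k j≢k) eq = record
    { c≢d = λ e → C∌L S (subst (h S k ∊_) e (h∈tri S k)) (h∈ S k)
    ; cycᶜ = tri-cyc S eq ; cycᵈ = C-cyc S k ; c⊆ = tri⊆T S ; d⊆ = C⊆T S
    ; xc = h∈tri S i ; yc = h∈tri S j ; xd = ∈C i≢k ; yd = ∈C j≢k
    ; only = λ cyc e⊆ x∈e y∈e → go (classify cyc e⊆) x∈e y∈e }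
    where
    ∈C : ∀ {i} → i ≢ k → h S i ∊ C S k
    ∈C {i} i≢k = ∈C⁺ S (L⊆T S i (h∈ S i)) (λ u∈ → disj S i≢k (h∈ S i) u∈ refl)

    short : ∀ {a b : Maybe V} xs {u} → a ≡ nothing → b ≡ nothing → Unique xs → Head u xs → Last u xs →
     ¬ 2 ≤ length (fromMaybe a ++ xs ++ fromMaybe b)
    short (u ∷ []) refl refl _ (_ , refl) _ (s≤s ())
    short (u ∷ w ∷ xs) refl refl un (_ , refl) ([] , ())
    short (u ∷ w ∷ xs) refl refl un (_ , refl) (_ ∷ ys , lst) _ =
     unique-head un (subst (u ∈_) (sym (List.∷-injectiveʳ lst)) (∈-++⁺ʳ ys 1st)) refl

    go : ∀ {e} → Class e → h S i ∊ e → h S j ∊ e → e ≡ tri S ⊎ e ≡ C S k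
    go (is-a _ refl) _ _ = inj₁ refl
    go (is-b eqb refl) x∈e _ = contradiction (len S i)
     (short (L i) eq eqb (unique-++ˡ (unique-++ʳ (fromMaybe ao) (ext-unique S i))) (hd S i)
      (subst (λ u → Last u (L i)) (sym (triᵇ∩L x∈e (∈ext S (h∈ S i)))) (tl S i)))
    go (is-C l refl) x∈e y∈e with exhaust d l
    ... | inj₁ refl = contradiction (h∈ S i) (C∌L S x∈e)
    ... | inj₂ (inj₁ refl) = contradiction (h∈ S j) (C∌L S y∈e)
    ... | inj₂ (inj₂ refl) = inj₂ refl

  module _ {ao bo : Maybe V} {L : Fin 3 → List V} (S : ThreePath ao bo L) where
   open ThreePathSphere S

   thin-acrossᵇ : ∀ {i j k} → Distinct i j k → bo ≡ nothing → Thin (T S) (t S i) (t S j) (triᵇ S) (C S k)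
   thin-acrossᵇ {i} {j} {k} d eq =
    subst (λ s → Thin s (t S i) (t S j) (triᵇ S) (C S k)) (Subset.⊆-antisym (flip-T⁻ S) (flip-T S))
     (subst (Thin (T (flip S)) (t S i) (t S j) (triᵇ S)) (flip-C S k) (thin-across (flip S) d eq))

   Thin∃ : V → V → Set
   Thin∃ x y = ∃[ c ] ∃[ d ] Thin (T S) x y c d

   thin-sym : ∀ {x y} → Thin∃ x y → Thin∃ y x
   thin-sym (c , d , th) = c , d , record
    { Thin th using (c≢d; cycᶜ; cycᵈ; c⊆; d⊆)
    ; xc = Thin.yc th ; yc = Thin.xc th ; xd = Thin.yd th ; yd = Thin.xd th
    ; only = λ cyc e⊆ y∈ x∈ → Thin.only th cyc e⊆ x∈ y∈ }

   thin-L : ∀ {i x y} → x ∈ L i → y ∊ T S → Adj x y → Thin∃ x y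
   thin-L {i} x∈ y∈ adj with nbr-type S x∈ y∈ adj
   ... | along c = let j , k , d = others i in _ , _ , thin-along S d x∈ (consec±-∈ʳ c) adj
   ... | acrossᵃ j i≢j eq refl refl = let k , d = third i≢j in _ , _ , thin-across S d eq
   ... | acrossᵇ j i≢j eq refl refl = let k , d = third i≢j in _ , _ , thin-acrossᵇ d eq

   same-end : ∀ {m} {x y : V} → x ∈ fromMaybe m → y ∈ fromMaybe m → x ≡ y
   same-end {just _} 1st 1st = refl

   ends-far : ∀ {x y} → x ∈ fromMaybe ao → y ∈ fromMaybe bo → ¬ Adj x y
   ends-far {x} {y} x∈ y∈ adj
    with ∈-fromMaybe⁻ x∈ | adj-consec (pathL S zero) (a∈ext S {zero} x∈) (b∈ext S {zero} y∈) adj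
   ... | refl | inj₂ c = no-pred (ext-unique S zero) c
   ... | refl | inj₁ c = b∉L S y∈ (h∈ S zero) (consec-succ (ext-unique S zero) c (a-h S {zero} refl))

   thin-any : ∀ {x y} → x ∊ T S → y ∊ T S → Adj x y → Thin∃ x y
   thin-any x∈ y∈ adj with placeT S x∈ | placeT S y∈
   ... | in-L _ x∈L | _ = thin-L x∈L y∈ adj
   ... | _ | in-L _ y∈L = thin-sym (thin-L y∈L x∈ (Adj-sym adj))
   ... | at-a x∈a | at-a y∈a = contradiction (same-end x∈a y∈a) (Adj⇒≢ adj)
   ... | at-b x∈b | at-b y∈b = contradiction (same-end x∈b y∈b) (Adj⇒≢ adj)
   ... | at-a x∈a | at-b y∈b = contradiction adj (ends-far x∈a y∈b)
   ... | at-b x∈b | at-a y∈a = contradiction (Adj-sym adj) (ends-far y∈a x∈b)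

   threePath⇒sphere : Sphere (T S)
   threePath⇒sphere = record { closed = closed ; same = same ; cover = cover }
    where
    closed : Closed (cycs (T S))
    closed x y adj with x Subset.∈? T S | y Subset.∈? T S
    ... | yes x∈ | yes y∈ = let c , d , th = thin-any x∈ y∈ adj in
     trans (Thin.∂-thin th {cycs (T S)} (cycs-in (T S)))
      (cong₂ _xor_ (coef-cycs (Thin.cycᶜ th) (Thin.c⊆ th)) (coef-cycs (Thin.cycᵈ th) (Thin.d⊆ th)))
    ... | no x∉ | _ = par-false (cycs (T S)) λ {c} c∈ →
     cong (_∧ mem c y) (∉⇒mem λ x∈ → x∉ (proj₂ (All.lookup (cycs-in (T S)) c∈) x∈))
    ... | yes _ | no y∉ = par-false (cycs (T S)) λ {c} c∈ →
     trans (cong (mem c x ∧_) (∉⇒mem λ y∈ → y∉ (proj₂ (All.lookup (cycs-in (T S)) c∈) y∈))) (Bool.∧-zeroʳ _)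

    neighbour : ∀ {x xs} → x ∈ xs → 2 ≤ length xs → ∃[ y ] Consec± x y xs
    neighbour {xs = x ∷ []} _ (s≤s ())
    neighbour {xs = x ∷ y ∷ xs} 1st _ = y , inj₁ here
    neighbour {xs = x ∷ y ∷ xs} 2nd _ = x , inj₂ here
    neighbour {xs = x ∷ y ∷ z ∷ xs} (there (there z∈)) _ with neighbour {xs = y ∷ z ∷ xs} (there z∈) (s≤s (s≤s z≤n))
    ... | w , inj₁ c = w , inj₁ (there c)
    ... | w , inj₂ c = w , inj₂ (there c)

    module _ {z : List (Subset n)} (cs : CycsIn (T S) z) (cl : Closed z) where

     same-C : ∀ {i j} → i ≢ j → coef z (C S i) ≡ coef z (C S j)
     same-C {i} {j} i≢j with third i≢j
     ... | k , distinct _ i≢k j≢k with neighbour (∈ext S (h∈ S k)) (len S k)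
     ...   | y , c = let adj = consec±-adj (pathL S k) c in
      Thin.thin-same (thin-along S (distinct (i≢k ∘ sym) (j≢k ∘ sym) i≢j) (h∈ S k) (consec±-∈ʳ c) adj) {z} cs adj cl

     same-C₀ : ∀ i → coef z (C S i) ≡ coef z (C S 2F)
     same-C₀ i with i ≟ 2F
     ... | yes refl = refl
     ... | no i≢ = same-C i≢

     d₀₁ : Distinct zero 1F 2F
     d₀₁ = distinct (λ ()) (λ ()) (λ ())

     to-C₂ : ∀ {c} → Cyc c → c ⊆ T S → coef z c ≡ coef z (C S 2F)
     to-C₂ cyc c⊆ with classify cyc c⊆
     ... | is-a eq refl = Thin.thin-same (thin-across S d₀₁ eq) {z} cs (joinᵃ S eq (λ ())) cl
     ... | is-b eq refl = Thin.thin-same (thin-acrossᵇ d₀₁ eq) {z} cs (joinᵇ S eq (λ ())) cl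
     ... | is-C k refl = same-C₀ k

    same : ∀ {z} → CycsIn (T S) z → Closed z → ∀ {c d} → Cyc c → c ⊆ T S → Cyc d → d ⊆ T S → coef z c ≡ coef z d
    same {z} cs cl cc c⊆ cd d⊆ = trans (to-C₂ {z} cs cl cc c⊆) (sym (to-C₂ {z} cs cl cd d⊆))

    outside-L : ∀ {x} → Place S x → ∃[ k ] x ∉ L k
    outside-L (at-a x∈) = zero , λ x∈L → a∉L S x∈ x∈L refl
    outside-L (at-b x∈) = zero , λ x∈L → b∉L S x∈ x∈L refl
    outside-L (in-L i x∈) with others i
    ... | j , _ , distinct i≢j _ _ = j , λ x∈j → disj S i≢j x∈ x∈j refl

    cover : ∀ {x} → x ∊ T S → ∃[ c ] Cyc c × c ⊆ T S × x ∊ c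
    cover x∈ = let k , x∉ = outside-L (placeT S x∈) in C S k , C-cyc S k , C⊆T S , ∈C⁺ S x∈ x∉

 open Spheres public

 module ConeFill (w : V) {U : Subset n} (w∈ : w ∊ U) (ε : V → V → Bool)
  (symm : ∀ x y → ε x y ≡ ε y x) (supp : ∀ {x y} → ε x y ≡ true → Adj x y × x ∊ U)
  (off-w : ∀ y → ε w y ≡ false) (even : ∀ {x} → x ≢ w → ¬ Adj w x → par (ε x) (allFin n) ≡ false) where

  odd : V → Bool
  odd x = par (ε x) (allFin n)

  spoke total : V → V → Bool
  spoke x y = (does (x ≟ w) ∧ odd y) xor (does (y ≟ w) ∧ odd x)
  total x y = ε x y xor spoke x y

  private
   odd-adj : ∀ {x} → odd x ≡ true → Adj w x × x ∊ U
   odd-adj {x} e = decidable-stable (adj? w x) (λ ¬wx → case trans (sym e) (even x≢w ¬wx) of λ ()) ,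
    proj₂ (supp (proj₂ (proj₂ (par-true⇒∃ (allFin n) e))))
    where
    x≢w : x ≢ w
    x≢w refl = case trans (sym e) (par-false (allFin n) λ {y} _ → off-w y) of λ ()

   total-sym : ∀ x y → total x y ≡ total y x
   total-sym x y = cong₂ _xor_ (symm x y) (Bool.xor-comm (does (x ≟ w) ∧ odd y) _)

   total-supp : ∀ {x y} → total x y ≡ true → Adj x y × x ∊ U
   total-supp {x} {y} e with xor-true (ε x y) e
   ... | inj₁ e₁ = supp e₁
   ... | inj₂ e₁ with xor-true (does (x ≟ w) ∧ odd y) e₁
   ...   | inj₁ e₂ = let x≡w , oy = ∧-true {does (x ≟ w)} e₂ in
    case does-true (x ≟ w) x≡w of λ { refl → proj₁ (odd-adj oy) , w∈ }
   ...   | inj₂ e₂ = let y≡w , ox = ∧-true {does (y ≟ w)} e₂ in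
    case does-true (y ≟ w) y≡w of λ { refl → Adj-sym (proj₁ (odd-adj ox)) , proj₂ (odd-adj ox) }

   diag : ∀ x → total x x ≡ false
   diag x with total x x in e
   ... | false = refl
   ... | true = contradiction refl (Adj⇒≢ (proj₁ (total-supp e)))

   degree : V → Bool
   degree x = par (total x) (allFin n)

   degree-off : ∀ x (x≟w : Dec (x ≡ w)) → degree x ≡ does x≟w ∧ degree w
   degree-off x (yes refl) = refl
   degree-off x (no x≢w) = trans (par-cong (allFin n) λ {y} _ → cong (λ d → ε x y xor ((d ∧ odd y) xor (does (y ≟ w) ∧ odd x))) (dec-false (x ≟ w) x≢w))
    (trans (par-xor (ε x) (λ y → does (y ≟ w) ∧ odd x) (allFin n))
    (trans (cong (odd x xor_) (par-δ-fin (λ _ → odd x) w)) (Bool.xor-same (odd x))))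

   even-w : degree w ≡ false
   even-w = trans (sym (par-δ-fin (λ _ → degree w) w)) (trans (par-cong (allFin n) λ {x} _ → sym (degree-off x (x ≟ w)))
    (handshake total (allFin n) diag total-sym))

  opaque
   filling : Filling U total
   filling = fill record
    { symm = total-sym ; supp = total-supp
    ; even = λ x → trans (degree-off x (x ≟ w)) (trans (cong (does (x ≟ w) ∧_) even-w) (Bool.∧-zeroʳ _)) }

 -- An induced cycle seen as two paths s ∷ α ++ [ t ] and s ∷ β ++ [ t ].
 record Bicycle (s t : V) (α β : List V) : Set where
  field
   pathα : IPath (s ∷ α ++ [ t ])
   pathβ : IPath (s ∷ β ++ [ t ])
   anti : Anti α β
   α≥1 : 1 ≤ length α
   β≥1 : 1 ≤ length β

  set : Subset n
  set = ⟦ s ∷ t ∷ α ++ β ⟧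

  private
   first-far : ∀ α → 1 ≤ length α → IPath (s ∷ α ++ [ t ]) → Far s t
   first-far (a ∷ α) _ (link _ far _) = All.lookup far (∈-++⁺ʳ α 1st)

  s-t : Far s t
  s-t = first-far α α≥1 pathα

  headα : ∃[ a ] Head a α
  headα = has-head {xs = α} α≥1
  headβ : ∃[ b ] Head b β
  headβ = has-head {xs = β} β≥1

  s∉α : s ∉ α
  s∉α s∈ = unique-head (ipath-unique pathα) (∈-++⁺ˡ s∈) refl
  s∉β : s ∉ β
  s∉β s∈ = unique-head (ipath-unique pathβ) (∈-++⁺ˡ s∈) refl
  t∉α : t ∉ α
  t∉α t∈ = unique-last (s ∷ α) (ipath-unique pathα) (there t∈)
  t∉β : t ∉ β
  t∉β t∈ = unique-last (s ∷ β) (ipath-unique pathβ) (there t∈)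

  α⊆ : ∀ {x} → x ∈ s ∷ α ++ [ t ] → x ∊ set
  α⊆ 1st = ∈⟦⟧⁺ 1st
  α⊆ (there x∈) with ∈-++⁻ α x∈
  ... | inj₁ x∈α = ∈⟦⟧⁺ (there (there (∈-++⁺ˡ x∈α)))
  ... | inj₂ 1st = ∈⟦⟧⁺ 2nd
  β⊆ : ∀ {x} → x ∈ s ∷ β ++ [ t ] → x ∊ set
  β⊆ 1st = ∈⟦⟧⁺ 1st
  β⊆ (there x∈) with ∈-++⁻ β x∈
  ... | inj₁ x∈β = ∈⟦⟧⁺ (there (there (∈-++⁺ʳ α x∈β)))
  ... | inj₂ 1st = ∈⟦⟧⁺ 2nd

  data Where (x : V) : Set where
   is-s : x ≡ s → Where x
   is-t : x ≡ t → Where x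
   in-α : x ∈ α → Where x
   in-β : x ∈ β → Where x

  position : ∀ {x} → x ∊ set → Where x
  position x∈ with ∈⟦⟧⁻ x∈
  ... | here x≡s = is-s x≡s
  ... | there (here x≡t) = is-t x≡t
  ... | there (there x∈') with ∈-++⁻ α x∈'
  ... | inj₁ x∈α = in-α x∈α
  ... | inj₂ x∈β = in-β x∈β

 module _ {s t : V} {α β : List V} (B : Bicycle s t α β) where
  open Bicycle B

  bicycle-swap : Bicycle s t β α
  bicycle-swap = record
   { pathα = pathβ ; pathβ = pathα ; anti = Anti-sym {α} {β} anti ; α≥1 = β≥1 ; β≥1 = α≥1 }

  bicycle-flip : Bicycle t s (reverse α) (reverse β)
  bicycle-flip = record
   { pathα = subst IPath (eq α) (ipath-reverse pathα)
   ; pathβ = subst IPath (eq β) (ipath-reverse pathβ)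
   ; anti = λ x∈ y∈ → anti (∈-reverse⁻ x∈) (∈-reverse⁻ y∈)
   ; α≥1 = subst (1 ≤_) (sym (List.length-reverse α)) α≥1
   ; β≥1 = subst (1 ≤_) (sym (List.length-reverse β)) β≥1 }
   where
   eq : ∀ α → reverse (s ∷ α ++ [ t ]) ≡ t ∷ reverse α ++ [ s ]
   eq α = trans (List.unfold-reverse s (α ++ [ t ])) (cong (_++ [ s ]) (List.reverse-++ α [ t ]))

 bicycle-swap-set : ∀ {s t α β} (B : Bicycle s t α β) → Bicycle.set (bicycle-swap B) ≡ Bicycle.set B
 bicycle-swap-set {s} {t} {α} {β} B = Subset.⊆-antisym (half {β} {α}) (half {α} {β})
  where
  half : ∀ {α β} → ⟦ s ∷ t ∷ α ++ β ⟧ ⊆ ⟦ s ∷ t ∷ β ++ α ⟧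
  half {α} {β} x∈ with ∈⟦⟧⁻ x∈
  ... | here refl = ∈⟦⟧⁺ 1st
  ... | there 1st = ∈⟦⟧⁺ 2nd
  ... | there (there x∈') with ∈-++⁻ α x∈'
  ... | inj₁ x∈α = ∈⟦⟧⁺ (there (there (∈-++⁺ʳ β x∈α)))
  ... | inj₂ x∈β = ∈⟦⟧⁺ (there (there (∈-++⁺ˡ x∈β)))

 bicycle⇒cyc : ∀ {s t α β} (B : Bicycle s t α β) → Cyc (Bicycle.set B)
 bicycle⇒cyc {s} {t} {[]} {_} record { α≥1 = () }
 bicycle⇒cyc {s} {t} {_ ∷ _} {[]} record { β≥1 = () }
 bicycle⇒cyc {s} {t} {a ∷ α} {b ∷ β} B = subst Cyc (Subset.⊆-antisym r⊆ ⊆r) (rooted⇒cyc r)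
  where
  open Bicycle B

  sb : Adj s b
  sb = consec-adj pathβ here

  end-adj : ∀ {u w} → Last u (a ∷ α ++ [ t ]) → Last w (b ∷ β) → Adj u w
  end-adj lu (ys , eq) with last-unique lu (a ∷ α , refl)
  ... | refl = Adj-sym (consec-adj pathβ (there (subst (Consec _ t)
   (trans (sym (List.++-assoc ys _ _)) (cong (_++ [ t ]) (sym eq))) (consec-last ys))))

  b-in : ∀ {w} → w ∈ b ∷ β → w ∈ s ∷ b ∷ β ++ [ t ]
  b-in w∈ = there (∈-++⁺ˡ w∈)

  dis : ∀ {u w} → u ∈ s ∷ a ∷ α ++ [ t ] → w ∈ b ∷ β → u ≢ w
  dis 1st w∈ refl = s∉β w∈
  dis (there u∈) w∈ refl with ∈-++⁻ (a ∷ α) u∈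
  ... | inj₁ u∈α = proj₁ (anti u∈α w∈) refl
  ... | inj₂ 1st = t∉β w∈

  ends : ∀ {u w} → u ∈ s ∷ a ∷ α ++ [ t ] → w ∈ b ∷ β → Adj u w →
   (u ≡ s × w ≡ b) ⊎ (Last u (a ∷ α ++ [ t ]) × Last w (b ∷ β))
  ends 1st w∈ adj with adj-consec pathβ 1st (b-in w∈) adj
  ... | inj₁ c = inj₁ (refl , consec-succ (ipath-unique pathβ) c here)
  ... | inj₂ c = contradiction c (no-pred (ipath-unique pathβ))
  ends (there u∈) w∈ adj with ∈-++⁻ (a ∷ α) u∈
  ... | inj₁ u∈α = contradiction adj (proj₂ (anti u∈α w∈))
  ... | inj₂ 1st with snoc b β
  ... | l , m , eq with adj-consec pathβ (there (∈-++⁺ʳ (b ∷ β) 1st)) (b-in w∈) adj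
  ... | inj₁ c = contradiction c (no-succ (s ∷ b ∷ β) (ipath-unique pathβ))
  ... | inj₂ c = inj₂ ((a ∷ α , refl) , subst (λ w → Last w (b ∷ β)) (sym w≡m) (l , eq))
   where
   w≡m : _ ≡ m
   w≡m = consec-pred (ipath-unique pathβ) c (there (subst (Consec m t)
    (trans (sym (List.++-assoc l _ _)) (cong (_++ [ t ]) (sym eq))) (consec-last l)))

  r : Rooted s a ((α ++ [ t ]) ++ reverse β) b
  r = ring pathα (ipath-prefix (b ∷ β) (ipath-tail pathβ)) sb end-adj dis ends

  r⊆ : ⟦ Rooted.list r ⟧ ⊆ set
  r⊆ x∈ with ∈⟦⟧⁻ x∈
  ... | here refl = ∈⟦⟧⁺ 1st
  ... | there 1st = ∈⟦⟧⁺ 3rd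
  ... | there (there x∈') with ∈-++⁻ ((α ++ [ t ]) ++ reverse β) x∈'
  ... | inj₂ 1st = ∈⟦⟧⁺ (there (there (∈-++⁺ʳ (a ∷ α) 1st)))
  ... | inj₁ x∈″ with ∈-++⁻ (α ++ [ t ]) x∈″
  ... | inj₁ x∈αt = α⊆ (there (there x∈αt))
  ... | inj₂ x∈β = β⊆ (there (there (∈-++⁺ˡ (∈-reverse⁻ {xs = β} x∈β))))

  ⊆r : set ⊆ ⟦ Rooted.list r ⟧
  ⊆r x∈ with position x∈
  ... | is-s refl = ∈⟦⟧⁺ 1st
  ... | is-t refl = ∈⟦⟧⁺ (there (there (∈-++⁺ˡ (∈-++⁺ˡ (∈-++⁺ʳ α 1st)))))
  ... | in-α 1st = ∈⟦⟧⁺ 2nd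
  ... | in-α (there x∈α) = ∈⟦⟧⁺ (there (there (∈-++⁺ˡ (∈-++⁺ˡ (∈-++⁺ˡ x∈α)))))
  ... | in-β 1st = ∈⟦⟧⁺ (there (there (∈-++⁺ʳ ((α ++ [ t ]) ++ reverse β) 1st)))
  ... | in-β (there x∈β) = ∈⟦⟧⁺ (there (there (∈-++⁺ˡ (∈-++⁺ʳ (α ++ [ t ]) (∈-reverse⁺ x∈β)))))

 record BicycleOf (c : Subset n) (s t : V) : Set where
  field
   {α β} : List V
   bicycle : Bicycle s t α β
   set≡ : Bicycle.set bicycle ≡ c
  open Bicycle bicycle public

 cyc⇒bicycle : ∀ {c s t} → Cyc c → s ∊ c → t ∊ c → Far s t → BicycleOf c s t
 cyc⇒bicycle {c} {s} {t} cyc s∈ t∈ (s≢t , ¬st) with cyc⇒rooted cyc s∈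
 ... | R with RootedIn.⊆list R t∈
 ... | here refl = contradiction refl s≢t
 ... | there 1st = contradiction (RootedIn.va R) ¬st
 ... | there (there t∈') with ∈-++⁻ (RootedIn.mid R) t∈'
 ... | inj₂ 1st = contradiction (RootedIn.vb R) ¬st
 ... | inj₁ t∈mid with ∈-∃++ t∈mid
 ... | l , r , eq = record { bicycle = B ; set≡ = Subset.⊆-antisym B⊆ ⊆B }
  where
  open RootedIn R
  list-eq : a ∷ mid ++ [ b ] ≡ (a ∷ l) ++ t ∷ r ++ [ b ]
  list-eq = cong (a ∷_) (trans (cong (_++ [ b ]) eq) (List.++-assoc l (t ∷ r) [ b ]))

  arc' : IPath ((a ∷ l) ++ t ∷ r ++ [ b ])
  arc' = subst IPath list-eq arc

  far-s : ∀ {x} → x ∈ mid → Far s x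
  far-s = All.lookup far

  l⊆ : ∀ {x} → x ∈ l → x ∈ mid
  l⊆ x∈ = subst (_ ∈_) (sym eq) (∈-++⁺ˡ x∈)
  r⊆ : ∀ {x} → x ∈ r → x ∈ mid
  r⊆ x∈ = subst (_ ∈_) (sym eq) (∈-++⁺ʳ l (there x∈))

  rev : reverse (t ∷ r ++ [ b ]) ≡ (b ∷ reverse r) ++ [ t ]
  rev = trans (List.unfold-reverse t (r ++ [ b ])) (cong (_++ [ t ]) (List.reverse-++ r [ b ]))

  β-eq : ∀ {x} → x ∈ b ∷ reverse r → x ∈ r ++ [ b ]
  β-eq 1st = ∈-++⁺ʳ r 1st
  β-eq (there x∈) = ∈-++⁺ˡ (∈-reverse⁻ {xs = r} x∈)

  B : Bicycle s t (a ∷ l) (b ∷ reverse r)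
  B = record
   { pathα = link va (All.++⁺ (All.tabulate (far-s ∘ l⊆)) (far-s t∈mid ∷ []))
    (ipath-prefix ((a ∷ l) ++ [ t ]) (subst IPath (sym (List.++-assoc (a ∷ l) [ t ] (r ++ [ b ]))) arc'))
   ; pathβ = link vb (All.++⁺ (All.tabulate (far-s ∘ r⊆ ∘ ∈-reverse⁻)) (far-s t∈mid ∷ []))
    (subst IPath rev (ipath-reverse (ipath-suffix (a ∷ l) arc')))
   ; anti = λ x∈ y∈ → ipath-far (a ∷ l) arc' x∈ (β-eq y∈)
   ; α≥1 = s≤s z≤n
   ; β≥1 = s≤s z≤n }

  module B = Bicycle B

  B⊆ : B.set ⊆ c
  B⊆ x∈ with B.position x∈
  ... | B.is-s refl = s∈
  ... | B.is-t refl = t∈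
  ... | B.in-α 1st = list⊆ 2nd
  ... | B.in-α (there x∈l) = list⊆ (there (there (∈-++⁺ˡ (l⊆ x∈l))))
  ... | B.in-β 1st = list⊆ (there (there (∈-++⁺ʳ mid 1st)))
  ... | B.in-β (there x∈r) = list⊆ (there (there (∈-++⁺ˡ (r⊆ (∈-reverse⁻ x∈r)))))

  ⊆B : c ⊆ B.set
  ⊆B {x} x∈ with ⊆list x∈
  ... | here refl = ∈⟦⟧⁺ 1st
  ... | there x∈' with ∈-++⁻ (a ∷ l) (subst (x ∈_) list-eq x∈')
  ... | inj₁ x∈al = B.α⊆ (there (∈-++⁺ˡ x∈al))
  ... | inj₂ 1st = ∈⟦⟧⁺ 2nd
  ... | inj₂ (there x∈rb) with ∈-++⁻ r x∈rb
  ... | inj₁ x∈r = B.β⊆ (there (∈-++⁺ˡ {xs = b ∷ reverse r} (there (∈-reverse⁺ x∈r))))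
  ... | inj₂ 1st = B.β⊆ 2nd

 infixl 6 _+v_

 _+v_ : Subset n → V → Subset n
 c +v q = c Subset.∪ Subset.⁅ q ⁆

 ∈+v⁻ : ∀ {c q x} → x ∊ c +v q → x ∊ c ⊎ x ≡ q
 ∈+v⁻ {c} {q} x∈ with Subset.x∈p∪q⁻ c Subset.⁅ q ⁆ x∈
 ... | inj₁ x∈c = inj₁ x∈c
 ... | inj₂ x∈q = inj₂ (Subset.x∈⁅y⁆⇒x≡y q x∈q)

 ⊆+v : ∀ {c q} → c ⊆ c +v q
 ⊆+v {c} = Subset.p⊆p∪q _

 q∈+v : ∀ {c q} → q ∊ c +v q
 q∈+v {c} {q} = Subset.q⊆p∪q c _ (Subset.x∈⁅x⁆ q)

 module _ {c : Subset n} {q s t : V} (cyc : Cyc c) (q∉ : q ∉ₛ c) (s∈ : s ∊ c) (t∈ : t ∊ c)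
  (qs : Adj q s) (qt : Adj q t) (s-t : Far s t) where

  private
   without-q : ∀ {e} → Cyc e → e ⊆ c +v q → q ∉ₛ e → e ≡ c
   without-q ce e⊆ q∉e = cyc-antichain cyc ce λ x∈ →
    [ id , (λ { refl → contradiction x∈ q∉e }) ]′ (∈+v⁻ (e⊆ x∈))

   follow : ∀ {e x y} r → Cyc e → e ⊆ c +v q → IPath (x ∷ y ∷ r) → All (_∊ c) (x ∷ y ∷ r) →
    (∀ {u} l → y ∷ r ≡ l ++ [ u ] → All (Far q) l) → x ∊ e → y ∊ e → All (_∊ e) r
   follow [] ce e⊆ p all far x∈ y∈ = []
   follow {e} {x} {y} (z ∷ r) ce e⊆ (link xy fx p@(link yz _ _)) (xc ∷ yc ∷ zc ∷ rc) far x∈ y∈ =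
    z∈ ∷ follow r ce e⊆ p (yc ∷ zc ∷ rc) (λ l eq → All.tail (far (y ∷ l) (cong (y ∷_) eq))) y∈ z∈
    where
    z∈ : z ∊ e
    z∈ with snoc z r
    ... | l , u , eq = two-⊆ cyc ce
     (λ w∈ yw → [ id , (λ { refl → contradiction (Adj-sym yw) (proj₂ (All.head (far (y ∷ l) (cong (y ∷_) eq)))) }) ]′ (∈+v⁻ (e⊆ w∈)))
     yc y∈ zc yz

   thin-hub : ∀ {d} → Cyc d → d ⊆ c +v q → d ≢ c → ∃[ x ] ∃[ y ] Adj x y × Thin (c +v q) x y c d
   thin-hub {d} cd d⊆ d≢c with q Subset.∈? d
   ... | no q∉d = contradiction (without-q cd d⊆ q∉d) d≢c
   ... | yes q∈d = go (mid ++ [ b ]) refl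
    where
    open RootedIn (cyc⇒rooted cd q∈d)

    on-c : ∀ {x} → x ∈ a ∷ mid ++ [ b ] → x ∊ c
    on-c x∈ = [ id , (λ x≡q → contradiction (sym x≡q) (arc-∉ x∈)) ]′ (∈+v⁻ (d⊆ (list⊆ (there x∈))))

    go : ∀ xs → mid ++ [ b ] ≡ xs → ∃[ x ] ∃[ y ] Adj x y × Thin (c +v q) x y c d
    go [] eq = case List.++-conicalʳ mid [ b ] eq of λ ()
    go (y ∷ r) eq = a , y , consec-adj arc' here , record
     { c≢d = d≢c ∘ sym ; cycᶜ = cyc ; cycᵈ = cd ; c⊆ = ⊆+v ; d⊆ = d⊆
     ; xc = on-c 1st ; yc = on-c (there y∈) ; xd = list⊆ 2nd ; yd = list⊆ (there (there y∈))
     ; only = only' }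
     where
     y∈ : y ∈ mid ++ [ b ]
     y∈ = subst (y ∈_) (sym eq) 1st
     arc' : IPath (a ∷ y ∷ r)
     arc' = subst (λ l → IPath (a ∷ l)) eq arc

     only' : ∀ {e} → Cyc e → e ⊆ c +v q → a ∊ e → y ∊ e → e ≡ c ⊎ e ≡ d
     only' {e} ce e⊆ a∈ y∈e with q Subset.∈? e
     ... | no q∉e = inj₁ (without-q ce e⊆ q∉e)
     ... | yes q∈e = inj₂ (sym (cyc-antichain ce cd λ x∈ → All.lookup all (⊆list x∈)))
      where
      rest : All (_∊ e) r
      rest = follow r ce e⊆ arc' (subst (λ l → All (_∊ c) (a ∷ l)) eq (All.tabulate on-c))
       (λ l eq' → subst (All (Far q)) (List.∷ʳ-injectiveˡ mid l (trans eq eq')) far) a∈ y∈e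
      all : All (_∊ e) (q ∷ a ∷ mid ++ [ b ])
      all = q∈e ∷ a∈ ∷ subst (All (_∊ e)) (sym eq) (y∈e ∷ rest)

   B : BicycleOf c s t
   B = cyc⇒bicycle cyc s∈ t∈ s-t
   module B = BicycleOf B

   ∈c : ∀ {x} → x ∊ B.set → x ∊ c
   ∈c {x} = subst (x ∊_) B.set≡
   c∈ : ∀ {x} → x ∊ c → x ∊ B.set
   c∈ {x} = subst (x ∊_) (sym B.set≡)

   -- The two halves of the wheel: q together with one of the arcs of c.
   half : List V → Subset n
   half α = ⟦ q ∷ s ∷ α ++ [ t ] ⟧

   half⊆ : ∀ {α} → (∀ {u} → u ∈ s ∷ α ++ [ t ] → u ∊ B.set) → half α ⊆ c +v q
   half⊆ sub x∈ with ∈⟦⟧⁻ x∈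
   ... | here refl = q∈+v
   ... | there x∈' = ⊆+v (∈c (sub x∈'))

   edge : Subset n → V → V → Bool
   edge S x y = (mem S x ∧ mem S y) ∧ adjᵇ x y

   A : Subset n
   A = ⟦ s ∷ B.α ++ [ t ] ⟧

   edge-α : ∀ {x} y → x ∈ B.α → edge A x y ≡ edge c x y
   edge-α {x} y x∈ with adj? x y
   ... | no _ = trans (Bool.∧-zeroʳ _) (sym (Bool.∧-zeroʳ _))
   ... | yes xy = cong (_∧ true) (cong₂ _∧_ (trans (∈⇒mem (∈⟦⟧⁺ (there (∈-++⁺ˡ x∈)))) (sym (∈⇒mem (∈c (B.α⊆ (there (∈-++⁺ˡ x∈)))))))
    (bool-ext (λ e → ∈⇒mem (∈c (B.α⊆ (∈⟦⟧⁻ (mem⇒∈ e))))) (λ e → ∈⇒mem (in-A (B.position (c∈ (mem⇒∈ e)))))))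
    where
    in-A : B.Where y → y ∊ A
    in-A (B.is-s refl) = ∈⟦⟧⁺ 1st
    in-A (B.is-t refl) = ∈⟦⟧⁺ (there (∈-++⁺ʳ B.α 1st))
    in-A (B.in-α y∈) = ∈⟦⟧⁺ (there (∈-++⁺ˡ y∈))
    in-A (B.in-β y∈) = contradiction xy (proj₂ (B.anti x∈ y∈))

   odd-α : ∀ {x} → x ∈ B.α → par (edge A x) (allFin n) ≡ false
   odd-α {x} x∈ = trans (par-cong (allFin n) λ {y} _ → edge-α y x∈) (cyc-even cyc x)

   inner : ∀ {x} → ¬ Adj q x → x ∈ s ∷ B.α ++ [ t ] → par (edge A x) (allFin n) ≡ false
   inner ¬qx 1st = contradiction qs ¬qx
   inner ¬qx (there x∈) with ∈-++⁻ B.α x∈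
   ... | inj₁ x∈α = odd-α x∈α
   ... | inj₂ 1st = contradiction qt ¬qx

   even : ∀ {x} → x ≢ q → ¬ Adj q x → par (edge A x) (allFin n) ≡ false
   even {x} _ ¬qx with x Subset.∈? A
   ... | yes x∈ = inner ¬qx (∈⟦⟧⁻ x∈)
   ... | no x∉ = par-false (allFin n) λ {y} _ → cong (λ b → (b ∧ mem A y) ∧ adjᵇ x y) (∉⇒mem x∉)

   edge-sym : ∀ x y → edge A x y ≡ edge A y x
   edge-sym x y = cong₂ _∧_ (Bool.∧-comm (mem A x) _) (adjᵇ-sym x y)

   edge-supp : ∀ {x y} → edge A x y ≡ true → Adj x y × x ∊ half B.α
   edge-supp {x} {y} e = let e₁ , e₂ = ∧-true {mem A x ∧ mem A y} e in
    adjᵇ⇒ e₂ , ∈⟦⟧⁺ (there (∈⟦⟧⁻ (mem⇒∈ (proj₁ (∧-true e₁)))))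

   edge-q : ∀ y → edge A q y ≡ false
   edge-q y = cong (λ b → (b ∧ mem A y) ∧ adjᵇ q y) (∉⇒mem λ q∈ → q∉ (∈c (B.α⊆ (∈⟦⟧⁻ q∈))))

   module First = ConeFill q {half B.α} (∈⟦⟧⁺ 1st) (edge A) edge-sym edge-supp edge-q even

   first : List (Subset n)
   first = proj₁ First.filling

   first-∂ : ∀ {x y} → x ∈ B.α → Adj x y → ∂ (c ∷ first) x y ≡ false
   first-∂ {x} {y} x∈ xy = ≡⇒xor≡false (sym (begin
    ∂ first x y
    ≡⟨ proj₂ (proj₂ First.filling) x y xy ⟩
     edge A x y xor ((does (x ≟ q) ∧ First.odd y) xor (does (y ≟ q) ∧ First.odd x))
    ≡⟨ cong₂ _xor_ (edge-α y x∈) (cong₂ (λ a b → (a ∧ First.odd y) xor (does (y ≟ q) ∧ b))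
     (dec-false (x ≟ q) λ { refl → q∉ (∈c (B.α⊆ (there (∈-++⁺ˡ x∈)))) }) (odd-α x∈)) ⟩
     edge c x y xor (does (y ≟ q) ∧ false)
    ≡⟨ trans (cong (edge c x y xor_) (Bool.∧-zeroʳ _)) (Bool.xor-identityʳ _) ⟩
     edge c x y
    ≡⟨ trans (cong ((mem c x ∧ mem c y) ∧_) (⇒adjᵇ xy)) (Bool.∧-identityʳ _) ⟩
     mem c x ∧ mem c y ∎))
    where open ≡-Reasoning

   first-in : CycsIn (c +v q) (c ∷ first)
   first-in = (cyc , ⊆+v) ∷ cycsIn-mono (half⊆ B.α⊆) (proj₁ (proj₂ First.filling))

   opaque
    rest : Filling (half B.β) (λ x y → ∂ (c ∷ first) x y ∧ adjᵇ x y)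
    rest = fill record
     { symm = EvenSet.symm E ; even = EvenSet.even E
     ; supp = λ {x} {y} e → let a , x∈ = EvenSet.supp E {x} {y} e in a , in-half (∈+v⁻ x∈) a (proj₁ (∧-true e)) }
     where
     E : EvenSet (c +v q) (λ x y → ∂ (c ∷ first) x y ∧ adjᵇ x y)
     E = cyc-evenSet first-in
     in-half : ∀ {x y} → x ∊ c ⊎ x ≡ q → Adj x y → ∂ (c ∷ first) x y ≡ true → x ∊ half B.β
     in-half (inj₂ refl) _ _ = ∈⟦⟧⁺ 1st
     in-half {x} (inj₁ x∈) xy e = go (B.position (c∈ x∈))
      where
      go : B.Where x → x ∊ half B.β
      go (B.is-s refl) = ∈⟦⟧⁺ 2nd
      go (B.is-t refl) = ∈⟦⟧⁺ (there (there (∈-++⁺ʳ B.β 1st)))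
      go (B.in-β x∈β) = ∈⟦⟧⁺ (there (there (∈-++⁺ˡ x∈β)))
      go (B.in-α x∈α) = case trans (sym e) (first-∂ x∈α xy) of λ ()

   second halves : List (Subset n)
   second = proj₁ rest
   halves = first ++ second

   halves-∂ : ∀ x y → Adj x y → ∂ halves x y ≡ mem c x ∧ mem c y
   halves-∂ x y xy = begin
    ∂ (first ++ second) x y
    ≡⟨ ∂-++ first second x y ⟩
     ∂ first x y xor ∂ second x y
    ≡⟨ cong (∂ first x y xor_) (trans (proj₂ (proj₂ rest) x y xy) (trans (cong (∂ (c ∷ first) x y ∧_) (⇒adjᵇ xy)) (Bool.∧-identityʳ _))) ⟩
     ∂ first x y xor ((mem c x ∧ mem c y) xor ∂ first x y)
    ≡⟨ cong (∂ first x y xor_) (Bool.xor-comm (mem c x ∧ mem c y) _) ⟩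
     ∂ first x y xor (∂ first x y xor (mem c x ∧ mem c y))
    ≡⟨ xor-cancelˡ (∂ first x y) _ ⟩
     mem c x ∧ mem c y ∎
    where open ≡-Reasoning

   halves-in : CycsIn (c +v q) halves
   halves-in = All.++⁺ (All.tail first-in) (cycsIn-mono (half⊆ B.β⊆) (proj₁ (proj₂ rest)))

   c⊈half : ∀ {α β} → Bicycle s t α β → (∀ {x} → x ∈ β → x ∊ c) → ¬ c ⊆ half α
   c⊈half {α} {[]} record { β≥1 = () }
   c⊈half {α} {b ∷ β} B β⊆ c⊆ with ∈⟦⟧⁻ (c⊆ (β⊆ 1st))
   ... | here refl = q∉ (β⊆ 1st)
   ... | there 1st = Bicycle.s∉β B 1st
   ... | there (there b∈) with ∈-++⁻ α b∈
   ... | inj₁ b∈α = proj₁ (Bicycle.anti B b∈α 1st) refl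
   ... | inj₂ 1st = Bicycle.t∉β B 1st

   c∉halves : c ∉ halves
   c∉halves c∈h with ∈-++⁻ first c∈h
   ... | inj₁ c∈₁ = c⊈half B.bicycle (λ x∈ → ∈c (B.β⊆ (there (∈-++⁺ˡ x∈))))
    (proj₂ (All.lookup (proj₁ (proj₂ First.filling)) c∈₁))
   ... | inj₂ c∈₂ = c⊈half (bicycle-swap B.bicycle) (λ x∈ → ∈c (B.α⊆ (there (∈-++⁺ˡ x∈))))
    (proj₂ (All.lookup (proj₁ (proj₂ rest)) c∈₂))

   z₀ : List (Subset n)
   z₀ = c ∷ halves

   z₀-in : CycsIn (c +v q) z₀
   z₀-in = (cyc , ⊆+v) ∷ halves-in

   z₀-closed : Closed z₀
   z₀-closed x y adj = ≡⇒xor≡false (sym (halves-∂ x y adj))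

   z₀-c : coef z₀ c ≡ true
   z₀-c = trans (cong₂ _xor_ (dec-true (c ≟ₛ c) refl) (coef-∉ {z = halves} c∉halves)) refl

   same-c : ∀ {z} → CycsIn (c +v q) z → Closed z → ∀ {d} → Cyc d → d ⊆ c +v q → coef z d ≡ coef z c
   same-c {z} cs cl {d} cd d⊆ with d ≟ₛ c
   ... | yes refl = refl
   ... | no d≢c   = let x , y , adj , th = thin-hub cd d⊆ d≢c in sym (Thin.thin-same th {z} cs adj cl)

  hub⇒sphere : Sphere (c +v q)
  hub⇒sphere = record
   { closed = λ x y adj → trans (∂-≈ {cycs (c +v q)} {z₀} agree x y) (z₀-closed x y adj)
   ; same = λ {z} cs cl cc c⊆ cd d⊆ → trans (same-c {z} cs cl cc c⊆) (sym (same-c {z} cs cl cd d⊆))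
   ; cover = λ x∈ → cover (∈+v⁻ x∈) }
   where
   all-true : ∀ {d} → Cyc d → d ⊆ c +v q → coef z₀ d ≡ true
   all-true cd d⊆ = trans (same-c {z₀} z₀-in z₀-closed cd d⊆) z₀-c

   agree : cycs (c +v q) ≈ z₀
   agree d with cyc? d | d ⊆? (c +v q)
   ... | yes cd | yes d⊆ = trans (coef-cycs cd d⊆) (sym (all-true cd d⊆))
   ... | no ¬cd | _ = trans (coef-∉ {z = cycs (c +v q)} λ d∈ → ¬cd (proj₁ (All.lookup (cycs-in (c +v q)) d∈)))
    (sym (coef-∉ {z = z₀} λ d∈ → ¬cd (proj₁ (All.lookup z₀-in d∈))))
   ... | yes _ | no d⊈ = trans (coef-∉ {z = cycs (c +v q)} λ d∈ → d⊈ (proj₂ (All.lookup (cycs-in (c +v q)) d∈)))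
    (sym (coef-∉ {z = z₀} λ d∈ → d⊈ (proj₂ (All.lookup z₀-in d∈))))

   -- The halves are not empty, because their boundary is that of c.
   q-cover : ∃[ d ] Cyc d × d ⊆ c +v q × q ∊ d
   q-cover with par-true⇒∃ halves (trans (halves-∂ s _ (Two.xu two)) (cong₂ _∧_ (∈⇒mem s∈) (∈⇒mem (Two.u∈ two))))
    where
    two : Two s c
    two = cyc-two cyc s∈
   ... | d , d∈ , _ with All.lookup halves-in d∈
   ... | cd , d⊆ = d , cd , d⊆ , decidable-stable (q Subset.∈? d) λ q∉d →
    c∉halves (subst (_∈ halves) (without-q cd d⊆ q∉d) d∈)

   cover : ∀ {x} → x ∊ c ⊎ x ≡ q → ∃[ d ] Cyc d × d ⊆ c +v q × x ∊ d
   cover (inj₁ x∈c) = c , cyc , ⊆+v , x∈c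
   cover (inj₂ refl) = q-cover

 Solid : Subset n → Set
 Solid T = IsSolid (induced G T)

 opaque
  solid? : ∀ T → Dec (Solid T)
  solid? T = isSolid? (induced G T)

 module _ (ao bo : Maybe V) (L : Fin 3 → List V) where

  Ext : Fin 3 → List V
  Ext i = fromMaybe ao ++ L i ++ fromMaybe bo

  Verts : List V
  Verts = fromMaybe ao ++ fromMaybe bo ++ L zero ++ L 1F ++ L 2F

  data Kind (h t : Fin 3 → V) (x y : V) : Set where
   along : ∀ i → Consec± x y (Ext i) → Kind h t x y
   acrossᵃ : ∀ i j → i ≢ j → ao ≡ nothing → x ≡ h i → y ≡ h j → Kind h t x y
   acrossᵇ : ∀ i j → i ≢ j → bo ≡ nothing → x ≡ t i → y ≡ t j → Kind h t x y

  -- A three-path configuration specified by the list of all its edges.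
  record Spec : Set where
   field
    h t : Fin 3 → V
    hd : ∀ i → Head (h i) (L i)
    tl : ∀ i → Last (t i) (L i)
    len : ∀ i → 2 ≤ length (Ext i)
    uniq : Unique Verts
    to : ∀ {x y} → x ∈ Verts → y ∈ Verts → Adj x y → Kind h t x y
    from : ∀ {x y} → Kind h t x y → Adj x y

 module _ {ao bo : Maybe V} {L : Fin 3 → List V} (S : Spec ao bo L) where
  open Spec S

  private
   ∈V : ∀ i {x} → x ∈ L i → x ∈ Verts ao bo L
   ∈V zero x∈ = ∈-++⁺ʳ (fromMaybe ao) (∈-++⁺ʳ (fromMaybe bo) (∈-++⁺ˡ x∈))
   ∈V 1F x∈ = ∈-++⁺ʳ (fromMaybe ao) (∈-++⁺ʳ (fromMaybe bo) (∈-++⁺ʳ (L zero) (∈-++⁺ˡ x∈)))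
   ∈V 2F x∈ = ∈-++⁺ʳ (fromMaybe ao) (∈-++⁺ʳ (fromMaybe bo) (∈-++⁺ʳ (L zero) (∈-++⁺ʳ (L 1F) x∈)))

   uniq-bL : Unique (fromMaybe bo ++ L zero ++ L 1F ++ L 2F)
   uniq-bL = unique-++ʳ (fromMaybe ao) uniq
   uniq-L : Unique (L zero ++ L 1F ++ L 2F)
   uniq-L = unique-++ʳ (fromMaybe bo) uniq-bL

   ∈L : ∀ i {x} → x ∈ L i → x ∈ L zero ++ L 1F ++ L 2F
   ∈L zero x∈ = ∈-++⁺ˡ x∈
   ∈L 1F x∈ = ∈-++⁺ʳ (L zero) (∈-++⁺ˡ x∈)
   ∈L 2F x∈ = ∈-++⁺ʳ (L zero) (∈-++⁺ʳ (L 1F) x∈)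

   uniq-at : ∀ i → Unique (L i)
   uniq-at zero = unique-++ˡ uniq-L
   uniq-at 1F = unique-++ˡ (unique-++ʳ (L zero) uniq-L)
   uniq-at 2F = unique-++ʳ (L 1F) (unique-++ʳ (L zero) uniq-L)

   disj' : ∀ {i j x} → i ≢ j → x ∈ L i → x ∉ L j
   disj' {zero} {zero} i≢j _ _ = i≢j refl
   disj' {suc zero} {suc zero} i≢j _ _ = i≢j refl
   disj' {2F} {2F} i≢j _ _ = i≢j refl
   disj' {zero} {suc zero} _ x∈ y∈ = unique-disjoint uniq-L (x∈ , ∈-++⁺ˡ y∈)
   disj' {zero} {2F} _ x∈ y∈ = unique-disjoint uniq-L (x∈ , ∈-++⁺ʳ (L 1F) y∈)
   disj' {suc zero} {2F} _ x∈ y∈ = unique-disjoint (unique-++ʳ (L zero) uniq-L) (x∈ , y∈)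
   disj' {suc zero} {zero} _ x∈ y∈ = unique-disjoint uniq-L (y∈ , ∈-++⁺ˡ x∈)
   disj' {2F} {zero} _ x∈ y∈ = unique-disjoint uniq-L (y∈ , ∈-++⁺ʳ (L 1F) x∈)
   disj' {2F} {suc zero} _ x∈ y∈ = unique-disjoint (unique-++ʳ (L zero) uniq-L) (y∈ , x∈)

   a∉L' : ∀ {i x} → x ∈ fromMaybe ao → x ∉ L i
   a∉L' {i} x∈a x∈L = unique-disjoint uniq (x∈a , ∈-++⁺ʳ (fromMaybe bo) (∈L i x∈L))
   b∉L' : ∀ {i x} → x ∈ fromMaybe bo → x ∉ L i
   b∉L' {i} x∈b x∈L = unique-disjoint uniq-bL (x∈b , ∈L i x∈L)
   a∉b' : ∀ {x} → x ∈ fromMaybe ao → x ∉ fromMaybe bo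
   a∉b' x∈a x∈b = unique-disjoint uniq (x∈a , ∈-++⁺ˡ x∈b)

   end-unique : ∀ m → Unique (fromMaybe {A = V} m)
   end-unique nothing = []
   end-unique (just _) = [] ∷ []

   ext-uniq : ∀ i → Unique (Ext ao bo L i)
   ext-uniq i = Unique.++⁺ (end-unique ao)
    (Unique.++⁺ (uniq-at i) (end-unique bo) λ (x∈L , x∈b) → b∉L' {i} x∈b x∈L)
    λ (x∈a , x∈) → [ a∉L' {i} x∈a , a∉b' x∈a ]′ (∈-++⁻ (L i) x∈)

   ext⊆ : ∀ i {x} → x ∈ Ext ao bo L i → x ∈ Verts ao bo L
   ext⊆ i x∈ with ∈-++⁻ (fromMaybe ao) x∈
   ... | inj₁ x∈a = ∈-++⁺ˡ x∈a
   ... | inj₂ x∈' with ∈-++⁻ (L i) x∈'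
   ... | inj₁ x∈L = ∈V i x∈L
   ... | inj₂ x∈b = ∈-++⁺ʳ (fromMaybe ao) (∈-++⁺ˡ x∈b)

   L∩ext : ∀ {i j x} → x ∈ L i → x ∈ Ext ao bo L j → i ≡ j
   L∩ext {i} {j} x∈ x∈ext = decidable-stable (i ≟ j) λ i≢j → case ∈-++⁻ (fromMaybe ao) x∈ext of λ
    { (inj₁ x∈a) → a∉L' {i} x∈a x∈
    ; (inj₂ x∈') → case ∈-++⁻ (L j) x∈' of λ
     { (inj₁ x∈j) → disj' i≢j x∈ x∈j ; (inj₂ x∈b) → b∉L' {i} x∈b x∈ } }

   inside-L : ∀ ao bo xs {x y h : V} → Head h xs → Unique (fromMaybe ao ++ xs ++ fromMaybe bo) →
    Consec x y (fromMaybe ao ++ xs ++ fromMaybe bo) → x ∈ xs ⊎ y ∈ xs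
   inside-L (just a) bo xs (ys , refl) u here = inj₂ 1st
   inside-L (just a) bo xs hd (_ ∷ u) (there c) = inside-L nothing bo xs hd u c
   inside-L nothing nothing xs hd u c = inj₁ (subst (_ ∈_) (List.++-identityʳ xs) (consec-∈ˡ c))
   inside-L nothing (just b) xs hd u c with ∈-++⁻ xs (consec-∈ˡ c)
   ... | inj₁ x∈ = inj₁ x∈
   ... | inj₂ 1st = contradiction c (no-succ xs u)

   chordless : ∀ i {x y} → x ∈ Ext ao bo L i → y ∈ Ext ao bo L i → Adj x y → Consec± x y (Ext ao bo L i)
   chordless i x∈ y∈ adj with to (ext⊆ i x∈) (ext⊆ i y∈) adj
   ... | acrossᵃ j k j≢k _ refl refl = contradiction
    (trans (L∩ext (head-∈ (hd j)) x∈) (sym (L∩ext (head-∈ (hd k)) y∈))) j≢k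
   ... | acrossᵇ j k j≢k _ refl refl = contradiction
    (trans (L∩ext (last-∈ (tl j)) x∈) (sym (L∩ext (last-∈ (tl k)) y∈))) j≢k
   ... | along j (inj₁ c) with inside-L ao bo (L j) (hd j) (ext-uniq j) c
   ... | inj₁ x∈L = subst (λ k → Consec± _ _ (Ext ao bo L k)) (L∩ext x∈L x∈) (inj₁ c)
   ... | inj₂ y∈L = subst (λ k → Consec± _ _ (Ext ao bo L k)) (L∩ext y∈L y∈) (inj₁ c)
   chordless i x∈ y∈ adj | along j (inj₂ c) with inside-L ao bo (L j) (hd j) (ext-uniq j) c
   ... | inj₁ y∈L = subst (λ k → Consec± _ _ (Ext ao bo L k)) (L∩ext y∈L y∈) (inj₂ c)
   ... | inj₂ x∈L = subst (λ k → Consec± _ _ (Ext ao bo L k)) (L∩ext x∈L x∈) (inj₂ c)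

   ∈ext' : ∀ {i x} → x ∈ L i → x ∈ Ext ao bo L i
   ∈ext' x∈ = ∈-++⁺ʳ (fromMaybe ao) (∈-++⁺ˡ x∈)

   cross' : ∀ {i j x y} → i ≢ j → x ∈ L i → y ∈ L j → Adj x y →
    (ao ≡ nothing × x ≡ h i × y ≡ h j) ⊎ (bo ≡ nothing × x ≡ t i × y ≡ t j)
   cross' {i} {j} i≢j x∈ y∈ adj with to (∈V i x∈) (∈V j y∈) adj
   ... | along k c = contradiction (trans (L∩ext x∈ (consec±-∈ˡ c)) (sym (L∩ext y∈ (consec±-∈ʳ c)))) i≢j
   ... | acrossᵃ k l _ eq refl refl = inj₁ (eq , cong h (sym (L∩ext x∈ (∈ext' (head-∈ (hd k))))) , cong h (sym (L∩ext y∈ (∈ext' (head-∈ (hd l))))))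
   ... | acrossᵇ k l _ eq refl refl = inj₂ (eq , cong t (sym (L∩ext x∈ (∈ext' (last-∈ (tl k))))) , cong t (sym (L∩ext y∈ (∈ext' (last-∈ (tl l))))))

  spec⇒threePath : ThreePath ao bo L
  spec⇒threePath = record
   { h = h ; t = t ; hd = hd ; tl = tl ; len = len
   ; pathL = λ i → linked⇒ipath (ext-uniq i) (λ c → from (along i (inj₁ c))) (chordless i)
   ; disj = λ { i≢j x∈ y∈ refl → disj' i≢j x∈ y∈ }
   ; cross = cross'
   ; joinᵃ = λ eq i≢j → from (acrossᵃ _ _ i≢j eq refl refl)
   ; joinᵇ = λ eq i≢j → from (acrossᵇ _ _ i≢j eq refl refl) }

 module _ {ao bo : Maybe V} {L : Fin 3 → List V} (S : ThreePath ao bo L) where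
  private module S = ThreePath S

  private
   no-dup : ∀ {m : Maybe V} → Unique (fromMaybe m)
   no-dup {nothing} = []
   no-dup {just _} = [] ∷ []

   uniq-L : ∀ i → Unique (L i)
   uniq-L i = unique-++ˡ (unique-++ʳ (fromMaybe ao) (S.ext-unique i))

   uniq : Unique (Verts ao bo L)
   uniq = Unique.++⁺ no-dup (Unique.++⁺ no-dup
    (Unique.++⁺ (uniq-L zero) (Unique.++⁺ (uniq-L 1F) (uniq-L 2F)
     λ (x∈ , y∈) → S.disj (λ ()) x∈ y∈ refl)
     λ (x∈ , y∈) → [ (λ y∈₁ → S.disj (λ ()) x∈ y∈₁ refl) , (λ y∈₂ → S.disj (λ ()) x∈ y∈₂ refl) ]′ (∈-++⁻ (L 1F) y∈))
    λ (x∈ , y∈) → in-some (∈-++⁻ (L zero) y∈) λ i y∈i → S.b∉L x∈ y∈i refl)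
    λ (x∈ , y∈) → case ∈-++⁻ (fromMaybe bo) y∈ of λ
     { (inj₁ y∈b) → S.a∉b x∈ y∈b refl
     ; (inj₂ y∈L) → in-some (∈-++⁻ (L zero) y∈L) λ i y∈i → S.a∉L x∈ y∈i refl }
    where
    in-some : ∀ {y} → y ∈ L zero ⊎ y ∈ L 1F ++ L 2F → ¬ (∀ i → y ∉ L i)
    in-some (inj₁ y∈) f = f zero y∈
    in-some (inj₂ y∈) f = [ f 1F , f 2F ]′ (∈-++⁻ (L 1F) y∈)

   swap-kind : ∀ {x y} → Kind ao bo L S.h S.t x y → Kind ao bo L S.h S.t y x
   swap-kind (along i c) = along i (consec±-sym c)
   swap-kind (acrossᵃ i j i≢j eq p q) = acrossᵃ j i (i≢j ∘ sym) eq q p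
   swap-kind (acrossᵇ i j i≢j eq p q) = acrossᵇ j i (i≢j ∘ sym) eq q p

   from-L : ∀ {i x y} → x ∈ L i → y ∈ Verts ao bo L → Adj x y → Kind ao bo L S.h S.t x y
   from-L {i} x∈ y∈ adj with nbr-type S x∈ (∈⟦⟧⁺ y∈) adj
   ... | Nbr.along c = along i c
   ... | Nbr.acrossᵃ j i≢j eq x≡ y≡ = acrossᵃ i j i≢j eq x≡ y≡
   ... | Nbr.acrossᵇ j i≢j eq x≡ y≡ = acrossᵇ i j i≢j eq x≡ y≡

   to : ∀ {x y} → x ∈ Verts ao bo L → y ∈ Verts ao bo L → Adj x y → Kind ao bo L S.h S.t x y
   to x∈ y∈ adj with S.place x∈ | S.place y∈
   ... | ThreePath.in-L i x∈L | _ = from-L x∈L y∈ adj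
   ... | _ | ThreePath.in-L j y∈L = swap-kind (from-L y∈L x∈ (Adj-sym adj))
   ... | ThreePath.at-a x∈a | ThreePath.at-a y∈a = contradiction (same-end S x∈a y∈a) (Adj⇒≢ adj)
   ... | ThreePath.at-b x∈b | ThreePath.at-b y∈b = contradiction (same-end S x∈b y∈b) (Adj⇒≢ adj)
   ... | ThreePath.at-a x∈a | ThreePath.at-b y∈b = contradiction adj (ends-far S x∈a y∈b)
   ... | ThreePath.at-b x∈b | ThreePath.at-a y∈a = contradiction (Adj-sym adj) (ends-far S y∈a x∈b)

   from : ∀ {x y} → Kind ao bo L S.h S.t x y → Adj x y
   from (along i c) = consec±-adj (S.pathL i) c
   from (acrossᵃ i j i≢j eq refl refl) = S.joinᵃ eq i≢j
   from (acrossᵇ i j i≢j eq refl refl) = S.joinᵇ eq i≢j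

  threePath⇒spec : Spec ao bo L
  threePath⇒spec = record
   { h = S.h ; t = S.t ; hd = S.hd ; tl = S.tl ; len = S.len ; uniq = uniq ; to = to ; from = from }

 open PartialGraph using (Vertex; Edge)

 private
  module Perm⊕ = MonoidSolver (Perm.++-commutativeMonoid {A = V})
  open Perm⊕ using (_⊕_; _⊜_)

 stamp-perm : ∀ (b : V) h₀ h₁ h₂ I₀ I₁ I₂ →
  b ∷ (h₀ ∷ I₀) ++ (h₁ ∷ I₁) ++ (h₂ ∷ I₂) ↭ h₀ ∷ h₁ ∷ h₂ ∷ b ∷ I₀ ++ I₁ ++ I₂
 stamp-perm b h₀ h₁ h₂ I₀ I₁ I₂ = Perm⊕.solve 7
  (λ b h₀ h₁ h₂ I₀ I₁ I₂ → b ⊕ ((h₀ ⊕ I₀) ⊕ ((h₁ ⊕ I₁) ⊕ (h₂ ⊕ I₂))) ⊜ h₀ ⊕ (h₁ ⊕ (h₂ ⊕ (b ⊕ (I₀ ⊕ (I₁ ⊕ I₂))))))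
  Perm.refl [ b ] [ h₀ ] [ h₁ ] [ h₂ ] I₀ I₁ I₂

 prism-perm : ∀ (h₀ h₁ h₂ t₀ t₁ t₂ : V) I₀ I₁ I₂ →
  (h₀ ∷ I₀ ++ [ t₀ ]) ++ (h₁ ∷ I₁ ++ [ t₁ ]) ++ (h₂ ∷ I₂ ++ [ t₂ ]) ↭
  h₀ ∷ h₁ ∷ h₂ ∷ t₀ ∷ t₁ ∷ t₂ ∷ I₀ ++ I₁ ++ I₂
 prism-perm h₀ h₁ h₂ t₀ t₁ t₂ I₀ I₁ I₂ = Perm⊕.solve 9
  (λ h₀ h₁ h₂ t₀ t₁ t₂ I₀ I₁ I₂ →
   (h₀ ⊕ (I₀ ⊕ t₀)) ⊕ ((h₁ ⊕ (I₁ ⊕ t₁)) ⊕ (h₂ ⊕ (I₂ ⊕ t₂))) ⊜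
   h₀ ⊕ (h₁ ⊕ (h₂ ⊕ (t₀ ⊕ (t₁ ⊕ (t₂ ⊕ (I₀ ⊕ (I₁ ⊕ I₂))))))))
  Perm.refl [ h₀ ] [ h₁ ] [ h₂ ] [ t₀ ] [ t₁ ] [ t₂ ] I₀ I₁ I₂

 Corners : (Fin 3 → V) → V → V → Set
 Corners h x y = ∃[ i ] ∃[ j ] i ≢ j × x ≡ h i × y ≡ h j

 tri-edge⁺ : ∀ (h : Fin 3 → V) {x y} → Corners h x y → Edge (triangle (h zero) (h 1F) (h 2F)) x y
 tri-edge⁺ h (zero , zero , i≢j , _) = contradiction refl i≢j
 tri-edge⁺ h (suc zero , suc zero , i≢j , _) = contradiction refl i≢j
 tri-edge⁺ h (2F , 2F , i≢j , _) = contradiction refl i≢j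
 tri-edge⁺ h (zero , suc zero , _ , refl , refl) = consec⇒edge _ (inj₁ here)
 tri-edge⁺ h (suc zero , zero , _ , refl , refl) = consec⇒edge _ (inj₂ here)
 tri-edge⁺ h (suc zero , 2F , _ , refl , refl) = consec⇒edge _ (inj₁ (there here))
 tri-edge⁺ h (2F , suc zero , _ , refl , refl) = consec⇒edge _ (inj₂ (there here))
 tri-edge⁺ h (2F , zero , _ , refl , refl) = consec⇒edge _ (inj₁ (there (there here)))
 tri-edge⁺ h (zero , 2F , _ , refl , refl) = consec⇒edge _ (inj₂ (there (there here)))

 tri-consec : ∀ (h : Fin 3 → V) {x y} → Consec x y (h zero ∷ h 1F ∷ h 2F ∷ h zero ∷ []) → Corners h x y
 tri-consec h here = zero , suc zero , (λ ()) , refl , refl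
 tri-consec h (there here) = suc zero , 2F , (λ ()) , refl , refl
 tri-consec h (there (there here)) = 2F , zero , (λ ()) , refl , refl
 tri-consec h (there (there (there (there ()))))

 tri-edge⁻ : ∀ (h : Fin 3 → V) {x y} → Edge (triangle (h zero) (h 1F) (h 2F)) x y → Corners h x y
 tri-edge⁻ h e with edge⇒consec _ e
 ... | inj₁ c = tri-consec h c
 ... | inj₂ c = let i , j , i≢j , p , q = tri-consec h c in j , i , i≢j ∘ sym , q , p

 tri-vertex⁻ : ∀ (h : Fin 3 → V) {x} → Vertex (triangle (h zero) (h 1F) (h 2F)) x → ∃[ i ] x ≡ h i
 tri-vertex⁻ h (here eq) = zero , eq
 tri-vertex⁻ h (there (here eq)) = suc zero , eq
 tri-vertex⁻ h (there (there (here eq))) = 2F , eq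
 tri-vertex⁻ h (there (there (there (here eq)))) = zero , eq

 module _ {ao bo : Maybe V} {L : Fin 3 → List V} (S : ThreePath ao bo L) where
  private
   module S = ThreePath S
   sp : Spec ao bo L
   sp = threePath⇒spec S

  private
   to : ∀ {x y} → x ∊ S.T → y ∊ S.T → Adj x y → Kind ao bo L S.h S.t x y
   to x∈ y∈ = Spec.to sp (∈⟦⟧⁻ x∈) (∈⟦⟧⁻ y∈)

   in-ext : ∀ {x} → x ∊ S.T → ∃[ i ] x ∈ S.ext i
   in-ext x∈ with S.placeT x∈
   ... | ThreePath.at-a x∈a = zero , S.a∈ext x∈a
   ... | ThreePath.at-b x∈b = zero , S.b∈ext {zero} x∈b
   ... | ThreePath.in-L i x∈L = i , S.∈ext x∈L

  module _ (W : Fin 3 → List V) (eqW : ∀ i → S.ext i ≡ W i) where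

   paths : PartialGraph n → PartialGraph n
   paths X = X ∪ walk (W zero) ∪ walk (W 1F) ∪ walk (W 2F)

   vertex-W : ∀ {x} → x ∊ S.T → ∃[ i ] x ∈ W i
   vertex-W x∈ = let i , x∈ext = in-ext x∈ in i , subst (_ ∈_) (eqW i) x∈ext

   W-vertex : ∀ i {x} → x ∈ W i → x ∊ S.T
   W-vertex i x∈ = S.ext⊆T i (subst (_ ∈_) (sym (eqW i)) x∈)

   edge-W : ∀ i {x y} → Consec± x y (S.ext i) → Edge (walk (W i)) x y
   edge-W i c = consec⇒edge (W i) (subst (Consec± _ _) (eqW i) c)

   W-edge : ∀ i {x y} → Edge (walk (W i)) x y → x ∊ S.T × y ∊ S.T × Adj x y
   W-edge i e =
    let c = subst (Consec± _ _) (sym (eqW i)) (edge⇒consec (W i) e) in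
    S.ext⊆T i (consec±-∈ˡ c) , S.ext⊆T i (consec±-∈ʳ c) , consec±-adj (S.pathL i) c

  corner-a : ∀ {x y} → ao ≡ nothing → Corners S.h x y → x ∊ S.T × y ∊ S.T × Adj x y
  corner-a eq (i , j , i≢j , refl , refl) = S.L⊆T i (S.h∈ i) , S.L⊆T j (S.h∈ j) , S.joinᵃ eq i≢j
  corner-b : ∀ {x y} → bo ≡ nothing → Corners S.t x y → x ∊ S.T × y ∊ S.T × Adj x y
  corner-b eq (i , j , i≢j , refl , refl) = S.L⊆T i (S.t∈ i) , S.L⊆T j (S.t∈ j) , S.joinᵇ eq i≢j

  to-kind : ∀ {x y} → x ∊ S.T → y ∊ S.T → Adj x y → Kind ao bo L S.h S.t x y
  to-kind = to

 module _ {A : Fin 3 → Set} where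

  u₃⁺ : ∀ i → A i → (A zero ⊎ A 1F) ⊎ A 2F
  u₃⁺ zero w = inj₁ (inj₁ w)
  u₃⁺ 1F w = inj₁ (inj₂ w)
  u₃⁺ 2F w = inj₂ w

  u₃⁻ : (A zero ⊎ A 1F) ⊎ A 2F → ∃ A
  u₃⁻ (inj₁ (inj₁ w)) = zero , w
  u₃⁻ (inj₁ (inj₂ w)) = suc zero , w
  u₃⁻ (inj₂ w) = 2F , w

  module _ {B : Set} where

   u₄⁺ : ∀ i → A i → ((B ⊎ A zero) ⊎ A 1F) ⊎ A 2F
   u₄⁺ zero w = inj₁ (inj₁ (inj₂ w))
   u₄⁺ 1F w = inj₁ (inj₂ w)
   u₄⁺ 2F w = inj₂ w

   u₄⁻ : ((B ⊎ A zero) ⊎ A 1F) ⊎ A 2F → B ⊎ ∃ A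
   u₄⁻ (inj₁ (inj₁ (inj₁ b))) = inj₁ b
   u₄⁻ (inj₁ (inj₁ (inj₂ w))) = inj₂ (zero , w)
   u₄⁻ (inj₁ (inj₂ w)) = inj₂ (suc zero , w)
   u₄⁻ (inj₂ w) = inj₂ (2F , w)

 head-nonempty : ∀ {x : V} {xs} → Head x xs → 1 ≤ length xs
 head-nonempty (_ , refl) = s≤s z≤n

 thetaSolid : ∀ {a b L} (S : ThreePath (just a) (just b) L) → Solid (ThreePath.T S)
 thetaSolid {a} {b} {L} S = inj₂ (inj₁ (a , b , L zero , L 1F , L 2F ,
  Spec.uniq (threePath⇒spec S) , head-nonempty (S.hd zero) , head-nonempty (S.hd 1F) , head-nonempty (S.hd 2F) ,
  equal (λ x → mk⇔ (λ x∈ → let i , x∈W = vertex-W S S.ext eqW x∈ in u₃⁺ {λ i → x ∈ S.ext i} i x∈W)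
   (λ v → let i , x∈W = u₃⁻ {λ i → x ∈ S.ext i} v in W-vertex S S.ext eqW i x∈W))
   (λ x y → mk⇔ (λ (x∈ , y∈ , adj) → e⁺ (to-kind S x∈ y∈ adj))
    (λ e → let i , e' = u₃⁻ {λ i → Edge (walk (S.ext i)) x y} e in W-edge S S.ext eqW i e'))))
  where
  module S = ThreePath S
  eqW : ∀ i → S.ext i ≡ S.ext i
  eqW i = refl
  e⁺ : ∀ {x y} → Kind (just a) (just b) L S.h S.t x y → _
  e⁺ {x} {y} (along i c) = u₃⁺ {λ i → Edge (walk (S.ext i)) x y} i (edge-W S S.ext eqW i c)
  e⁺ (acrossᵃ _ _ _ () _ _)
  e⁺ (acrossᵇ _ _ _ () _ _)

 stampSolid : ∀ {b L} (S : ThreePath nothing (just b) L) → Solid (ThreePath.T S)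
 stampSolid {b} {L} S = inj₂ (inj₂ (inj₁ (S.h zero , S.h 1F , S.h 2F , b ,
  I zero , I 1F , I 2F ,
  unique-↭ (stamp-perm b _ _ _ (I zero) (I 1F) (I 2F))
   (subst Unique verts-eq (Spec.uniq (threePath⇒spec S))) ,
  equal (λ x → mk⇔ (λ x∈ → let i , x∈W = vertex-W S W eqW x∈ in u₄⁺ {λ i → x ∈ W i} i x∈W)
   (λ v → v⁻ (u₄⁻ {λ i → x ∈ W i} v)))
   (λ x y → mk⇔ (λ (x∈ , y∈ , adj) → e⁺ (to-kind S x∈ y∈ adj))
    (λ e → e⁻ (u₄⁻ {λ i → Edge (walk (W i)) x y} e))))))
  where
  module S = ThreePath S
  I W : Fin 3 → List V
  I i = proj₁ (S.hd i)
  W i = S.h i ∷ I i ++ [ b ]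
  eqW : ∀ i → S.ext i ≡ W i
  eqW i = cong (_++ [ b ]) (proj₂ (S.hd i))

  verts-eq : b ∷ L zero ++ L 1F ++ L 2F ≡
   b ∷ (S.h zero ∷ I zero) ++ (S.h 1F ∷ I 1F) ++ (S.h 2F ∷ I 2F)
  verts-eq = cong (b ∷_) (cong₂ _++_ (proj₂ (S.hd zero)) (cong₂ _++_ (proj₂ (S.hd 1F)) (proj₂ (S.hd 2F))))

  v⁻ : ∀ {x} → Vertex (triangle (S.h zero) (S.h 1F) (S.h 2F)) x ⊎ ∃ (λ i → x ∈ W i) → x ∊ S.T
  v⁻ (inj₁ v) with tri-vertex⁻ S.h v
  ... | i , refl = S.L⊆T i (S.h∈ i)
  v⁻ (inj₂ (i , x∈)) = W-vertex S W eqW i x∈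

  e⁺ : ∀ {x y} → Kind nothing (just b) L S.h S.t x y → _
  e⁺ {x} {y} (along i c) = u₄⁺ {λ i → Edge (walk (W i)) x y} i (edge-W S W eqW i c)
  e⁺ (acrossᵃ i j i≢j _ p q) = inj₁ (inj₁ (inj₁ (tri-edge⁺ S.h (i , j , i≢j , p , q))))
  e⁺ (acrossᵇ _ _ _ () _ _)

  e⁻ : ∀ {x y} → Edge (triangle (S.h zero) (S.h 1F) (S.h 2F)) x y ⊎ ∃ (λ i → Edge (walk (W i)) x y) →
   x ∊ S.T × y ∊ S.T × Adj x y
  e⁻ (inj₁ e) = corner-a S refl (tri-edge⁻ S.h e)
  e⁻ (inj₂ (i , e)) = W-edge S W eqW i e

 prismSolid : ∀ {L} (S : ThreePath nothing nothing L) → Solid (ThreePath.T S)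
 prismSolid {L} S = inj₂ (inj₂ (inj₂ (
  S.h zero , S.h 1F , S.h 2F , S.t zero , S.t 1F , S.t 2F ,
  I zero , I 1F , I 2F ,
  unique-↭ (prism-perm _ _ _ _ _ _ (I zero) (I 1F) (I 2F))
   (subst Unique verts-eq (Spec.uniq (threePath⇒spec S))) ,
  equal (λ x → mk⇔ (λ x∈ → let i , x∈W = vertex-W S W eqW x∈ in u₄⁺ {λ i → x ∈ W i} i x∈W)
   (λ v → v⁻ (u₄⁻ {λ i → x ∈ W i} v)))
   (λ x y → mk⇔ (λ (x∈ , y∈ , adj) → e⁺ (to-kind S x∈ y∈ adj))
    (λ e → e⁻ (u₄⁻ {λ i → Edge (walk (W i)) x y} e))))))
  where
  module S = ThreePath S
  inner : ∀ i → ∃[ J ] L i ≡ S.h i ∷ J ++ [ S.t i ]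
  inner i with S.hd i | S.tl i | subst (λ l → 2 ≤ length l) (List.++-identityʳ (L i)) (S.len i)
  ... | ys , eq | [] , eq' | le = contradiction (subst (λ l → 2 ≤ length l) eq' le) λ { (s≤s ()) }
  ... | ys , eq | z ∷ zs , eq' | le = zs , trans eq' (cong (λ v → v ∷ zs ++ [ S.t i ]) (List.∷-injectiveˡ (trans (sym eq') eq)))

  I W : Fin 3 → List V
  I i = proj₁ (inner i)
  W i = S.h i ∷ I i ++ [ S.t i ]
  eqW : ∀ i → S.ext i ≡ W i
  eqW i = trans (List.++-identityʳ (L i)) (proj₂ (inner i))

  verts-eq : L zero ++ L 1F ++ L 2F ≡ W zero ++ W 1F ++ W 2F
  verts-eq = cong₂ _++_ (proj₂ (inner zero)) (cong₂ _++_ (proj₂ (inner 1F)) (proj₂ (inner 2F)))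

  Δ Δ' : PartialGraph n
  Δ = triangle (S.h zero) (S.h 1F) (S.h 2F)
  Δ' = triangle (S.t zero) (S.t 1F) (S.t 2F)

  v⁻ : ∀ {x} → (Vertex Δ x ⊎ Vertex Δ' x) ⊎ ∃ (λ i → x ∈ W i) → x ∊ S.T
  v⁻ (inj₁ (inj₁ v)) with tri-vertex⁻ S.h v
  ... | i , refl = S.L⊆T i (S.h∈ i)
  v⁻ (inj₁ (inj₂ v)) with tri-vertex⁻ S.t v
  ... | i , refl = S.L⊆T i (S.t∈ i)
  v⁻ (inj₂ (i , x∈)) = W-vertex S W eqW i x∈

  e⁺ : ∀ {x y} → Kind nothing nothing L S.h S.t x y → _
  e⁺ {x} {y} (along i c) = u₄⁺ {λ i → Edge (walk (W i)) x y} i (edge-W S W eqW i c)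
  e⁺ (acrossᵃ i j i≢j _ p q) = inj₁ (inj₁ (inj₁ (inj₁ (tri-edge⁺ S.h (i , j , i≢j , p , q)))))
  e⁺ (acrossᵇ i j i≢j _ p q) = inj₁ (inj₁ (inj₁ (inj₂ (tri-edge⁺ S.t (i , j , i≢j , p , q)))))

  e⁻ : ∀ {x y} → (Edge Δ x y ⊎ Edge Δ' x y) ⊎ ∃ (λ i → Edge (walk (W i)) x y) → x ∊ S.T × y ∊ S.T × Adj x y
  e⁻ (inj₁ (inj₁ e)) = corner-a S refl (tri-edge⁻ S.h e)
  e⁻ (inj₁ (inj₂ e)) = corner-b S refl (tri-edge⁻ S.t e)
  e⁻ (inj₂ (i , e)) = W-edge S W eqW i e

 threePath⇒solid : ∀ {ao bo L} (S : ThreePath ao bo L) → Solid (ThreePath.T S)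
 threePath⇒solid {just _} {just _} S = thetaSolid S
 threePath⇒solid {nothing} {just _} S = stampSolid S
 threePath⇒solid {nothing} {nothing} S = prismSolid S
 threePath⇒solid {just _} {nothing} S =
  subst Solid (Subset.⊆-antisym (flip-T⁻ S) (flip-T S)) (stampSolid (flip S))

 -- The two shapes of a solid: three paths, or a cycle and a hub.
 record Hub (T : Subset n) : Set where
  field
   {c} : Subset n
   {q s t u} : V
   cyc : Cyc c
   q∉ : q ∉ₛ c
   s∈ : s ∊ c
   t∈ : t ∊ c
   u∈ : u ∊ c
   qs : Adj q s
   qt : Adj q t
   qu : Adj q u
   s≢t : s ≢ t
   s≢u : s ≢ u
   t≢u : t ≢ u
   T≡ : T ≡ c +v q

 data Shape (T : Subset n) : Set where
  hub : Hub T → Shape T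
  three-path : ∀ {ao bo L} (S : ThreePath ao bo L) → T ≡ ThreePath.T S → Shape T

 pyramid⇒hub : ∀ {T} → IsPyramid (induced G T) → Hub T
 pyramid⇒hub {T} (q , c₀ , cs , u@(_ ∷ u') , len , N , N⊆ , le , equal vertices edges) with three-of N le
 ... | s , t , w , s∈ , t∈ , w∈ , s≢t , s≢w , t≢w = record
  { c = c ; cyc = c₀ , cs , u' , len , equal (λ x → mk⇔ (λ x∈ → ∈-++⁺ˡ (∈⟦⟧⁻ x∈)) (λ x∈ → ∈⟦⟧⁺ (un-close x∈)))
   (λ x y → mk⇔ (λ (x∈ , y∈ , adj) → rim-edge (∈⟦⟧⁻ x∈) (∈⟦⟧⁻ y∈) (Equivalence.to (edges x y) (in-T (∈⟦⟧⁻ x∈) , in-T (∈⟦⟧⁻ y∈) , adj)))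
    (λ e → let k = edge⇒consec closure e in
     ∈⟦⟧⁺ (un-close (consec±-∈ˡ k)) , ∈⟦⟧⁺ (un-close (consec±-∈ʳ k)) ,
     proj₂ (proj₂ (Equivalence.from (edges x y) (inj₁ e)))))
  ; q∉ = λ q∈ → q∉rim (∈⟦⟧⁻ q∈)
  ; s∈ = ∈⟦⟧⁺ (N⊆ s s∈) ; t∈ = ∈⟦⟧⁺ (N⊆ t t∈) ; u∈ = ∈⟦⟧⁺ (N⊆ w w∈)
  ; qs = spoke s∈ ; qt = spoke t∈ ; qu = spoke w∈
  ; s≢t = s≢t ; s≢u = s≢w ; t≢u = t≢w
  ; T≡ = Subset.⊆-antisym T⊆ ⊆T }
  where
  closure : List V
  closure = c₀ ∷ cs ++ [ c₀ ]
  c : Subset n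
  c = ⟦ c₀ ∷ cs ⟧

  q∉rim : q ∉ c₀ ∷ cs
  q∉rim q∈ = unique-head u q∈ refl

  un-close : ∀ {x} → x ∈ closure → x ∈ c₀ ∷ cs
  un-close x∈ with ∈-++⁻ (c₀ ∷ cs) x∈
  ... | inj₁ x∈' = x∈'
  ... | inj₂ 1st = here refl

  in-T : ∀ {x} → x ∈ c₀ ∷ cs → x ∊ T
  in-T x∈ = Equivalence.from (vertices _) (inj₁ (∈-++⁺ˡ x∈))

  spoke : ∀ {x} → x ∊ N → Adj q x
  spoke x∈ = proj₂ (proj₂ (Equivalence.from (edges _ _) (inj₂ (inj₁ (refl , x∈)))))

  rim-edge : ∀ {x y} → x ∈ c₀ ∷ cs → y ∈ c₀ ∷ cs → Edge (cycle c₀ cs ∪ star q N) x y → Edge (cycle c₀ cs) x y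
  rim-edge x∈ y∈ (inj₁ e) = e
  rim-edge x∈ y∈ (inj₂ (inj₁ (refl , _))) = contradiction x∈ q∉rim
  rim-edge x∈ y∈ (inj₂ (inj₂ (refl , _))) = contradiction y∈ q∉rim

  T⊆ : T ⊆ c +v q
  T⊆ {x} x∈ with Equivalence.to (vertices x) x∈
  ... | inj₁ x∈c = ⊆+v (∈⟦⟧⁺ (un-close x∈c))
  ... | inj₂ (inj₁ refl) = q∈+v
  ... | inj₂ (inj₂ x∈N) = ⊆+v (∈⟦⟧⁺ (N⊆ x x∈N))

  ⊆T : c +v q ⊆ T
  ⊆T {x} x∈ with ∈+v⁻ x∈
  ... | inj₁ x∈c = in-T (∈⟦⟧⁻ x∈c)
  ... | inj₂ refl = Equivalence.from (vertices _) (inj₂ (inj₁ refl))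

 hub⇒solid : ∀ {T} → Hub T → Solid T
 hub⇒solid {T} H with Hub.cyc H
 ... | c₀ , cs , u' , len , equal vertices edges = inj₁ (q , c₀ , cs ,
  All.tabulate (λ x∈ eq → q∉ (Equivalence.from (vertices q) (∈-++⁺ˡ (subst (_∈ c₀ ∷ cs) (sym eq) x∈)))) ∷ u' , len , N ,
  (λ x x∈ → un-close (Equivalence.to (vertices x) (proj₁ (∈N⁻ x∈)))) ,
  of-three (∈N⁺ s∈ qs) (∈N⁺ t∈ qt) (∈N⁺ u∈ qu) s≢t s≢u t≢u ,
  subst (λ T → induced G T ≐ cycle c₀ cs ∪ star q N) (sym T≡)
   (equal (λ x → mk⇔ (λ x∈ → [ inj₁ ∘ Equivalence.to (vertices x) , inj₂ ∘ inj₁ ]′ (∈+v⁻ x∈))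
    λ { (inj₁ x∈) → ⊆+v (Equivalence.from (vertices x) x∈)
     ; (inj₂ (inj₁ refl)) → q∈+v
     ; (inj₂ (inj₂ x∈N)) → ⊆+v (proj₁ (∈N⁻ x∈N)) })
    (λ x y → mk⇔ (λ (x∈ , y∈ , adj) → e⁺ (∈+v⁻ x∈) (∈+v⁻ y∈) adj)
     λ { (inj₁ e) → let x∈ , y∈ , adj = Equivalence.from (edges x y) e in ⊆+v x∈ , ⊆+v y∈ , adj
      ; (inj₂ (inj₁ (refl , y∈N))) → q∈+v , ⊆+v (proj₁ (∈N⁻ y∈N)) , proj₂ (∈N⁻ y∈N)
      ; (inj₂ (inj₂ (refl , x∈N))) → ⊆+v (proj₁ (∈N⁻ x∈N)) , q∈+v , Adj-sym (proj₂ (∈N⁻ x∈N)) })))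
  where
  open Hub H
  N? : ∀ x → Dec (x ∊ c × Adj q x)
  N? x = (x Subset.∈? c) ×-dec adj? q x
  N : Subset n
  N = Vec.tabulate λ x → does (N? x)

  ∈N⁺ : ∀ {x} → x ∊ c → Adj q x → x ∊ N
  ∈N⁺ {x} x∈ adj = mem⇒∈ (trans (Vec.lookup∘tabulate _ x) (dec-true (N? x) (x∈ , adj)))
  ∈N⁻ : ∀ {x} → x ∊ N → x ∊ c × Adj q x
  ∈N⁻ {x} x∈ = does-true (N? x) (trans (sym (Vec.lookup∘tabulate (λ x → does (N? x)) x)) (∈⇒mem x∈))

  un-close : ∀ {x} → x ∈ c₀ ∷ cs ++ [ c₀ ] → x ∈ c₀ ∷ cs
  un-close x∈ with ∈-++⁻ (c₀ ∷ cs) x∈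
  ... | inj₁ x∈' = x∈'
  ... | inj₂ 1st = here refl

  e⁺ : ∀ {x y} → x ∊ c ⊎ x ≡ q → y ∊ c ⊎ y ≡ q → Adj x y → Edge (cycle c₀ cs ∪ star q N) x y
  e⁺ (inj₁ x∈) (inj₁ y∈) adj = inj₁ (Equivalence.to (edges _ _) (x∈ , y∈ , adj))
  e⁺ (inj₂ refl) (inj₁ y∈) adj = inj₂ (inj₁ (refl , ∈N⁺ y∈ adj))
  e⁺ (inj₁ x∈) (inj₂ refl) adj = inj₂ (inj₂ (refl , ∈N⁺ x∈ (Adj-sym adj)))
  e⁺ (inj₂ refl) (inj₂ refl) adj = contradiction refl (Adj⇒≢ adj)

 open PartialGraph using (Vertex; Edge)

 private
  module _ {ao bo : Maybe V} {L : Fin 3 → List V} where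

   in-exts : ∀ {x} → x ∈ Verts ao bo L → ∃[ i ] x ∈ Ext ao bo L i
   in-exts x∈ with ∈-++⁻ (fromMaybe ao) x∈
   ... | inj₁ x∈a = zero , ∈-++⁺ˡ x∈a
   ... | inj₂ x∈₁ with ∈-++⁻ (fromMaybe bo) x∈₁
   ... | inj₁ x∈b = zero , ∈-++⁺ʳ (fromMaybe ao) (∈-++⁺ʳ (L zero) x∈b)
   ... | inj₂ x∈₂ with ∈-++⁻ (L zero) x∈₂
   ... | inj₁ x∈0 = zero , ∈-++⁺ʳ (fromMaybe ao) (∈-++⁺ˡ x∈0)
   ... | inj₂ x∈₃ with ∈-++⁻ (L 1F) x∈₃
   ... | inj₁ x∈1 = suc zero , ∈-++⁺ʳ (fromMaybe ao) (∈-++⁺ˡ x∈1)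
   ... | inj₂ x∈2 = 2F , ∈-++⁺ʳ (fromMaybe ao) (∈-++⁺ˡ x∈2)

   L-in : ∀ i {x} → x ∈ L i → x ∈ Verts ao bo L
   L-in zero x∈ = ∈-++⁺ʳ (fromMaybe ao) (∈-++⁺ʳ (fromMaybe bo) (∈-++⁺ˡ x∈))
   L-in 1F x∈ = ∈-++⁺ʳ (fromMaybe ao) (∈-++⁺ʳ (fromMaybe bo) (∈-++⁺ʳ (L zero) (∈-++⁺ˡ x∈)))
   L-in 2F x∈ = ∈-++⁺ʳ (fromMaybe ao) (∈-++⁺ʳ (fromMaybe bo) (∈-++⁺ʳ (L zero) (∈-++⁺ʳ (L 1F) x∈)))

   exts-in : ∀ i {x} → x ∈ Ext ao bo L i → x ∈ Verts ao bo L
   exts-in i x∈ with ∈-++⁻ (fromMaybe ao) x∈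
   ... | inj₁ x∈a = ∈-++⁺ˡ x∈a
   ... | inj₂ x∈' with ∈-++⁻ (L i) x∈'
   ... | inj₁ x∈L = L-in i x∈L
   ... | inj₂ x∈b = ∈-++⁺ʳ (fromMaybe ao) (∈-++⁺ˡ x∈b)

   from-edges : ∀ {T : Subset n} (h t : Fin 3 → V) → (∀ i → Head (h i) (L i)) → (∀ i → Last (t i) (L i)) →
    (∀ i → 2 ≤ length (Ext ao bo L i)) → Unique (Verts ao bo L) →
    (∀ {x} → x ∊ T → x ∈ Verts ao bo L) → (∀ {x} → x ∈ Verts ao bo L → x ∊ T) →
    (∀ {x y} → x ∊ T × y ∊ T × Adj x y → Kind ao bo L h t x y) →
    (∀ {x y} → Kind ao bo L h t x y → x ∊ T × y ∊ T × Adj x y) → Shape T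
   from-edges h t hd tl len uniq ⊆V V⊆ to from = three-path (spec⇒threePath sp)
    (Subset.⊆-antisym (λ x∈ → ∈⟦⟧⁺ (⊆V x∈)) (λ x∈ → V⊆ (∈⟦⟧⁻ x∈)))
    where
    sp : Spec ao bo L
    sp = record { h = h ; t = t ; hd = hd ; tl = tl ; len = len ; uniq = uniq
     ; to = λ x∈ y∈ adj → to (V⊆ x∈ , V⊆ y∈ , adj)
     ; from = λ k → proj₂ (proj₂ (from k)) }

 trihedron⇒shape : ∀ {T} → IsTrihedron (induced G T) → Shape T
 trihedron⇒shape {T} (a , b , I₁ , I₂ , I₃ , uniq , l₁ , l₂ , l₃ , equal vertices edges) =
  from-edges {just a} {just b} {L} (proj₁ ∘ heads) (proj₁ ∘ lasts) (proj₂ ∘ heads) (proj₂ ∘ lasts) len uniq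
   (λ {x} x∈ → let i , x∈i = u₃⁻ {λ i → x ∈ W i} (Equivalence.to (vertices x) x∈) in exts-in {just a} {just b} {L} i x∈i)
   (λ {x} x∈ → let i , x∈i = in-exts {just a} {just b} {L} x∈ in Equivalence.from (vertices x) (u₃⁺ {λ i → x ∈ W i} i x∈i))
   (λ {x} {y} e → let i , e' = u₃⁻ {λ i → Edge (walk (W i)) x y} (Equivalence.to (edges x y) e) in along i (edge⇒consec (W i) e'))
   λ { {x} {y} (along i k) → Equivalence.from (edges x y) (u₃⁺ {λ i → Edge (walk (W i)) x y} i (consec⇒edge (W i) k))
    ; (acrossᵃ _ _ _ () _ _) ; (acrossᵇ _ _ _ () _ _) }
  where
  L W : Fin 3 → List V
  L = three I₁ I₂ I₃
  W i = a ∷ L i ++ [ b ]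
  L≥1 : ∀ i → 1 ≤ length (L i)
  L≥1 zero = l₁
  L≥1 1F = l₂
  L≥1 2F = l₃
  heads : ∀ i → ∃[ x ] Head x (L i)
  heads i = has-head (L≥1 i)
  lasts : ∀ i → ∃[ x ] Last x (L i)
  lasts i = has-last (L≥1 i)
  len : ∀ i → 2 ≤ length (W i)
  len i = s≤s (subst (1 ≤_) (sym (List.length-++ (L i))) (ℕ.m≤n+m 1 (length (L i))))

 stamp⇒shape : ∀ {T} → IsStamp (induced G T) → Shape T
 stamp⇒shape {T} (t₁ , t₂ , t₃ , b , I₁ , I₂ , I₃ , uniq , equal vertices edges) =
  from-edges {nothing} {just b} {L} h (proj₁ ∘ lasts) (λ i → I i , refl) (proj₂ ∘ lasts) len
   (unique-↭ (Perm.↭-sym (stamp-perm b t₁ t₂ t₃ I₁ I₂ I₃)) uniq)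
   (λ {x} x∈ → v⁻ (u₄⁻ {λ i → x ∈ W i} (Equivalence.to (vertices x) x∈)))
   (λ {x} x∈ → let i , x∈i = in-exts {nothing} {just b} {L} x∈ in
    Equivalence.from (vertices x) (u₄⁺ {λ i → x ∈ W i} i x∈i))
   (λ {x} {y} e → e⁻ (u₄⁻ {λ i → Edge (walk (W i)) x y} (Equivalence.to (edges x y) e)))
   λ { {x} {y} (along i k) → Equivalence.from (edges x y) (u₄⁺ {λ i → Edge (walk (W i)) x y} i (consec⇒edge (W i) k))
    ; {x} {y} (acrossᵃ i j i≢j _ p q) → Equivalence.from (edges x y) (inj₁ (inj₁ (inj₁ (tri-edge⁺ h (i , j , i≢j , p , q)))))
    ; (acrossᵇ _ _ _ () _ _) }
  where
  h : Fin 3 → V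
  h = three t₁ t₂ t₃
  I L W : Fin 3 → List V
  I = three I₁ I₂ I₃
  L i = h i ∷ I i
  W i = L i ++ [ b ]
  lasts : ∀ i → ∃[ x ] Last x (L i)
  lasts i = has-last (s≤s z≤n)
  len : ∀ i → 2 ≤ length (W i)
  len i = s≤s (subst (1 ≤_) (sym (List.length-++ (I i))) (ℕ.m≤n+m 1 (length (I i))))

  v⁻ : ∀ {x} → Vertex (triangle t₁ t₂ t₃) x ⊎ ∃ (λ i → x ∈ W i) → x ∈ Verts nothing (just b) L
  v⁻ (inj₁ v) with tri-vertex⁻ h v
  ... | i , refl = L-in {nothing} {just b} {L} i 1st
  v⁻ (inj₂ (i , x∈)) = exts-in {nothing} {just b} {L} i x∈

  e⁻ : ∀ {x y} → Edge (triangle t₁ t₂ t₃) x y ⊎ ∃ (λ i → Edge (walk (W i)) x y) →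
   Kind nothing (just b) L h (proj₁ ∘ lasts) x y
  e⁻ (inj₁ e) = let i , j , i≢j , p , q = tri-edge⁻ h e in acrossᵃ i j i≢j refl p q
  e⁻ (inj₂ (i , e)) = along i (edge⇒consec (W i) e)

 prism⇒shape : ∀ {T} → IsPrism (induced G T) → Shape T
 prism⇒shape {T} (x₁ , x₂ , x₃ , y₁ , y₂ , y₃ , I₁ , I₂ , I₃ , uniq , equal vertices edges) =
  from-edges {nothing} {nothing} {L} h t (λ i → I i ++ [ t i ] , refl) (λ i → h i ∷ I i , refl) len
   (unique-↭ (Perm.↭-sym (prism-perm x₁ x₂ x₃ y₁ y₂ y₃ I₁ I₂ I₃)) uniq)
   (λ {x} x∈ → v⁻ (u₄⁻ {λ i → x ∈ L i} (Equivalence.to (vertices x) x∈)))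
   (λ {x} x∈ → let i , x∈i = in-exts {nothing} {nothing} {L} x∈ in
    Equivalence.from (vertices x) (u₄⁺ {λ i → x ∈ L i} i (subst (x ∈_) (List.++-identityʳ (L i)) x∈i)))
   (λ {x} {y} e → e⁻ (u₄⁻ {λ i → Edge (walk (L i)) x y} (Equivalence.to (edges x y) e)))
   λ { {x} {y} (along i k) → Equivalence.from (edges x y) (u₄⁺ {λ i → Edge (walk (L i)) x y} i
    (consec⇒edge (L i) (subst (Consec± x y) (List.++-identityʳ (L i)) k)))
    ; {x} {y} (acrossᵃ i j i≢j _ p q) → Equivalence.from (edges x y) (inj₁ (inj₁ (inj₁ (inj₁ (tri-edge⁺ h (i , j , i≢j , p , q))))))
    ; {x} {y} (acrossᵇ i j i≢j _ p q) → Equivalence.from (edges x y) (inj₁ (inj₁ (inj₁ (inj₂ (tri-edge⁺ t (i , j , i≢j , p , q)))))) }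
  where
  h t : Fin 3 → V
  h = three x₁ x₂ x₃
  t = three y₁ y₂ y₃
  I L : Fin 3 → List V
  I = three I₁ I₂ I₃
  L i = h i ∷ I i ++ [ t i ]
  len : ∀ i → 2 ≤ length (Ext nothing nothing L i)
  len i = subst (λ l → 2 ≤ length l) (sym (List.++-identityʳ (L i)))
   (s≤s (subst (1 ≤_) (sym (List.length-++ (I i))) (ℕ.m≤n+m 1 (length (I i)))))

  v⁻ : ∀ {x} → (Vertex (triangle x₁ x₂ x₃) x ⊎ Vertex (triangle y₁ y₂ y₃) x) ⊎ ∃ (λ i → x ∈ L i) → x ∈ Verts nothing nothing L
  v⁻ (inj₁ (inj₁ v)) with tri-vertex⁻ h v
  ... | i , refl = L-in {nothing} {nothing} {L} i 1st
  v⁻ (inj₁ (inj₂ v)) with tri-vertex⁻ t v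
  ... | i , refl = L-in {nothing} {nothing} {L} i (there (∈-++⁺ʳ (I i) 1st))
  v⁻ (inj₂ (i , x∈)) = L-in {nothing} {nothing} {L} i x∈

  e⁻ : ∀ {x y} → (Edge (triangle x₁ x₂ x₃) x y ⊎ Edge (triangle y₁ y₂ y₃) x y) ⊎ ∃ (λ i → Edge (walk (L i)) x y) →
   Kind nothing nothing L h t x y
  e⁻ (inj₁ (inj₁ e)) = let i , j , i≢j , p , q = tri-edge⁻ h e in acrossᵃ i j i≢j refl p q
  e⁻ (inj₁ (inj₂ e)) = let i , j , i≢j , p , q = tri-edge⁻ t e in acrossᵇ i j i≢j refl p q
  e⁻ {x} {y} (inj₂ (i , e)) = along i (subst (Consec± x y) (sym (List.++-identityʳ (L i))) (edge⇒consec (L i) e))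

 solid⇒shape : ∀ {T} → Solid T → Shape T
 solid⇒shape (inj₁ p) = hub (pyramid⇒hub p)
 solid⇒shape (inj₂ (inj₁ p)) = trihedron⇒shape p
 solid⇒shape (inj₂ (inj₂ (inj₁ p))) = stamp⇒shape p
 solid⇒shape (inj₂ (inj₂ (inj₂ p))) = prism⇒shape p

 triangle-cyc : ∀ {s t u} → Adj s t → Adj s u → Adj t u → Cyc ⟦ s ∷ t ∷ u ∷ [] ⟧
 triangle-cyc st su tu = rooted⇒cyc (rooted {mid = []} st su [] (link tu [] [-]))

 cyc-triangle : ∀ {c s t u} → Cyc c → s ∊ c → t ∊ c → u ∊ c → Adj s t → Adj s u → Adj t u →
  ∀ {x} → x ∊ c → x ∈ s ∷ t ∷ u ∷ []
 cyc-triangle {c} {s} {t} {u} cyc s∈ t∈ u∈ st su tu x∈ =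
  ∈⟦⟧⁻ (subst (_ ∊_) (sym (cyc-antichain cyc (triangle-cyc st su tu) sub)) x∈)
  where
  sub : ⟦ s ∷ t ∷ u ∷ [] ⟧ ⊆ c
  sub x∈ with ∈⟦⟧⁻ x∈
  ... | here refl = s∈
  ... | there 1st = t∈
  ... | 3rd = u∈

 private
  K₄ : ∀ {q s t u} → Adj q s → Adj q t → Adj q u → Adj s t → Adj s u → Adj t u →
   ThreePath nothing (just q) (three [ s ] [ t ] [ u ])
  K₄ {q} {s} {t} {u} qs qt qu st su tu = record
   { h = h ; t = h ; hd = λ i → [] , Leq i ; tl = λ i → [] , Leq i
   ; len = λ i → subst (λ l → 2 ≤ length (l ++ [ q ])) (sym (Leq i)) ℕ.≤-refl
   ; pathL = λ i → subst (λ l → IPath (l ++ [ q ])) (sym (Leq i)) (link (Adj-sym (qh i)) [] [-])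
   ; disj = λ { {i} {j} i≢j u∈ w∈ refl → Adj⇒≢ (hh i≢j) (trans (sym (at i u∈)) (at j w∈)) }
   ; cross = λ {i} {j} _ u∈ w∈ _ → inj₁ (refl , at i u∈ , at j w∈)
   ; joinᵃ = λ _ → hh ; joinᵇ = λ () }
   where
   h : Fin 3 → V
   h = three s t u
   L : Fin 3 → List V
   L = three [ s ] [ t ] [ u ]
   Leq : ∀ i → L i ≡ [ h i ]
   Leq zero = refl
   Leq 1F = refl
   Leq 2F = refl
   at : ∀ i {x} → x ∈ L i → x ≡ h i
   at i x∈ with subst (_ ∈_) (Leq i) x∈
   ... | here eq = eq
   qh : ∀ i → Adj q (h i)
   qh zero = qs
   qh 1F = qt
   qh 2F = qu
   hh : ∀ {i j} → i ≢ j → Adj (h i) (h j)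
   hh {zero} {zero} i≢j = contradiction refl i≢j
   hh {suc zero} {suc zero} i≢j = contradiction refl i≢j
   hh {2F} {2F} i≢j = contradiction refl i≢j
   hh {zero} {suc zero} _ = st
   hh {zero} {2F} _ = su
   hh {suc zero} {2F} _ = tu
   hh {suc zero} {zero} _ = Adj-sym st
   hh {2F} {zero} _ = Adj-sym su
   hh {2F} {suc zero} _ = Adj-sym tu

 hub⇒sphere' : ∀ {T} → Hub T → Sphere T
 hub⇒sphere' {T} H with adj? (Hub.s H) (Hub.t H) | adj? (Hub.s H) (Hub.u H) | adj? (Hub.t H) (Hub.u H)
 ... | no ¬st | _ | _ = subst Sphere (sym T≡) (hub⇒sphere cyc q∉ s∈ t∈ qs qt (s≢t , ¬st))
  where open Hub H
 ... | yes _ | no ¬su | _ = subst Sphere (sym T≡) (hub⇒sphere cyc q∉ s∈ u∈ qs qu (s≢u , ¬su))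
  where open Hub H
 ... | yes _ | yes _ | no ¬tu = subst Sphere (sym T≡) (hub⇒sphere cyc q∉ t∈ u∈ qt qu (t≢u , ¬tu))
  where open Hub H
 ... | yes st | yes su | yes tu = subst Sphere (sym (trans T≡ eq)) (threePath⇒sphere S)
  where
  open Hub H
  S : ThreePath nothing (just q) (three [ s ] [ t ] [ u ])
  S = K₄ qs qt qu st su tu
  eq : c +v q ≡ ThreePath.T S
  eq = Subset.⊆-antisym ⊆S S⊆
   where
   ⊆S : c +v q ⊆ ThreePath.T S
   ⊆S x∈ with ∈+v⁻ x∈
   ... | inj₁ x∈c = ∈⟦⟧⁺ (there (cyc-triangle cyc s∈ t∈ u∈ st su tu x∈c))
   ... | inj₂ refl = ∈⟦⟧⁺ 1st
   S⊆ : ThreePath.T S ⊆ c +v q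
   S⊆ x∈ with ∈⟦⟧⁻ x∈
   ... | here refl = q∈+v
   ... | there 1st = ⊆+v s∈
   ... | 3rd = ⊆+v t∈
   ... | there 3rd = ⊆+v u∈

 solid⇒sphere : ∀ {T} → Solid T → Sphere T
 solid⇒sphere solid with solid⇒shape solid
 ... | hub H = hub⇒sphere' H
 ... | three-path S refl = threePath⇒sphere S

 private
  record Pair (ao bo : Maybe V) (P Q : List V) (hP hQ tP tQ : V) : Set where
   field
    disj : ∀ {u w} → u ∈ P → w ∈ Q → u ≢ w
    cross : ∀ {u w} → u ∈ P → w ∈ Q → Adj u w → (ao ≡ nothing × u ≡ hP × w ≡ hQ) ⊎ (bo ≡ nothing × u ≡ tP × w ≡ tQ)
    joinᵃ : ao ≡ nothing → Adj hP hQ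
    joinᵇ : bo ≡ nothing → Adj tP tQ

  pair-sym : ∀ {ao bo P Q hP hQ tP tQ} → Pair ao bo P Q hP hQ tP tQ → Pair ao bo Q P hQ hP tQ tP
  pair-sym p = record
   { disj = λ u∈ w∈ eq → Pair.disj p w∈ u∈ (sym eq)
   ; cross = λ u∈ w∈ adj → [ (λ (e , x , y) → inj₁ (e , y , x)) , (λ (e , x , y) → inj₂ (e , y , x)) ]′ (Pair.cross p w∈ u∈ (Adj-sym adj))
   ; joinᵃ = λ e → Adj-sym (Pair.joinᵃ p e)
   ; joinᵇ = λ e → Adj-sym (Pair.joinᵇ p e) }

  all₃ : ∀ {P : Fin 3 → Set} → P zero → P 1F → P 2F → ∀ i → P i
  all₃ p q r zero = p
  all₃ p q r 1F = q
  all₃ p q r 2F = r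

  from-pairs : ∀ {ao bo} (L₀ L₁ L₂ : List V) {h₀ h₁ h₂ t₀ t₁ t₂} →
   Head h₀ L₀ → Head h₁ L₁ → Head h₂ L₂ → Last t₀ L₀ → Last t₁ L₁ → Last t₂ L₂ →
   2 ≤ length (fromMaybe ao ++ L₀ ++ fromMaybe bo) → 2 ≤ length (fromMaybe ao ++ L₁ ++ fromMaybe bo) →
   2 ≤ length (fromMaybe ao ++ L₂ ++ fromMaybe bo) →
   IPath (fromMaybe ao ++ L₀ ++ fromMaybe bo) → IPath (fromMaybe ao ++ L₁ ++ fromMaybe bo) →
   IPath (fromMaybe ao ++ L₂ ++ fromMaybe bo) →
   Pair ao bo L₀ L₁ h₀ h₁ t₀ t₁ → Pair ao bo L₀ L₂ h₀ h₂ t₀ t₂ → Pair ao bo L₁ L₂ h₁ h₂ t₁ t₂ →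
   ThreePath ao bo (three L₀ L₁ L₂)
  from-pairs {ao} {bo} L₀ L₁ L₂ {h₀} {h₁} {h₂} {t₀} {t₁} {t₂} hd₀ hd₁ hd₂ tl₀ tl₁ tl₂ l₀ l₁ l₂ p₀ p₁ p₂ P₀₁ P₀₂ P₁₂ = record
   { h = h ; t = t
   ; hd = all₃ hd₀ hd₁ hd₂ ; tl = all₃ tl₀ tl₁ tl₂ ; len = all₃ l₀ l₁ l₂ ; pathL = all₃ p₀ p₁ p₂
   ; disj = λ i≢j → Pair.disj (pair i≢j) ; cross = λ i≢j → Pair.cross (pair i≢j)
   ; joinᵃ = λ e i≢j → Pair.joinᵃ (pair i≢j) e ; joinᵇ = λ e i≢j → Pair.joinᵇ (pair i≢j) e }
   where
   h t : Fin 3 → V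
   h = three h₀ h₁ h₂
   t = three t₀ t₁ t₂
   L : Fin 3 → List V
   L = three L₀ L₁ L₂
   pair : ∀ {i j} → i ≢ j → Pair ao bo (L i) (L j) (h i) (h j) (t i) (t j)
   pair {zero} {zero} i≢j = contradiction refl i≢j
   pair {suc zero} {suc zero} i≢j = contradiction refl i≢j
   pair {2F} {2F} i≢j = contradiction refl i≢j
   pair {zero} {suc zero} _ = P₀₁
   pair {zero} {2F} _ = P₀₂
   pair {suc zero} {2F} _ = P₁₂
   pair {suc zero} {zero} _ = pair-sym P₀₁
   pair {2F} {zero} _ = pair-sym P₀₂
   pair {2F} {suc zero} _ = pair-sym P₁₂

 Grows : Subset n → List V → Set
 Grows c Q = ∃[ T ] Solid T × c ⊆ T × (∀ {x} → x ∊ T → x ∊ c ⊎ x ∈ Q)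

 module _ {s t : V} {α β : List V} (B : Bicycle s t α β) where
  open Bicycle B

  head-α : ∀ {u} → u ∈ α → Adj s u → Head u α
  head-α u∈ adj = go α u∈ pathα (adj-consec pathα 1st (there (∈-++⁺ˡ u∈)) adj)
   where
   go : ∀ α {u} → u ∈ α → IPath (s ∷ α ++ [ t ]) → Consec± s u (s ∷ α ++ [ t ]) → Head u α
   go (a ∷ α) _ p (inj₁ here) = α , refl
   go (a ∷ α) _ p (inj₁ (there c)) = contradiction refl (unique-head (ipath-unique p) (consec-∈ˡ c))
   go α _ p (inj₂ c) = contradiction c (no-pred (ipath-unique p))

  ∈α⁺ : ∀ {x} → x ∈ α → x ∊ set
  ∈α⁺ x∈ = α⊆ (there (∈-++⁺ˡ x∈))
  ∈β⁺ : ∀ {x} → x ∈ β → x ∊ set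
  ∈β⁺ x∈ = β⊆ (there (∈-++⁺ˡ x∈))
  s⁺ : s ∊ set
  s⁺ = α⊆ 1st
  t⁺ : t ∊ set
  t⁺ = ∈⟦⟧⁺ 2nd

 last-α : ∀ {s t α β u} → Bicycle s t α β → u ∈ α → Adj t u → Last u α
 last-α {α = α} {u = u} B u∈ adj = subst (Last u) (List.reverse-involutive α)
  (head⇒last (head-α (bicycle-flip B) (∈-reverse⁺ u∈) adj))

 last-β : ∀ {s t α β u} → Bicycle s t α β → u ∈ β → Adj t u → Last u β
 last-β B = last-α (bicycle-swap B)

 private
  pad : ∀ {P : List V → Set} {xs} → P xs → P (xs ++ [])
  pad {P} {xs} p = subst P (sym (List.++-identityʳ xs)) p

  head-++ : ∀ {x : V} {xs ys} → Head x xs → Head x (xs ++ ys)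
  head-++ {ys = ys} (zs , refl) = zs ++ ys , refl

  last-++ : ∀ {x : V} {ys} xs → Last x ys → Last x (xs ++ ys)
  last-++ xs (zs , refl) = xs ++ zs , sym (List.++-assoc xs zs _)

  two-ends : ∀ {x y : V} {xs} → Head x xs → Last y xs → x ≢ y → 2 ≤ length xs
  two-ends (_ ∷ _ , refl) _ x≢y = s≤s (s≤s z≤n)
  two-ends ([] , refl) ([] , refl) x≢y = contradiction refl x≢y
  two-ends ([] , refl) (_ ∷ [] , ()) x≢y
  two-ends ([] , refl) (_ ∷ _ ∷ _ , ()) x≢y

  end : Maybe V → V → V
  end (just a) _ = a
  end nothing h = h

  end-head : ∀ ao {h L R} → Head h L → Head (end ao h) (fromMaybe ao ++ L ++ R)
  end-head (just a) hd = _ , refl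
  end-head nothing hd = head-++ hd

  end-last : ∀ ao bo {t L} → Last t L → Last (end bo t) (fromMaybe ao ++ L ++ fromMaybe bo)
  end-last ao (just b) {L = L} tl = last-++ (fromMaybe ao) (L , refl)
  end-last ao nothing {t} {L} tl = last-++ (fromMaybe ao) (pad {Last t} tl)

 module Ear {s t : V} {α β : List V} (B : Bicycle s t α β) {Q : List V} {e e' : V}
  (pathQ : IPath Q) (hdQ : Head e Q) (tlQ : Last e' Q)
  (off : ∀ {q} → q ∈ Q → q ∉ₛ Bicycle.set B) where

  open Bicycle B

  private
   ≢off : ∀ {u q} → u ∊ set → q ∈ Q → u ≢ q
   ≢off u∈ q∈ refl = off q∈ u∈

   not-last : ∀ {q l} → Q ≡ l ++ [ e' ] → q ∈ l → q ≢ e'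
   not-last {l = l} eq q∈ refl = unique-last l (subst Unique eq (ipath-unique pathQ)) q∈

   not-head : ∀ {q r} → Q ≡ e ∷ r → q ∈ r → q ≢ e
   not-head eq q∈ refl = unique-head (subst Unique eq (ipath-unique pathQ)) q∈ refl

   path-to-t : Adj e' t → (∀ {q} → q ∈ Q → Adj q t → q ≡ e') → IPath (Q ++ [ t ])
   path-to-t e't only = go tlQ
    where
    go : Last e' Q → IPath (Q ++ [ t ])
    go (l , eq) = subst (λ Q → IPath (Q ++ [ t ])) (sym eq)
     (subst IPath (sym (List.++-assoc l [ e' ] [ t ]))
      (ipath-join l (subst IPath eq pathQ) [-] e't
       (λ { q∈ 1st → (λ q≡t → ≢off (t⁺ B) (in-Q q∈) (sym q≡t)) , λ adj → not-last eq q∈ (only (in-Q q∈) adj) }) []))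
     where
     in-Q : ∀ {q} → q ∈ l → q ∈ Q
     in-Q q∈ = subst (_ ∈_) (sym eq) (∈-++⁺ˡ q∈)

   path-from-s : ∀ {R} → All (Far s) R → Adj e s → (∀ {q} → q ∈ Q → Adj q s → q ≡ e) → IPath (Q ++ R) → IPath (s ∷ Q ++ R)
   path-from-s {R} far es only p = go hdQ
    where
    go : Head e Q → IPath (s ∷ Q ++ R)
    go (r , eq) = subst (λ Q → IPath (s ∷ Q ++ R)) (sym eq)
     (link (Adj-sym es)
      (All.++⁺ (All.tabulate λ q∈ → ≢off (s⁺ B) (in-Q q∈) , λ adj → not-head eq q∈ (only (in-Q q∈) (Adj-sym adj))) far)
      (subst (λ Q → IPath (Q ++ R)) eq p))
     where
     in-Q : ∀ {q} → q ∈ r → q ∈ Q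
     in-Q q∈ = subst (_ ∈_) (sym eq) (there q∈)

  -- Either s is a common end of the three paths, or e has a second neighbour
  -- on the cycle, a triangle is formed, and s belongs to the path along β.
  data Start : Maybe V → List V → V → V → Set where
   one : ∀ {h₀ h₁} → Head h₀ α → Head h₁ β → Start (just s) [] h₀ h₁
   two : ∀ {s'} → s' ∈ α → Adj s s' → Adj e s' → Start nothing [ s ] s' s

  -- Likewise at t, where the second neighbour of e' may lie on α or on β.
  data Finish : Maybe V → List V → List V → V → V → Set where
   one : ∀ {t₀ t₁} → Last t₀ α → Last t₁ β → Finish (just t) [] [] t₀ t₁
   inα : ∀ {t'} → t' ∈ α → Adj t t' → Adj e' t' → Finish nothing [] [ t ] t' t
   inβ : ∀ {t'} → t' ∈ β → Adj t t' → Adj e' t' → Finish nothing [ t ] [] t t'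

  module _ {ao ys h₀ h₁} (S : Start ao ys h₀ h₁) {bo zα zβ t₀ t₁} (F : Finish bo zα zβ t₀ t₁)
   (es : Adj e s) (e't : Adj e' t) (long : ao ≡ nothing → bo ≡ nothing → h₀ ≢ t₀ × e ≢ e')
   (att : ∀ {q x} → q ∈ Q → x ∊ set → Adj q x →
    (q ≡ e × (x ≡ s ⊎ ao ≡ nothing × x ≡ h₀)) ⊎
    (q ≡ e' × (x ≡ t ⊎ bo ≡ nothing × (x ≡ t₀ ⊎ x ≡ t₁)))) where

   private
    S-end T-end : Set
    S-end = Start ao ys h₀ h₁
    T-end = Finish bo zα zβ t₀ t₁

    L₀ L₁ : List V
    L₀ = α ++ zα
    L₁ = ys ++ β ++ zβ

    s≢ : s ≢ t
    s≢ = proj₁ s-t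
    αβ : ∀ {u} → u ∈ α → u ∉ β
    αβ u∈α u∈β = proj₁ (anti u∈α u∈β) refl

    h₀∈ : S-end → h₀ ∈ α
    h₀∈ (one hd _) = head-∈ hd
    h₀∈ (two s'∈ _ _) = s'∈

    t₀∈ : T-end → t₀ ∈ α ⊎ (t₀ ≡ t × t₁ ∈ β)
    t₀∈ (one tl _) = inj₁ (last-∈ tl)
    t₀∈ (inα t'∈ _ _) = inj₁ t'∈
    t₀∈ (inβ t'∈ _ _) = inj₂ (refl , t'∈)

    t₁∈ : T-end → t₁ ∈ β ⊎ (t₁ ≡ t × t₀ ∈ α)
    t₁∈ (one _ tl) = inj₁ (last-∈ tl)
    t₁∈ (inα t'∈ _ _) = inj₂ (refl , t'∈)
    t₁∈ (inβ t'∈ _ _) = inj₁ t'∈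

    hd₀ : S-end → Head h₀ L₀
    hd₀ (one hd _) = head-++ hd
    hd₀ (two s'∈ ss' _) = head-++ (head-α B s'∈ ss')
    hd₁ : S-end → Head h₁ L₁
    hd₁ (one _ hd) = head-++ hd
    hd₁ (two _ _ _) = β ++ zβ , refl

    tl₀ : T-end → Last t₀ L₀
    tl₀ (one tl _) = pad {Last _} tl
    tl₀ (inα t'∈ tt' _) = pad {Last _} (last-α B t'∈ tt')
    tl₀ (inβ _ _ _) = α , refl
    tl₁ : T-end → Last t₁ L₁
    tl₁ (one _ tl) = last-++ ys (pad {Last _} tl)
    tl₁ (inα _ _ _) = last-++ ys (β , refl)
    tl₁ (inβ t'∈ tt' _) = last-++ ys (pad {Last _} (last-β B t'∈ tt'))

    decode₀ : ∀ {u} → T-end → u ∈ L₀ → u ∈ α ⊎ (u ≡ t × bo ≡ nothing × t₀ ≡ t)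
    decode₀ F u∈ with F | ∈-++⁻ α u∈
    ... | _ | inj₁ u∈α = inj₁ u∈α
    ... | inβ _ _ _ | inj₂ 1st = inj₂ (refl , refl , refl)

    decode₁ : ∀ {w} → S-end → T-end → w ∈ L₁ →
     (w ≡ s × ao ≡ nothing × h₁ ≡ s) ⊎ w ∈ β ⊎ (w ≡ t × bo ≡ nothing × t₁ ≡ t)
    decode₁ S F w∈ with ∈-++⁻ ys w∈
    decode₁ (two _ _ _) F w∈ | inj₁ 1st = inj₁ (refl , refl , refl)
    decode₁ S F w∈ | inj₂ w∈' with F | ∈-++⁻ β w∈'
    ... | _ | inj₁ w∈β = inj₂ (inj₁ w∈β)
    ... | inα _ _ _ | inj₂ 1st = inj₂ (inj₂ (refl , refl , refl))

    shrink₀ : T-end → ∀ xs → IPath (xs ++ [ t ]) → IPath ((xs ++ zα) ++ fromMaybe bo)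
    shrink₀ (one _ _) xs p = subst (λ l → IPath (l ++ [ t ])) (sym (List.++-identityʳ xs)) p
    shrink₀ (inα _ _ _) xs p = pad {IPath} (pad {IPath} (ipath-prefix xs p))
    shrink₀ (inβ _ _ _) xs p = pad {IPath} p
    shrink₁ : T-end → ∀ xs → IPath (xs ++ [ t ]) → IPath ((xs ++ zβ) ++ fromMaybe bo)
    shrink₁ (one _ _) xs p = subst (λ l → IPath (l ++ [ t ])) (sym (List.++-identityʳ xs)) p
    shrink₁ (inα _ _ _) xs p = pad {IPath} p
    shrink₁ (inβ _ _ _) xs p = pad {IPath} (pad {IPath} (ipath-prefix xs p))

    path₀ : S-end → IPath (fromMaybe ao ++ L₀ ++ fromMaybe bo)
    path₀ (one _ _) = shrink₀ F (s ∷ α) pathα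
    path₀ (two _ _ _) = shrink₀ F α (ipath-tail pathα)
    path₁ : S-end → IPath (fromMaybe ao ++ L₁ ++ fromMaybe bo)
    path₁ (one _ _) = shrink₁ F (s ∷ β) pathβ
    path₁ (two _ _ _) = shrink₁ F (s ∷ β) pathβ

    t-only : ∀ {q} → q ∈ Q → Adj q t → q ≡ e'
    t-only q∈ qt with att q∈ (t⁺ B) qt
    ... | inj₂ (q≡ , _) = q≡
    ... | inj₁ (_ , inj₁ t≡s) = contradiction (sym t≡s) s≢
    ... | inj₁ (_ , inj₂ (_ , refl)) = contradiction (h₀∈ S) t∉α
    s-only : ∀ {q} → q ∈ Q → Adj q s → q ≡ e
    s-only q∈ qs with att q∈ (s⁺ B) qs
    ... | inj₁ (q≡ , _) = q≡
    ... | inj₂ (_ , inj₁ s≡t) = contradiction s≡t s≢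
    ... | inj₂ (_ , inj₂ (_ , inj₁ refl)) = contradiction (t₀∈ F) [ s∉α , (λ (s≡t , _) → s≢ s≡t) ]′
    ... | inj₂ (_ , inj₂ (_ , inj₂ refl)) = contradiction (t₁∈ F) [ s∉β , (λ (s≡t , _) → s≢ s≡t) ]′

    path-end : T-end → IPath (Q ++ fromMaybe bo) × All (Far s) (fromMaybe bo)
    path-end (one _ _) = path-to-t e't t-only , s-t ∷ []
    path-end (inα _ _ _) = pad {IPath} pathQ , []
    path-end (inβ _ _ _) = pad {IPath} pathQ , []
    path₂ : S-end → IPath (fromMaybe ao ++ Q ++ fromMaybe bo)
    path₂ (one _ _) = path-from-s (proj₂ (path-end F)) es s-only (proj₁ (path-end F))
    path₂ (two _ _ _) = proj₁ (path-end F)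

    ends₀ : S-end → T-end → end ao h₀ ≢ end bo t₀
    ends₀ (one _ _) (one _ _) = s≢
    ends₀ (one _ _) (inα t'∈ _ _) = λ { refl → s∉α t'∈ }
    ends₀ (one _ _) (inβ _ _ _) = s≢
    ends₀ (two s'∈ _ _) (one _ _) = λ { refl → t∉α s'∈ }
    ends₀ (two _ _ _) (inα _ _ _) = proj₁ (long refl refl)
    ends₀ (two _ _ _) (inβ _ _ _) = proj₁ (long refl refl)
    ends₁ : S-end → T-end → end ao h₁ ≢ end bo t₁
    ends₁ (one _ _) (one _ _) = s≢
    ends₁ (one _ _) (inα _ _ _) = s≢
    ends₁ (one _ _) (inβ t'∈ _ _) = λ { refl → s∉β t'∈ }
    ends₁ (two _ _ _) (one _ _) = s≢
    ends₁ (two _ _ _) (inα _ _ _) = s≢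
    ends₁ (two _ _ _) (inβ t'∈ _ _) = λ { refl → s∉β t'∈ }
    e∈ : e ∈ Q
    e∈ = head-∈ hdQ
    e'∈ : e' ∈ Q
    e'∈ = last-∈ tlQ
    ends₂ : S-end → T-end → end ao e ≢ end bo e'
    ends₂ (one _ _) (one _ _) = s≢
    ends₂ (one _ _) (inα _ _ _) = ≢off (s⁺ B) e'∈
    ends₂ (one _ _) (inβ _ _ _) = ≢off (s⁺ B) e'∈
    ends₂ (two _ _ _) (one _ _) = ≢-sym (≢off (t⁺ B) e∈)
    ends₂ (two _ _ _) (inα _ _ _) = proj₂ (long refl refl)
    ends₂ (two _ _ _) (inβ _ _ _) = proj₂ (long refl refl)

    joins : S-end → ao ≡ nothing → Adj h₀ h₁ × Adj h₀ e × Adj h₁ e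
    joins (two _ ss' es') _ = Adj-sym ss' , Adj-sym es' , Adj-sym es
    joins' : T-end → bo ≡ nothing → Adj t₀ t₁ × Adj t₀ e' × Adj t₁ e'
    joins' (inα _ tt' e't') _ = Adj-sym tt' , Adj-sym e't' , Adj-sym e't
    joins' (inβ _ tt' e't') _ = tt' , Adj-sym e't , Adj-sym e't'

    s-α : ∀ {u} → S-end → ao ≡ nothing → u ∈ α → Adj u s → u ≡ h₀
    s-α (two s'∈ ss' _) _ u∈ us = head-unique (head-α B u∈ (Adj-sym us)) (head-α B s'∈ ss')
    t-α : ∀ {u} → T-end → t₁ ≡ t → u ∈ α → Adj u t → u ≡ t₀
    t-α (one _ tl) refl u∈ ut = contradiction (last-∈ tl) t∉β
    t-α (inα t'∈ tt' _) _ u∈ ut = last-unique (last-α B u∈ (Adj-sym ut)) (last-α B t'∈ tt')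
    t-α (inβ t'∈ _ _) refl u∈ ut = contradiction t'∈ t∉β
    t-β : ∀ {u} → T-end → t₀ ≡ t → u ∈ β → Adj t u → u ≡ t₁
    t-β (one tl _) refl u∈ tu = contradiction (last-∈ tl) t∉α
    t-β (inα t'∈ _ _) refl u∈ tu = contradiction t'∈ t∉α
    t-β (inβ t'∈ tt' _) _ u∈ tu = last-unique (last-β B u∈ tu) (last-β B t'∈ tt')
    not-both : t₀ ≡ t → t₁ ≡ t → ⊥
    not-both refl refl = [ t∉α , (λ (_ , t∈β) → t∉β t∈β) ]′ (t₀∈ F)

    Cross : V → V → V → V → V → V → Set
    Cross u w a b c d = (ao ≡ nothing × u ≡ a × w ≡ b) ⊎ (bo ≡ nothing × u ≡ c × w ≡ d)

    disj₀₁ : ∀ {u w} → u ∈ L₀ → w ∈ L₁ → u ≢ w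
    disj₀₁ u∈ w∈ refl with decode₀ F u∈ | decode₁ S F w∈
    ... | inj₁ u∈α | inj₁ (refl , _) = s∉α u∈α
    ... | inj₁ u∈α | inj₂ (inj₁ w∈β) = αβ u∈α w∈β
    ... | inj₁ u∈α | inj₂ (inj₂ (refl , _)) = t∉α u∈α
    ... | inj₂ (refl , _) | inj₁ (t≡s , _) = s≢ (sym t≡s)
    ... | inj₂ (refl , _) | inj₂ (inj₁ t∈β) = t∉β t∈β
    ... | inj₂ (_ , _ , t₀≡t) | inj₂ (inj₂ (_ , _ , t₁≡t)) = not-both t₀≡t t₁≡t

    cross₀₁ : ∀ {u w} → u ∈ L₀ → w ∈ L₁ → Adj u w → Cross u w h₀ h₁ t₀ t₁
    cross₀₁ u∈ w∈ uw with decode₀ F u∈ | decode₁ S F w∈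
    ... | inj₁ u∈α | inj₁ (refl , ao≡ , h₁≡) = inj₁ (ao≡ , s-α S ao≡ u∈α uw , sym h₁≡)
    ... | inj₁ u∈α | inj₂ (inj₁ w∈β) = contradiction uw (proj₂ (anti u∈α w∈β))
    ... | inj₁ u∈α | inj₂ (inj₂ (refl , bo≡ , t₁≡)) = inj₂ (bo≡ , t-α F t₁≡ u∈α uw , sym t₁≡)
    ... | inj₂ (refl , _) | inj₁ (refl , _) = contradiction (Adj-sym uw) (proj₂ s-t)
    ... | inj₂ (refl , bo≡ , t₀≡) | inj₂ (inj₁ w∈β) = inj₂ (bo≡ , sym t₀≡ , t-β F t₀≡ w∈β uw)
    ... | inj₂ (refl , _) | inj₂ (inj₂ (refl , _)) = contradiction refl (Adj⇒≢ uw)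

    set₀ : ∀ {u} → u ∈ L₀ → u ∊ set
    set₀ u∈ = [ ∈α⁺ B , (λ { (refl , _) → t⁺ B }) ]′ (decode₀ F u∈)
    set₁ : ∀ {w} → w ∈ L₁ → w ∊ set
    set₁ w∈ = [ (λ { (refl , _) → s⁺ B }) , [ ∈β⁺ B , (λ { (refl , _) → t⁺ B }) ]′ ]′ (decode₁ S F w∈)

    s∉₀ : s ∉ L₀
    s∉₀ s∈ = [ s∉α , (λ (s≡t , _) → s≢ s≡t) ]′ (decode₀ F s∈)
    h₀∉₁ : h₀ ∉ L₁
    h₀∉₁ h∈ = disj₀₁ (∈-++⁺ˡ (h₀∈ S)) h∈ refl
    t₀∉₁ : t₀ ∉ L₁
    t₀∉₁ t∈ = disj₀₁ (last-∈ (tl₀ F)) t∈ refl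
    t₁∉₀ : t₁ ∉ L₀
    t₁∉₀ t∈ = disj₀₁ t∈ (last-∈ (tl₁ F)) refl

    cross₀₂ : ∀ {u w} → u ∈ L₀ → w ∈ Q → Adj u w → Cross u w h₀ e t₀ e'
    cross₀₂ u∈ w∈ uw with att w∈ (set₀ u∈) (Adj-sym uw)
    ... | inj₁ (_ , inj₁ refl) = contradiction u∈ s∉₀
    ... | inj₁ (w≡ , inj₂ (ao≡ , u≡)) = inj₁ (ao≡ , u≡ , w≡)
    ... | inj₂ (w≡ , inj₂ (bo≡ , inj₁ u≡)) = inj₂ (bo≡ , u≡ , w≡)
    ... | inj₂ (_ , inj₂ (_ , inj₂ refl)) = contradiction u∈ t₁∉₀
    ... | inj₂ (w≡ , inj₁ refl) with decode₀ F u∈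
    ... | inj₁ t∈α = contradiction t∈α t∉α
    ... | inj₂ (_ , bo≡ , t₀≡t) = inj₂ (bo≡ , sym t₀≡t , w≡)

    cross₁₂ : ∀ {u w} → u ∈ L₁ → w ∈ Q → Adj u w → Cross u w h₁ e t₁ e'
    cross₁₂ u∈ w∈ uw with att w∈ (set₁ u∈) (Adj-sym uw)
    ... | inj₁ (_ , inj₂ (_ , refl)) = contradiction u∈ h₀∉₁
    ... | inj₂ (w≡ , inj₂ (bo≡ , inj₂ u≡)) = inj₂ (bo≡ , u≡ , w≡)
    ... | inj₂ (_ , inj₂ (_ , inj₁ refl)) = contradiction u∈ t₀∉₁
    ... | inj₁ (w≡ , inj₁ refl) with decode₁ S F u∈
    ... | inj₁ (_ , ao≡ , h₁≡s) = inj₁ (ao≡ , sym h₁≡s , w≡)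
    ... | inj₂ (inj₁ s∈β) = contradiction s∈β s∉β
    ... | inj₂ (inj₂ (s≡t , _)) = contradiction s≡t s≢
    cross₁₂ u∈ w∈ uw | inj₂ (w≡ , inj₁ refl) with decode₁ S F u∈
    ... | inj₁ (t≡s , _) = contradiction (sym t≡s) s≢
    ... | inj₂ (inj₁ t∈β) = contradiction t∈β t∉β
    ... | inj₂ (inj₂ (_ , bo≡ , t₁≡t)) = inj₂ (bo≡ , sym t₁≡t , w≡)

    P : ThreePath ao bo (three L₀ L₁ Q)
    P = from-pairs L₀ L₁ Q (hd₀ S) (hd₁ S) hdQ (tl₀ F) (tl₁ F) tlQ
     (two-ends (end-head ao (hd₀ S)) (end-last ao bo (tl₀ F)) (ends₀ S F))
     (two-ends (end-head ao (hd₁ S)) (end-last ao bo (tl₁ F)) (ends₁ S F))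
     (two-ends (end-head ao hdQ) (end-last ao bo tlQ) (ends₂ S F))
     (path₀ S) (path₁ S) (path₂ S)
     (record { disj = disj₀₁ ; cross = cross₀₁ ; joinᵃ = proj₁ ∘ joins S ; joinᵇ = proj₁ ∘ joins' F })
     (record { disj = ≢off ∘ set₀ ; cross = cross₀₂ ; joinᵃ = proj₁ ∘ proj₂ ∘ joins S ; joinᵇ = proj₁ ∘ proj₂ ∘ joins' F })
     (record { disj = ≢off ∘ set₁ ; cross = cross₁₂ ; joinᵃ = proj₂ ∘ proj₂ ∘ joins S ; joinᵇ = proj₂ ∘ proj₂ ∘ joins' F })

    T : Subset n
    T = ThreePath.T P

    s∈T : S-end → s ∊ T
    s∈T (one _ _) = ∈⟦⟧⁺ 1st
    s∈T (two _ _ _) = ThreePath.L⊆T P 1F 1st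
    t∈T : T-end → t ∊ T
    t∈T (one _ _) = ∈⟦⟧⁺ (∈-++⁺ʳ (fromMaybe ao) 1st)
    t∈T (inα _ _ _) = ThreePath.L⊆T P 1F (∈-++⁺ʳ ys (∈-++⁺ʳ β 1st))
    t∈T (inβ _ _ _) = ThreePath.L⊆T P zero (∈-++⁺ʳ α 1st)

    sub : set ⊆ T
    sub x∈ with position x∈
    ... | is-s refl = s∈T S
    ... | is-t refl = t∈T F
    ... | in-α x∈α = ThreePath.L⊆T P zero (∈-++⁺ˡ x∈α)
    ... | in-β x∈β = ThreePath.L⊆T P 1F (∈-++⁺ʳ ys (∈-++⁺ˡ x∈β))

    a∈set : ∀ {x} → S-end → x ∈ fromMaybe ao → x ∊ set
    a∈set (one _ _) 1st = s⁺ B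
    b∈set : ∀ {x} → T-end → x ∈ fromMaybe bo → x ∊ set
    b∈set (one _ _) 1st = t⁺ B

    sup : ∀ {x} → x ∊ T → x ∊ set ⊎ x ∈ Q
    sup x∈ with ThreePath.placeT P x∈
    ... | ThreePath.at-a x∈a = inj₁ (a∈set S x∈a)
    ... | ThreePath.at-b x∈b = inj₁ (b∈set F x∈b)
    ... | ThreePath.in-L zero x∈ = inj₁ (set₀ x∈)
    ... | ThreePath.in-L 1F x∈ = inj₁ (set₁ x∈)
    ... | ThreePath.in-L 2F x∈ = inj₂ x∈

   ear : Grows set Q
   ear = T , threePath⇒solid P , sub , sup

  -- The neighbour h of s and t becomes the hub, and Q replaces it in the cycle.
  wheel : ∀ {h f} → h ∈ α → Adj s h → Adj t h → Adj e s → Adj e' t → f ∈ Q → Adj f h →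
   (∀ {q x} → q ∈ Q → x ∊ set → Adj q x → x ≡ h ⊎ (q ≡ e × x ≡ s) ⊎ (q ≡ e' × x ≡ t)) → Grows set Q
  wheel {h} {f} h∈ sh th es e't f∈ fh att = R.set +v h , hub⇒solid H , sub , sup
   where
   α≡h : ∀ {x} → x ∈ α → x ≡ h
   α≡h x∈ with head-α B h∈ sh | last-α B h∈ th
   ... | [] , refl | _ = case x∈ of λ { (here eq) → eq }
   ... | y ∷ ys , refl | [] , ()
   ... | y ∷ ys , refl | z ∷ zs , eq with List.∷-injective eq
   ... | refl , eq' = contradiction (subst (h ∈_) (sym eq') (∈-++⁺ʳ zs 1st))
    (λ h∈' → unique-head (ipath-unique (ipath-tail pathα)) (∈-++⁺ˡ h∈') refl)

   s≢h : s ≢ h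
   s≢h refl = s∉α h∈
   t≢h : t ≢ h
   t≢h refl = t∉α h∈

   pQ : IPath (s ∷ Q ++ [ t ])
   pQ = path-from-s (s-t ∷ []) es (λ q∈ adj → [ (λ s≡h → contradiction s≡h s≢h) , [ proj₁ , (λ (_ , s≡t) → contradiction s≡t (proj₁ s-t)) ]′ ]′ (att q∈ (s⁺ B) adj))
    (path-to-t e't (λ q∈ adj → [ (λ t≡h → contradiction t≡h t≢h) , [ (λ (_ , t≡s) → contradiction (sym t≡s) (proj₁ s-t)) , proj₁ ]′ ]′ (att q∈ (t⁺ B) adj)))

   R : Bicycle s t β Q
   R = record
    { pathα = pathβ ; pathβ = pQ ; α≥1 = β≥1 ; β≥1 = head-nonempty hdQ
    ; anti = λ x∈ q∈ → ≢off (∈β⁺ B x∈) q∈ , λ adj → case att q∈ (∈β⁺ B x∈) (Adj-sym adj) of λ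
     { (inj₁ refl) → proj₁ (anti h∈ x∈) refl
     ; (inj₂ (inj₁ (_ , refl))) → s∉β x∈
     ; (inj₂ (inj₂ (_ , refl))) → t∉β x∈ } }
   module R = Bicycle R

   H : Hub (R.set +v h)
   H = record
    { cyc = bicycle⇒cyc R ; q∉ = h∉ ; s∈ = s⁺ R ; t∈ = t⁺ R ; u∈ = R.β⊆ (there (∈-++⁺ˡ f∈))
    ; qs = Adj-sym sh ; qt = Adj-sym th ; qu = Adj-sym fh
    ; s≢t = proj₁ s-t ; s≢u = ≢off (s⁺ B) f∈ ; t≢u = ≢off (t⁺ B) f∈ ; T≡ = refl }
    where
    h∉ : h ∉ₛ R.set
    h∉ h∈R with R.position h∈R
    ... | R.is-s h≡s = s≢h (sym h≡s)
    ... | R.is-t h≡t = t≢h (sym h≡t)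
    ... | R.in-α h∈β = proj₁ (anti h∈ h∈β) refl
    ... | R.in-β h∈Q = off h∈Q (∈α⁺ B h∈)

   sub : set ⊆ R.set +v h
   sub x∈ with position x∈
   ... | is-s refl = ⊆+v (s⁺ R)
   ... | is-t refl = ⊆+v (t⁺ R)
   ... | in-β x∈β = ⊆+v (R.α⊆ (there (∈-++⁺ˡ x∈β)))
   ... | in-α x∈α = subst (_∊ R.set +v h) (sym (α≡h x∈α)) q∈+v

   sup : ∀ {x} → x ∊ R.set +v h → x ∊ set ⊎ x ∈ Q
   sup x∈ with ∈+v⁻ x∈
   ... | inj₂ refl = inj₁ (∈α⁺ B h∈)
   ... | inj₁ x∈R with R.position x∈R
   ... | R.is-s refl = inj₁ (s⁺ B)
   ... | R.is-t refl = inj₁ (t⁺ B)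
   ... | R.in-α x∈β = inj₁ (∈β⁺ B x∈β)
   ... | R.in-β x∈Q = inj₂ x∈Q

 far? : ∀ x y → Dec (Far x y)
 far? x y = ¬? (x ≟ y) ×-dec ¬? (adj? x y)

 ¬far⇒near : ∀ {x y} → ¬ Far x y → Near x y
 ¬far⇒near {x} {y} ¬far = decidable-stable (near? x y) (λ ¬near → ¬far (¬Near⇒Far ¬near))

 record Attached (c : Subset n) (Q : List V) : Set where
  constructor attached
  field
   {p p' s t} : V
   p∈ : p ∈ Q
   p'∈ : p' ∈ Q
   s∈ : s ∊ c
   t∈ : t ∊ c
   ps : Adj p s
   p't : Adj p' t
   s-t : Far s t

 attached? : ∀ c Q → Dec (Attached c Q)
 attached? c Q = map′
  (λ (p , p' , s , t , p∈ , p'∈ , s∈ , t∈ , ps , p't , s-t) → attached p∈ p'∈ s∈ t∈ ps p't s-t)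
  (λ (attached p∈ p'∈ s∈ t∈ ps p't s-t) → _ , _ , _ , _ , p∈ , p'∈ , s∈ , t∈ , ps , p't , s-t)
  (Fin.any? λ p → Fin.any? λ p' → Fin.any? λ s → Fin.any? λ t →
   (p ∈? Q) ×-dec (p' ∈? Q) ×-dec (s Subset.∈? c) ×-dec (t Subset.∈? c) ×-dec
   adj? p s ×-dec adj? p' t ×-dec far? s t)

 private
  unattached : ∀ {c Q} → ¬ Attached c Q → ∀ {q q' x y} → q ∈ Q → q' ∈ Q → x ∊ c → y ∊ c → Adj q x → Adj q' y → Near x y
  unattached ¬att q∈ q'∈ x∈ y∈ qx q'y = ¬far⇒near λ x-y → ¬att (attached q∈ q'∈ x∈ y∈ qx q'y x-y)

  near-adj : ∀ {x y} → Near x y → x ≢ y → Adj x y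
  near-adj (inj₁ x≡y) x≢y = contradiction x≡y x≢y
  near-adj (inj₂ adj) _ = adj

  no-triangle : ∀ {c s t} → Cyc c → s ∊ c → t ∊ c → Far s t → ∀ {x y z} → x ∊ c → y ∊ c → z ∊ c →
   Adj x y → Adj x z → ¬ Adj y z
  no-triangle cyc s∈ t∈ s-t {x} {y} {z} x∈ y∈ z∈ xy xz yz = Far⇒¬Near s-t (near (in-tri s∈) (in-tri t∈))
   where
   in-tri : ∀ {u} → u ∊ _ → u ∈ x ∷ y ∷ z ∷ []
   in-tri = cyc-triangle cyc x∈ y∈ z∈ xy xz yz
   near : ∀ {u w} → u ∈ x ∷ y ∷ z ∷ [] → w ∈ x ∷ y ∷ z ∷ [] → Near u w
   near 1st 1st = inj₁ refl
   near 1st 2nd = inj₂ xy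
   near 1st 3rd = inj₂ xz
   near 2nd 1st = inj₂ (Adj-sym xy)
   near 2nd 2nd = inj₁ refl
   near 2nd 3rd = inj₂ yz
   near 3rd 1st = inj₂ (Adj-sym xz)
   near 3rd 2nd = inj₂ (Adj-sym yz)
   near 3rd 3rd = inj₁ refl

  grows-⊆ : ∀ {c Q Q'} → (∀ {x} → x ∈ Q → x ∈ Q') → Grows c Q → Grows c Q'
  grows-⊆ sub (T , solid , c⊆ , sup) = T , solid , c⊆ , λ x∈ → [ inj₁ , inj₂ ∘ sub ]′ (sup x∈)

  second? : ∀ (c : Subset n) q s → Dec (∃[ x ] x ∊ c × x ≢ s × Adj q x)
  second? c q s = Fin.any? λ x → (x Subset.∈? c) ×-dec ¬? (x ≟ s) ×-dec adj? q x

  single : ∀ {c q} → Cyc c → q ∉ₛ c → Attached c [ q ] → Grows c [ q ]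
  single {c} {q} cyc q∉ (attached {s = s} {t} 1st 1st s∈ t∈ qs qt s-t)
   with Fin.any? (λ u → (u Subset.∈? c) ×-dec ¬? (u ≟ s) ×-dec ¬? (u ≟ t) ×-dec adj? q u)
  ... | yes (u , u∈ , u≢s , u≢t , qu) = c +v q ,
   hub⇒solid (record { cyc = cyc ; q∉ = q∉ ; s∈ = s∈ ; t∈ = t∈ ; u∈ = u∈ ; qs = qs ; qt = qt ; qu = qu
    ; s≢t = proj₁ s-t ; s≢u = ≢-sym u≢s ; t≢u = ≢-sym u≢t ; T≡ = refl }) ,
   ⊆+v , λ x∈ → [ inj₁ , inj₂ ∘ here ]′ (∈+v⁻ x∈)
  ... | no none with cyc⇒bicycle cyc s∈ t∈ s-t
  ... | record { bicycle = B ; set≡ = refl } =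
   ear (one (proj₂ (has-head (Bicycle.α≥1 B))) (proj₂ (has-head (Bicycle.β≥1 B))))
    (one (proj₂ (has-last (Bicycle.α≥1 B))) (proj₂ (has-last (Bicycle.β≥1 B)))) qs qt (λ ()) att
   where
   off : ∀ {p} → p ∈ [ q ] → p ∉ₛ c
   off 1st = q∉
   open Ear B [-] ([] , refl) ([] , refl) off
   att : ∀ {p x} → p ∈ [ q ] → x ∊ c → Adj p x → (p ≡ q × (x ≡ s ⊎ _)) ⊎ (p ≡ q × (x ≡ t ⊎ _))
   att {x = x} 1st x∈ qx with x ≟ s | x ≟ t
   ... | yes x≡s | _ = inj₁ (refl , inj₁ x≡s)
   ... | no _ | yes x≡t = inj₂ (refl , inj₁ x≡t)
   ... | no x≢s | no x≢t = contradiction (x , x∈ , x≢s , x≢t , qx) none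

  module Minimal {c : Subset n} (cyc : Cyc c) {e e' : V} {M : List V} (pathQ : IPath (e ∷ M ++ [ e' ]))
   (off : ∀ {q} → q ∈ e ∷ M ++ [ e' ] → q ∉ₛ c)
   (¬init : ¬ Attached c (e ∷ M)) (¬tail : ¬ Attached c (M ++ [ e' ]))
   {s t : V} (s∈ : s ∊ c) (t∈ : t ∊ c) (es : Adj e s) (e't : Adj e' t) (s-t : Far s t) where

   Q : List V
   Q = e ∷ M ++ [ e' ]

   e'∈ : e' ∈ M ++ [ e' ]
   e'∈ = ∈-++⁺ʳ M 1st

   e≢e' : e ≢ e'
   e≢e' = unique-head (ipath-unique pathQ) e'∈

   near-s : ∀ {q x} → q ∈ e ∷ M → x ∊ c → Adj q x → Near x s
   near-s q∈ x∈ qx = unattached ¬init q∈ 1st x∈ s∈ qx es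

   near-t : ∀ {q x} → q ∈ M ++ [ e' ] → x ∊ c → Adj q x → Near x t
   near-t q∈ x∈ qx = unattached ¬tail q∈ e'∈ x∈ t∈ qx e't

   no-tri : ∀ {x y z} → x ∊ c → y ∊ c → z ∊ c → Adj x y → Adj x z → ¬ Adj y z
   no-tri = no-triangle cyc s∈ t∈ s-t

   data Part (q : V) : Set where
    is-e : q ≡ e → Part q
    in-M : q ∈ M → Part q
    is-e' : q ≡ e' → Part q

   part : ∀ {q} → q ∈ Q → Part q
   part (here q≡e) = is-e q≡e
   part (there q∈) with ∈-++⁻ M q∈
   ... | inj₁ q∈M = in-M q∈M
   ... | inj₂ (here q≡e') = is-e' q≡e'

   -- A common neighbour h of s and t replaced by Q.
   wheel-at : ∀ {h f} → h ∊ c → Adj s h → Adj t h → f ∈ Q → Adj f h →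
    (∀ {q x} → q ∈ Q → x ∊ c → Adj q x → x ≡ h ⊎ (q ≡ e × x ≡ s) ⊎ (q ≡ e' × x ≡ t)) → Grows c Q
   wheel-at {h} h∈ sh th f∈ fh att with cyc⇒bicycle cyc s∈ t∈ s-t
   ... | record { bicycle = B ; set≡ = refl } with Bicycle.position B h∈
   ... | Bicycle.is-s refl = contradiction refl (Adj⇒≢ sh)
   ... | Bicycle.is-t refl = contradiction refl (Adj⇒≢ th)
   ... | Bicycle.in-α h∈α = Ear.wheel B pathQ (_ , refl) (e ∷ M , refl) off h∈α sh th es e't f∈ fh att
   ... | Bicycle.in-β h∈β = subst (λ c → Grows c Q) swap-set
    (Ear.wheel (bicycle-swap B) pathQ (_ , refl) (e ∷ M , refl) (λ q∈ q∈s → off q∈ (subst (_ ∊_) swap-set q∈s))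
     h∈β sh th es e't f∈ fh (λ q∈ x∈ → att q∈ (subst (_ ∊_) swap-set x∈)))
    where
    swap-set : Bicycle.set (bicycle-swap B) ≡ Bicycle.set B
    swap-set = bicycle-swap-set B

   att-M : ∀ {f h} → f ∈ M → h ∊ c → Adj f h → Grows c Q
   att-M {f} {h} f∈ h∈ fh = wheel-at h∈ (Adj-sym hs) (Adj-sym ht) (there (∈-++⁺ˡ f∈)) fh att
    where
    f∈₁ : f ∈ e ∷ M
    f∈₁ = there f∈
    f∈₂ : f ∈ M ++ [ e' ]
    f∈₂ = ∈-++⁺ˡ f∈
    h≢s : h ≢ s
    h≢s refl = Far⇒¬Near s-t (near-t f∈₂ h∈ fh)
    h≢t : h ≢ t
    h≢t refl = Far⇒¬Near s-t (Near-sym (near-s f∈₁ h∈ fh))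
    hs : Adj h s
    hs = near-adj (near-s f∈₁ h∈ fh) h≢s
    ht : Adj h t
    ht = near-adj (near-t f∈₂ h∈ fh) h≢t

    near-h₁ : ∀ {q x} → q ∈ e ∷ M → x ∊ c → Adj q x → Near x h
    near-h₁ q∈ x∈ qx = unattached ¬init q∈ f∈₁ x∈ h∈ qx fh
    near-h₂ : ∀ {q x} → q ∈ M ++ [ e' ] → x ∊ c → Adj q x → Near x h
    near-h₂ q∈ x∈ qx = unattached ¬tail q∈ f∈₂ x∈ h∈ qx fh

    at-s : ∀ {q x} → q ∈ e ∷ M → x ∊ c → Adj q x → x ≡ h ⊎ x ≡ s
    at-s {q} {x} q∈ x∈ qx with near-s q∈ x∈ qx | near-h₁ q∈ x∈ qx
    ... | inj₁ x≡s | _ = inj₂ x≡s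
    ... | inj₂ _ | inj₁ x≡h = inj₁ x≡h
    ... | inj₂ xs | inj₂ xh = contradiction hs (no-tri x∈ h∈ s∈ xh xs)
    at-t : ∀ {q x} → q ∈ M ++ [ e' ] → x ∊ c → Adj q x → x ≡ h ⊎ x ≡ t
    at-t {q} {x} q∈ x∈ qx with near-t q∈ x∈ qx | near-h₂ q∈ x∈ qx
    ... | inj₁ x≡t | _ = inj₂ x≡t
    ... | inj₂ _ | inj₁ x≡h = inj₁ x≡h
    ... | inj₂ xt | inj₂ xh = contradiction ht (no-tri x∈ h∈ t∈ xh xt)

    att : ∀ {q x} → q ∈ Q → x ∊ c → Adj q x → x ≡ h ⊎ (q ≡ e × x ≡ s) ⊎ (q ≡ e' × x ≡ t)
    att q∈ x∈ qx with part q∈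
    ... | is-e refl = [ inj₁ , (λ x≡s → inj₂ (inj₁ (refl , x≡s))) ]′ (at-s 1st x∈ qx)
    ... | is-e' refl = [ inj₁ , (λ x≡t → inj₂ (inj₂ (refl , x≡t))) ]′ (at-t e'∈ x∈ qx)
    ... | in-M q∈M with at-s (there q∈M) x∈ qx | at-t (∈-++⁺ˡ q∈M) x∈ qx
    ... | inj₁ x≡h | _ = inj₁ x≡h
    ... | inj₂ _ | inj₁ x≡h = inj₁ x≡h
    ... | inj₂ x≡s | inj₂ x≡t = contradiction (trans (sym x≡s) x≡t) (proj₁ s-t)

   module Free (free : ∀ {f h} → f ∈ M → h ∊ c → ¬ Adj f h) where

    ends : ∀ {q x} → q ∈ Q → x ∊ c → Adj q x → (q ≡ e × Adj e x) ⊎ (q ≡ e' × Adj e' x)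
    ends q∈ x∈ qx with part q∈
    ... | is-e refl = inj₁ (refl , qx)
    ... | is-e' refl = inj₂ (refl , qx)
    ... | in-M q∈M = contradiction qx (free q∈M x∈)

    s-adj : ∀ {s'} → s' ∊ c → s' ≢ s → Adj e s' → Adj s s'
    s-adj s'∈ s'≢s es' = Adj-sym (near-adj (near-s 1st s'∈ es') s'≢s)
    t-adj : ∀ {t'} → t' ∊ c → t' ≢ t → Adj e' t' → Adj t t'
    t-adj t'∈ t'≢t e't' = Adj-sym (near-adj (near-t e'∈ t'∈ e't') t'≢t)

    pair-s : ∀ {s'} → s' ∊ c → s' ≢ s → Adj e s' → ∀ {x} → x ∊ c → Adj e x → x ≡ s ⊎ x ≡ s'
    pair-s {s'} s'∈ s'≢s es' {x} x∈ ex with x ≟ s | unattached ¬init 1st 1st x∈ s'∈ ex es'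
    ... | yes x≡s | _ = inj₁ x≡s
    ... | no _ | inj₁ x≡s' = inj₂ x≡s'
    ... | no x≢s | inj₂ xs' = contradiction xs' (no-tri s∈ x∈ s'∈ (s-adj x∈ x≢s ex) (s-adj s'∈ s'≢s es'))
    pair-t : ∀ {t'} → t' ∊ c → t' ≢ t → Adj e' t' → ∀ {x} → x ∊ c → Adj e' x → x ≡ t ⊎ x ≡ t'
    pair-t {t'} t'∈ t'≢t e't' {x} x∈ e'x with x ≟ t | unattached ¬tail e'∈ e'∈ x∈ t'∈ e'x e't'
    ... | yes x≡t | _ = inj₁ x≡t
    ... | no _ | inj₁ x≡t' = inj₂ x≡t'
    ... | no x≢t | inj₂ xt' = contradiction xt' (no-tri t∈ x∈ t'∈ (t-adj x∈ x≢t e'x) (t-adj t'∈ t'≢t e't'))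

    module _ {α β} (B : Bicycle s t α β) (set≡ : Bicycle.set B ≡ c) where

     open Bicycle B hiding (s-t)
     open Ear B pathQ (_ , refl) (e ∷ M , refl) (λ q∈ → off q∈ ∘ subst (_ ∊_) set≡)

     join : ∀ {ao ys h₀ h₁ bo zα zβ t₀ t₁} → Start ao ys h₀ h₁ → Finish bo zα zβ t₀ t₁ →
      (ao ≡ nothing → bo ≡ nothing → h₀ ≢ t₀) →
      (∀ {x} → x ∊ c → Adj e x → x ≡ s ⊎ ao ≡ nothing × x ≡ h₀) →
      (∀ {x} → x ∊ c → Adj e' x → x ≡ t ⊎ bo ≡ nothing × (x ≡ t₀ ⊎ x ≡ t₁)) → Grows c Q
     join S F apart at-s at-t = subst (λ c → Grows c Q) set≡ (ear S F es e't (λ a b → apart a b , e≢e') λ q∈ x∈ qx →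
      [ (λ (q≡ , ex) → inj₁ (q≡ , at-s (subst (_ ∊_) set≡ x∈) ex)) , (λ (q≡ , e'x) → inj₂ (q≡ , at-t (subst (_ ∊_) set≡ x∈) e'x)) ]′
      (ends q∈ (subst (_ ∊_) set≡ x∈) qx))

     finish : ∀ {ao ys h₀ h₁} → Start ao ys h₀ h₁ → (∀ {x} → x ∊ c → Adj e x → x ≡ s ⊎ ao ≡ nothing × x ≡ h₀) →
      (ao ≡ nothing → h₀ ≢ t × ¬ Adj e' h₀) → Dec (∃[ t' ] t' ∊ c × t' ≢ t × Adj e' t') → Grows c Q
     finish S at-s apart (no ¬t') = join S (one (proj₂ (has-last α≥1)) (proj₂ (has-last β≥1))) (λ _ ()) at-s
      λ {x} x∈ e'x → inj₁ (decidable-stable (x ≟ t) λ x≢t → ¬t' (x , x∈ , x≢t , e'x))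
     finish S at-s apart (yes (t' , t'∈ , t'≢t , e't')) with position (subst (t' ∊_) (sym set≡) t'∈)
     ... | is-s refl = contradiction (Adj-sym (t-adj t'∈ t'≢t e't')) (proj₂ s-t)
     ... | is-t t'≡t = contradiction t'≡t t'≢t
     ... | in-α t'∈α = join S (inα t'∈α (t-adj t'∈ t'≢t e't') e't') (λ a _ → λ { refl → proj₂ (apart a) e't' }) at-s
      λ x∈ e'x → [ inj₁ , (λ x≡ → inj₂ (refl , inj₁ x≡)) ]′ (pair-t t'∈ t'≢t e't' x∈ e'x)
     ... | in-β t'∈β = join S (inβ t'∈β (t-adj t'∈ t'≢t e't') e't') (λ a _ → proj₁ (apart a)) at-s
      λ x∈ e'x → [ inj₁ , (λ x≡ → inj₂ (refl , inj₂ x≡)) ]′ (pair-t t'∈ t'≢t e't' x∈ e'x)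

     start : ∀ {s'} → s' ∊ c → s' ≢ s → Adj e s' → ¬ Adj e' s' → s' ∈ α → Grows c Q
     start s'∈ s'≢s es' ¬e's' s'∈α = finish (two s'∈α (s-adj s'∈ s'≢s es') es')
      (λ x∈ ex → [ inj₁ , (λ x≡ → inj₂ (refl , x≡)) ]′ (pair-s s'∈ s'≢s es' x∈ ex))
      (λ _ → (λ { refl → t∉α s'∈α }) , ¬e's') (second? c e' t)

    free-case : Dec (∃[ s' ] s' ∊ c × s' ≢ s × Adj e s') → Grows c Q
    free-case s'? with cyc⇒bicycle cyc s∈ t∈ s-t | s'?
    ... | record { bicycle = B ; set≡ = set≡ } | no ¬s' =
     finish B set≡ (Ear.one (proj₂ (has-head (Bicycle.α≥1 B))) (proj₂ (has-head (Bicycle.β≥1 B))))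
      (λ {x} x∈ ex → inj₁ (decidable-stable (x ≟ s) λ x≢s → ¬s' (x , x∈ , x≢s , ex))) (λ ()) (second? c e' t)
    ... | record { bicycle = B ; set≡ = set≡ } | yes (s' , s'∈ , s'≢s , es') with adj? e' s'
    ... | yes e's' = wheel-at s'∈ (s-adj s'∈ s'≢s es') (t-adj s'∈ s'≢t e's') 1st es' λ q∈ x∈ qx → case ends q∈ x∈ qx of λ
     { (inj₁ (q≡ , ex)) → [ (λ x≡s → inj₂ (inj₁ (q≡ , x≡s))) , inj₁ ]′ (pair-s s'∈ s'≢s es' x∈ ex)
     ; (inj₂ (q≡ , e'x)) → [ (λ x≡t → inj₂ (inj₂ (q≡ , x≡t))) , inj₁ ]′ (pair-t s'∈ s'≢t e's' x∈ e'x) }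
     where
     s'≢t : s' ≢ t
     s'≢t refl = proj₂ s-t (s-adj s'∈ s'≢s es')
    ... | no ¬e's' with Bicycle.position B (subst (s' ∊_) (sym set≡) s'∈)
    ... | Bicycle.is-s s'≡s = contradiction s'≡s s'≢s
    ... | Bicycle.is-t refl = contradiction (s-adj s'∈ s'≢s es') (proj₂ s-t)
    ... | Bicycle.in-α s'∈α = start B set≡ s'∈ s'≢s es' ¬e's' s'∈α
    ... | Bicycle.in-β s'∈β = start (bicycle-swap B) (trans (bicycle-swap-set B) set≡) s'∈ s'≢s es' ¬e's' s'∈β

  minimal : ∀ {c e e' M s t} → Cyc c → IPath (e ∷ M ++ [ e' ]) → (∀ {q} → q ∈ e ∷ M ++ [ e' ] → q ∉ₛ c) →
   ¬ Attached c (e ∷ M) → ¬ Attached c (M ++ [ e' ]) →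
   s ∊ c → t ∊ c → Adj e s → Adj e' t → Far s t → Grows c (e ∷ M ++ [ e' ])
  minimal {c} {e} {e'} {M} {s} {t} cyc pathQ off ¬init ¬tail s∈ t∈ es e't s-t
   with Fin.any? (λ f → Fin.any? λ h → (f ∈? M) ×-dec (h Subset.∈? c) ×-dec adj? f h)
  ... | yes (f , h , f∈ , h∈ , fh) = Minimal.att-M cyc {M = M} pathQ off ¬init ¬tail s∈ t∈ es e't s-t f∈ h∈ fh
  ... | no none = Minimal.Free.free-case cyc {M = M} pathQ off ¬init ¬tail s∈ t∈ es e't s-t
   (λ f∈ h∈ fh → none (_ , _ , f∈ , h∈ , fh)) (second? c e s)

  both-ends : ∀ {c e e' M} → ¬ Attached c (e ∷ M) → ¬ Attached c (M ++ [ e' ]) → Attached c (e ∷ M ++ [ e' ]) →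
   ∃[ s ] ∃[ t ] s ∊ c × t ∊ c × Adj e s × Adj e' t × Far s t
  both-ends {M = M} ¬init ¬tail (attached 1st 1st s∈ t∈ ps p't s-t) =
   contradiction (attached 1st 1st s∈ t∈ ps p't s-t) ¬init
  both-ends {M = M} ¬init ¬tail (attached (there p∈) (there p'∈) s∈ t∈ ps p't s-t) =
   contradiction (attached p∈ p'∈ s∈ t∈ ps p't s-t) ¬tail
  both-ends {M = M} ¬init ¬tail (attached 1st (there p'∈) s∈ t∈ ps p't s-t) with ∈-++⁻ M p'∈
  ... | inj₁ p'∈M = contradiction (attached 1st (there p'∈M) s∈ t∈ ps p't s-t) ¬init
  ... | inj₂ 1st = _ , _ , s∈ , t∈ , ps , p't , s-t
  both-ends {M = M} ¬init ¬tail (attached (there p∈) 1st s∈ t∈ ps p't s-t) with ∈-++⁻ M p∈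
  ... | inj₁ p∈M = contradiction (attached (there p∈M) 1st s∈ t∈ ps p't s-t) ¬init
  ... | inj₂ 1st = _ , _ , t∈ , s∈ , p't , ps , Far-sym s-t

  grow : ∀ k {c} Q → length Q ≤ k → Cyc c → IPath Q → (∀ {q} → q ∈ Q → q ∉ₛ c) → Attached c Q → Grows c Q
  grow k [] le cyc path off (attached () _ _ _ _ _ _)
  grow k (e ∷ []) le cyc path off att = single cyc (off 1st) att
  grow (suc k) {c} (e ∷ x ∷ xs) (s≤s le) cyc path off att with snoc x xs
  ... | M , e' , eq = subst (λ l → Grows c (e ∷ l)) (sym eq)
   (go (subst (λ l → IPath (e ∷ l)) eq path) (λ q∈ → off (subst (λ l → _ ∈ e ∷ l) (sym eq) q∈))
    (subst (λ l → Attached c (e ∷ l)) eq att) (subst (λ l → length l ≤ k) eq le))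
   where
   go : IPath (e ∷ M ++ [ e' ]) → (∀ {q} → q ∈ e ∷ M ++ [ e' ] → q ∉ₛ c) → Attached c (e ∷ M ++ [ e' ]) →
    length (M ++ [ e' ]) ≤ k → Grows c (e ∷ M ++ [ e' ])
   go path off att le with attached? c (M ++ [ e' ]) | attached? c (e ∷ M)
   ... | yes att' | _ = grows-⊆ there (grow k (M ++ [ e' ]) le cyc (ipath-tail path) (off ∘ there) att')
   ... | no _ | yes att' = grows-⊆ ∈-++⁺ˡ (grow k (e ∷ M)
    (subst (_≤ k) (trans (List.length-++ M) (ℕ.+-comm (length M) 1)) le) cyc (ipath-prefix (e ∷ M) path) (off ∘ ∈-++⁺ˡ) att')
   ... | no ¬tail | no ¬init =
    let s , t , s∈ , t∈ , es , e't , s-t = both-ends ¬init ¬tail att in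
    minimal cyc path off ¬init ¬tail s∈ t∈ es e't s-t

 attached⇒solid : ∀ {c Q} → Cyc c → IPath Q → (∀ {q} → q ∈ Q → q ∉ₛ c) → Attached c Q → Grows c Q
 attached⇒solid {Q = Q} = grow (length Q) Q ℕ.≤-refl

 record Gen (U : Subset n) (z : List (Subset n)) : Set where
  constructor mkGen
  field
   solids' : List (Subset n)
   solid : All (λ T → Solid T × T ⊆ U) solids'
   sum : z ≈ concatMap cycs solids'

 gen-≈ : ∀ {U z z'} → z' ≈ z → Gen U z → Gen U z'
 gen-≈ eq (mkGen σ ok e) = mkGen σ ok λ c → trans (eq c) (e c)

 gen-++ : ∀ {U z z'} → Gen U z → Gen U z' → Gen U (z ++ z')
 gen-++ {U} {z} {z'} (mkGen σ ok e) (mkGen σ' ok' e') = mkGen (σ ++ σ') (All.++⁺ ok ok') λ c →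
  trans (coef-++ z z' c) (trans (cong₂ _xor_ (e c) (e' c))
   (trans (sym (coef-++ (concatMap cycs σ) (concatMap cycs σ') c))
    (cong (λ l → coef l c) (sym (List.concatMap-++ cycs σ σ')))))

 gen-mono : ∀ {U U' z} → U ⊆ U' → Gen U z → Gen U' z
 gen-mono {U} {U'} sub (mkGen σ ok e) = mkGen σ (go ok) e
  where
  go : ∀ {σ} → All (λ T → Solid T × T ⊆ U) σ → All (λ T → Solid T × T ⊆ U') σ
  go [] = []
  go ((s , T⊆) ∷ ok) = (s , λ x∈ → sub (T⊆ x∈)) ∷ go ok

 gen-[] : ∀ {U z} → z ≈ [] → Gen U z
 gen-[] e = mkGen [] [] e

 gen-solid : ∀ {U T} → Solid T → T ⊆ U → Gen U (cycs T)
 gen-solid {T = T} solid T⊆ = mkGen [ T ] ((solid , T⊆) ∷ []) λ c → cong (λ l → coef l c) (sym (List.++-identityʳ (cycs T)))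

 closed-≈ : ∀ {z z'} → z ≈ z' → Closed z → Closed z'
 closed-≈ {z} {z'} e cl x y adj = trans (sym (∂-≈ {z} {z'} e x y)) (cl x y adj)

 closed-++ : ∀ {z z'} → Closed z → Closed z' → Closed (z ++ z')
 closed-++ {z} {z'} cl cl' x y adj = trans (∂-++ z z' x y) (cong₂ _xor_ (cl x y adj) (cl' x y adj))

 closed-++ʳ : ∀ z {z'} → Closed (z ++ z') → Closed z → Closed z'
 closed-++ʳ z {z'} cl cl₁ x y adj = trans (cong (_xor ∂ z' x y) (sym (cl₁ x y adj))) (trans (sym (∂-++ z z' x y)) (cl x y adj))

 gen-closed : ∀ {U z} → Gen U z → Closed z
 gen-closed {U} {z} (mkGen σ ok e) = closed-≈ {concatMap cycs σ} {z} (λ c → sym (e c)) (go ok)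
  where
  go : ∀ {σ} → All (λ T → Solid T × T ⊆ U) σ → Closed (concatMap cycs σ)
  go [] x y adj = refl
  go {T ∷ σ} ((solid , _) ∷ ok) x y adj = closed-++ {cycs T} {concatMap cycs σ} (Sphere.closed (solid⇒sphere solid)) (go ok) x y adj

 -- Modulo boundaries of solids, c is a sum of cycles that satisfy Ok.
 record Reduces (U : Subset n) (Ok : Subset n → Set) (z : List (Subset n)) : Set where
  field
   {rest} : List (Subset n)
   in-U : CycsIn U rest
   ok : All Ok rest
   gen : Gen U (z ++ rest)

 module _ {U : Subset n} {Ok : Subset n → Set} where

  reduces-ok : ∀ {c} → Cyc c → c ⊆ U → Ok c → Reduces U Ok [ c ]
  reduces-ok {c} cyc c⊆ ok = record
   { in-U = (cyc , c⊆) ∷ [] ; ok = ok ∷ [] ; gen = gen-[] λ d → xor-cancelˡ (does (c ≟ₛ d)) false }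

  reduces-all : ∀ z → (∀ {c} → c ∈ z → Reduces U Ok [ c ]) → Reduces U Ok z
  reduces-all [] red = record { in-U = [] ; ok = [] ; gen = gen-[] λ _ → refl }
  reduces-all (c ∷ z) red = record
   { in-U = All.++⁺ R₁.in-U R₂.in-U ; ok = All.++⁺ R₁.ok R₂.ok
   ; gen = gen-≈ {z = (c ∷ R₁.rest) ++ (z ++ R₂.rest)} shuffle (gen-++ R₁.gen R₂.gen) }
   where
   module R₁ = Reduces (red 1st)
   module R₂ = Reduces (reduces-all z (red ∘ there))
   shuffle : (c ∷ z) ++ (R₁.rest ++ R₂.rest) ≈ (c ∷ R₁.rest) ++ (z ++ R₂.rest)
   shuffle d = begin
    coef ((c ∷ z) ++ (R₁.rest ++ R₂.rest)) d
    ≡⟨ coef-++ (c ∷ z) (R₁.rest ++ R₂.rest) d ⟩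
     (k xor coef z d) xor coef (R₁.rest ++ R₂.rest) d
    ≡⟨ cong ((k xor coef z d) xor_) (coef-++ R₁.rest R₂.rest d) ⟩
     (k xor coef z d) xor (coef R₁.rest d xor coef R₂.rest d)
    ≡⟨ xor-swap k (coef z d) (coef R₁.rest d) (coef R₂.rest d) ⟩
     (k xor coef R₁.rest d) xor (coef z d xor coef R₂.rest d)
    ≡⟨ cong ((k xor coef R₁.rest d) xor_) (sym (coef-++ z R₂.rest d)) ⟩
     (k xor coef R₁.rest d) xor coef (z ++ R₂.rest) d
    ≡⟨ sym (coef-++ (c ∷ R₁.rest) (z ++ R₂.rest) d) ⟩
     coef ((c ∷ R₁.rest) ++ (z ++ R₂.rest)) d ∎
    where
    open ≡-Reasoning
    k : Bool
    k = does (c ≟ₛ d)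

  -- A face of a solid is the sum of its other faces.
  reduces-solid : ∀ {T c} → Solid T → T ⊆ U → Cyc c → c ⊆ T →
   (∀ {d} → Cyc d → d ⊆ T → d ≢ c → Reduces U Ok [ d ]) → Reduces U Ok [ c ]
  reduces-solid {T} {c} solid T⊆ cyc c⊆ red = record
   { in-U = R.in-U ; ok = R.ok
   ; gen = gen-≈ {z = cycs T ++ (faces ++ R.rest)} eq (gen-++ (gen-solid solid T⊆) R.gen) }
   where
   faces : List (Subset n)
   faces = filter (λ d → ¬? (d ≟ₛ c)) (cycs T)

   red' : ∀ {d} → d ∈ faces → Reduces U Ok [ d ]
   red' d∈ with ∈-filter⁻ (λ d → ¬? (d ≟ₛ c)) {xs = cycs T} d∈
   ... | d∈T , d≢c with All.lookup (cycs-in T) d∈T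
   ... | cd , d⊆ = red cd d⊆ d≢c

   module R = Reduces (reduces-all faces red')

   without-c : ∀ d → coef faces d ≡ not (does (d ≟ₛ c)) ∧ coef (cycs T) d
   without-c d = trans (par-filter (λ d → ¬? (d ≟ₛ c)) (λ e → does (e ≟ₛ d)) (cycs T))
    (trans (par-cong (cycs T) λ {e} _ → pointwise e) (par-∧ (not (does (d ≟ₛ c))) (λ e → does (e ≟ₛ d)) (cycs T)))
    where
    pointwise : ∀ e → does (¬? (e ≟ₛ c)) ∧ does (e ≟ₛ d) ≡ not (does (d ≟ₛ c)) ∧ does (e ≟ₛ d)
    pointwise e with e ≟ₛ d
    ... | yes refl = refl
    ... | no _ = trans (Bool.∧-zeroʳ _) (sym (Bool.∧-zeroʳ _))

   split : ∀ d → coef (cycs T) d ≡ does (c ≟ₛ d) xor coef faces d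
   split d with c ≟ₛ d
   ... | yes refl = trans (coef-cycs cyc c⊆) (cong not (sym (trans (without-c c)
    (cong (λ b → not b ∧ coef (cycs T) c) (dec-true (c ≟ₛ c) refl)))))
   ... | no c≢d = sym (trans (without-c d) (cong (λ b → not b ∧ coef (cycs T) d) (dec-false (d ≟ₛ c) (c≢d ∘ sym))))

   eq : [ c ] ++ R.rest ≈ cycs T ++ (faces ++ R.rest)
   eq d = sym (begin
    coef (cycs T ++ (faces ++ R.rest)) d
    ≡⟨ coef-++ (cycs T) (faces ++ R.rest) d ⟩
     coef (cycs T) d xor coef (faces ++ R.rest) d
    ≡⟨ cong₂ _xor_ (split d) (coef-++ faces R.rest d) ⟩
     (k xor o) xor (o xor r)
    ≡⟨ Bool.xor-assoc k o (o xor r) ⟩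
     k xor (o xor (o xor r))
    ≡⟨ cong (k xor_) (xor-cancelˡ o r) ⟩
     k xor r ∎)
    where
    open ≡-Reasoning
    k o r : Bool
    k = does (c ≟ₛ d)
    o = coef faces d
    r = coef R.rest d

 ipath-closed : ∀ {xs x} {P : V → Set} → IPath xs → x ∈ xs → P x →
  (∀ {x y} → x ∈ xs → y ∈ xs → P x → Adj x y → P y) → All P xs
 ipath-closed [-] 1st px closed = px ∷ []
 ipath-closed {x ∷ y ∷ zs} (link adj _ p) 1st px closed =
  px ∷ ipath-closed p 1st (closed 1st 2nd px adj) (λ x∈ y∈ → closed (there x∈) (there y∈))
 ipath-closed {x ∷ y ∷ zs} (link adj _ p) (there x∈) px closed =
  closed 2nd 1st (All.head rest) (Adj-sym adj) ∷ rest
  where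
  rest : All _ (y ∷ zs)
  rest = ipath-closed p x∈ px (λ x∈ y∈ → closed (there x∈) (there y∈))

 walk-before : ∀ {a xs b} l {u r} → Walk a xs b → a ∷ xs ≡ a ∷ l ++ u ∷ r → ∃[ w ] Walk a l w × Adj w u
 walk-before [] (step adj w) refl = _ , stop , adj
 walk-before (x ∷ l) (step adj w) eq with List.∷-injectiveʳ eq
 ... | refl = let w' , wk , adj' = walk-before l w refl in w' , step adj wk , adj'

 Touches : V → List V → Set
 Touches q α = ∃[ a ] a ∈ α × Near q a

 record Link (P : V → Set) (k : ℕ) (α β : List V) : Set where
  constructor mkLink
  field
   {x z} : V
   {xs} : List V
   walk' : Walk x xs z
   short : suc (length xs) ≤ k
   within : All P (x ∷ xs)
   startα : Touches x α
   endβ : Touches z β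

 module _ {U : Subset n} {v y : V} where

  Between : V → Set
  Between x = x ∊ U × x ≢ v × x ≢ y

  NotBoth : Subset n → Set
  NotBoth c = ¬ (v ∊ c × y ∊ c)

  private
   length-parts : ∀ {k} l {u : V} {r} → length (l ++ u ∷ r) ≤ suc k → length l ≤ k × length r ≤ k
   length-parts {k} l {u} {r} le = ℕ.≤-trans (ℕ.m≤m+n _ _) sum , ℕ.≤-trans (ℕ.m≤n+m _ (length l)) sum
    where
    sum : length l + length r ≤ k
    sum = ℕ.≤-pred (subst (_≤ suc k) (trans (List.length-++ l) (ℕ.+-suc (length l) (length r))) le)

   touch-adj : ∀ {α x a} → a ∈ α → Adj x a → Touches x α
   touch-adj a∈ adj = _ , a∈ , inj₂ adj

   after : ∀ {k q xs q' u α β} l r → Walk q xs q' → q ∷ xs ≡ l ++ u ∷ r → length (q ∷ xs) ≤ suc k → All Between (q ∷ xs) →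
    u ∈ α → Touches q' β → ¬ Touches u β → Link Between k α β
   after l [] w eq le ok u∈ tβ ¬tβ with walk-split l w eq
   ... | stop = contradiction tβ ¬tβ
   after {k} l (x ∷ r) w eq le ok u∈ tβ ¬tβ with walk-split l w eq
   ... | step adj w' = mkLink w' (proj₂ (length-parts l (subst (λ l → length l ≤ suc k) eq le)))
    (All.tail (All.++⁻ʳ l (subst (All Between) eq ok))) (touch-adj u∈ (Adj-sym adj)) tβ

   before : ∀ {k q xs q' u α β} l r → Walk q xs q' → q ∷ xs ≡ l ++ u ∷ r → length (q ∷ xs) ≤ suc k → All Between (q ∷ xs) →
    u ∈ α → Touches q β → ¬ Touches u β → Link Between k β α
   before [] r w refl le ok u∈ tβ ¬tβ = contradiction tβ ¬tβ
   before {k} (x ∷ l) r w eq le ok u∈ tβ ¬tβ with List.∷-injectiveˡ eq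
   ... | refl with walk-before l w eq
   ... | z , w' , adj = mkLink w' (proj₁ (length-parts (x ∷ l) (subst (λ l → length l ≤ suc k) eq le)))
    (All.++⁻ˡ (x ∷ l) (subst (All Between) eq ok)) tβ (touch-adj u∈ adj)

   anti⇒¬touch : ∀ {α β u} → Anti α β → u ∈ α → ¬ Touches u β
   anti⇒¬touch an u∈ (b , b∈ , near) = Far⇒¬Near (an u∈ b∈) near

   between-walk : ∀ {a xs b w r₂} l₂ → Walk a xs b → xs ≡ l₂ ++ w ∷ r₂ → Far a w →
    ∃[ x ] ∃[ l ] ∃[ z ] l₂ ≡ x ∷ l × Walk x l z × Adj a x × Adj z w
   between-walk [] (step adj _) refl far = contradiction adj (proj₂ far)
   between-walk (x ∷ l₂) (step adj w) eq far with List.∷-injectiveˡ eq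
   ... | refl = let z , wk , adj' = walk-before l₂ w eq in x , l₂ , z , refl , wk , adj , adj'

   between : ∀ {k q xs q' u w α β} l r → Walk q xs q' → q ∷ xs ≡ l ++ u ∷ r → length (q ∷ xs) ≤ suc k → All Between (q ∷ xs) →
    w ∈ r → u ∈ α → w ∈ β → Far u w → Link Between k α β
   between {k} l r wk eq le ok w∈r u∈ w∈ far with ∈-∃++ w∈r
   ... | l₂ , r₂ , refl with between-walk l₂ (walk-split l wk eq) refl far
   ... | x , l' , z , refl , wk' , ux , zw = mkLink wk'
    (ℕ.≤-trans (ℕ.≤-trans (ℕ.m≤m+n _ _) (ℕ.≤-reflexive (sym (List.length-++ (x ∷ l')))))
     (proj₂ (length-parts l (subst (λ l → length l ≤ suc k) eq le))))
    (All.++⁻ˡ (x ∷ l') (All.tail (All.++⁻ʳ l (subst (All Between) eq ok))))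
    (touch-adj u∈ (Adj-sym ux)) (touch-adj w∈ zw)

  module _ {α β α' β' : List V} (B : Bicycle v y α β) (B' : Bicycle v y α' β') where
   private
    module B = Bicycle B
    module B' = Bicycle B'

   cover-arc : (∀ {x} → x ∈ β' → x ∊ B.set) → ∀ {x} → x ∈ α → x ∈ β' → All (_∈ β') α
   cover-arc on-c x∈α x∈β' = ipath-closed (ipath-prefix α (ipath-tail B.pathα)) x∈α x∈β' closed
    where
    closed : ∀ {a b} → a ∈ α → b ∈ α → a ∈ β' → Adj a b → b ∈ β'
    closed {a} {b} a∈ b∈ a∈' adj with B'.position (two-⊆ (bicycle⇒cyc B) (bicycle⇒cyc B') nbr
     (∈α⁺ B a∈) (∈β⁺ B' a∈') (∈α⁺ B b∈) adj)
     where
     nbr : ∀ {z} → z ∊ B'.set → Adj a z → z ∊ B.set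
     nbr z∈ az with B'.position z∈
     ... | B'.is-s refl = s⁺ B
     ... | B'.is-t refl = t⁺ B
     ... | B'.in-α z∈α = contradiction (Adj-sym az) (proj₂ (B'.anti z∈α a∈'))
     ... | B'.in-β z∈β = on-c z∈β
    ... | B'.is-s refl = contradiction b∈ B.s∉α
    ... | B'.is-t refl = contradiction b∈ B.t∉α
    ... | B'.in-α b∈α' = contradiction (Adj-sym adj) (proj₂ (B'.anti b∈α' a∈'))
    ... | B'.in-β b∈β' = b∈β'

  module _ {α β α' β' : List V} (B : Bicycle v y α β) (B' : Bicycle v y α' β') where
   private
    module B = Bicycle B
    module B' = Bicycle B'

   shorter-link : ∀ {k q xs q' u} → Walk q xs q' → length (q ∷ xs) ≤ suc k → All Between (q ∷ xs) →
    Touches q α → Touches q' β → (∀ {x} → x ∊ B'.set → x ∊ B.set ⊎ x ∈ q ∷ xs) →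
    u ∈ q ∷ xs → u ∈ α' → Link Between k α' β' ⊎ Link Between k β' α'
   shorter-link {k} {q} {xs} {q'} {u} wk le ok tα tβ sub u∈ u∈α' with ∈-∃++ u∈
   ... | l , r , eq with Any.any? (_∈? (q ∷ xs)) β'
   ... | yes meets = go (∈-++⁻ l (subst (w ∈_) eq w∈Q))
    where
    w : V
    w = proj₁ (find meets)
    w∈β' : w ∈ β'
    w∈β' = proj₁ (proj₂ (find meets))
    w∈Q : w ∈ q ∷ xs
    w∈Q = proj₂ (proj₂ (find meets))
    u-w : Far u w
    u-w = B'.anti u∈α' w∈β'
    go : w ∈ l ⊎ w ∈ u ∷ r → _
    go (inj₂ (here w≡u)) = contradiction (sym w≡u) (proj₁ u-w)
    go (inj₂ (there w∈r)) = inj₁ (between l r wk eq le ok w∈r u∈α' w∈β' u-w)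
    go (inj₁ w∈l) with ∈-∃++ w∈l
    ... | l₁ , r₁ , refl = inj₂ (between l₁ (r₁ ++ u ∷ r) wk (trans eq (List.++-assoc l₁ (w ∷ r₁) (u ∷ r))) le ok
     (∈-++⁺ʳ r₁ 1st) w∈β' u∈α' (Far-sym u-w))
   ... | no misses = go B'.headβ
    where
    on-c : ∀ {x} → x ∈ β' → x ∊ B.set
    on-c x∈ = [ id , (λ x∈Q → contradiction (lose x∈ x∈Q) misses) ]′ (sub (∈β⁺ B' x∈))

    widen : ∀ {x α} → All (_∈ β') α → Touches x α → Touches x β'
    widen all (a , a∈ , near) = a , All.lookup all a∈ , near

    go : ∃[ b ] Head b β' → _
    go (b , hd) with B.position (on-c (head-∈ hd))
    ... | B.is-s refl = contradiction (head-∈ hd) B'.s∉β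
    ... | B.is-t refl = contradiction (head-∈ hd) B'.t∉β
    ... | B.in-α b∈α = inj₂ (before l r wk eq le ok u∈α' (widen (cover-arc B B' on-c b∈α (head-∈ hd)) tα)
     (anti⇒¬touch {α'} {β'} B'.anti u∈α'))
    ... | B.in-β b∈β = inj₁ (after l r wk eq le ok u∈α' (widen (cover-arc (bicycle-swap B) B'
     (λ x∈ → subst (_ ∊_) (sym (bicycle-swap-set B)) (on-c x∈)) b∈β (head-∈ hd)) tβ)
     (anti⇒¬touch {α'} {β'} B'.anti u∈α'))

  linked⇒reduces : ∀ k {α β} (B : Bicycle v y α β) → Bicycle.set B ⊆ U → Link Between k α β →
   Reduces U NotBoth [ Bicycle.set B ]
  linked⇒reduces zero B c⊆ (mkLink _ () _ _ _)
  linked⇒reduces (suc k) {α} {β} B c⊆ (mkLink {q} {q'} {xs} wk le ok tα tβ) with shorten wk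
  ... | ys , wk' , path , sub , le' = go (Any.any? (Subset._∈? B.set) (q ∷ ys))
   where
   module B = Bicycle B
   c : Subset n
   c = B.set

   leQ : length (q ∷ ys) ≤ suc k
   leQ = ℕ.≤-trans (s≤s le') le
   okQ : All Between (q ∷ ys)
   okQ = All.tabulate (All.lookup ok ∘ sub)

   go : Dec (Any (_∊ c) (q ∷ ys)) → Reduces U NotBoth [ c ]
   go (yes meets) with find meets
   ... | u , u∈ , u∈c with ∈-∃++ u∈ | B.position u∈c
   ... | _ | B.is-s refl = contradiction refl (proj₁ (proj₂ (All.lookup okQ u∈)))
   ... | _ | B.is-t refl = contradiction refl (proj₂ (proj₂ (All.lookup okQ u∈)))
   ... | l , r , eq | B.in-α u∈α = linked⇒reduces k B c⊆
    (after l r wk' eq leQ okQ u∈α tβ (anti⇒¬touch {α} {β} B.anti u∈α))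
   ... | l , r , eq | B.in-β u∈β = linked⇒reduces k B c⊆
    (before l r wk' eq leQ okQ u∈β tα (anti⇒¬touch {β} {α} (Anti-sym {α} {β} B.anti) u∈β))
   go (no misses) with attached⇒solid (bicycle⇒cyc B) path off att
    where
    off : ∀ {p} → p ∈ q ∷ ys → p ∉ₛ c
    off p∈ p∈c = misses (lose p∈ p∈c)

    real : ∀ {p α} → p ∈ q ∷ ys → (∀ {a} → a ∈ α → a ∊ c) → Touches p α → ∃[ a ] a ∈ α × Adj p a
    real p∈ α⊆ (a , a∈ , inj₁ refl) = contradiction (α⊆ a∈) (off p∈)
    real p∈ α⊆ (a , a∈ , inj₂ adj) = a , a∈ , adj

    att : Attached c (q ∷ ys)
    att with real 1st (∈α⁺ B) tα | real (walk-end wk') (∈β⁺ B) tβ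
    ... | a , a∈ , qa | b , b∈ , q'b = attached 1st (walk-end wk') (∈α⁺ B a∈) (∈β⁺ B b∈) qa q'b (B.anti a∈ b∈)
   ... | T , solid , c⊆T , T⊆ = reduces-solid solid T⊆U (bicycle⇒cyc B) c⊆T face
    where
    T⊆U : T ⊆ U
    T⊆U x∈ = [ c⊆ , (λ x∈Q → proj₁ (All.lookup okQ x∈Q)) ]′ (T⊆ x∈)

    face : ∀ {d} → Cyc d → d ⊆ T → d ≢ c → Reduces U NotBoth [ d ]
    face {d} cd d⊆ d≢c with (v Subset.∈? d) ×-dec (y Subset.∈? d)
    ... | no ¬both = reduces-ok cd (λ x∈ → T⊆U (d⊆ x∈)) ¬both
    ... | yes (v∈ , y∈) with cyc⇒bicycle cd v∈ y∈ B.s-t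
    ... | record { bicycle = B' ; set≡ = refl } with Any.any? (Subset._∈? d) (q ∷ ys)
    ... | no none = contradiction (cyc-antichain (bicycle⇒cyc B) cd λ x∈ →
     [ id , (λ x∈Q → contradiction (lose x∈Q x∈) none) ]′ (T⊆ (d⊆ x∈))) d≢c
    ... | yes some with find some
    ... | u , u∈Q , u∈d with Bicycle.position B' u∈d
    ... | Bicycle.is-s refl = contradiction refl (proj₁ (proj₂ (All.lookup okQ u∈Q)))
    ... | Bicycle.is-t refl = contradiction refl (proj₂ (proj₂ (All.lookup okQ u∈Q)))
    ... | Bicycle.in-α u∈α' with shorter-link B B' wk' leQ okQ tα tβ (λ x∈ → T⊆ (d⊆ x∈)) u∈Q u∈α'
    ... | inj₁ ln = linked⇒reduces k B' (λ x∈ → T⊆U (d⊆ x∈)) ln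
    ... | inj₂ ln = subst (λ c → Reduces U NotBoth [ c ]) (bicycle-swap-set B')
     (linked⇒reduces k (bicycle-swap B') (λ x∈ → T⊆U (d⊆ (subst (_ ∊_) (bicycle-swap-set B') x∈))) ln)
    face {d} cd d⊆ d≢c | yes (v∈ , y∈) | record { bicycle = B' ; set≡ = refl } | yes some | u , u∈Q , u∈d
     | Bicycle.in-β u∈β'
     with shorter-link B (bicycle-swap B') wk' leQ okQ tα tβ
      (λ x∈ → T⊆ (d⊆ (subst (_ ∊_) (bicycle-swap-set B') x∈))) u∈Q u∈β'
    ... | inj₂ ln = linked⇒reduces k B' (λ x∈ → T⊆U (d⊆ x∈)) ln
    ... | inj₁ ln = subst (λ c → Reduces U NotBoth [ c ]) (bicycle-swap-set B')
     (linked⇒reduces k (bicycle-swap B') (λ x∈ → T⊆U (d⊆ (subst (_ ∊_) (bicycle-swap-set B') x∈))) ln)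

 cyc-neighbour : ∀ {c x} → Cyc c → x ∊ c → ∃[ y ] y ∊ c × Adj x y
 cyc-neighbour cyc x∈ = let open Two (cyc-two cyc x∈) in u , u∈ , xu

 cyc-edge : ∀ {c} → Cyc c → ∃[ x ] ∃[ y ] x ∊ c × y ∊ c × Adj x y
 cyc-edge cyc = let x , x∈ = cyc-nonempty cyc ; y , y∈ , adj = cyc-neighbour cyc x∈ in x , y , x∈ , y∈ , adj

 ∂-single : ∀ z {c x y} → x ∊ c → y ∊ c → (∀ {d} → d ∈ z → x ∊ d → y ∊ d → d ≡ c) → ∂ z x y ≡ coef z c
 ∂-single z {c} {x} {y} x∈ y∈ only = par-cong z pointwise
  where
  pointwise : ∀ {d} → d ∈ z → mem d x ∧ mem d y ≡ does (d ≟ₛ c)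
  pointwise {d} d∈ with d ≟ₛ c
  ... | yes refl = cong₂ _∧_ (∈⇒mem x∈) (∈⇒mem y∈)
  ... | no d≢c with mem d x in dx | mem d y in dy
  ... | false | _ = refl
  ... | true | false = refl
  ... | true | true = contradiction (only d∈ (mem⇒∈ dx) (mem⇒∈ dy)) d≢c

 coef-filter : ∀ {P : Subset n → Set} (P? : ∀ c → Dec (P c)) z d → coef (filter P? z) d ≡ does (P? d) ∧ coef z d
 coef-filter P? z d = trans (par-filter P? (λ e → does (e ≟ₛ d)) z)
  (trans (par-cong z λ {e} _ → pointwise e) (par-∧ (does (P? d)) (λ e → does (e ≟ₛ d)) z))
  where
  pointwise : ∀ e → does (P? e) ∧ does (e ≟ₛ d) ≡ does (P? d) ∧ does (e ≟ₛ d)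
  pointwise e with e ≟ₛ d
  ... | yes refl = refl
  ... | no _ = trans (Bool.∧-zeroʳ _) (sym (Bool.∧-zeroʳ _))

 -- Ways to remove vertices from U when generating the relations of U.
 data Reduction (U : Subset n) : Set where
  at-most-one : (∀ {c d} → Cyc c → c ⊆ U → Cyc d → d ⊆ U → c ≡ d) → Reduction U
  dominated : ∀ {u v} → u ∊ U → v ∊ U → Adj u v → (∀ {x} → x ∊ U → Adj u x → x ≡ v ⊎ Adj v x) → Reduction U
  separated : ∀ {v y} → v ∊ U → y ∊ U →
   (∀ {c} → Cyc c → c ⊆ U → v ∊ c → y ∊ c → Reduces U (NotBoth {U} {v} {y}) [ c ]) → Reduction U

 private
  closed-one : ∀ {U z} → (∀ {c d} → Cyc c → c ⊆ U → Cyc d → d ⊆ U → c ≡ d) → CycsIn U z → Closed z → z ≈ []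
  closed-one {U} {z} one cs cl c with c ∈ₗ? z
   where
   _∈ₗ?_ : ∀ (c : Subset n) z → Dec (c ∈ z)
   _∈ₗ?_ = DecMembership._∈?_ _≟ₛ_
  ... | no c∉ = coef-∉ {z = z} c∉
  ... | yes c∈ with All.lookup cs c∈
  ...   | cyc , c⊆ = let x , y , x∈ , y∈ , adj = cyc-edge cyc in
   trans (sym (∂-single z x∈ y∈ λ d∈ _ _ → one (proj₁ (All.lookup cs d∈)) (proj₂ (All.lookup cs d∈)) cyc c⊆)) (cl x y adj)

  -- Cycles through a dominated vertex u reduce to triangles on the edge u v.
  reduces-dominated : ∀ {U u v} → u ∊ U → v ∊ U → Adj u v → (∀ {x} → x ∊ U → Adj u x → x ≡ v ⊎ Adj v x) →
   ∀ {c} → Cyc c → c ⊆ U → Reduces U (λ d → u ∊ d → v ∊ d) [ c ]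
  reduces-dominated {U} {u} {v} u∈ v∈ uv dom {c} cyc c⊆ with u Subset.∈? c | v Subset.∈? c
  ... | no u∉c | _ = reduces-ok cyc c⊆ λ u∈c → contradiction u∈c u∉c
  ... | yes u∈c | yes v∈c = reduces-ok cyc c⊆ λ _ → v∈c
  ... | yes u∈c | no v∉c = reduces-solid (hub⇒solid H) T⊆ cyc ⊆+v face
   where
   module N = Two (cyc-two cyc u∈c)
   adj-v : ∀ {x} → x ∊ c → Adj u x → Adj v x
   adj-v x∈ ux = [ (λ { refl → contradiction x∈ v∉c }) , id ]′ (dom (c⊆ x∈) ux)
   H : Hub (c +v v)
   H = record
    { cyc = cyc ; q∉ = v∉c ; s∈ = u∈c ; t∈ = N.u∈ ; u∈ = N.w∈ ; qs = Adj-sym uv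
    ; qt = adj-v N.u∈ N.xu ; qu = adj-v N.w∈ N.xw ; s≢t = Adj⇒≢ N.xu ; s≢u = Adj⇒≢ N.xw ; t≢u = N.u≢w ; T≡ = refl }
   T⊆ : c +v v ⊆ U
   T⊆ x∈ with ∈+v⁻ x∈
   ... | inj₁ x∈c = c⊆ x∈c
   ... | inj₂ refl = v∈
   face : ∀ {d} → Cyc d → d ⊆ c +v v → d ≢ c → Reduces U _ [ d ]
   face {d} cd d⊆ d≢c = reduces-ok cd (λ x∈ → T⊆ (d⊆ x∈)) λ _ → decidable-stable (v Subset.∈? d) λ v∉d →
    d≢c (cyc-antichain cyc cd λ x∈ → [ id , (λ { refl → contradiction x∈ v∉d }) ]′ (∈+v⁻ (d⊆ x∈)))

  drop-dominated : ∀ {U u v z} → Adj u v → (∀ {x} → x ∊ U → Adj u x → x ≡ v ⊎ Adj v x) →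
   CycsIn U z → All (λ d → u ∊ d → v ∊ d) z → Closed z → ∀ {c} → c ∈ z → u ∊ c → coef z c ≡ false
  drop-dominated {U} {u} {v} {z} uv dom cs ok cl {c} c∈ u∈c = go (N.only v∈c uv)
   where
   cyc : Cyc c
   cyc = proj₁ (All.lookup cs c∈)
   c⊆ : c ⊆ U
   c⊆ = proj₂ (All.lookup cs c∈)
   v∈c : v ∊ c
   v∈c = All.lookup ok c∈ u∈c
   module N = Two (cyc-two cyc u∈c)

   is-triangle : ∀ {a d} → Cyc d → u ∊ d → v ∊ d → a ∊ d → Adj u a → Adj v a → d ≡ ⟦ u ∷ v ∷ a ∷ [] ⟧
   is-triangle cd u∈ v∈ a∈ ua va = sym (cyc-antichain cd (triangle-cyc uv ua va) sub)
    where
    sub : ⟦ u ∷ v ∷ _ ∷ [] ⟧ ⊆ _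
    sub x∈ with ∈⟦⟧⁻ x∈
    ... | here refl = u∈
    ... | there 1st = v∈
    ... | 3rd = a∈

   at : ∀ {a} → a ∊ c → Adj u a → a ≢ v → coef z c ≡ false
   at {a} a∈ ua a≢v with dom (c⊆ a∈) ua
   ... | inj₁ a≡v = contradiction a≡v a≢v
   ... | inj₂ va = trans (sym (∂-single z u∈c a∈ λ d∈ u∈d a∈d →
    trans (is-triangle (proj₁ (All.lookup cs d∈)) u∈d (All.lookup ok d∈ u∈d) a∈d ua va) (sym (is-triangle cyc u∈c v∈c a∈ ua va))))
    (cl u a ua)

   go : v ≡ N.u ⊎ v ≡ N.w → coef z c ≡ false
   go (inj₁ refl) = at N.w∈ N.xw (≢-sym N.u≢w)
   go (inj₂ refl) = at N.u∈ N.xu N.u≢w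

 module _ (reduction : ∀ U → Reduction U) where

  private
   sum-rest : ∀ {U z r} → Gen U (z ++ r) → Gen U r → Gen U z
   sum-rest {U} {z} {r} g h = gen-≈ {z = (z ++ r) ++ r} (λ c → sym (begin
    coef ((z ++ r) ++ r) c ≡⟨ coef-++ (z ++ r) r c ⟩
    coef (z ++ r) c xor coef r c ≡⟨ cong (_xor coef r c) (coef-++ z r c) ⟩
    (coef z c xor coef r c) xor coef r c ≡⟨ Bool.xor-assoc (coef z c) (coef r c) (coef r c) ⟩
    coef z c xor (coef r c xor coef r c) ≡⟨ cong (coef z c xor_) (Bool.xor-same (coef r c)) ⟩
    coef z c xor false ≡⟨ Bool.xor-identityʳ (coef z c) ⟩
    coef z c ∎)) (gen-++ g h)
    where open ≡-Reasoning

   rest-closed : ∀ {U z r} → Closed z → Gen U (z ++ r) → Closed r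
   rest-closed {U} {z} {r} cl g = closed-++ʳ z {r} (gen-closed g) cl

   -⊆ : ∀ {U : Subset n} {v} → U Subset.- v ⊆ U
   -⊆ {U} {v} x∈ = proj₁ (∈-remove⁻ U v x∈)

   ⊆- : ∀ {U c : Subset n} {v} → c ⊆ U → v ∉ₛ c → c ⊆ U Subset.- v
   ⊆- c⊆ v∉ x∈ = Subset.x∈p∧x≢y⇒x∈p-y (c⊆ x∈) λ { refl → v∉ x∈ }

   cycsIn-- : ∀ {U v z} → CycsIn U z → All (v ∉ₛ_) z → CycsIn (U Subset.- v) z
   cycsIn-- [] [] = []
   cycsIn-- ((cyc , c⊆) ∷ cs) (v∉ ∷ vs) = (cyc , ⊆- c⊆ v∉) ∷ cycsIn-- cs vs

  generate' : ∀ k {U z} → ∣ U ∣ ≤ k → CycsIn U z → Closed z → Gen U z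
  generate' k {U} {z} le cs cl with reduction U
  ... | at-most-one one = gen-[] (closed-one {z = z} one cs cl)
  generate' zero {U} le cs cl | dominated u∈ v∈ uv dom = contradiction (ℕ.<-≤-trans (ℕ.≤-<-trans z≤n (Subset.x∈p⇒∣p-x∣<∣p∣ u∈)) le) (ℕ.<-irrefl refl)
  generate' (suc k) {U} {z} le cs cl | dominated {u} {v} u∈ v∈ uv dom =
   sum-rest {z = z} {R.rest} R.gen (gen-≈ {z = low} low-eq (gen-mono -⊆
    (generate' k (ℕ.≤-pred (ℕ.<-≤-trans (Subset.x∈p⇒∣p-x∣<∣p∣ u∈) le)) low-in (closed-≈ {R.rest} {low} low-eq R-closed))))
   where
   module R = Reduces (reduces-all z λ c∈ → reduces-dominated u∈ v∈ uv dom (proj₁ (All.lookup cs c∈)) (proj₂ (All.lookup cs c∈)))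
   R-closed : Closed R.rest
   R-closed = rest-closed {z = z} cl R.gen
   low : List (Subset n)
   low = filter (λ c → ¬? (u Subset.∈? c)) R.rest
   low-in : CycsIn (U Subset.- u) low
   low-in = cycsIn-- (All.filter⁺ _ R.in-U) (All.all-filter (λ c → ¬? (u Subset.∈? c)) R.rest)
   low-eq : R.rest ≈ low
   low-eq c with u Subset.∈? c | DecMembership._∈?_ _≟ₛ_ c R.rest
   ... | no u∉ | _ = sym (trans (coef-filter (λ c → ¬? (u Subset.∈? c)) R.rest c)
    (cong (_∧ coef R.rest c) (dec-true (¬? (u Subset.∈? c)) u∉)))
   ... | yes u∈c | no c∉ = trans (coef-∉ {z = R.rest} c∉) (sym (coef-∉ {z = low} λ c∈ → c∉ (proj₁ (∈-filter⁻ (λ c → ¬? (u Subset.∈? c)) c∈))))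
   ... | yes u∈c | yes c∈ = trans (drop-dominated uv dom R.in-U R.ok R-closed c∈ u∈c)
    (sym (coef-∉ {z = low} λ c∈' → proj₂ (∈-filter⁻ (λ c → ¬? (u Subset.∈? c)) {xs = R.rest} c∈') u∈c))
  generate' zero {U} le cs cl | separated v∈ y∈ red = contradiction (ℕ.<-≤-trans (ℕ.≤-<-trans z≤n (Subset.x∈p⇒∣p-x∣<∣p∣ v∈)) le) (ℕ.<-irrefl refl)
  generate' (suc k) {U} {z} le cs cl | separated {v} {y} v∈ y∈ red =
   sum-rest {z = z} {R.rest} R.gen (gen-≈ {z = (z₁ ++ f) ++ (z₂ ++ f)} eq
    (gen-++ (gen-mono -⊆ (generate' k (smaller v∈) (All.++⁺ z₁-in (cycsIn-mono (λ x∈ → -⊆ x∈) f-in)) cl₁))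
     (gen-mono -⊆ (generate' k (smaller y∈) (All.++⁺ z₂-in (cycsIn-mono f⊆ f-in)) cl₂))))
   where
   reduce : ∀ {c} → c ∈ z → Reduces U (NotBoth {U} {v} {y}) [ c ]
   reduce {c} c∈ with All.lookup cs c∈ | (v Subset.∈? c) ×-dec (y Subset.∈? c)
   ... | cyc , c⊆ | yes (v∈c , y∈c) = red cyc c⊆ v∈c y∈c
   ... | cyc , c⊆ | no ¬both = reduces-ok cyc c⊆ ¬both

   module R = Reduces (reduces-all z reduce)

   smaller : ∀ {x} → x ∊ U → ∣ U Subset.- x ∣ ≤ k
   smaller x∈ = ℕ.≤-pred (ℕ.<-≤-trans (Subset.x∈p⇒∣p-x∣<∣p∣ x∈) le)

   ∌v? : ∀ c → Dec (v ∉ₛ c)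
   ∌v? c = ¬? (v Subset.∈? c)
   ∋v? : ∀ c → Dec (v ∊ c)
   ∋v? c = v Subset.∈? c

   z₁ z₂ : List (Subset n)
   z₁ = filter ∌v? R.rest
   z₂ = filter ∋v? R.rest

   z₁-in : CycsIn (U Subset.- v) z₁
   z₁-in = cycsIn-- (All.filter⁺ _ R.in-U) (All.all-filter ∌v? R.rest)
   z₂-in : CycsIn (U Subset.- y) z₂
   z₂-in = cycsIn-- (All.filter⁺ _ R.in-U) (All.tabulate λ {c} c∈ y∈c →
    let c∈R , v∈c = ∈-filter⁻ ∋v? {xs = R.rest} c∈ in All.lookup R.ok c∈R (v∈c , y∈c))

   split : ∀ c → coef R.rest c ≡ coef z₁ c xor coef z₂ c
   split c = sym (trans (cong₂ _xor_ (coef-filter ∌v? R.rest c) (coef-filter ∋v? R.rest c)) (part (does (∋v? c)) (coef R.rest c)))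
    where
    part : ∀ a b → (not a ∧ b) xor (a ∧ b) ≡ b
    part false b = Bool.xor-identityʳ b
    part true b = refl

   closed-sum : Closed (z₁ ++ z₂)
   closed-sum = closed-≈ {R.rest} {z₁ ++ z₂} (λ c → trans (split c) (sym (coef-++ z₁ z₂ c))) (rest-closed {z = z} cl R.gen)

   ∂-eq : ∀ x y → Adj x y → ∂ z₁ x y ≡ ∂ z₂ x y
   ∂-eq x y adj = xor≡false⇒≡ (trans (sym (∂-++ z₁ z₂ x y)) (closed-sum x y adj))

   U' : Subset n
   U' = (U Subset.- v) Subset.- y

   ε : EvenSet U' (λ x y → ∂ z₁ x y ∧ adjᵇ x y)
   ε = record
    { symm = EvenSet.symm E₁ ; even = EvenSet.even E₁
    ; supp = λ {x} {w} e → let adj , x∈ = EvenSet.supp E₁ e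
                               _ , x∈₂ = EvenSet.supp E₂ {x} {w} (trans (cong (_∧ adjᵇ x w) (sym (∂-eq x w adj))) e)
     in adj , Subset.x∈p∧x≢y⇒x∈p-y x∈ (proj₂ (∈-remove⁻ U y x∈₂)) }
    where
    E₁ : EvenSet (U Subset.- v) (λ x y → ∂ z₁ x y ∧ adjᵇ x y)
    E₁ = cyc-evenSet z₁-in
    E₂ : EvenSet (U Subset.- y) (λ x y → ∂ z₂ x y ∧ adjᵇ x y)
    E₂ = cyc-evenSet z₂-in

   -- The common boundary of the two halves avoids v and y, so it can be filled there.
   filling : Filling U' (λ x y → ∂ z₁ x y ∧ adjᵇ x y)
   filling = fill ε
   f : List (Subset n)
   f = proj₁ filling
   f-in : CycsIn U' f
   f-in = proj₁ (proj₂ filling)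
   f-∂ : ∀ x y → Adj x y → ∂ f x y ≡ ∂ z₁ x y
   f-∂ x y adj = trans (proj₂ (proj₂ filling) x y adj) (trans (cong (∂ z₁ x y ∧_) (⇒adjᵇ adj)) (Bool.∧-identityʳ _))

   f⊆ : U' ⊆ U Subset.- y
   f⊆ x∈ = let x∈' , x≢y = ∈-remove⁻ (U Subset.- v) y x∈ in
    Subset.x∈p∧x≢y⇒x∈p-y (proj₁ (∈-remove⁻ U v x∈')) x≢y

   cl₁ : Closed (z₁ ++ f)
   cl₁ x y adj = trans (∂-++ z₁ f x y) (≡⇒xor≡false (sym (f-∂ x y adj)))
   cl₂ : Closed (z₂ ++ f)
   cl₂ x y adj = trans (∂-++ z₂ f x y) (≡⇒xor≡false (trans (sym (∂-eq x y adj)) (sym (f-∂ x y adj))))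

   eq : R.rest ≈ (z₁ ++ f) ++ (z₂ ++ f)
   eq c = trans (split c) (sym (begin
    coef ((z₁ ++ f) ++ (z₂ ++ f)) c
    ≡⟨ trans (coef-++ (z₁ ++ f) (z₂ ++ f) c) (cong₂ _xor_ (coef-++ z₁ f c) (coef-++ z₂ f c)) ⟩
     (coef z₁ c xor coef f c) xor (coef z₂ c xor coef f c)
    ≡⟨ xor-swap (coef z₁ c) (coef f c) (coef z₂ c) (coef f c) ⟩
     (coef z₁ c xor coef z₂ c) xor (coef f c xor coef f c)
    ≡⟨ cong ((coef z₁ c xor coef z₂ c) xor_) (Bool.xor-same (coef f c)) ⟩
     (coef z₁ c xor coef z₂ c) xor false
    ≡⟨ Bool.xor-identityʳ _ ⟩
     coef z₁ c xor coef z₂ c ∎))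
    where open ≡-Reasoning

 reach-trans : ∀ {P a b c} → Reach P a b → Reach P b c → Reach P a c
 reach-trans (xs , w , pa ∷ ps) (ys , w' , _ ∷ ps') = xs ++ ys , walk-++ w w' , pa ∷ All.++⁺ ps ps'

 reach-sym : ∀ {P a b} → Reach P a b → Reach P b a
 reach-sym ([] , stop , pa ∷ []) = [] , stop , pa ∷ []
 reach-sym (x ∷ xs , step adj w , pa ∷ ps) = reach-step (reach-sym (xs , w , ps)) (Adj-sym adj) pa

 reach-map : ∀ {P Q : V → Set} {a b} → (∀ {x} → P x → Q x) → Reach P a b → Reach Q a b
 reach-map f (xs , w , ps) = xs , w , All.map f ps

 reach-within : ∀ {P a} (C : Component P a) {s} → s ∊ Component.S C → Reach (_∊ Component.S C) a s
 reach-within C s∈ with Component.reach C s∈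
 ... | xs , w , ps = xs , w , Component.a∈ C ∷
  walk-closed {P = _∊ Component.S C} w (Component.a∈ C) λ _ y∈ x∈S adj → Component.closed C x∈S (All.lookup ps (there y∈)) adj

 reach⇒reduces : ∀ {U v y α β a b} (B : Bicycle v y α β) → Bicycle.set B ⊆ U → a ∈ α → b ∈ β →
  Reach (Between {U} {v} {y}) a b → Reduces U (NotBoth {U} {v} {y}) [ Bicycle.set B ]
 reach⇒reduces B c⊆ a∈ b∈ (xs , w , ps) = linked⇒reduces (suc (length xs)) B c⊆
  (mkLink w ℕ.≤-refl ps (_ , a∈ , inj₁ refl) (_ , b∈ , inj₁ refl))

 private
  module Choose {U : Subset n} {v y x₀ : V} (v∈ : v ∊ U) (y∈ : y ∊ U) (v-y : Far v y)
   (K : Component (Between {U} {v} {y}) x₀) where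

   module K = Component K

   data Side (x : V) : Set where
    is-v : x ≡ v → Side x
    is-y : x ≡ y → Side x
    in-K : x ∊ K.S → Side x
    out : x ≢ v → x ≢ y → x ∉ₛ K.S → Side x

   side : ∀ x → Side x
   side x with x ≟ v | x ≟ y | x Subset.∈? K.S
   ... | yes p | _ | _ = is-v p
   ... | no _ | yes p | _ = is-y p
   ... | no _ | no _ | yes p = in-K p
   ... | no p | no q | no r = out p q r

   K⊆U : K.S ⊆ U
   K⊆U x∈ = proj₁ (K.sound x∈)
   K≢v : ∀ {x} → x ∊ K.S → x ≢ v
   K≢v x∈ = proj₁ (proj₂ (K.sound x∈))
   K≢y : ∀ {x} → x ∊ K.S → x ≢ y
   K≢y x∈ = proj₂ (proj₂ (K.sound x∈))

   leaves : ∀ {x z} → x ∊ K.S → z ∊ U → Adj x z → z ≡ v ⊎ z ≡ y ⊎ z ∊ K.S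
   leaves {x} {z} x∈ z∈ adj with side z
   ... | is-v z≡v = inj₁ z≡v
   ... | is-y z≡y = inj₂ (inj₁ z≡y)
   ... | in-K z∈K = inj₂ (inj₂ z∈K)
   ... | out z≢v z≢y z∉ = contradiction (K.closed x∈ (z∈ , z≢v , z≢y) adj) z∉

   no-cycle : ∀ {p r} → (∀ {x} → x ∊ K.S → ¬ Adj p x) → p ∉ₛ K.S →
    (∀ {x z} → x ∊ K.S → z ∊ U → Adj x z → z ≡ p ⊎ z ≡ r ⊎ z ∊ K.S) → r ∉ₛ K.S → r ≢ p →
    ∀ {c} → Cyc c → c ⊆ U → x₀ ∊ c → ¬ p ∊ c
   no-cycle {p} {r} none p∉ exits r∉ r≢p {c} cyc c⊆ x₀∈ p∈ with r Subset.∈? c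
   ... | no r∉c = p∉ (cyc-closed {P = _∊ K.S} cyc x₀∈ K.a∈ stay p∈)
    where
    stay : ∀ {x z} → x ∊ c → z ∊ c → x ∊ K.S → Adj x z → z ∊ K.S
    stay x∈ z∈ x∈K adj with exits x∈K (c⊆ z∈) adj
    ... | inj₁ refl = contradiction (Adj-sym adj) (none x∈K)
    ... | inj₂ (inj₁ refl) = contradiction z∈ r∉c
    ... | inj₂ (inj₂ z∈K) = z∈K
   ... | yes r∈c = p∉ (All.lookup (ipath-closed {P = _∊ K.S} arc (on-arc x₀∈ λ { refl → r∉ K.a∈ }) K.a∈ stay) (on-arc p∈ r≢p))
    where
    open RootedIn (cyc⇒rooted cyc r∈c)
    on-arc : ∀ {x} → x ∊ c → r ≢ x → x ∈ a ∷ mid ++ [ b ]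
    on-arc x∈ r≢x with ⊆list x∈
    ... | here refl = contradiction refl r≢x
    ... | there x∈' = x∈'
    stay : ∀ {x z} → x ∈ a ∷ mid ++ [ b ] → z ∈ a ∷ mid ++ [ b ] → x ∊ K.S → Adj x z → z ∊ K.S
    stay x∈ z∈ x∈K adj with exits x∈K (c⊆ (list⊆ (there z∈))) adj
    ... | inj₁ refl = contradiction (Adj-sym adj) (none x∈K)
    ... | inj₂ (inj₁ refl) = contradiction refl (arc-∉ z∈)
    ... | inj₂ (inj₂ z∈K) = z∈K

   v∉K : v ∉ₛ K.S
   v∉K v∈K = K≢v v∈K refl
   y∉K : y ∉ₛ K.S
   y∉K y∈K = K≢y y∈K refl

   module Joined {s s' : V} (s∈ : s ∊ K.S) (vs : Adj v s) (s'∈ : s' ∊ K.S) (ys' : Adj y s') where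

    reach-v : ∀ {P : V → Set} → (∀ {x} → x ∊ K.S → P x) → P v → Reach P x₀ v
    reach-v f pv = reach-step (reach-map f (reach-within K s∈)) (Adj-sym vs) pv
    reach-y : ∀ {P : V → Set} → (∀ {x} → x ∊ K.S → P x) → P y → Reach P x₀ y
    reach-y f py = reach-step (reach-map f (reach-within K s'∈)) (Adj-sym ys') py

    larger : ∀ {P : V → Set} (K' : Component P x₀) → (∀ {x} → x ∊ K.S → P x) → ∀ {w} → w ∉ₛ K.S → Reach P x₀ w →
     ∣ K.S ∣ < ∣ Component.S K' ∣
    larger K' f w∉ rw = Subset.p⊂q⇒∣p∣<∣q∣
     ((λ x∈ → Component.complete K' (reach-map f (reach-within K x∈))) , _ , Component.complete K' rw , w∉)

    rest-only : (∀ {x} → x ∊ U → x ≢ v → x ≢ y → x ∊ K.S) → ∀ {c} → Cyc c → c ⊆ U → v ∊ c → y ∊ c →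
     Reduces U (NotBoth {U} {v} {y}) [ c ]
    rest-only all-K cyc c⊆ v∈c y∈c with cyc⇒bicycle cyc v∈c y∈c v-y
    ... | record { bicycle = B ; set≡ = refl } with Bicycle.headα B | Bicycle.headβ B
    ... | a , ha | b , hb = reach⇒reduces B c⊆ (head-∈ ha) (head-∈ hb) (reach-trans (reach-sym (reach a∈K)) (reach b∈K))
     where
     module B = Bicycle B
     reach : ∀ {x} → x ∊ K.S → Reach (Between {U} {v} {y}) x₀ x
     reach = K.reach
     a∈K : a ∊ K.S
     a∈K = all-K (c⊆ (∈α⁺ B (head-∈ ha))) (λ { refl → B.s∉α (head-∈ ha) }) (λ { refl → B.t∉α (head-∈ ha) })
     b∈K : b ∊ K.S
     b∈K = all-K (c⊆ (∈β⁺ B (head-∈ hb))) (λ { refl → B.s∉β (head-∈ hb) }) (λ { refl → B.t∉β (head-∈ hb) })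

    module Handle {k : V} (k∈ : k ∊ U) (k≢v : k ≢ v) (k≢y : k ≢ y) (k∉ : k ∉ₛ K.S) (kv : Adj k v) (ky : Adj k y)
     (only-k : ∀ {x} → x ∊ U → x ≢ v → x ≢ y → x ∉ₛ K.S → x ≡ k) where

     Inside : V → Set
     Inside x = x ∊ K.S ⊎ x ≡ v ⊎ x ≡ y

     route : Reach Inside v y
     route = reach-trans (reach-sym (reach-v inj₁ (inj₂ (inj₁ refl)))) (reach-y inj₁ (inj₂ (inj₂ refl)))

     nbr-k : ∀ {x} → x ∊ U → Adj k x → x ≡ v ⊎ x ≡ y
     nbr-k {x} x∈ kx with side x
     ... | is-v p = inj₁ p
     ... | is-y p = inj₂ p
     ... | in-K x∈K = contradiction (K.closed x∈K (k∈ , k≢v , k≢y) (Adj-sym kx)) k∉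
     ... | out p q r = contradiction (sym (only-k x∈ p q r)) (Adj⇒≢ kx)

     far-k : ∀ {x} → x ∊ K.S → Far k x
     far-k x∈ = (λ { refl → k∉ x∈ }) , λ kx → k∉ (K.closed x∈ (k∈ , k≢v , k≢y) (Adj-sym kx))

     handle : Reduction U
     handle with route
     ... | xs , w , ps with shorten w
     ... | [] , stop , _ , _ , _ = contradiction refl (proj₁ v-y)
     ... | ys@(_ ∷ _) , w' , path , sub , _ with walk-snoc w'
     ... | mid , eq with Fin.any? (λ s → (s Subset.∈? K.S) ×-dec ¬? (s ∈? (v ∷ ys)))
     ... | yes (s , s∈K , s∉) = separated k∈ (K⊆U s∈K) λ cyc c⊆ k∈c s∈c → pair cyc c⊆ (cyc⇒bicycle cyc k∈c s∈c (far-k s∈K))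
      where
      P : V → Set
      P = Between {U} {k} {s}
      ok : ∀ {x} → x ∈ v ∷ ys → P x
      ok x∈ with All.lookup ps (sub x∈)
      ... | inj₁ x∈K = K⊆U x∈K , (λ { refl → k∉ x∈K }) , λ { refl → s∉ x∈ }
      ... | inj₂ (inj₁ refl) = v∈ , ≢-sym k≢v , λ { refl → s∉ x∈ }
      ... | inj₂ (inj₂ refl) = y∈ , ≢-sym k≢y , λ { refl → s∉ x∈ }
      link-vy : Reach P v y
      link-vy = ys , w' , All.tabulate ok

      pair : ∀ {c} → Cyc c → c ⊆ U → BicycleOf c k s → Reduces U (NotBoth {U} {k} {s}) [ c ]
      pair cyc c⊆ record { α = α ; β = β ; bicycle = B ; set≡ = refl } with Bicycle.headα B | Bicycle.headβ B
      ... | a , ha@(_ , refl) | b , hb@(_ , refl) = go (nbr-k (c⊆ (∈α⁺ B 1st)) (consec-adj (Bicycle.pathα B) here))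
       (nbr-k (c⊆ (∈β⁺ B 1st)) (consec-adj (Bicycle.pathβ B) here))
       where
       go : a ≡ v ⊎ a ≡ y → b ≡ v ⊎ b ≡ y → _
       go (inj₁ refl) (inj₂ refl) = reach⇒reduces B c⊆ 1st 1st link-vy
       go (inj₂ refl) (inj₁ refl) = reach⇒reduces B c⊆ 1st 1st (reach-sym link-vy)
       go (inj₁ refl) (inj₁ eq) = contradiction (sym eq) (proj₁ (Bicycle.anti B 1st 1st))
       go (inj₂ refl) (inj₂ eq) = contradiction (sym eq) (proj₁ (Bicycle.anti B 1st 1st))
     ... | no none = at-most-one λ cc c⊆ cd d⊆ → trans (whole cc c⊆) (sym (whole cd d⊆))
      where
      root : Rooted k v mid y
      root = rooted kv ky (All.tabulate λ {x} x∈ → far-mid x∈) (subst (λ l → IPath (v ∷ l)) eq path)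
       where
       uniq : Unique (v ∷ mid ++ [ y ])
       uniq = subst (λ l → Unique (v ∷ l)) eq (ipath-unique path)
       far-mid : ∀ {x} → x ∈ mid → Far k x
       far-mid {x} x∈ with All.lookup ps (sub (there (subst (x ∈_) (sym eq) (∈-++⁺ˡ x∈))))
       ... | inj₁ x∈K = far-k x∈K
       ... | inj₂ (inj₁ refl) = contradiction refl (unique-head uniq (∈-++⁺ˡ x∈))
       ... | inj₂ (inj₂ refl) = contradiction x∈ (unique-last mid (unique-++ʳ [ v ] uniq))

      whole : ∀ {c} → Cyc c → c ⊆ U → c ≡ ⟦ Rooted.list root ⟧
      whole cyc c⊆ = cyc-antichain (rooted⇒cyc root) cyc λ x∈ → ∈⟦⟧⁺ (on-list (c⊆ x∈))
       where
       on-list : ∀ {x} → x ∊ U → x ∈ Rooted.list root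
       on-list {x} x∈ with side x
       ... | is-v refl = there 1st
       ... | is-y refl = there (there (∈-++⁺ʳ mid 1st))
       ... | out p q r = here (only-k x∈ p q r)
       ... | in-K x∈K = there (subst (λ l → x ∈ v ∷ l) eq
        (decidable-stable (x ∈? (v ∷ ys)) λ x∉ → none (x , x∈K , x∉)))

  between? : ∀ U v y x → Dec (Between {U} {v} {y} x)
  between? U v y x = (x Subset.∈? U) ×-dec ¬? (x ≟ v) ×-dec ¬? (x ≟ y)

  choose : ∀ fuel {U v y x₀} → v ∊ U → y ∊ U → Far v y → (K : Component (Between {U} {v} {y}) x₀) →
   n < fuel + ∣ Component.S K ∣ → Reduction U
  choose zero v∈ y∈ v-y K le = contradiction (ℕ.<-≤-trans le (Subset.∣p∣≤n (Component.S K))) (ℕ.<-irrefl refl)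
  choose (suc fuel) {U} {v} {y} {x₀} v∈ y∈ v-y K le
   with Fin.any? (λ s → (s Subset.∈? Component.S K) ×-dec adj? v s) | Fin.any? (λ s → (s Subset.∈? Component.S K) ×-dec adj? y s)
  ... | no none | _ = separated x₀∈ v∈ λ cyc c⊆ x∈ v∈c → contradiction v∈c
   (no-cycle (λ x∈K vx → none (_ , x∈K , vx)) v∉K leaves y∉K (≢-sym (proj₁ v-y)) cyc c⊆ x∈)
   where
   open Choose v∈ y∈ v-y K
   x₀∈ : x₀ ∊ U
   x₀∈ = K⊆U K.a∈
  ... | yes _ | no none = separated (K⊆U K.a∈) y∈ λ cyc c⊆ x∈ y∈c → contradiction y∈c
   (no-cycle (λ x∈K yx → none (_ , x∈K , yx)) y∉K (λ x∈K z∈ adj → swap₁ (leaves x∈K z∈ adj)) v∉K (proj₁ v-y) cyc c⊆ x∈)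
   where
   open Choose v∈ y∈ v-y K
   swap₁ : ∀ {A B C : Set} → A ⊎ B ⊎ C → B ⊎ A ⊎ C
   swap₁ (inj₁ a) = inj₂ (inj₁ a)
   swap₁ (inj₂ (inj₁ b)) = inj₁ b
   swap₁ (inj₂ (inj₂ c)) = inj₂ (inj₂ c)
  ... | yes (s , s∈ , vs) | yes (s' , s'∈ , ys') =
   go (Fin.any? λ k → rest? k ×-dec far? k v) (Fin.any? λ k → rest? k ×-dec far? k y)
    (Fin.any? λ k → Fin.any? λ l → rest? k ×-dec rest? l ×-dec far? k l)
    (Fin.any? rest?)
   where
   open Choose v∈ y∈ v-y K
   open Joined s∈ vs s'∈ ys'

   Rest : V → Set
   Rest k = k ∊ U × k ≢ v × k ≢ y × k ∉ₛ K.S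
   rest? : ∀ k → Dec (Rest k)
   rest? k = (k Subset.∈? U) ×-dec ¬? (k ≟ v) ×-dec ¬? (k ≟ y) ×-dec ¬? (k Subset.∈? K.S)

   again : ∀ {p q} → p ∊ U → q ∊ U → Far p q → p ∉ₛ K.S → q ∉ₛ K.S → ∀ {w} → w ∉ₛ K.S →
    ((∀ {x} → x ∊ K.S → Between {U} {p} {q} x) → Reach (Between {U} {p} {q}) x₀ w) → Reduction U
   again {p} {q} p∈ q∈ p-q p∉ q∉ w∉ reach = choose fuel p∈ q∈ p-q K' (ℕ.<-≤-trans le
    (ℕ.≤-trans (ℕ.≤-reflexive (sym (ℕ.+-suc fuel ∣ K.S ∣))) (ℕ.+-monoʳ-≤ fuel (larger K' K⊆P w∉ (reach K⊆P)))))
    where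
    K⊆P : ∀ {x} → x ∊ K.S → Between {U} {p} {q} x
    K⊆P x∈ = K⊆U x∈ , (λ { refl → p∉ x∈ }) , λ { refl → q∉ x∈ }
    K' : Component (Between {U} {p} {q}) x₀
    K' = component (between? U p q) (K⊆P K.a∈)

   go : Dec (∃[ k ] Rest k × Far k v) → Dec (∃[ k ] Rest k × Far k y) → Dec (∃[ k ] ∃[ l ] Rest k × Rest l × Far k l) →
    Dec (∃ Rest) → Reduction U
   go (yes (k , (k∈ , k≢v , k≢y , k∉) , k-v)) _ _ _ = again v∈ k∈ (Far-sym k-v) v∉K k∉ y∉K
    λ f → reach-y f (y∈ , ≢-sym (proj₁ v-y) , ≢-sym k≢y)
   go (no _) (yes (k , (k∈ , k≢v , k≢y , k∉) , k-y)) _ _ = again k∈ y∈ k-y k∉ y∉K v∉K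
    λ f → reach-v f (v∈ , ≢-sym k≢v , proj₁ v-y)
   go (no _) (no _) (yes (k , l , (k∈ , k≢v , _ , k∉) , (l∈ , l≢v , _ , l∉) , k-l)) _ = again k∈ l∈ k-l k∉ l∉ v∉K
    λ f → reach-v f (v∈ , ≢-sym k≢v , ≢-sym l≢v)
   go (no _) (no _) (no _) (no none) = separated v∈ y∈ (rest-only λ {x} x∈ x≢v x≢y →
    decidable-stable (x Subset.∈? K.S) λ x∉ → none (x , x∈ , x≢v , x≢y , x∉))
   go (no ¬v) (no ¬y) (no ¬kl) (yes (k , rk@(k∈ , k≢v , k≢y , k∉))) with Fin.any? (λ l → rest? l ×-dec ¬? (l ≟ k))
   ... | no only = Handle.handle k∈ k≢v k≢y k∉ (adj-v rk) (adj-y rk) λ {x} x∈ p q r →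
    decidable-stable (x ≟ k) λ x≢k → only (x , (x∈ , p , q , r) , x≢k)
    where
    adj-v : ∀ {l} → Rest l → Adj l v
    adj-v {l} rl@(_ , l≢v , _) = [ (λ l≡v → contradiction l≡v l≢v) , id ]′ (¬far⇒near λ l-v → ¬v (l , rl , l-v))
    adj-y : ∀ {l} → Rest l → Adj l y
    adj-y {l} rl@(_ , _ , l≢y , _) = [ (λ l≡y → contradiction l≡y l≢y) , id ]′ (¬far⇒near λ l-y → ¬y (l , rl , l-y))
   ... | yes (l , rl@(l∈ , l≢v , l≢y , l∉) , l≢k) = dominated k∈ l∈ kl twin
    where
    kl : Adj k l
    kl = [ (λ k≡l → contradiction (sym k≡l) l≢k) , id ]′ (¬far⇒near λ k-l → ¬kl (k , l , rk , rl , k-l))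
    twin : ∀ {x} → x ∊ U → Adj k x → x ≡ l ⊎ Adj l x
    twin {x} x∈ kx with side x
    ... | is-v refl = inj₂ ([ (λ l≡v → contradiction l≡v l≢v) , id ]′ (¬far⇒near λ l-v → ¬v (l , rl , l-v)))
    ... | is-y refl = inj₂ ([ (λ l≡y → contradiction l≡y l≢y) , id ]′ (¬far⇒near λ l-y → ¬y (l , rl , l-y)))
    ... | in-K x∈K = contradiction (K.closed x∈K (k∈ , k≢v , k≢y) (Adj-sym kx)) k∉
    ... | out p q r = [ inj₁ ∘ sym , inj₂ ]′ (¬far⇒near λ l-x → ¬kl (l , x , rl , (x∈ , p , q , r) , l-x))

 reduction : ∀ U → Reduction U
 reduction U with Fin.any? (λ v → Fin.any? λ y → (v Subset.∈? U) ×-dec (y Subset.∈? U) ×-dec far? v y)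
 ... | yes (v , y , v∈ , y∈ , v-y) with Fin.any? (between? U v y)
 ... | yes (x₀ , b) = choose (suc n) v∈ y∈ v-y K (s≤s (ℕ.m≤m+n n _))
  where
  K : Component (Between {U} {v} {y}) x₀
  K = component (between? U v y) b
 ... | no none = separated v∈ y∈ λ cyc c⊆ v∈c y∈c → empty (cyc⇒bicycle cyc v∈c y∈c v-y) c⊆
  where
  empty : ∀ {c} → BicycleOf c v y → c ⊆ U → Reduces U (NotBoth {U} {v} {y}) [ c ]
  empty record { bicycle = B ; set≡ = refl } c⊆ with Bicycle.headα B
  ... | a , ha = contradiction (a , c⊆ (∈α⁺ B (head-∈ ha)) , (λ { refl → Bicycle.s∉α B (head-∈ ha) }) ,
   λ { refl → Bicycle.t∉α B (head-∈ ha) }) none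
 reduction U | no complete with Fin.any? (λ u → Fin.any? λ v → (u Subset.∈? U) ×-dec (v Subset.∈? U) ×-dec ¬? (u ≟ v))
 ... | yes (u , v , u∈ , v∈ , u≢v) = dominated u∈ v∈ (near-adj' u∈ v∈ u≢v) dom
  where
  near-adj' : ∀ {u v} → u ∊ U → v ∊ U → u ≢ v → Adj u v
  near-adj' u∈ v∈ u≢v = [ (λ u≡v → contradiction u≡v u≢v) , id ]′ (¬far⇒near λ u-v → complete (_ , _ , u∈ , v∈ , u-v))
  dom : ∀ {x} → x ∊ U → Adj u x → x ≡ v ⊎ Adj v x
  dom {x} x∈ _ with x ≟ v
  ... | yes x≡v = inj₁ x≡v
  ... | no x≢v = inj₂ (near-adj' v∈ x∈ (≢-sym x≢v))
 ... | no small = at-most-one λ cc c⊆ _ _ → let x , y , x∈ , y∈ , adj = cyc-edge cc in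
  contradiction (x , y , c⊆ x∈ , c⊆ y∈ , Adj⇒≢ adj) small

 generate : ∀ {U z} → CycsIn U z → Closed z → Gen U z
 generate = generate' reduction _ ℕ.≤-refl

 -- Chains of induced cycles modulo the cycles inside a set B.
 module _ (B : Subset n) where

  RelAdj : V → V → Set
  RelAdj x y = Adj x y × ¬ (x ∊ B × y ∊ B)

  relAdj? : ∀ x y → Dec (RelAdj x y)
  relAdj? x y = adj? x y ×-dec ¬? ((x Subset.∈? B) ×-dec (y Subset.∈? B))

  RelClosed : List (Subset n) → Set
  RelClosed z = ∀ x y → RelAdj x y → ∂ z x y ≡ false

  Outside : Subset n → Set
  Outside c = ¬ c ⊆ B

  outside? : ∀ c → Dec (Outside c)
  outside? c = ¬? (c ⊆? B)

  outside-vertex : ∀ {c} → Outside c → ∃[ x ] x ∊ c × x ∉ₛ B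
  outside-vertex {c} out with Fin.any? (λ x → (x Subset.∈? c) ×-dec ¬? (x Subset.∈? B))
  ... | yes found = found
  ... | no none = contradiction (λ {x} x∈ → decidable-stable (x Subset.∈? B) λ x∉ → none (x , x∈ , x∉)) out

  outside-edge : ∀ {c} → Cyc c → Outside c → ∃[ x ] ∃[ y ] x ∊ c × y ∊ c × y ∉ₛ B × Adj x y
  outside-edge cyc out = let y , y∈ , y∉ = outside-vertex out
                             x , x∈ , adj = cyc-neighbour cyc y∈ in x , y , x∈ , y∈ , y∉ , Adj-sym adj

  coef-inside : ∀ {z c} → All (_⊆ B) z → Outside c → coef z c ≡ false
  coef-inside {z} all out = coef-∉ {z = z} λ c∈ → out (All.lookup all c∈)

  close : ∀ {U z} → CycsIn U z → RelClosed z → ∃[ z' ] CycsIn (B Subset.∩ U) z' × Closed (z ++ z')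
  close {U} {z} cs cl = z' , proj₁ (proj₂ filling) , λ x y adj → trans (∂-++ z z' x y)
   (≡⇒xor≡false (sym (trans (proj₂ (proj₂ filling) x y adj) (trans (cong (∂ z x y ∧_) (⇒adjᵇ adj)) (Bool.∧-identityʳ _)))))
   where
   E : EvenSet U (λ x y → ∂ z x y ∧ adjᵇ x y)
   E = cyc-evenSet cs
   filling : Filling (B Subset.∩ U) (λ x y → ∂ z x y ∧ adjᵇ x y)
   filling = fill record
    { symm = EvenSet.symm E ; even = EvenSet.even E
    ; supp = λ {x} {y} e → let adj , x∈ = EvenSet.supp E e in adj , Subset.x∈p∩q⁺
     (decidable-stable (x Subset.∈? B) (λ x∉ →
      case trans (sym (cl x y (adj , x∉ ∘ proj₁))) (proj₁ (∧-true {∂ z x y} e)) of λ ()) , x∈) }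
   z' : List (Subset n)
   z' = proj₁ filling

  private
   inside-∩ : ∀ {U z} → CycsIn (B Subset.∩ U) z → All (_⊆ B) z
   inside-∩ [] = []
   inside-∩ {U} ((_ , c⊆) ∷ cs) = (λ x∈ → proj₁ (Subset.x∈p∩q⁻ B U (c⊆ x∈))) ∷ inside-∩ cs

   cycsIn-∩ : ∀ {U z} → CycsIn (B Subset.∩ U) z → CycsIn U z
   cycsIn-∩ {U} = cycsIn-mono (λ x∈ → proj₂ (Subset.x∈p∩q⁻ B U x∈))

  rel-generate : ∀ {U z} → CycsIn U z → RelClosed z →
   ∃[ σ ] All (λ T → (Solid T × T ⊆ U) × Outside T) σ ×
    (∀ {c} → Outside c → coef z c ≡ coef (concatMap cycs σ) c)
  rel-generate {U} {z} cs cl with close cs cl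
  ... | z' , cs' , closed with generate (All.++⁺ cs (cycsIn-∩ cs')) closed
  ... | mkGen σ ok sum = filter outside? σ ,
   All.zip (All.filter⁺ outside? ok , All.all-filter outside? σ) , λ {c} out → begin
    coef z c
    ≡⟨ sym (trans (cong (coef z c xor_) (coef-inside {z = z'} (inside-∩ cs') out)) (Bool.xor-identityʳ _)) ⟩
     coef z c xor coef z' c
    ≡⟨ trans (sym (coef-++ z z' c)) (sum c) ⟩
     coef (concatMap cycs σ) c
    ≡⟨ drop σ out ⟩
     coef (concatMap cycs (filter outside? σ)) c ∎
   where
   open ≡-Reasoning
   drop : ∀ σ {c} → Outside c → coef (concatMap cycs σ) c ≡ coef (concatMap cycs (filter outside? σ)) c
   drop [] out = refl
   drop (T ∷ σ) {c} out with T ⊆? B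
   ... | no _ = trans (coef-++ (cycs T) _ c) (trans (cong (coef (cycs T) c xor_) (drop σ out)) (sym (coef-++ (cycs T) _ c)))
   ... | yes T⊆ = trans (coef-++ (cycs T) _ c) (trans (cong (_xor coef (concatMap cycs σ) c)
    (coef-∉ {z = cycs T} λ c∈ → out λ x∈ → T⊆ (proj₂ (All.lookup (cycs-in T) c∈) x∈))) (drop σ out))

  rel-vanish : ∀ {T t z} → Solid T → t ∊ T → CycsIn (T Subset.- t) z → RelClosed z → ∀ {c} → Outside c → coef z c ≡ false
  rel-vanish {T} {t} {z} solid t∈ cs cl {c} out with DecMembership._∈?_ _≟ₛ_ c z
  ... | no c∉ = coef-∉ {z = z} c∉
  ... | yes c∈ with close cs cl
  ... | z' , cs' , closed = begin
   coef z c
   ≡⟨ sym (trans (cong (coef z c xor_) (coef-inside {z = z'} (inside-∩ cs') out)) (Bool.xor-identityʳ _)) ⟩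
    coef z c xor coef z' c
   ≡⟨ sym (coef-++ z z' c) ⟩
    coef (z ++ z') c
   ≡⟨ Sphere.same S {z ++ z'} (cycsIn-mono (λ x∈ → proj₁ (∈-remove⁻ T t x∈)) all) closed
    (proj₁ (All.lookup cs c∈)) (λ x∈ → proj₁ (∈-remove⁻ T t (proj₂ (All.lookup cs c∈) x∈)))
    (proj₁ (proj₂ covered)) (proj₁ (proj₂ (proj₂ covered))) ⟩
    coef (z ++ z') (proj₁ covered)
   ≡⟨ coef-∉ {z = z ++ z'} (λ d∈ → proj₂ (∈-remove⁻ T t (proj₂ (All.lookup all d∈) (proj₂ (proj₂ (proj₂ covered))))) refl) ⟩
    false ∎
   where
   open ≡-Reasoning
   S : Sphere T
   S = solid⇒sphere solid
   all : CycsIn (T Subset.- t) (z ++ z')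
   all = All.++⁺ cs (cycsIn-∩ cs')
   covered : ∃[ d ] Cyc d × d ⊆ T × t ∊ d
   covered = Sphere.cover S t∈

  outside-face : ∀ {T} → Solid T → Outside T → ∃[ d ] Cyc d × d ⊆ T × Outside d
  outside-face solid out with outside-vertex out
  ... | t , t∈ , t∉ with Sphere.cover (solid⇒sphere solid) t∈
  ... | d , cd , d⊆ , t∈d = d , cd , d⊆ , λ d⊆B → t∉ (d⊆B t∈d)

relation-count : ∀ {A B : Set} (R : A → B → Set) {xs : List A} {ys : List B} → Unique xs →
 (∀ {x} → x ∈ xs → ∃[ y ] y ∈ ys × R x y) →
 (∀ {x x' y} → x ∈ xs → x' ∈ xs → R x y → R x' y → x ≡ x') → length xs ≤ length ys
relation-count R {[]} _ total functional = z≤n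
relation-count R {x ∷ xs} (x∉ ∷ u) total functional with total 1st
... | y , y∈ , xy with ∈-∃++ y∈
... | as , bs , refl = ℕ.≤-trans (s≤s (relation-count R {xs} {as ++ bs} u rest λ x∈ x'∈ → functional (there x∈) (there x'∈)))
 (ℕ.≤-reflexive (sym (trans (List.length-++ as) (trans (ℕ.+-suc (length as) _) (cong suc (sym (List.length-++ as)))))))
 where
 rest : ∀ {x'} → x' ∈ xs → ∃[ y' ] y' ∈ as ++ bs × R x' y'
 rest {x'} x'∈ with total (there x'∈)
 ... | y' , y'∈ , r with ∈-++⁻ as y'∈
 ... | inj₁ ∈as = y' , ∈-++⁺ˡ ∈as , r
 ... | inj₂ (there ∈bs) = y' , ∈-++⁺ʳ as ∈bs , r
 ... | inj₂ 1st = contradiction (functional 1st (there x'∈) xy r) (All.lookup x∉ x'∈)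

record Enumeration (A : Set) : Set where
 field
  elements : List A
  complete : ∀ x → x ∈ elements
  unique : Unique elements

open Enumeration {{...}}

instance
 enumerate-Fin : ∀ {n} → Enumeration (Fin n)
 enumerate-Fin {n} = record { elements = allFin n ; complete = ∈-allFin ; unique = Unique.allFin⁺ n }

 enumerate-Subset : ∀ {n} → Enumeration (Subset n)
 enumerate-Subset {n} = record { elements = subsets n ; complete = ∈-subsets ; unique = subsets-unique n }

 enumerate-× : ∀ {A B} {{_ : Enumeration A}} {{_ : Enumeration B}} → Enumeration (A × B)
 enumerate-× = record
  { elements = cartesianProduct elements elements
  ; complete = λ (x , y) → ∈-cartesianProduct⁺ (complete x) (complete y)
  ; unique = Unique.cartesianProduct⁺ unique unique }

count≡ : ∀ {A B : Set} (R : A → B → Set) {xs : List A} {ys : List B} → Unique xs → Unique ys →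
 (∀ {x} → x ∈ xs → ∃[ y ] y ∈ ys × R x y) → (∀ {y} → y ∈ ys → ∃[ x ] x ∈ xs × R x y) →
 (∀ {x x' y} → x ∈ xs → x' ∈ xs → R x y → R x' y → x ≡ x') →
 (∀ {x y y'} → y ∈ ys → y' ∈ ys → R x y → R x y' → y ≡ y') → length xs ≡ length ys
count≡ R u u' total total' functional functional' = ℕ.≤-antisym
 (relation-count R u total functional) (relation-count (λ y x → R x y) u' total' functional')

module _ {A : Set} {{_ : Enumeration A}} where

 opaque
  listing : {P : A → Set} → (∀ x → Dec (P x)) → List A
  listing P? = filter P? elements

  listing≡ : ∀ {P : A → Set} (P? : ∀ x → Dec (P x)) → filter P? elements ≡ listing P?
  listing≡ P? = refl

  listed⁺ : ∀ {P : A → Set} {P? : ∀ x → Dec (P x)} {x} → P x → x ∈ listing P?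
  listed⁺ {P? = P?} p = ∈-filter⁺ P? (complete _) p

  listed⁻ : ∀ {P : A → Set} {P? : ∀ x → Dec (P x)} {x} → x ∈ listing P? → P x
  listed⁻ {P? = P?} x∈ = proj₂ (∈-filter⁻ P? {xs = elements} x∈)

  listing-unique : ∀ {P : A → Set} {P? : ∀ x → Dec (P x)} → Unique (listing P?)
  listing-unique {P? = P?} = Unique.filter⁺ P? unique

  listing-split : ∀ {P Q : A → Set} (P? : ∀ x → Dec (P x)) (Q? : ∀ x → Dec (Q x)) →
   length (listing P?) ≡ length (listing λ x → P? x ×-dec ¬? (Q? x)) + length (listing λ x → P? x ×-dec Q? x)
  listing-split P? Q? = go elements
   where
   go : ∀ xs → length (filter P? xs) ≡ length (filter (λ x → P? x ×-dec ¬? (Q? x)) xs) + length (filter (λ x → P? x ×-dec Q? x) xs)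
   go [] = refl
   go (x ∷ xs) with does (P? x) | does (Q? x)
   ... | false | _ = go xs
   ... | true | false = cong suc (go xs)
   ... | true | true = trans (cong suc (go xs)) (sym (ℕ.+-suc _ _))

 listing-≐ : ∀ {P Q : A → Set} {P? : ∀ x → Dec (P x)} {Q? : ∀ x → Dec (Q x)} →
  (∀ {x} → P x → Q x) → (∀ {x} → Q x → P x) → length (listing P?) ≡ length (listing Q?)
 listing-≐ to from = count≡ _≡_ listing-unique listing-unique
  (λ {x} x∈ → x , listed⁺ (to (listed⁻ x∈)) , refl) (λ {x} x∈ → x , listed⁺ (from (listed⁻ x∈)) , refl)
  (λ _ _ e e' → trans e (sym e')) (λ _ _ e e' → trans (sym e) e')

opaque
 unfolding listing

 card : ∀ {n} (S : Subset n) → length (listing (Subset._∈? S)) ≡ ∣ S ∣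
 card S = go S (Subset._∈? S) id λ x → bool-ext (λ e → ∈⇒mem (does-true (x Subset.∈? S) e)) (λ e → dec-true (x Subset.∈? S) (mem⇒∈ e))
  where
  go : ∀ {k} {A : Set} {P : A → Set} (S : Subset k) (P? : ∀ x → Dec (P x)) (f : Fin k → A) →
   (∀ x → does (P? (f x)) ≡ mem S x) → length (filter P? (Data.List.tabulate f)) ≡ ∣ S ∣
  go [] P? f eq = refl
  go (true ∷ S) P? f eq with does (P? (f zero)) | eq zero
  ... | true | _ = cong suc (go S P? (f ∘ suc) (eq ∘ suc))
  go (false ∷ S) P? f eq with does (P? (f zero)) | eq zero
  ... | false | _ = go S P? (f ∘ suc) (eq ∘ suc)

length-subsets : ∀ k → length (subsets k) ≡ 2 ℕ.^ k
length-subsets zero = refl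
length-subsets (suc k) = trans (List.length-++ (map (inside ∷_) (subsets k)))
 (cong₂ ℕ._+_ (trans (List.length-map _ (subsets k)) (length-subsets k))
  (trans (List.length-map _ (subsets k)) (trans (length-subsets k) (sym (ℕ.+-identityʳ _)))))

injective⇒≤ : ∀ {k l} (f : Subset k → Subset l) → (∀ {u v} → f u ≡ f v → u ≡ v) → k ≤ l
injective⇒≤ {k} {l} f inj = ℕ.≮⇒≥ λ l<k → ℕ.≤⇒≯
 (subst (_≤ 2 ℕ.^ l) (length-subsets k) (subst (length (subsets k) ≤_) (length-subsets l)
  (relation-count (λ u v → v ≡ f u) (subsets-unique k) (λ {u} _ → f u , ∈-subsets (f u) , refl)
   λ _ _ e e' → inj (trans (sym e) e'))))
 (ℕ.^-monoʳ-< 2 (s≤s (s≤s z≤n)) l<k)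

injective₃⇒≤ : ∀ {a b c a' b' c'} (f : Subset a → Subset b → Subset a') (g : Subset b → Subset b')
 (h : Subset b → Subset c → Subset c') →
 (∀ {s t u s' t' u'} → f s t ≡ f s' t' → g t ≡ g t' → h t u ≡ h t' u' → s ≡ s' × t ≡ t' × u ≡ u') →
 a + (b + c) ≤ a' + (b' + c')
injective₃⇒≤ {a} {b} {c} {a'} {b'} {c'} f g h inj = injective⇒≤ F F-inj
 where
 F : Subset (a + (b + c)) → Subset (a' + (b' + c'))
 F v with Vec.splitAt a v
 ... | s , v' , _ with Vec.splitAt b v'
 ... | t , u , _ = f s t Vec.++ (g t Vec.++ h t u)
 F-inj : ∀ {v w} → F v ≡ F w → v ≡ w
 F-inj {v} {w} eq with Vec.splitAt a v | Vec.splitAt a w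
 ... | s , v' , refl | s' , w' , refl with Vec.splitAt b v' | Vec.splitAt b w'
 ... | t , u , refl | t' , u' , refl with Vec.++-injective (f s t) (f s' t') eq
 ... | e₁ , eq' with Vec.++-injective (g t) (g t') eq'
 ... | e₂ , e₃ with inj e₁ e₂ e₃
 ... | refl , refl , refl = refl

-- A bit vector indexed by the entries of a list, as a function on all of A, and back.
module Coordinates {A : Set} (_≟_ : DecidableEquality A) where

 val : (L : List A) → Subset (length L) → A → Bool
 val [] [] x = false
 val (y ∷ L) (b ∷ v) x with y ≟ x
 ... | yes _ = b
 ... | no _ = val L v x

 coords : (L : List A) → (A → Bool) → Subset (length L)
 coords [] p = []
 coords (x ∷ L) p = p x ∷ coords L p

 coords-injective : ∀ {p p'} L → coords L p ≡ coords L p' → ∀ {x} → x ∈ L → p x ≡ p' x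
 coords-injective (x ∷ L) eq 1st = Vec.∷-injectiveˡ eq
 coords-injective (x ∷ L) eq (there x∈) = coords-injective L (Vec.∷-injectiveʳ eq) x∈

 val-∉ : ∀ L v {x} → x ∉ L → val L v x ≡ false
 val-∉ [] [] x∉ = refl
 val-∉ (y ∷ L) (b ∷ v) {x} x∉ with y ≟ x
 ... | yes refl = contradiction 1st x∉
 ... | no _ = val-∉ L v (x∉ ∘ there)

 val-injective : ∀ {L} → Unique L → ∀ v v' → (∀ {x} → x ∈ L → val L v x ≡ val L v' x) → v ≡ v'
 val-injective {[]} _ [] [] eq = refl
 val-injective {y ∷ L} (y∉ ∷ u) (b ∷ v) (b' ∷ v') eq = cong₂ _∷_ first (val-injective u v v' λ x∈ → rest x∈ (eq (there x∈)))
  where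
  first : b ≡ b'
  first with y ≟ y | eq 1st
  ... | yes _ | e = e
  ... | no y≢y | _ = contradiction refl y≢y
  rest : ∀ {x} → x ∈ L → val (y ∷ L) (b ∷ v) x ≡ val (y ∷ L) (b' ∷ v') x → val L v x ≡ val L v' x
  rest {x} x∈ e with y ≟ x
  ... | yes refl = contradiction refl (All.lookup y∉ x∈)
  ... | no _ = e

module _ {k : ℕ} where

 open Coordinates (_≟ₛ_ {k}) public

 chain : (L : List (Subset k)) → Subset (length L) → List (Subset k)
 chain L v = filter (λ c → val L v c Bool.≟ true) (subsets k)

 coef-chain : ∀ L v c → coef (chain L v) c ≡ val L v c
 coef-chain L v c = trans (coef-filter-subsets (λ c → val L v c Bool.≟ true) c) (bool-ext (does-true (_ Bool.≟ true)) (dec-true (_ Bool.≟ true)))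

 chain⊆ : ∀ L v {c} → c ∈ chain L v → c ∈ L
 chain⊆ L v {c} c∈ with DecMembership._∈?_ _≟ₛ_ c L
 ... | yes c∈L = c∈L
 ... | no c∉ = case trans (sym (val-∉ L v c∉)) (proj₂ (∈-filter⁻ (λ c → val L v c Bool.≟ true) {xs = subsets k} c∈)) of λ ()

 chain-injective : ∀ {L} → Unique L → ∀ v v' → (∀ {c} → c ∈ L → coef (chain L v) c ≡ coef (chain L v') c) → v ≡ v'
 chain-injective {L} u v v' eq = val-injective u v v' λ {c} c∈ → trans (sym (coef-chain L v c)) (trans (eq c∈) (coef-chain L v' c))

∈-tabulate⁺ : ∀ {n} (f : Fin n → Bool) {x} → f x ≡ true → x ∊ Vec.tabulate f
∈-tabulate⁺ f {x} e = mem⇒∈ (trans (Vec.lookup∘tabulate f x) e)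

∈-tabulate⁻ : ∀ {n} (f : Fin n → Bool) {x} → x ∊ Vec.tabulate f → f x ≡ true
∈-tabulate⁻ f {x} x∈ = trans (sym (Vec.lookup∘tabulate f x)) (∈⇒mem x∈)

module _ {n m} (q : Fin n → Fin m) (U : Subset n) where

 ∈-image⁺ : ∀ {x} → x ∊ U → q x ∊ image q U
 ∈-image⁺ {x} x∈ = ∈-tabulate⁺ _ (dec-true (Fin.any? _) (x , x∈ , refl))

 ∈-image⁻ : ∀ {a} → a ∊ image q U → ∃[ x ] x ∊ U × q x ≡ a
 ∈-image⁻ a∈ = does-true (Fin.any? λ x → (x Subset.∈? U) ×-dec (q x ≟ _)) (∈-tabulate⁻ _ a∈)

module _ {n} (G : Graph n) {w : Fin n} where

 ∈-nbhd⁺ : ∀ {x} → x ≡ w ⊎ Graph.Adj G w x → x ∊ closedNeighbourhood G w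
 ∈-nbhd⁺ {x} p = ∈-tabulate⁺ _ (dec-true ((x ≟ w) ⊎-dec Graph.adj? G w x) p)

 ∈-nbhd⁻ : ∀ {x} → x ∊ closedNeighbourhood G w → x ≡ w ⊎ Graph.Adj G w x
 ∈-nbhd⁻ {x} x∈ = does-true ((x ≟ w) ⊎-dec Graph.adj? G w x) (∈-tabulate⁻ _ x∈)

open GraphTheory public

-- A vertex map that identifies only neighbours of w and makes them a clique.
record Fold {n m} (G : Graph n) (H : Graph m) (w : Fin n) (q : Fin n → Fin m) : Set where
 field
  adj⁺ : ∀ {x y} → Adj G x y → Adj H (q x) (q y)
  adj⁻ : ∀ {a b} → Adj H a b → ∃[ x ] ∃[ y ] q x ≡ a × q y ≡ b × Adj G x y
  fibre : ∀ {x y} → q x ≡ q y → x ≡ y ⊎ (Adj G w x × Adj G w y)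
  clique : ∀ {x y} → Adj G w x → Adj G w y → q x ≢ q y → Adj H (q x) (q y)

 B : Subset n
 B = closedNeighbourhood G w

 W : Subset m
 W = closedNeighbourhood H (q w)

 fibre-w : ∀ {x} → q x ≡ q w → x ≡ w
 fibre-w eq with fibre eq
 ... | inj₁ x≡w = x≡w
 ... | inj₂ (_ , ww) = contradiction refl (Adj⇒≢ G ww)

 B⇒W : ∀ {x} → x ∊ B → q x ∊ W
 B⇒W x∈ with ∈-nbhd⁻ G x∈
 ... | inj₁ refl = ∈-nbhd⁺ H (inj₁ refl)
 ... | inj₂ wx = ∈-nbhd⁺ H (inj₂ (adj⁺ wx))

 W⇒B : ∀ {x} → q x ∊ W → x ∊ B
 W⇒B {x} x∈ with ∈-nbhd⁻ H x∈
 ... | inj₁ eq = ∈-nbhd⁺ G (inj₁ (fibre-w eq))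
 ... | inj₂ a with adj⁻ a
 ... | u , v , qu , qv , uv with fibre-w qu | fibre qv
 ... | refl | inj₁ refl = ∈-nbhd⁺ G (inj₂ uv)
 ... | refl | inj₂ (_ , wx) = ∈-nbhd⁺ G (inj₂ wx)

 W-lift : ∀ {a} → a ∊ W → ∃[ x ] x ∊ B × q x ≡ a
 W-lift a∈ with ∈-nbhd⁻ H a∈
 ... | inj₁ refl = w , ∈-nbhd⁺ G (inj₁ refl) , refl
 ... | inj₂ a with adj⁻ a
 ... | u , v , qu , refl , uv with fibre-w qu
 ... | refl = v , ∈-nbhd⁺ G (inj₂ uv) , refl

 W-clique : ∀ {a b} → a ∊ W → b ∊ W → a ≢ b → Adj H a b
 W-clique a∈ b∈ a≢b with W-lift a∈ | W-lift b∈
 ... | x , x∈ , refl | y , y∈ , refl with ∈-nbhd⁻ G x∈ | ∈-nbhd⁻ G y∈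
 ... | inj₁ refl | inj₁ refl = contradiction refl a≢b
 ... | inj₁ refl | inj₂ wy = adj⁺ wy
 ... | inj₂ wx | inj₁ refl = Adj-sym H (adj⁺ wx)
 ... | inj₂ wx | inj₂ wy = clique wx wy a≢b

 injective : ∀ {x y} → x ∉ₛ B → q x ≡ q y → x ≡ y
 injective x∉ eq with fibre eq
 ... | inj₁ x≡y = x≡y
 ... | inj₂ (wx , _) = contradiction (∈-nbhd⁺ G (inj₂ wx)) x∉

module Transfer {n m : ℕ} {G : Graph n} {H : Graph m} {w : Fin n} {q : Fin n → Fin m} (F : Fold G H w q) where

 open Fold F public

 RelG : Fin n → Fin n → Set
 RelG = RelAdj G B

 RelH : Fin m → Fin m → Set
 RelH = RelAdj H W

 ρ : Fin m → Fin n → Fin n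
 ρ a y with Fin.any? (λ x → (q x ≟ a) ×-dec adj? G x y)
 ... | yes (x , _) = x
 ... | no _ = y

 ρ-spec : ∀ {a x y} → q x ≡ a → Adj G x y → q (ρ a y) ≡ a × Adj G (ρ a y) y
 ρ-spec {a} {x} {y} eq xy with Fin.any? (λ x → (q x ≟ a) ×-dec adj? G x y)
 ... | yes (_ , p) = p
 ... | no none = contradiction (x , eq , xy) none

 -- Of the edges with the same image, exactly one is kept.
 Kept : Fin n → Fin n → Set
 Kept x y = RelG x y × ρ (q x) y ≡ x × ρ (q y) x ≡ y

 opaque
  kept? : ∀ x y → Dec (Kept x y)
  kept? x y = relAdj? G B x y ×-dec (ρ (q x) y ≟ x) ×-dec (ρ (q y) x ≟ y)

 kept-sym : ∀ {x y} → Kept x y → Kept y x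
 kept-sym ((a , out) , e , e') = (Adj-sym G a , λ (y∈ , x∈) → out (x∈ , y∈)) , e' , e

 record Lift (a b : Fin m) : Set where
  field
   {x y} : Fin n
   qx : q x ≡ a
   qy : q y ≡ b
   kept : Kept x y
   only : ∀ {x' y'} → q x' ≡ a → q y' ≡ b → Kept x' y' → x' ≡ x × y' ≡ y

 lift-edge : ∀ {a b} → RelH a b → Lift a b
 lift-edge {a} {b} (ab , out) with b Subset.∈? W
 ... | no b∉ = one (adj⁻ ab) b∉
  where
  one : ∀ {a b} → ∃[ x ] ∃[ y ] q x ≡ a × q y ≡ b × Adj G x y → b ∉ₛ W → Lift a b
  one {a} {b} (x , y , qx , refl , xy) b∉ = record
   { qx = proj₁ spec ; qy = refl
   ; kept = (proj₂ spec , λ (_ , y∈) → y∉ y∈) , cong (λ a → ρ a y) (proj₁ spec)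
    , sym (injective y∉ (sym (proj₁ (ρ-spec refl (Adj-sym G (proj₂ spec))))))
   ; only = λ { qx' qy' (_ , e , _) → let y≡ = sym (injective y∉ (sym qy')) in
    trans (sym e) (cong₂ ρ qx' y≡) , y≡ } }
   where
   y∉ : y ∉ₛ B
   y∉ y∈ = b∉ (B⇒W y∈)
   spec : q (ρ a y) ≡ a × Adj G (ρ a y) y
   spec = ρ-spec qx xy
 ... | yes b∈ with adj⁻ ab
 ... | x , y , refl , qy , xy = record
  { qx = refl ; qy = proj₁ spec
  ; kept = (Adj-sym G (proj₂ spec) , λ (x∈ , _) → x∉ x∈)
   , sym (injective x∉ (sym (proj₁ (ρ-spec refl (Adj-sym G (proj₂ spec))))))
   , cong (λ a → ρ a x) (proj₁ spec)
  ; only = λ { qx' qy' (_ , _ , e) → let x≡ = sym (injective x∉ (sym qx')) in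
   x≡ , trans (sym e) (cong₂ ρ qy' x≡) } }
  where
  x∉ : x ∉ₛ B
  x∉ x∈ = out (B⇒W x∈ , b∈)
  spec : q (ρ b x) ≡ b × Adj G (ρ b x) x
  spec = ρ-spec qy (Adj-sym G xy)

 lift : (Fin m → Fin m → Bool) → Fin n → Fin n → Bool
 lift η x y = does (kept? x y) ∧ η (q x) (q y)

 lift-true : ∀ η {x y} → lift η x y ≡ true → Kept x y × η (q x) (q y) ≡ true
 lift-true η {x} {y} e = let k , e' = ∧-true {does (kept? x y)} e in does-true (kept? x y) k , e'

 lift-sym : ∀ {η} → (∀ a b → η a b ≡ η b a) → ∀ x y → lift η x y ≡ lift η y x
 lift-sym {η} symm x y = cong₂ _∧_
  (bool-ext (λ e → dec-true (kept? y x) (kept-sym (does-true (kept? x y) e)))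
   (λ e → dec-true (kept? x y) (kept-sym (does-true (kept? y x) e))))
  (symm (q x) (q y))

 push : (Fin n → Fin n → Bool) → Fin m → Fin m → Bool
 push ε a b = par (λ x → par (λ y → (does (a ≟ q x) ∧ does (b ≟ q y)) ∧ ε x y) (allFin n)) (allFin n)

 push-cong : ∀ {ε ε' a b} → (∀ x y → q x ≡ a → q y ≡ b → ε x y ≡ ε' x y) → push ε a b ≡ push ε' a b
 push-cong {ε} {ε'} {a} {b} eq = par-cong (allFin n) λ {x} _ → par-cong (allFin n) λ {y} _ → at x y
  where
  at : ∀ x y → (does (a ≟ q x) ∧ does (b ≟ q y)) ∧ ε x y ≡ (does (a ≟ q x) ∧ does (b ≟ q y)) ∧ ε' x y
  at x y with a ≟ q x | b ≟ q y
  ... | yes refl | yes refl = eq x y refl refl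
  ... | yes _ | no _ = refl
  ... | no _ | _ = refl

 push-xor : ∀ ε ε' a b → push (λ x y → ε x y xor ε' x y) a b ≡ push ε a b xor push ε' a b
 push-xor ε ε' a b = trans
  (par-cong (allFin n) λ {x} _ → trans (par-cong (allFin n) λ {y} _ → Bool.∧-distribˡ-xor (p x y) (ε x y) (ε' x y))
   (par-xor (λ y → p x y ∧ ε x y) (λ y → p x y ∧ ε' x y) (allFin n)))
  (par-xor (λ x → par (λ y → p x y ∧ ε x y) (allFin n)) (λ x → par (λ y → p x y ∧ ε' x y) (allFin n)) (allFin n))
  where
  p : Fin n → Fin n → Bool
  p x y = does (a ≟ q x) ∧ does (b ≟ q y)

 push-sym : ∀ {ε} → (∀ x y → ε x y ≡ ε y x) → ∀ a b → push ε a b ≡ push ε b a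
 push-sym {ε} symm a b = trans
  (par-swap (λ x y → (does (a ≟ q x) ∧ does (b ≟ q y)) ∧ ε x y) (allFin n) (allFin n))
  (par-cong (allFin n) λ {y} _ → par-cong (allFin n) λ {x} _ →
   cong₂ _∧_ (Bool.∧-comm (does (a ≟ q x)) (does (b ≟ q y))) (symm x y))

 push-true : ∀ ε {a b} → push ε a b ≡ true → ∃[ x ] ∃[ y ] q x ≡ a × q y ≡ b × ε x y ≡ true
 push-true ε {a} {b} e with par-true⇒∃ (allFin n) e
 ... | x , _ , e₁ with par-true⇒∃ (allFin n) e₁
 ... | y , _ , e₂ with ∧-true {does (a ≟ q x) ∧ does (b ≟ q y)} e₂
 ... | e₃ , e₄ with ∧-true {does (a ≟ q x)} e₃
 ... | e₅ , e₆ = x , y , sym (does-true (a ≟ q x) e₅) , sym (does-true (b ≟ q y) e₆) , e₄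

 push-degree : ∀ ε a → par (push ε a) (allFin m) ≡ par (λ x → does (a ≟ q x) ∧ par (ε x) (allFin n)) (allFin n)
 push-degree ε a = trans (par-swap (λ b x → par (f b x) (allFin n)) (allFin m) (allFin n))
  (par-cong (allFin n) λ {x} _ → trans (par-swap (λ b y → f b x y) (allFin m) (allFin n))
   (trans (par-cong (allFin n) λ {y} _ → at x y) (par-∧ (does (a ≟ q x)) (ε x) (allFin n))))
  where
  f : Fin m → Fin n → Fin n → Bool
  f b x y = (does (a ≟ q x) ∧ does (b ≟ q y)) ∧ ε x y
  at : ∀ x y → par (λ b → f b x y) (allFin m) ≡ does (a ≟ q x) ∧ ε x y
  at x y with does (a ≟ q x)
  ... | false = par-const-false (allFin m)
  ... | true = par-δ-fin H (λ _ → ε x y) (q y)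

 push-lift : ∀ η {a b} → RelH a b → push (lift η) a b ≡ η a b
 push-lift η {a} {b} r = trans
  (par-cong (allFin n) λ {x} _ → trans (par-cong (allFin n) λ {y} _ → at x y)
   (trans (par-∧ (does (x ≟ L.x)) (λ y → does (y ≟ L.y) ∧ η a b) (allFin n))
    (cong (does (x ≟ L.x) ∧_) (par-δ-fin G (λ _ → η a b) L.y))))
  (par-δ-fin G (λ _ → η a b) L.x)
  where
  module L = Lift (lift-edge r)
  at : ∀ x y → (does (a ≟ q x) ∧ does (b ≟ q y)) ∧ lift η x y ≡ does (x ≟ L.x) ∧ (does (y ≟ L.y) ∧ η a b)
  at x y with a ≟ q x | b ≟ q y | kept? x y | x ≟ L.x | y ≟ L.y
  ... | yes e | yes e' | yes _ | yes _ | yes _ = cong₂ η (sym e) (sym e')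
  ... | yes e | yes e' | yes k | no x≢ | _ = contradiction (proj₁ (L.only (sym e) (sym e') k)) x≢
  ... | yes e | yes e' | yes k | yes _ | no y≢ = contradiction (proj₂ (L.only (sym e) (sym e') k)) y≢
  ... | no a≢ | _ | _ | yes e | yes _ = contradiction (trans (sym L.qx) (cong q (sym e))) a≢
  ... | yes _ | no b≢ | _ | yes _ | yes e = contradiction (trans (sym L.qy) (cong q (sym e))) b≢
  ... | yes _ | yes _ | no ¬k | yes refl | yes refl = contradiction L.kept ¬k
  ... | no _ | _ | _ | no _ | _ = refl
  ... | no _ | _ | _ | yes _ | no _ = refl
  ... | yes _ | no _ | _ | no _ | _ = refl
  ... | yes _ | no _ | _ | yes _ | no _ = refl
  ... | yes _ | yes _ | no _ | no _ | _ = refl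
  ... | yes _ | yes _ | no _ | yes _ | no _ = refl

 push-even : ∀ {U ε} → EvenSet G U ε → EvenSet H (image q U) (push ε)
 push-even {U} {ε} E = record
  { symm = push-sym (EvenSet.symm E)
  ; supp = supp
  ; even = λ a → trans (push-degree ε a) (par-false (allFin n) λ {x} _ →
   trans (cong (does (a ≟ q x) ∧_) (EvenSet.even E x)) (Bool.∧-zeroʳ _)) }
  where
  supp : ∀ {a b} → push ε a b ≡ true → Adj H a b × a ∊ image q U
  supp {a} {b} e with push-true ε {a} {b} e
  ... | x , y , refl , refl , e' = adj⁺ (proj₁ (EvenSet.supp E e')) , ∈-image⁺ q U (proj₂ (EvenSet.supp E e'))

 lift-degree : ∀ {η} → (∀ {a b} → η a b ≡ true → Adj H a b) → ∀ {x} → x ∉ₛ B →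
  par (lift η x) (allFin n) ≡ par (η (q x)) (allFin m)
 lift-degree {η} supp {x} x∉ = sym (begin
  par (η (q x)) (allFin m)
  ≡⟨ par-cong (allFin m) (λ {b} _ → at b) ⟩
   par (push (lift η) (q x)) (allFin m)
  ≡⟨ push-degree (lift η) (q x) ⟩
   par (λ x' → does (q x ≟ q x') ∧ par (lift η x') (allFin n)) (allFin n)
  ≡⟨ par-cong (allFin n) (λ {x'} _ → cong (_∧ par (lift η x') (allFin n))
   (bool-ext (λ e → dec-true (x' ≟ x) (sym (injective x∉ (does-true (q x ≟ q x') e))))
    (λ e → dec-true (q x ≟ q x') (cong q (sym (does-true (x' ≟ x) e)))))) ⟩
   par (λ x' → does (x' ≟ x) ∧ par (lift η x') (allFin n)) (allFin n)
  ≡⟨ par-δ-fin G (λ x' → par (lift η x') (allFin n)) x ⟩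
   par (lift η x) (allFin n) ∎)
  where
  open ≡-Reasoning
  at : ∀ b → η (q x) b ≡ push (lift η) (q x) b
  at b with adj? H (q x) b
  ... | yes a = sym (push-lift η (a , λ (x∈ , _) → x∉ (W⇒B x∈)))
  ... | no ¬a = bool-ext (λ e → contradiction (supp e) ¬a) λ e →
   case push-true (lift η) {q x} {b} e of λ { (x' , y' , e₁ , e₂ , e₃) →
    contradiction (supp (trans (sym (cong₂ η e₁ e₂)) (proj₂ (lift-true η {x'} {y'} e₃)))) ¬a }

rel-fill : ∀ {n} (G : Graph n) (w : Fin n) {U : Subset n} (ε : Fin n → Fin n → Bool) →
 (∀ x y → ε x y ≡ ε y x) →
 (∀ {x y} → ε x y ≡ true → RelAdj G (closedNeighbourhood G w) x y × x ∊ U) → w ∊ U →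
 (∀ {x} → x ∉ₛ closedNeighbourhood G w → par (ε x) (allFin n) ≡ false) →
 ∃[ z ] CycsIn G U z × (∀ {x y} → RelAdj G (closedNeighbourhood G w) x y → ∂ G z x y ≡ ε x y)
rel-fill {n} G w {U} ε symm supp w∈ even = proj₁ filling , proj₁ (proj₂ filling) , λ {x} {y} r →
 trans (proj₂ (proj₂ filling) x y (proj₁ r)) (trans (cong (ε x y xor_) (no-spoke r)) (Bool.xor-identityʳ _))
 where
 off-w : ∀ y → ε w y ≡ false
 off-w y = bool-ext (λ e → let (a , out) , _ = supp e in contradiction (∈-nbhd⁺ G (inj₁ refl) , ∈-nbhd⁺ G (inj₂ a)) out) λ ()
 supp' : ∀ {x y} → ε x y ≡ true → Adj G x y × x ∊ U
 supp' e = let (a , _) , x∈ = supp e in a , x∈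
 even' : ∀ {x} → x ≢ w → ¬ Adj G w x → par (ε x) (allFin n) ≡ false
 even' x≢w ¬wx = even λ x∈ → [ x≢w , ¬wx ]′ (∈-nbhd⁻ G x∈)
 open ConeFill G w w∈ ε symm supp' off-w even'
 no-spoke : ∀ {x y} → RelAdj G (closedNeighbourhood G w) x y → spoke x y ≡ false
 no-spoke {x} {y} (a , out) with x ≟ w | y ≟ w
 ... | yes refl | _ = contradiction (∈-nbhd⁺ G (inj₁ refl) , ∈-nbhd⁺ G (inj₂ a)) out
 ... | no _ | yes refl = contradiction (∈-nbhd⁺ G (inj₂ (Adj-sym G a)) , ∈-nbhd⁺ G (inj₁ refl)) out
 ... | no _ | no _ = refl

infix 4 _≈[_]_

_≈[_]_ : ∀ {k} → List (Subset k) → Subset k → List (Subset k) → Set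
z ≈[ U ] z' = ∀ {c} → ¬ c ⊆ U → coef z c ≡ coef z' c

≈[]-concatMap : ∀ {k l} (f : Subset k → List (Subset l)) {U U'} →
 (∀ {c d} → c ⊆ U → ¬ d ⊆ U' → coef (f c) d ≡ false) →
 ∀ z z' → z ≈[ U ] z' → concatMap f z ≈[ U' ] concatMap f z'
≈[]-concatMap {k} f {U} vanish z z' eq {d} out = trans (expand z) (trans (par-cong (subsets k) λ {c} _ → at c) (sym (expand z')))
 where
 expand : ∀ z → coef (concatMap f z) d ≡ par (λ c → coef z c ∧ coef (f c) d) (subsets k)
 expand z = trans (par-concatMap _ f z) (par-via-coef (λ c → coef (f c) d) z)
 at : ∀ c → coef z c ∧ coef (f c) d ≡ coef z' c ∧ coef (f c) d
 at c with c Subset.⊆? U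
 ... | yes c⊆ = trans (cong (coef z c ∧_) (vanish c⊆ out)) (trans (trans (Bool.∧-zeroʳ _) (sym (Bool.∧-zeroʳ _))) (cong (coef z' c ∧_) (sym (vanish c⊆ out))))
 ... | no ¬c⊆ = cong (_∧ coef (f c) d) (eq ¬c⊆)

module _ {k : ℕ} (z : List (Subset k)) where

 norm : List (Subset k)
 norm = filter (λ c → coef z c Bool.≟ true) (subsets k)

 norm-≈ : norm ≈ z
 norm-≈ c = trans (coef-filter-subsets (λ c → coef z c Bool.≟ true) c)
  (bool-ext (does-true (coef z c Bool.≟ true)) (dec-true (coef z c Bool.≟ true)))

 ∈-norm⁻ : ∀ {c} → c ∈ norm → coef z c ≡ true
 ∈-norm⁻ c∈ = proj₂ (∈-filter⁻ (λ c → coef z c Bool.≟ true) {xs = subsets k} c∈)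

norm-concatMap : ∀ {k l} (f : Subset k → List (Subset l)) σ z {U} → z ≈[ U ] concatMap f σ → concatMap f (norm σ) ≈[ U ] z
norm-concatMap f σ z eq {c} out = trans (≈-concatMap f {norm σ} {σ} (norm-≈ σ) c) (sym (eq out))

coef-true⇒∈ : ∀ {k} (z : List (Subset k)) {c} → coef z c ≡ true → c ∈ z
coef-true⇒∈ z {c} e with par-true⇒∃ z e
... | d , d∈ , d≡c = subst (_∈ z) (does-true (d ≟ₛ c) d≡c) d∈

∂ᵃ : ∀ {n} (G : Graph n) → List (Subset n) → Fin n → Fin n → Bool
∂ᵃ G z x y = ∂ G z x y ∧ adjᵇ G x y

∂ᵃ-∷ : ∀ {n} (G : Graph n) c z x y → ∂ᵃ G (c ∷ z) x y ≡ ∂ᵃ G (c ∷ []) x y xor ∂ᵃ G z x y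
∂ᵃ-∷ G c z x y = trans (Bool.∧-distribʳ-xor (adjᵇ G x y) (mem c x ∧ mem c y) (∂ G z x y))
 (cong (λ k → (k ∧ adjᵇ G x y) xor ∂ᵃ G z x y) (sym (Bool.xor-identityʳ (mem c x ∧ mem c y))))

∂ᵃ-adj : ∀ {n} (G : Graph n) z {x y} → Adj G x y → ∂ᵃ G z x y ≡ ∂ G z x y
∂ᵃ-adj G z {x} {y} a = trans (cong (∂ G z x y ∧_) (⇒adjᵇ G a)) (Bool.∧-identityʳ _)

cyc-∂ᵃ : ∀ {n} (G : Graph n) {c} → Cyc G c → EvenSet G c (∂ᵃ G (c ∷ []))
cyc-∂ᵃ G {c} cyc = cyc-evenSet G {c} {c ∷ []} ((cyc , λ x∈ → x∈) ∷ [])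

lonely : ∀ {n} (G : Graph n) (B : Subset n) {z d} → RelClosed G B z → Cyc G d → Outside G B d →
 (∀ {e} → e ∈ z → Outside G B e → e ≡ d) → ∀ {e} → Outside G B e → coef z e ≡ false
lonely G B {z} {d} cl cyc out only {e} out-e with e ≟ₛ d
... | no e≢d = coef-∉ {z = z} λ e∈ → e≢d (only e∈ out-e)
... | yes refl with outside-edge G B cyc out
... | x , y , x∈ , y∈ , y∉ , a = trans (sym (par-cong z λ {c} c∈ → at c c∈)) (cl x y (a , y∉ ∘ proj₂))
 where
 at : ∀ c → c ∈ z → mem c x ∧ mem c y ≡ does (c ≟ₛ e)
 at c c∈ with c ≟ₛ e
 ... | yes refl = cong₂ _∧_ (∈⇒mem x∈) (∈⇒mem y∈)
 ... | no c≢e with outside? G B c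
 ... | yes out-c = contradiction (only c∈ out-c) c≢e
 ... | no in-c = trans (cong (mem c x ∧_) (∉⇒mem λ y∈c → in-c λ c⊆ → y∉ (c⊆ y∈c))) (Bool.∧-zeroʳ _)

rel-vanish-outside : ∀ {n} (G : Graph n) (B : Subset n) {T t z} → Solid G T → t ∊ T → All (Cyc G) z → RelClosed G B z →
 (∀ {e} → e ∈ z → Outside G B e → e ⊆ T × t ∉ₛ e) → ∀ {c} → Outside G B c → coef z c ≡ false
rel-vanish-outside G B {T} {t} {z} solid t∈ cycs cl only {c} out = trans
 (sym (trans (coef-filter G (outside? G B) z c) (cong (_∧ coef z c) (dec-true (outside? G B c) out))))
 (rel-vanish G B {z = z'} solid t∈ (All.tabulate λ {e} e∈ →
  let e∈z , out-e = ∈-filter⁻ (outside? G B) {xs = z} e∈ ; e⊆ , t∉ = only e∈z out-e in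
  All.lookup cycs e∈z , λ {x} x∈ → Subset.x∈p∧x≢y⇒x∈p-y (e⊆ x∈) λ { refl → t∉ x∈ })
  (λ x y r → trans (trans (par-filter (outside? G B) _ z) (par-cong z λ {e} _ → rel e r)) (cl x y r)) out)
 where
 z' : List (Subset _)
 z' = filter (outside? G B) z
 rel : ∀ e {x y} → RelAdj G B x y → does (outside? G B e) ∧ (mem e x ∧ mem e y) ≡ mem e x ∧ mem e y
 rel e {x} {y} (_ , xy∉) = go (outside? G B e)
  where
  go : (out? : Dec (Outside G B e)) → does out? ∧ (mem e x ∧ mem e y) ≡ mem e x ∧ mem e y
  go (yes _) = refl
  go (no in-e) = bool-ext (λ ()) λ eq → let ex , ey = ∧-true eq in
   contradiction (λ e⊆ → xy∉ (e⊆ (mem⇒∈ ex) , e⊆ (mem⇒∈ ey))) in-e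

module Chains {n m : ℕ} {G : Graph n} {H : Graph m} {w : Fin n} {q : Fin n → Fin m} (F : Fold G H w q) where

 open Transfer F public

 image-mono : ∀ {U U'} → U ⊆ U' → image q U ⊆ image q U'
 image-mono {U} {U'} sub a∈ with ∈-image⁻ q U a∈
 ... | x , x∈ , refl = ∈-image⁺ q U' (sub x∈)

 image-B : image q B ⊆ W
 image-B a∈ with ∈-image⁻ q B a∈
 ... | x , x∈ , refl = B⇒W x∈

 opaque
  f₂ : Subset n → List (Subset m)
  f₂ c with cyc? G c
  ... | yes cyc = proj₁ (fill H (push-even (cyc-∂ᵃ G cyc)))
  ... | no _ = []

  f₂-in : ∀ c → CycsIn H (image q c) (f₂ c)
  f₂-in c with cyc? G c
  ... | yes cyc = proj₁ (proj₂ (fill H (push-even (cyc-∂ᵃ G cyc))))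
  ... | no _ = []

  f₂-∂ : ∀ {c} → Cyc G c → ∀ {a b} → Adj H a b → ∂ H (f₂ c) a b ≡ push (∂ᵃ G (c ∷ [])) a b
  f₂-∂ {c} cyc {a} {b} ab with cyc? G c
  ... | yes cyc = proj₂ (proj₂ (fill H (push-even (cyc-∂ᵃ G cyc)))) a b ab
  ... | no ¬cyc = contradiction cyc ¬cyc

 F₂ : List (Subset n) → List (Subset m)
 F₂ = concatMap f₂

 F₂-in : ∀ {U z} → CycsIn G U z → CycsIn H (image q U) (F₂ z)
 F₂-in [] = []
 F₂-in (_∷_ {x = c} (_ , c⊆) cs) = All.++⁺ (cycsIn-mono H (image-mono λ x∈ → c⊆ x∈) (f₂-in c)) (F₂-in cs)

 F₂-∂ : ∀ {U z} → CycsIn G U z → ∀ {a b} → Adj H a b → ∂ H (F₂ z) a b ≡ push (∂ᵃ G z) a b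
 F₂-∂ [] {a} {b} ab = sym (par-false (allFin n) λ _ → par-false (allFin n) λ _ → Bool.∧-zeroʳ _)
 F₂-∂ {z = c ∷ z} ((cyc , _) ∷ cs) {a} {b} ab = trans (∂-++ H (f₂ c) (F₂ z) a b)
  (trans (cong₂ _xor_ (f₂-∂ cyc ab) (F₂-∂ cs ab))
  (sym (trans (push-cong {a = a} {b} λ x y _ _ → ∂ᵃ-∷ G c z x y) (push-xor (∂ᵃ G (c ∷ [])) (∂ᵃ G z) a b))))

 F₂-inside : ∀ {z} → CycsIn G B z → ∀ {d} → Outside H W d → coef (F₂ z) d ≡ false
 F₂-inside cs = coef-inside H W (go (F₂-in cs))
  where
  go : ∀ {y} → CycsIn H (image q B) y → All (_⊆ W) y
  go [] = []
  go ((_ , c⊆) ∷ cs) = (λ x∈ → image-B (c⊆ x∈)) ∷ go cs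

 F₂-cong : ∀ z z' → z ≈[ B ] z' → F₂ z ≈[ W ] F₂ z'
 F₂-cong z z' = ≈[]-concatMap f₂ (λ {c} c⊆ → coef-inside H W (go (λ x∈ → c⊆ x∈) (f₂-in c))) z z'
  where
  go : ∀ {c y} → c ⊆ B → CycsIn H (image q c) y → All (_⊆ W) y
  go c⊆ [] = []
  go c⊆ ((_ , d⊆) ∷ cs) = (λ x∈ → image-B (image-mono (λ x∈ → c⊆ x∈) (d⊆ x∈))) ∷ go c⊆ cs

 up : Subset m → Subset n
 up d = Vec.tabulate λ x → mem d (q x) ∨ does (x ≟ w)

 w∈up : ∀ {d} → w ∊ up d
 w∈up {d} = ∈-tabulate⁺ _ (trans (cong (mem d (q w) ∨_) (dec-true (w ≟ w) refl)) (Bool.∨-zeroʳ _))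

 ∈-up⁺ : ∀ {d x} → q x ∊ d → x ∊ up d
 ∈-up⁺ x∈ = ∈-tabulate⁺ _ (cong (_∨ _) (∈⇒mem x∈))

 ∈-up⁻ : ∀ {d x} → x ∊ up d → q x ∊ d ⊎ x ≡ w
 ∈-up⁻ {d} {x} x∈ with mem d (q x) in e | x ≟ w | ∈-tabulate⁻ (λ x → mem d (q x) ∨ does (x ≟ w)) {x} x∈
 ... | true | _ | _ = inj₁ (mem⇒∈ e)
 ... | false | yes x≡w | _ = inj₂ x≡w
 ... | false | no _ | p = case p of λ ()

 up-mono : ∀ {d d'} → d ⊆ d' → up d ⊆ up d'
 up-mono {d} {d'} sub x∈ with ∈-up⁻ {d} x∈
 ... | inj₁ qx∈ = ∈-up⁺ (sub qx∈)
 ... | inj₂ refl = w∈up {d'}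

 up-W : ∀ {d} → d ⊆ W → up d ⊆ B
 up-W {d} d⊆ x∈ with ∈-up⁻ {d} x∈
 ... | inj₁ qx∈ = W⇒B (d⊆ qx∈)
 ... | inj₂ refl = ∈-nbhd⁺ G (inj₁ refl)

 private
  filled : ∀ {d} → Cyc H d → ∃[ z ] CycsIn G (up d) z × (∀ {x y} → RelG x y → ∂ G z x y ≡ lift (∂ᵃ H (d ∷ [])) x y)
  filled {d} cyc = rel-fill G w (lift (∂ᵃ H (d ∷ []))) (lift-sym (EvenSet.symm E))
   (λ {x} {y} e → let k , e' = lift-true (∂ᵃ H (d ∷ [])) {x} {y} e in proj₁ k , ∈-up⁺ (proj₂ (EvenSet.supp E {q x} {q y} e')))
   (w∈up {d})
   (λ x∉ → trans (lift-degree (λ {a} {b} e → proj₁ (EvenSet.supp E {a} {b} e)) x∉) (EvenSet.even E _))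
   where
   E : EvenSet H d (∂ᵃ H (d ∷ []))
   E = cyc-∂ᵃ H cyc

 opaque
  g₂ : Subset m → List (Subset n)
  g₂ d with cyc? H d
  ... | yes cyc = proj₁ (filled cyc)
  ... | no _ = []

  g₂-in : ∀ d → CycsIn G (up d) (g₂ d)
  g₂-in d with cyc? H d
  ... | yes cyc = proj₁ (proj₂ (filled cyc))
  ... | no _ = []

  g₂-∂ : ∀ {d} → Cyc H d → ∀ {x y} → RelG x y → ∂ G (g₂ d) x y ≡ lift (∂ᵃ H (d ∷ [])) x y
  g₂-∂ {d} cyc r with cyc? H d
  ... | yes cyc = proj₂ (proj₂ (filled cyc)) r
  ... | no ¬cyc = contradiction cyc ¬cyc

 G₂ : List (Subset m) → List (Subset n)
 G₂ = concatMap g₂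

 G₂-in : ∀ {U z} → CycsIn H U z → CycsIn G (up U) (G₂ z)
 G₂-in [] = []
 G₂-in (_∷_ {x = d} (_ , d⊆) cs) = All.++⁺ (cycsIn-mono G (up-mono λ x∈ → d⊆ x∈) (g₂-in d)) (G₂-in cs)

 G₂-∂ : ∀ {U z} → CycsIn H U z → ∀ {x y} → RelG x y → ∂ G (G₂ z) x y ≡ lift (∂ᵃ H z) x y
 G₂-∂ [] {x} {y} r = sym (Bool.∧-zeroʳ _)
 G₂-∂ {z = d ∷ z} ((cyc , _) ∷ cs) {x} {y} r = trans (∂-++ G (g₂ d) (G₂ z) x y)
  (trans (cong₂ _xor_ (g₂-∂ cyc r) (G₂-∂ cs r))
  (trans (sym (Bool.∧-distribˡ-xor (does (kept? x y)) _ _)) (cong (does (kept? x y) ∧_) (sym (∂ᵃ-∷ H d z (q x) (q y))))))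

 apex-∉ : ∀ {c} → Cyc H c → Outside H W c → q w ∉ₛ c
 apex-∉ {c} cyc out qw∈ = out sub
  where
  open Two (cyc-two H cyc qw∈) renaming (u to s; w to t; u∈ to s∈; w∈ to t∈)
  in-W : ∀ {x} → x ∈ q w ∷ s ∷ t ∷ [] → x ∊ W
  in-W 1st = ∈-nbhd⁺ H (inj₁ refl)
  in-W 2nd = ∈-nbhd⁺ H (inj₂ xu)
  in-W 3rd = ∈-nbhd⁺ H (inj₂ xw)
  sub : c ⊆ W
  sub x∈ = in-W (cyc-triangle H cyc qw∈ s∈ t∈ xu xw (W-clique (in-W 2nd) (in-W 3rd) u≢w) x∈)

 outside-⊆ : ∀ {e U} → Cyc H e → Outside H W e → e ⊆ image q (up U) → e ⊆ U
 outside-⊆ {e} {U} cyc out e⊆ x∈ with ∈-image⁻ q (up U) (e⊆ x∈)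
 ... | y , y∈ , refl with ∈-up⁻ {U} y∈
 ... | inj₁ qy∈ = qy∈
 ... | inj₂ refl = contradiction x∈ (apex-∉ cyc out)

 f₂g₂ : ∀ {d} → Cyc H d → Outside H W d → F₂ (g₂ d) ≈[ W ] d ∷ []
 f₂g₂ {d} cyc out {e} out-e = sym (trans (Bool.xor-identityʳ (does (d ≟ₛ e)))
  (xor≡false⇒≡ (lonely H W {d ∷ F₂ (g₂ d)} closed cyc out only out-e)))
  where
  open ≡-Reasoning
  only : ∀ {e} → e ∈ d ∷ F₂ (g₂ d) → Outside H W e → e ≡ d
  only (here eq) _ = eq
  only (there e∈) oe = let ce , e⊆ = All.lookup (F₂-in (g₂-in d)) e∈ in
   cyc-antichain H cyc ce (outside-⊆ ce oe (λ x∈ → e⊆ x∈))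
  agree : ∀ {a b} → RelH a b → ∀ x y → q x ≡ a → q y ≡ b → ∂ᵃ G (g₂ d) x y ≡ lift (∂ᵃ H (d ∷ [])) x y
  agree (_ , ab∉) x y refl refl with adj? G x y
  ... | yes a = trans (Bool.∧-identityʳ _) (g₂-∂ cyc (a , λ (x∈ , y∈) → ab∉ (B⇒W x∈ , B⇒W y∈)))
  ... | no ¬a = trans (Bool.∧-zeroʳ _) (bool-ext (λ ()) λ e →
   contradiction (proj₁ (proj₁ (proj₁ (lift-true (∂ᵃ H (d ∷ [])) {x} {y} e)))) ¬a)
  closed : RelClosed H W (d ∷ F₂ (g₂ d))
  closed a b r = ≡⇒xor≡false (sym (begin
   ∂ H (F₂ (g₂ d)) a b
   ≡⟨ F₂-∂ (g₂-in d) (proj₁ r) ⟩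
    push (∂ᵃ G (g₂ d)) a b
   ≡⟨ push-cong {a = a} {b} (agree r) ⟩
    push (lift (∂ᵃ H (d ∷ []))) a b
   ≡⟨ push-lift (∂ᵃ H (d ∷ [])) r ⟩
    ∂ᵃ H (d ∷ []) a b
   ≡⟨ trans (∂ᵃ-adj H (d ∷ []) (proj₁ r)) (Bool.xor-identityʳ _) ⟩
    mem d a ∧ mem d b ∎))

 F₂G₂ : ∀ {U z} → CycsIn H U z → F₂ (G₂ z) ≈[ W ] z
 F₂G₂ [] out = refl
 F₂G₂ {z = d ∷ z} ((cyc , _) ∷ cs) {c} out = trans (coef-concatMap-++ f₂ (g₂ d) (G₂ z) c) (cong₂ _xor_ single (F₂G₂ cs out))
  where
  single : coef (F₂ (g₂ d)) c ≡ does (d ≟ₛ c)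
  single with outside? H W d
  ... | yes out-d = trans (f₂g₂ cyc out-d out) (Bool.xor-identityʳ _)
  ... | no in-d = trans (F₂-inside (cycsIn-mono G (up-W d⊆) (g₂-in d)) out) (sym (dec-false (d ≟ₛ c) λ { refl → out d⊆ }))
   where
   d⊆ : d ⊆ W
   d⊆ = decidable-stable (d Subset.⊆? W) in-d

 F₂-closed : ∀ {U z} → CycsIn G U z → Closed G z → Closed H (F₂ z)
 F₂-closed {z = z} cs cl a b ab = trans (F₂-∂ cs ab) (par-false (allFin n) λ {x} _ → par-false (allFin n) λ {y} _ →
  trans (cong ((does (a ≟ q x) ∧ does (b ≟ q y)) ∧_) (at x y)) (Bool.∧-zeroʳ _))
  where
  at : ∀ x y → ∂ᵃ G z x y ≡ false
  at x y with adj? G x y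
  ... | yes a = trans (Bool.∧-identityʳ _) (cl x y a)
  ... | no _ = Bool.∧-zeroʳ _

 apex-∉-solid : ∀ {T} → Solid H T → Outside H W T → q w ∉ₛ T
 apex-∉-solid {T} solid out qw∈ with outside-face H W solid out
 ... | d , cyc , d⊆ , out-d = case trans (sym (coef-cycs H cyc (λ x∈ → d⊆ x∈)))
  (rel-vanish-outside H W {z = cycs H T} solid qw∈ (All.map proj₁ (cycs-in H T))
   (λ a b r → Sphere.closed (solid⇒sphere H solid) a b (proj₁ r))
   (λ e∈ oe → let ce , e⊆ = All.lookup (cycs-in H T) e∈ in (λ x∈ → e⊆ x∈) , apex-∉ ce oe) out-d) of λ ()

 record Generated (T : Subset m) : Set where
  field
   σ : List (Subset n)
   ok : ∀ {S} → S ∈ σ → (Solid G S × S ⊆ up T) × Outside G B S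
   once : ∀ {S} → S ∈ σ → coef σ S ≡ true
   sum : Solid H T → concatMap (cycs G) σ ≈[ B ] G₂ (cycs H T)

 opaque
  generated : ∀ T → Generated T
  generated T = go (solid? H T)
   where
   pack : Solid H T → ∃[ σ ] All (λ S → (Solid G S × S ⊆ up T) × Outside G B S) σ ×
    (G₂ (cycs H T) ≈[ B ] concatMap (cycs G) σ) → Generated T
   pack solid (σ , ok , sum) = record
    { σ = norm σ
    ; ok = λ S∈ → All.lookup ok (coef-true⇒∈ σ (∈-norm⁻ σ S∈))
    ; once = λ {S} S∈ → trans (norm-≈ σ S) (∈-norm⁻ σ S∈)
    ; sum = λ _ → norm-concatMap (cycs G) σ (G₂ (cycs H T)) sum }
   rel-closed : Solid H T → RelClosed G B (G₂ (cycs H T))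
   rel-closed solid x y r = trans (G₂-∂ (cycs-in H T) r)
    (trans (cong (does (kept? x y) ∧_) (trans (∂ᵃ-adj H (cycs H T) (adj⁺ (proj₁ r)))
     (Sphere.closed (solid⇒sphere H solid) _ _ (adj⁺ (proj₁ r))))) (Bool.∧-zeroʳ _))
   go : Dec (Solid H T) → Generated T
   go (no ¬solid) = record { σ = [] ; ok = λ () ; once = λ () ; sum = λ solid → contradiction solid ¬solid }
   go (yes solid) = pack solid (rel-generate G B {up T} {G₂ (cycs H T)} (G₂-in (cycs-in H T)) (rel-closed solid))

 g₃ : Subset m → List (Subset n)
 g₃ T = Generated.σ (generated T)

 module _ {T : Subset m} where
  open Generated (generated T) public using () renaming (ok to g₃-ok; once to g₃-once; sum to g₃-sum)

 G₃ : List (Subset m) → List (Subset n)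
 G₃ = concatMap g₃

 G₃-sum : ∀ {t} → All (Solid H) t → concatMap (cycs G) (G₃ t) ≈[ B ] G₂ (concatMap (cycs H) t)
 G₃-sum [] out = refl
 G₃-sum {T ∷ t} (solid ∷ ss) {c} out = trans (coef-concatMap-++ (cycs G) (g₃ T) (G₃ t) c) (trans (cong₂ _xor_ (g₃-sum solid out) (G₃-sum ss out))
  (sym (coef-concatMap-++ g₂ (cycs H T) (concatMap (cycs H) t) c)))

 dull : ∀ {T S t d} → Solid H T → Solid G S → S ⊆ up T → t ∊ T → t ∉ₛ image q S → Outside H W d → coef (F₂ (cycs G S)) d ≡ false
 dull {T} {S} solid solid-S S⊆ t∈ t∉ = rel-vanish-outside H W {z = F₂ (cycs G S)} solid t∈ (All.map proj₁ (F₂-in (cycs-in G S)))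
  (λ a b r → F₂-closed (cycs-in G S) (Sphere.closed (solid⇒sphere G solid-S)) a b (proj₁ r))
  (λ e∈ oe → let ce , e⊆ = All.lookup (F₂-in (cycs-in G S)) e∈ in
   outside-⊆ ce oe (λ x∈ → image-mono (λ y∈ → S⊆ y∈) (e⊆ x∈)) , λ t∈e → t∉ (e⊆ t∈e))

 -- A solid in g₃ T whose image contains T; its existence makes G₃ triangular with respect to inclusion.
 g₃-top : ∀ {T} → Solid H T → Outside H W T → ∃[ S ] S ∈ g₃ T × T ⊆ image q S
 g₃-top {T} solid out with Any.any? (λ S → T Subset.⊆? image q S) (g₃ T)
 ... | yes found = find found
 ... | no none with outside-face H W solid out
 ... | d , cyc , d⊆ , out-d = case trans (sym (coef-cycs H cyc (λ x∈ → d⊆ x∈)))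
  (trans (sym (F₂G₂ (cycs-in H T) out-d)) (trans (sym (F₂-cong (concatMap (cycs G) (g₃ T)) (G₂ (cycs H T)) (g₃-sum solid) out-d)) (vanish (g₃ T) (λ S∈ → S∈)))) of λ ()
  where
  vanish : ∀ σ → (∀ {S} → S ∈ σ → S ∈ g₃ T) → coef (F₂ (concatMap (cycs G) σ)) d ≡ false
  vanish [] _ = refl
  vanish (S ∷ σ) sub = trans (coef-concatMap-++ f₂ (cycs G S) (concatMap (cycs G) σ) d) (cong₂ _xor_
   (let (solid-S , S⊆) , _ = g₃-ok (sub 1st)
        t , t∈ , t∉ = outside-vertex H (image q S) {T} (λ T⊆ → none (lose (sub 1st) (λ x∈ → T⊆ x∈))) in
    dull solid solid-S (λ x∈ → S⊆ x∈) t∈ t∉ out-d)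
   (vanish σ (sub ∘ there)))

 G₃-injective : ∀ {t} → All (λ T → Solid H T × Outside H W T) t → (∀ S → coef (G₃ t) S ≡ false) → ∀ T → coef t T ≡ false
 G₃-injective {t} ok zero-sum T = go m T (ℕ.m≤m+n m _)
  where
  go : ∀ k T → m ≤ k + ∣ T ∣ → coef t T ≡ false
  go k T bound with coef t T in eq
  ... | false = refl
  ... | true with All.lookup ok (coef-true⇒∈ t eq)
  ... | solid , out with g₃-top solid out
  ... | S , S∈ , T⊆ = trans (sym (begin
   coef (G₃ t) S
   ≡⟨ trans (par-concatMap _ g₃ t) (par-via-coef (λ T' → coef (g₃ T') S) t) ⟩
    par (λ T' → coef t T' ∧ coef (g₃ T') S) (subsets m)
   ≡⟨ par-cong (subsets m) (λ {T'} _ → at T' k bound) ⟩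
    par (λ T' → does (T' ≟ₛ T) ∧ true) (subsets m)
   ≡⟨ par-δ _≟ₛ_ (λ _ → true) (subsets-unique m) (∈-subsets T) ⟩
    true ∎)) (zero-sum S)
   where
   open ≡-Reasoning
   at : ∀ T' k → m ≤ k + ∣ T ∣ → coef t T' ∧ coef (g₃ T') S ≡ does (T' ≟ₛ T) ∧ true
   at T' k bound with T' ≟ₛ T
   ... | yes refl = cong₂ _∧_ eq (g₃-once S∈)
   ... | no T'≢T = bool-ext larger λ ()
    where
    larger : coef t T' ∧ coef (g₃ T') S ≡ true → false ≡ true
    larger e with ∧-true {coef t T'} e
    ... | e₁ , e₂ = trans (sym (smaller k bound)) e₁
     where
     T⊆T' : T ⊆ T'
     T⊆T' x∈ with ∈-image⁻ q S (T⊆ x∈)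
     ... | y , y∈ , refl with ∈-up⁻ {T'} (proj₂ (proj₁ (g₃-ok (coef-true⇒∈ (g₃ T') e₂))) y∈)
     ... | inj₁ qy∈ = qy∈
     ... | inj₂ refl = contradiction x∈ (apex-∉-solid solid out)
     grows : ∣ T ∣ < ∣ T' ∣
     grows = Subset.p⊂q⇒∣p∣<∣q∣ ((λ x∈ → T⊆T' x∈) ,
      outside-vertex H T {T'} λ T'⊆ → T'≢T (Subset.⊆-antisym T'⊆ (λ x∈ → T⊆T' x∈)))
     smaller : ∀ k → m ≤ k + ∣ T ∣ → coef t T' ≡ false
     smaller zero bound = contradiction (ℕ.≤-trans grows (ℕ.≤-trans (Subset.∣p∣≤n T') bound)) (ℕ.<-irrefl refl)
     smaller (suc k) bound = go k T' (ℕ.≤-trans bound (ℕ.≤-trans (ℕ.≤-reflexive (sym (ℕ.+-suc k ∣ T ∣))) (ℕ.+-monoʳ-≤ k grows)))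

xor-cancelʳ : ∀ a b c → a xor c ≡ b xor c → a ≡ b
xor-cancelʳ a b false eq = trans (sym (Bool.xor-identityʳ a)) (trans eq (Bool.xor-identityʳ b))
xor-cancelʳ a b true eq = trans (sym (twice a)) (trans (cong not eq) (twice b))
 where
 twice : ∀ a → not (a xor true) ≡ a
 twice false = refl
 twice true = refl

coords-cong : ∀ {A : Set} (_≟_ : DecidableEquality A) {p p'} (L : List A) → (∀ {x} → x ∈ L → p x ≡ p' x) →
 Coordinates.coords _≟_ L p ≡ Coordinates.coords _≟_ L p'
coords-cong _≟_ [] eq = refl
coords-cong _≟_ (x ∷ L) eq = cong₂ _∷_ (eq 1st) (coords-cong _≟_ L (eq ∘ there))

-- The solids, induced cycles and edges of G that do not lie inside B.
module _ {n : ℕ} (G : Graph n) (B : Subset n) where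

 relSolid? : ∀ T → Dec (Solid G T × Outside G B T)
 relSolid? T = solid? G T ×-dec outside? G B T

 relCycle? : ∀ c → Dec (Cyc G c × Outside G B c)
 relCycle? c = cyc? G c ×-dec outside? G B c

 relEdge? : (e : Fin n × Fin n) → Dec ((proj₁ e Fin.< proj₂ e × Adj G (proj₁ e) (proj₂ e)) × ¬ (proj₁ e ∊ B × proj₂ e ∊ B))
 relEdge? (x , y) = ((x Fin.<? y) ×-dec adj? G x y) ×-dec ¬? ((x Subset.∈? B) ×-dec (y Subset.∈? B))

 relSolids : List (Subset n)
 relSolids = listing relSolid?

 relCycles : List (Subset n)
 relCycles = listing relCycle?

 relEdges : List (Fin n × Fin n)
 relEdges = listing relEdge?

 RelAdj-sym : ∀ {x y} → RelAdj G B x y → RelAdj G B y x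
 RelAdj-sym (a , out) = Adj-sym G a , λ (y∈ , x∈) → out (x∈ , y∈)

 relEdges-agree : ∀ {p p' : Fin n → Fin n → Bool} → (∀ x y → p x y ≡ p y x) → (∀ x y → p' x y ≡ p' y x) →
  (∀ {e} → e ∈ relEdges → p (proj₁ e) (proj₂ e) ≡ p' (proj₁ e) (proj₂ e)) →
  ∀ {x y} → RelAdj G B x y → p x y ≡ p' x y
 relEdges-agree symm symm' eq {x} {y} r with x Fin.<? y
 ... | yes x<y = eq (listed⁺ ((x<y , proj₁ r) , proj₂ r))
 ... | no x≮y = trans (symm x y) (trans (eq (listed⁺ ((y<x , proj₁ (RelAdj-sym r)) , proj₂ (RelAdj-sym r)))) (symm' y x))
  where
  y<x : y Fin.< x
  y<x = ℕ.≤∧≢⇒< (ℕ.≮⇒≥ x≮y) λ e → Adj⇒≢ G (proj₁ r) (Fin.toℕ-injective (sym e))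

 ∂-≈[] : ∀ z z' → z ≈[ B ] z' → ∀ {x y} → RelAdj G B x y → ∂ G z x y ≡ ∂ G z' x y
 ∂-≈[] z z' eq {x} {y} (_ , xy∉) = trans (par-via-coef _ z)
  (trans (par-cong (subsets n) λ {c} _ → at c (outside? G B c)) (sym (par-via-coef _ z')))
  where
  at : ∀ c → Dec (Outside G B c) → coef z c ∧ (mem c x ∧ mem c y) ≡ coef z' c ∧ (mem c x ∧ mem c y)
  at c (yes out) = cong (_∧ _) (eq out)
  at c (no in-c) = trans (vanish (coef z c)) (sym (vanish (coef z' c)))
   where
   vanish : ∀ b → b ∧ (mem c x ∧ mem c y) ≡ false
   vanish b = bool-ext (λ e → let ex , ey = ∧-true (proj₂ (∧-true {b} e)) in
    contradiction (λ c⊆ → xy∉ (c⊆ (mem⇒∈ ex) , c⊆ (mem⇒∈ ey))) in-c) λ ()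

module _ {k} {A : Set} (_≟ᴬ_ : DecidableEquality A) (f : Subset k → A) where

 preimage : A → Subset k
 preimage a with Subset.anySubset? (λ t → f t ≟ᴬ a)
 ... | yes (t , _) = t
 ... | no _ = Subset.⊥

 preimage-section : ∀ t → f (preimage (f t)) ≡ f t
 preimage-section t with Subset.anySubset? (λ t' → f t' ≟ᴬ f t)
 ... | yes (_ , eq) = eq
 ... | no none = contradiction (t , refl) none

module RelativeCount {n m : ℕ} {G : Graph n} {H : Graph m} {w : Fin n} {q : Fin n → Fin m} (F : Fold G H w q) where

 open Chains F public

 SG : List (Subset n)
 SG = relSolids G B
 CG : List (Subset n)
 CG = relCycles G B
 SH : List (Subset m)
 SH = relSolids H W
 CH : List (Subset m)
 CH = relCycles H W
 EG : List (Fin n × Fin n)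
 EG = relEdges G B
 EH : List (Fin m × Fin m)
 EH = relEdges H W

 solids-ok : ∀ v → All (λ T → Solid H T × Outside H W T) (chain SH v)
 solids-ok v = All.tabulate λ T∈ → listed⁻ (chain⊆ SH v T∈)

 cyclesG : ∀ v → CycsIn G Subset.⊤ (chain CG v)
 cyclesG v = All.tabulate λ c∈ → proj₁ (listed⁻ (chain⊆ CG v c∈)) , λ _ → Subset.∈⊤

 cyclesH : ∀ v → CycsIn H Subset.⊤ (chain CH v)
 cyclesH v = All.tabulate λ c∈ → proj₁ (listed⁻ (chain⊆ CH v c∈)) , λ _ → Subset.∈⊤

 G₃-ok : ∀ t {S} → S ∈ G₃ t → S ∈ SG
 G₃-ok (T ∷ t) {S} S∈ = [ first , G₃-ok t ]′ (∈-++⁻ (g₃ T) S∈)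
  where
  first : S ∈ g₃ T → S ∈ SG
  first S∈T = let (solid , _) , out = g₃-ok {T} {S} S∈T in listed⁺ (solid , out)

 agree-SG : ∀ z z' → (∀ {S} → S ∈ z → S ∈ SG) → (∀ {S} → S ∈ z' → S ∈ SG) →
  coords SG (coef z) ≡ coords SG (coef z') → z ≈ z'
 agree-SG z z' ok ok' eq S = go (DecMembership._∈?_ _≟ₛ_ S SG)
  where
  go : Dec (S ∈ SG) → coef z S ≡ coef z' S
  go (yes S∈) = coords-injective SG eq S∈
  go (no S∉) = trans (coef-∉ {z = z} (S∉ ∘ ok)) (sym (coef-∉ {z = z'} (S∉ ∘ ok')))

 agree-cycles : ∀ {k} (K : Graph k) U z z' → All (Cyc K) z → All (Cyc K) z' →
  coords (relCycles K U) (coef z) ≡ coords (relCycles K U) (coef z') → z ≈[ U ] z'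
 agree-cycles K U z z' ok ok' eq {c} out = go (cyc? K c)
  where
  go : Dec (Cyc K c) → coef z c ≡ coef z' c
  go (yes cyc) = coords-injective (relCycles K U) eq (listed⁺ (cyc , out))
  go (no ¬cyc) = trans (coef-∉ {z = z} (¬cyc ∘ All.lookup ok)) (sym (coef-∉ {z = z'} (¬cyc ∘ All.lookup ok')))

 G₃-cancel : ∀ v v' → G₃ (chain SH v) ≈ G₃ (chain SH v') → v ≡ v'
 G₃-cancel v v' eq = chain-injective listing-unique v v' λ {T} _ →
  xor≡false⇒≡ (trans (sym (coef-++ (chain SH v) (chain SH v') T))
   (G₃-injective (All.++⁺ (solids-ok v) (solids-ok v')) (λ S →
    trans (coef-concatMap-++ g₃ (chain SH v) (chain SH v') S) (≡⇒xor≡false (eq S))) T))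

 G₂-cong : ∀ z z' → z ≈[ W ] z' → G₂ z ≈[ B ] G₂ z'
 G₂-cong z z' = ≈[]-concatMap g₂ (λ {d} d⊆ → coef-inside G B (go (λ x∈ → d⊆ x∈) (g₂-in d))) z z'
  where
  go : ∀ {d y} → d ⊆ W → CycsIn G (up d) y → All (_⊆ B) y
  go d⊆ [] = []
  go d⊆ ((_ , c⊆) ∷ cs) = (λ x∈ → up-W (λ x∈ → d⊆ x∈) (c⊆ x∈)) ∷ go d⊆ cs

 solids≤ : length SH ≤ length SG
 solids≤ = injective⇒≤ (λ v → coords SG (coef (G₃ (chain SH v)))) λ {v} {v'} eq →
  G₃-cancel v v' (agree-SG (G₃ (chain SH v)) (G₃ (chain SH v')) (G₃-ok (chain SH v)) (G₃-ok (chain SH v')) eq)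

 cycles≤ : length CH ≤ length CG
 cycles≤ = injective⇒≤ (λ v → coords CG (coef (G₂ (chain CH v)))) λ {v} {v'} eq →
  chain-injective listing-unique v v' λ c∈ → let out = proj₂ (listed⁻ c∈) in
   trans (sym (F₂G₂ (cyclesH v) out)) (trans (F₂-cong (G₂ (chain CH v)) (G₂ (chain CH v'))
    (agree-cycles G B (G₂ (chain CH v)) (G₂ (chain CH v'))
     (All.map proj₁ (G₂-in (cyclesH v))) (All.map proj₁ (G₂-in (cyclesH v'))) eq) out)
    (F₂G₂ (cyclesH v') out))

 module EdgeG = Coordinates {Fin n × Fin n} (Product.≡-dec _≟_ _≟_)
 module EdgeH = Coordinates {Fin m × Fin m} (Product.≡-dec _≟_ _≟_)

 boundary : Subset (length CG) → Fin n × Fin n → Bool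
 boundary t (x , y) = ∂ G (chain CG t) x y

 folded : Subset (length CG) → Subset (length CH)
 folded t = coords CH (coef (F₂ (chain CG t)))

 invariants : Subset (length CG) → Subset (length CH) × Subset (length EG)
 invariants t = folded t , EdgeG.coords EG (boundary t)

 invariants-≟ : DecidableEquality (Subset (length CH) × Subset (length EG))
 invariants-≟ = Product.≡-dec _≟ₛ_ _≟ₛ_

 opaque
  representative : Subset (length CH) × Subset (length EG) → Subset (length CG)
  representative = preimage invariants-≟ invariants

  representative-invariants : ∀ t → invariants (representative (invariants t)) ≡ invariants t
  representative-invariants = preimage-section invariants-≟ invariants

 same-boundary : ∀ t t' → EdgeG.coords EG (boundary t) ≡ EdgeG.coords EG (boundary t') →
  ∀ {x y} → RelG x y → ∂ G (chain CG t) x y ≡ ∂ G (chain CG t') x y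
 same-boundary t t' eq = relEdges-agree G B (∂-sym G (chain CG t)) (∂-sym G (chain CG t'))
  λ e∈ → EdgeG.coords-injective EG eq e∈

 reduced : Subset (length CG) → List (Subset n)
 reduced t = chain CG t ++ chain CG (representative (invariants t))

 opaque
  correction : ∀ t → ∃[ σ ] All (λ T → (Solid G T × T ⊆ Subset.⊤) × Outside G B T) σ × (reduced t ≈[ B ] concatMap (cycs G) σ)
  correction t = rel-generate G B {Subset.⊤} {reduced t} (All.++⁺ (cyclesG t) (cyclesG (representative (invariants t)))) λ x y r →
   trans (∂-++ G (chain CG t) (chain CG (representative (invariants t))) x y)
    (≡⇒xor≡false (sym (same-boundary (representative (invariants t)) t (cong proj₂ (representative-invariants t)) r)))

 κ : Subset (length CG) → List (Subset n)
 κ t = proj₁ (correction t)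

 κ-ok : ∀ t {S} → S ∈ κ t → S ∈ SG
 κ-ok t S∈ = let (solid , _) , out = All.lookup (proj₁ (proj₂ (correction t))) S∈ in listed⁺ (solid , out)

 η : Subset (length EH) → Fin m → Fin m → Bool
 η u a b = EdgeH.val EH u (a , b) xor EdgeH.val EH u (b , a)

 η-sym : ∀ u a b → η u a b ≡ η u b a
 η-sym u a b = Bool.xor-comm (EdgeH.val EH u (a , b)) _

 η-ordered : ∀ u {a b} → a Fin.< b → η u a b ≡ EdgeH.val EH u (a , b)
 η-ordered u {a} {b} a<b = trans (cong (EdgeH.val EH u (a , b) xor_) (EdgeH.val-∉ EH u λ e∈ → ℕ.<-asym a<b (proj₁ (proj₁ (listed⁻ e∈))))) (Bool.xor-identityʳ _)

 balance : Subset (length CG) → Subset (length EH) → Fin n → Fin n → Bool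
 balance t u x y = ∂ G (chain CG t) x y xor lift (η u) x y

 balance-sym : ∀ t u x y → balance t u x y ≡ balance t u y x
 balance-sym t u x y = cong₂ _xor_ (∂-sym G (chain CG t) x y) (lift-sym (η-sym u) x y)

 f : Subset (length SH) → Subset (length CG) → Subset (length SG)
 f s t = coords SG (coef (G₃ (chain SH s) ++ κ t))

 h : Subset (length CG) → Subset (length EH) → Subset (length EG)
 h t u = EdgeG.coords EG λ e → balance t u (proj₁ e) (proj₂ e)

 -- Pushing forward recovers the edge chain from h, and with it all
 -- invariants of the cycle chain t; then f and F₂G₂ = 1 give t and s.
 module _ {s t u s' t' u'} (e₁ : f s t ≡ f s' t') (e₂ : folded t ≡ folded t') (e₃ : h t u ≡ h t' u') where

  F₂-eq : F₂ (chain CG t) ≈[ W ] F₂ (chain CG t')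
  F₂-eq = agree-cycles H W (F₂ (chain CG t)) (F₂ (chain CG t'))
   (All.map proj₁ (F₂-in (cyclesG t))) (All.map proj₁ (F₂-in (cyclesG t'))) e₂

  balance-eq : ∀ {x y} → RelG x y → balance t u x y ≡ balance t' u' x y
  balance-eq = relEdges-agree G B (balance-sym t u) (balance-sym t' u') λ e∈ → EdgeG.coords-injective EG e₃ e∈

  push-balance : ∀ t u {a b} → RelH a b →
   push (λ x y → ∂ᵃ G (chain CG t) x y xor lift (η u) x y) a b ≡ η u a b xor ∂ H (F₂ (chain CG t)) a b
  push-balance t u {a} {b} r = trans (push-xor (∂ᵃ G (chain CG t)) (lift (η u)) a b)
   (trans (cong₂ _xor_ (sym (F₂-∂ (cyclesG t) (proj₁ r))) (push-lift (η u) r)) (Bool.xor-comm (∂ H (F₂ (chain CG t)) a b) _))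

  η-eq : ∀ {a b} → RelH a b → η u a b ≡ η u' a b
  η-eq {a} {b} r = xor-cancelʳ _ _ (∂ H (F₂ (chain CG t)) a b)
   (trans (sym (push-balance t u r)) (trans (push-cong {a = a} {b} at) (trans (push-balance t' u' r)
    (cong (η u' a b xor_) (sym (∂-≈[] H W (F₂ (chain CG t)) (F₂ (chain CG t')) F₂-eq r))))))
   where
   unkept : ∀ u {x y} → ¬ Adj G x y → lift (η u) x y ≡ false
   unkept u {x} {y} ¬a = bool-ext (λ e → contradiction (proj₁ (proj₁ (proj₁ (lift-true (η u) {x} {y} e)))) ¬a) λ ()
   at : ∀ x y → q x ≡ a → q y ≡ b → ∂ᵃ G (chain CG t) x y xor lift (η u) x y ≡ ∂ᵃ G (chain CG t') x y xor lift (η u') x y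
   at x y refl refl = go (adj? G x y)
    where
    go : Dec (Adj G x y) → ∂ᵃ G (chain CG t) x y xor lift (η u) x y ≡ ∂ᵃ G (chain CG t') x y xor lift (η u') x y
    go (yes a) = trans (cong (_xor lift (η u) x y) (∂ᵃ-adj G (chain CG t) a))
     (trans (balance-eq (a , λ (x∈ , y∈) → proj₂ r (B⇒W x∈ , B⇒W y∈))) (cong (_xor lift (η u') x y) (sym (∂ᵃ-adj G (chain CG t') a))))
    go (no ¬a) = cong₂ _xor_ (trans (none t) (sym (none t'))) (trans (unkept u ¬a) (sym (unkept u' ¬a)))
     where
     none : ∀ t → ∂ᵃ G (chain CG t) x y ≡ false
     none t = trans (cong (∂ G (chain CG t) x y ∧_) (dec-false (adj? G x y) ¬a)) (Bool.∧-zeroʳ _)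

  u-eq : u ≡ u'
  u-eq = EdgeH.val-injective listing-unique u u' λ e∈ → let (a<b , a) , out = listed⁻ e∈ ; r = a , out in
   trans (sym (η-ordered u a<b)) (trans (η-eq r) (η-ordered u' a<b))

  invariants-eq : invariants t ≡ invariants t'
  invariants-eq = cong₂ _,_ e₂ (coords-cong (Product.≡-dec _≟_ _≟_) EG λ {e} e∈ →
   xor-cancelʳ _ _ (lift (η u) (proj₁ e) (proj₂ e)) (trans (balance-eq (let (_ , a) , out = listed⁻ e∈ in a , out))
    (cong (λ u → boundary t' e xor lift (η u) (proj₁ e) (proj₂ e)) (sym u-eq))))

  total : ∀ s t {c} → Outside G B c → coef (concatMap (cycs G) (G₃ (chain SH s) ++ κ t)) c ≡
   (coef (G₂ (concatMap (cycs H) (chain SH s))) c xor coef (chain CG t) c) xor coef (chain CG (representative (invariants t))) c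
  total s t {c} out = trans (coef-concatMap-++ (cycs G) (G₃ (chain SH s)) (κ t) c) (trans (cong₂ _xor_ (G₃-sum (All.map proj₁ (solids-ok s)) out)
   (trans (sym (proj₂ (proj₂ (correction t)) out)) (coef-++ (chain CG t) _ c)))
   (sym (Bool.xor-assoc (coef (G₂ (concatMap (cycs H) (chain SH s))) c) _ _)))

  solids-eq : G₃ (chain SH s) ++ κ t ≈ G₃ (chain SH s') ++ κ t'
  solids-eq = agree-SG (G₃ (chain SH s) ++ κ t) (G₃ (chain SH s') ++ κ t') (ok s t) (ok s' t') e₁
   where
   ok : ∀ s t {S} → S ∈ G₃ (chain SH s) ++ κ t → S ∈ SG
   ok s t S∈ = [ G₃-ok (chain SH s) , κ-ok t ]′ (∈-++⁻ (G₃ (chain SH s)) S∈)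

  σ : List (Subset m)
  σ = concatMap (cycs H) (chain SH s)
  σ' : List (Subset m)
  σ' = concatMap (cycs H) (chain SH s')

  σ-in : ∀ t → CycsIn H Subset.⊤ (concatMap (cycs H) t)
  σ-in [] = []
  σ-in (T ∷ t) = All.++⁺ (cycsIn-mono H (λ _ → Subset.∈⊤) (cycs-in H T)) (σ-in t)

  cycles-eq : ∀ {c} → Outside G B c → coef (G₂ σ) c xor coef (chain CG t) c ≡ coef (G₂ σ') c xor coef (chain CG t') c
  cycles-eq {c} out = xor-cancelʳ _ _ (coef (chain CG (representative (invariants t))) c)
   (trans (sym (total s t out)) (trans (≈-concatMap (cycs G) {G₃ (chain SH s) ++ κ t} {G₃ (chain SH s') ++ κ t'} solids-eq c)
    (trans (total s' t' out) (cong (λ i → (coef (G₂ σ') c xor coef (chain CG t') c) xor coef (chain CG (representative i)) c) (sym invariants-eq)))))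

  σ-eq : σ ≈[ W ] σ'
  σ-eq {d} out = xor-cancelʳ _ _ (coef (F₂ (chain CG t)) d) (trans (sym (folded-sum s t)) (trans
   (F₂-cong (G₂ σ ++ chain CG t) (G₂ σ' ++ chain CG t') (λ {c} out → trans (coef-++ (G₂ σ) _ c) (trans (cycles-eq out) (sym (coef-++ (G₂ σ') _ c)))) out)
   (trans (folded-sum s' t') (cong (coef σ' d xor_) (sym (F₂-eq out))))))
   where
   folded-sum : ∀ s t → coef (F₂ (G₂ (concatMap (cycs H) (chain SH s)) ++ chain CG t)) d ≡
    coef (concatMap (cycs H) (chain SH s)) d xor coef (F₂ (chain CG t)) d
   folded-sum s t = trans (coef-concatMap-++ f₂ (G₂ (concatMap (cycs H) (chain SH s))) (chain CG t) d)
    (cong (_xor coef (F₂ (chain CG t)) d) (F₂G₂ (σ-in (chain SH s)) out))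

  t-eq : t ≡ t'
  t-eq = chain-injective listing-unique t t' λ {c} c∈ →
   let out = proj₂ (listed⁻ c∈) in
   xor-cancelʳ _ _ (coef (G₂ σ) c) (trans (Bool.xor-comm (coef (chain CG t) c) _) (trans (cycles-eq out)
    (trans (cong (_xor coef (chain CG t') c) (sym (G₂-cong σ σ' σ-eq out))) (Bool.xor-comm (coef (G₂ σ) c) _))))

  s-eq : s ≡ s'
  s-eq = G₃-cancel s s' λ S → xor-cancelʳ _ _ (coef (κ t) S) (trans (sym (coef-++ (G₃ (chain SH s)) (κ t) S))
   (trans (solids-eq S) (trans (coef-++ (G₃ (chain SH s')) (κ t') S) (cong (λ t → coef (G₃ (chain SH s')) S xor coef (κ t) S) (sym t-eq)))))

 relative≤ : length SH + (length CG + length EH) ≤ length SG + (length CH + length EG)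
 relative≤ = injective₃⇒≤ f folded h λ {s} {t} {u} {s'} {t'} {u'} e₁ e₂ e₃ →
  s-eq {s} {t} {u} {s'} {t'} {u'} e₁ e₂ e₃ , t-eq {s} {t} {u} {s'} {t'} {u'} e₁ e₂ e₃ , u-eq {s} {t} {u} {s'} {t'} {u'} e₁ e₂ e₃

module _ {n : ℕ} (G : Graph n) where

 solidList : List (Subset n)
 solidList = listing (solid? G)

 cycleList : List (Subset n)
 cycleList = listing (cyc? G)

 solidsIn : Subset n → List (Subset n)
 solidsIn U = listing λ T → solid? G T ×-dec (T Subset.⊆? U)

 cyclesIn : Subset n → List (Subset n)
 cyclesIn U = listing λ c → cyc? G c ×-dec (c Subset.⊆? U)

 module _ (B : Subset n) where

  solids-relative : length solidList ≡ length (relSolids G B) + length (solidsIn B)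
  solids-relative = listing-split (solid? G) (Subset._⊆? B)

  cycles-relative : length cycleList ≡ length (relCycles G B) + length (cyclesIn B)
  cycles-relative = listing-split (cyc? G) (Subset._⊆? B)

 solid-antichain : ∀ {S T c} → Solid G S → Solid G T → S ⊆ T → Cyc G c → c ⊆ S → S ≡ T
 solid-antichain {S} {T} {c} s t S⊆ cc c⊆ = Subset.⊆-antisym S⊆ T⊆
  where
  T⊆ : T ⊆ S
  T⊆ {x} x∈ = decidable-stable (x Subset.∈? S) λ x∉S →
   let d , cd , d⊆ , x∈d = Sphere.cover (solid⇒sphere G t) x∈ in
   case trans (sym (coef-cycs G cc (λ x∈ → c⊆ x∈)))
    (trans (Sphere.same (solid⇒sphere G t) {cycs G S} (cycsIn-mono G (λ x∈ → S⊆ x∈) (cycs-in G S)) (Sphere.closed (solid⇒sphere G s))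
     cc (λ x∈ → S⊆ (c⊆ x∈)) cd (λ x∈ → d⊆ x∈))
    (coef-∉ {z = cycs G S} λ d∈ → x∉S (proj₂ (All.lookup (cycs-in G S) d∈) x∈d))) of λ ()

module Cone {n : ℕ} (G : Graph n) (w : Fin n) where

 B : Subset n
 B = closedNeighbourhood G w

 N : Subset n
 N = B Subset.- w

 N⇒adj : ∀ {x} → x ∊ N → Adj G w x
 N⇒adj x∈ = let x∈B , x≢w = ∈-remove⁻ B w x∈ in [ (λ e → contradiction e x≢w) , id ]′ (∈-nbhd⁻ G x∈B)

 adj⇒N : ∀ {x} → Adj G w x → x ∊ N
 adj⇒N wx = Subset.x∈p∧x≢y⇒x∈p-y (∈-nbhd⁺ G (inj₂ wx)) (≢-sym (Adj⇒≢ G wx))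

 N⊆B : N ⊆ B
 N⊆B x∈ = proj₁ (∈-remove⁻ B w x∈)

 w∉N : w ∉ₛ N
 w∉N w∈ = Adj⇒≢ G (N⇒adj w∈) refl

 cone⇒solid : ∀ {c} → Cyc G c → c ⊆ N → Solid G (_+v_ G c w)
 cone⇒solid cyc c⊆ with cyc-nonempty G cyc
 ... | v , v∈ = let open Two (cyc-two G cyc v∈) renaming (u to s; w to t; u∈ to s∈; w∈ to t∈) in hub⇒solid G record
  { cyc = cyc ; q∉ = λ w∈ → w∉N (c⊆ w∈) ; s∈ = v∈ ; t∈ = s∈ ; u∈ = t∈
  ; qs = N⇒adj (c⊆ v∈) ; qt = N⇒adj (c⊆ s∈) ; qu = N⇒adj (c⊆ t∈)
  ; s≢t = Adj⇒≢ G xu ; s≢u = Adj⇒≢ G xw ; t≢u = u≢w ; T≡ = refl }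

 Triangle : Fin n → Fin n → Subset n → Set
 Triangle x y c = Adj G w x × Adj G w y × Adj G x y × c ≡ ⟦_⟧ G (w ∷ x ∷ y ∷ [])

 triangle-at : ∀ {c} → Cyc G c → c ⊆ B → w ∊ c → ∃[ x ] ∃[ y ] Triangle x y c
 triangle-at {c} cyc c⊆ w∈ = s , t , xu , xw , st , Subset.⊆-antisym
  (λ x∈ → ∈⟦⟧⁺ G (cyc-triangle G cyc w∈ s∈ t∈ xu xw st x∈)) (λ x∈ → in-c (∈⟦⟧⁻ G x∈))
  where
  open Two (cyc-two G cyc w∈) renaming (u to s; w to t; u∈ to s∈; w∈ to t∈)
  in-c : ∀ {x} → x ∈ w ∷ s ∷ t ∷ [] → x ∊ c
  in-c 1st = w∈
  in-c 2nd = s∈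
  in-c 3rd = t∈
  near-s : ∀ {r} → r ∊ c → Adj G s r → r ≢ w → r ≡ t
  near-s r∈ sr r≢w with ∈-nbhd⁻ G (c⊆ r∈)
  ... | inj₁ r≡w = contradiction r≡w r≢w
  ... | inj₂ wr with only r∈ wr
  ... | inj₁ refl = contradiction refl (Adj⇒≢ G sr)
  ... | inj₂ r≡t = r≡t
  st : Adj G s t
  st with cyc-two G cyc s∈
  ... | record { u = a ; w = b ; u≢w = a≢b ; u∈ = a∈ ; w∈ = b∈ ; xu = sa ; xw = sb } with a ≟ w
  ... | no a≢w = subst (Adj G s) (near-s a∈ sa a≢w) sa
  ... | yes refl = subst (Adj G s) (near-s b∈ sb (≢-sym a≢b)) sb

 -- Two triangles at w share a common edge opposite w only if they are equal,
 -- so some face of a solid through w avoids w.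
 opaque
  solid⇒cone : ∀ {T} → Solid G T → T ⊆ B → w ∊ T → ∃[ c ] Cyc G c × c ⊆ N × T ≡ _+v_ G c w
  solid⇒cone {T} solid T⊆ w∈ with Sphere.cover (solid⇒sphere G solid) w∈
  ... | e , ce , e⊆ , w∈e with triangle-at ce (λ x∈ → T⊆ (e⊆ x∈)) w∈e
  ... | x , y , wx , wy , xy , e≡ = opposite (par-other _≟ₛ_ (λ c → mem c x ∧ mem c y)
   (cycs-unique G T) (∈-cycs G ce (λ x∈ → e⊆ x∈))
   (cong₂ _∧_ (∈⇒mem (in-e 2nd)) (∈⇒mem (in-e 3rd)))
   (Sphere.closed (solid⇒sphere G solid) x y xy))
   where
   in-e : ∀ {z} → z ∈ w ∷ x ∷ y ∷ [] → z ∊ e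
   in-e z∈ = subst (_ ∊_) (sym e≡) (∈⟦⟧⁺ G z∈)
   opposite : ∃[ c ] c ∈ cycs G T × c ≢ e × mem c x ∧ mem c y ≡ true → ∃[ c ] Cyc G c × c ⊆ N × T ≡ _+v_ G c w
   opposite (c , c∈ , c≢e , xy∈) = c , cc , (λ z∈ → c⊆N z∈) ,
    sym (solid-antichain G {c = c} (cone⇒solid cc (λ z∈ → c⊆N z∈)) solid c+w⊆T cc (⊆+v G))
    where
    cc : Cyc G c
    cc = proj₁ (All.lookup (cycs-in G T) c∈)
    c⊆T : c ⊆ T
    c⊆T = proj₂ (All.lookup (cycs-in G T) c∈)
    x∈ : x ∊ c
    x∈ = mem⇒∈ (proj₁ (∧-true xy∈))
    y∈ : y ∊ c
    y∈ = mem⇒∈ (proj₂ (∧-true {mem c x} xy∈))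
    w∉ : w ∉ₛ c
    w∉ w∈c = c≢e (trans (Subset.⊆-antisym (λ z∈ → ∈⟦⟧⁺ G (cyc-triangle G cc w∈c x∈ y∈ wx wy xy z∈)) (λ z∈ → back (∈⟦⟧⁻ G z∈))) (sym e≡))
     where
     back : ∀ {z} → z ∈ w ∷ x ∷ y ∷ [] → z ∊ c
     back 1st = w∈c
     back 2nd = x∈
     back 3rd = y∈
    c⊆N : c ⊆ N
    c⊆N z∈ = Subset.x∈p∧x≢y⇒x∈p-y (T⊆ (c⊆T z∈)) λ { refl → w∉ z∈ }
    c+w⊆T : _+v_ G c w ⊆ T
    c+w⊆T z∈ with ∈+v⁻ G z∈
    ... | inj₁ z∈c = c⊆T z∈c
    ... | inj₂ refl = w∈

 triangles : List (Subset n)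
 triangles = listing λ c → (cyc? G c ×-dec (c Subset.⊆? B)) ×-dec (w Subset.∈? c)

 avoid : ∀ {c} → c ⊆ B → w ∉ₛ c → c ⊆ N
 avoid c⊆ w∉ x∈ = Subset.x∈p∧x≢y⇒x∈p-y (c⊆ x∈) λ { refl → w∉ x∈ }

 cycles-cone : length (cyclesIn G B) ≡ length (cyclesIn G N) + length triangles
 cycles-cone = trans (listing-split (λ c → cyc? G c ×-dec (c Subset.⊆? B)) (w Subset.∈?_)) (cong (_+ length triangles) (listing-≐
  (λ ((cyc , c⊆) , w∉) → cyc , avoid (λ x∈ → c⊆ x∈) w∉)
  (λ (cyc , c⊆) → (cyc , λ x∈ → N⊆B (c⊆ x∈)) , λ w∈ → w∉N (c⊆ w∈))))

 solids-cone : length (solidsIn G B) ≡ length (solidsIn G N) + length (cyclesIn G N)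
 solids-cone = trans (listing-split (λ T → solid? G T ×-dec (T Subset.⊆? B)) (w Subset.∈?_)) (cong₂ ℕ._+_
  (listing-≐ (λ ((solid , T⊆) , w∉) → solid , avoid (λ x∈ → T⊆ x∈) w∉)
   (λ (solid , T⊆) → (solid , λ x∈ → N⊆B (T⊆ x∈)) , λ w∈ → w∉N (T⊆ w∈)))
  (count≡ (λ T c → T ≡ _+v_ G c w) listing-unique listing-unique
   (λ T∈ → base (listed⁻ T∈)) (λ c∈ → apex (listed⁻ c∈)) (λ _ _ e e' → trans e (sym e'))
   (λ c∈ c'∈ e e' → same (listed⁻ c∈) (listed⁻ c'∈) (trans (sym e) e'))))
  where
  listed : ∀ {T} → ∃[ c ] Cyc G c × c ⊆ N × T ≡ _+v_ G c w → ∃[ c ] c ∈ cyclesIn G N × T ≡ _+v_ G c w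
  listed (c , cyc , c⊆ , eq) = c , listed⁺ (cyc , λ {x} → c⊆ {x}) , eq
  base : ∀ {T} → (Solid G T × T ⊆ B) × w ∊ T → ∃[ c ] c ∈ cyclesIn G N × T ≡ _+v_ G c w
  base ((solid , T⊆) , w∈) = listed (solid⇒cone solid (λ x∈ → T⊆ x∈) w∈)
  cone⊆ : ∀ {c} → c ⊆ N → _+v_ G c w ⊆ B
  cone⊆ c⊆ x∈ with ∈+v⁻ G x∈
  ... | inj₁ x∈c = N⊆B (c⊆ x∈c)
  ... | inj₂ refl = ∈-nbhd⁺ G (inj₁ refl)
  apex : ∀ {c} → Cyc G c × c ⊆ N → ∃[ T ] T ∈ listing (λ T → (solid? G T ×-dec (T Subset.⊆? B)) ×-dec (w Subset.∈? T)) × T ≡ _+v_ G c w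
  apex {c} (cyc , c⊆) = _+v_ G c w , listed⁺ ((cone⇒solid cyc (λ x∈ → c⊆ x∈) , λ {x} → cone⊆ (λ x∈ → c⊆ x∈) {x}) , q∈+v G) , refl
  uncone : ∀ {c c'} → _+v_ G c w ≡ _+v_ G c' w → c ⊆ N → c ⊆ c'
  uncone eq c⊆ {x} x∈ with ∈+v⁻ G (subst (x ∊_) eq (⊆+v G x∈))
  ... | inj₁ x∈c' = x∈c'
  ... | inj₂ refl = contradiction (c⊆ x∈) w∉N
  same : ∀ {c c'} → Cyc G c × c ⊆ N → Cyc G c' × c' ⊆ N → _+v_ G c w ≡ _+v_ G c' w → c ≡ c'
  same (_ , c⊆) (_ , c'⊆) e = Subset.⊆-antisym (uncone e (λ x∈ → c⊆ x∈)) (uncone (sym e) (λ x∈ → c'⊆ x∈))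

 Local Spoked Rim : Fin n × Fin n → Set
 Local (x , y) = (x Fin.< y × Adj G x y) × x ∊ B × y ∊ B
 Spoked (x , y) = x ≡ w ⊎ y ≡ w
 Rim e = Local e × ¬ Spoked e

 local? : ∀ e → Dec (Local e)
 local? (x , y) = ((x Fin.<? y) ×-dec adj? G x y) ×-dec (x Subset.∈? B) ×-dec (y Subset.∈? B)

 localEdges : List (Fin n × Fin n)
 localEdges = listing local?

 private
  spoked? : ∀ e → Dec (Spoked e)
  spoked? (x , y) = (x ≟ w) ⊎-dec (y ≟ w)

  Spoke : Fin n × Fin n → Fin n → Set
  Spoke (x , y) v = (x ≡ w × y ≡ v) ⊎ (y ≡ w × x ≡ v)

  ordered : ∀ {x y : Fin n} → x ≢ y → x Fin.< y ⊎ y Fin.< x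
  ordered {x} {y} x≢y with Fin.<-cmp x y
  ... | tri< x<y _ _ = inj₁ x<y
  ... | tri≈ _ x≡y _ = contradiction x≡y x≢y
  ... | tri> _ _ y<x = inj₂ y<x

  spokes : length (listing λ e → local? e ×-dec spoked? e) ≡ length (listing (adj? G w))
  spokes = count≡ Spoke listing-unique listing-unique
   (λ e∈ → let ((_ , a) , _) , p = listed⁻ e∈ in forth a p) (λ v∈ → back (listed⁻ v∈))
   (λ e∈ e'∈ → same (proj₁ (proj₁ (proj₁ (listed⁻ e∈)))) (proj₁ (proj₁ (proj₁ (listed⁻ e'∈)))))
   (λ v∈ v'∈ → same' (listed⁻ v∈) (listed⁻ v'∈))
   where
   forth : ∀ {x y} → Adj G x y → x ≡ w ⊎ y ≡ w → ∃[ v ] v ∈ listing (adj? G w) × Spoke (x , y) v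
   forth {x} {y} a (inj₁ refl) = y , listed⁺ a , inj₁ (refl , refl)
   forth {x} {y} a (inj₂ refl) = x , listed⁺ (Adj-sym G a) , inj₂ (refl , refl)
   back : ∀ {v} → Adj G w v → ∃[ e ] e ∈ listing (λ e → local? e ×-dec spoked? e) × Spoke e v
   back {v} wv = [ (λ w<v → (w , v) , listed⁺ (((w<v , wv) , ∈-nbhd⁺ G (inj₁ refl) , ∈-nbhd⁺ G (inj₂ wv)) , inj₁ refl) , inj₁ (refl , refl))
    , (λ v<w → (v , w) , listed⁺ (((v<w , Adj-sym G wv) , ∈-nbhd⁺ G (inj₂ wv) , ∈-nbhd⁺ G (inj₁ refl)) , inj₂ refl) , inj₂ (refl , refl))
    ]′ (ordered (Adj⇒≢ G wv))
   same : ∀ {e e' v} → proj₁ e Fin.< proj₂ e → proj₁ e' Fin.< proj₂ e' → Spoke e v → Spoke e' v → e ≡ e'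
   same _ _ (inj₁ (refl , refl)) (inj₁ (refl , refl)) = refl
   same l l' (inj₁ (refl , refl)) (inj₂ (refl , refl)) = contradiction l' (ℕ.<-asym l)
   same l l' (inj₂ (refl , refl)) (inj₁ (refl , refl)) = contradiction l' (ℕ.<-asym l)
   same _ _ (inj₂ (refl , refl)) (inj₂ (refl , refl)) = refl
   same' : ∀ {e v v'} → Adj G w v → Adj G w v' → Spoke e v → Spoke e v' → v ≡ v'
   same' _ _ (inj₁ (refl , refl)) (inj₁ (refl , refl)) = refl
   same' _ a' (inj₁ (refl , refl)) (inj₂ (refl , refl)) = contradiction refl (Adj⇒≢ G a')
   same' _ a' (inj₂ (refl , refl)) (inj₁ (refl , refl)) = contradiction refl (Adj⇒≢ G a')
   same' _ _ (inj₂ (refl , refl)) (inj₂ (refl , refl)) = refl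

  rims : length (listing λ e → local? e ×-dec ¬? (spoked? e)) ≡ length triangles
  rims = count≡ (λ e c → c ≡ ⟦_⟧ G (w ∷ proj₁ e ∷ proj₂ e ∷ [])) listing-unique listing-unique
   (λ e∈ → forth (listed⁻ e∈))
   (λ c∈ → let (cyc , c⊆) , w∈ = listed⁻ c∈ ; x , y , t = triangle-at cyc (λ x∈ → c⊆ x∈) w∈ in back t)
   (λ e∈ e'∈ eq eq' → same (listed⁻ e∈) (listed⁻ e'∈) (trans (sym eq) eq'))
   (λ _ _ eq eq' → trans eq (sym eq'))
   where
   forth : ∀ {e} → Rim e → ∃[ c ] c ∈ triangles × c ≡ ⟦_⟧ G (w ∷ proj₁ e ∷ proj₂ e ∷ [])
   forth {x , y} (((_ , a) , x∈ , y∈) , ¬p) = _ , listed⁺ ((triangle-cyc G wx wy a , λ {_} z∈ → in-B (∈⟦⟧⁻ G z∈)) , ∈⟦⟧⁺ G 1st) , refl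
    where
    wx : Adj G w x
    wx = N⇒adj (Subset.x∈p∧x≢y⇒x∈p-y x∈ (¬p ∘ inj₁))
    wy : Adj G w y
    wy = N⇒adj (Subset.x∈p∧x≢y⇒x∈p-y y∈ (¬p ∘ inj₂))
    in-B : ∀ {z} → z ∈ w ∷ x ∷ y ∷ [] → z ∊ B
    in-B 1st = ∈-nbhd⁺ G (inj₁ refl)
    in-B 2nd = x∈
    in-B 3rd = y∈
   rim : ∀ {x y} → x Fin.< y → Adj G w x → Adj G w y → Adj G x y → (x , y) ∈ listing (λ e → local? e ×-dec ¬? (spoked? e))
   rim x<y wx wy a = listed⁺ (((x<y , a) , ∈-nbhd⁺ G (inj₂ wx) , ∈-nbhd⁺ G (inj₂ wy)) , [ ≢-sym (Adj⇒≢ G wx) , ≢-sym (Adj⇒≢ G wy) ]′)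
   back : ∀ {c x y} → Triangle x y c → ∃[ e ] e ∈ listing (λ e → local? e ×-dec ¬? (spoked? e)) × c ≡ ⟦_⟧ G (w ∷ proj₁ e ∷ proj₂ e ∷ [])
   back {x = x} {y} (wx , wy , a , c≡) = [ (λ x<y → (x , y) , rim x<y wx wy a , c≡)
    , (λ y<x → (y , x) , rim y<x wy wx (Adj-sym G a) ,
     trans c≡ (Subset.⊆-antisym (λ z∈ → ∈⟦⟧⁺ G (swap (∈⟦⟧⁻ G z∈))) (λ z∈ → ∈⟦⟧⁺ G (swap (∈⟦⟧⁻ G z∈))))) ]′ (ordered (Adj⇒≢ G a))
    where
    swap : ∀ {x y z} → z ∈ w ∷ x ∷ y ∷ [] → z ∈ w ∷ y ∷ x ∷ []
    swap (here e) = here e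
    swap (there (here e)) = there (there (here e))
    swap (there (there (here e))) = there (here e)
   same : ∀ {e e'} → Rim e → Rim e' → ⟦_⟧ G (w ∷ proj₁ e ∷ proj₂ e ∷ []) ≡ ⟦_⟧ G (w ∷ proj₁ e' ∷ proj₂ e' ∷ []) → e ≡ e'
   same {x , y} {x' , y'} (((l , _) , _) , ¬p) (((l' , _) , _) , _) eq
    with ∈⟦⟧⁻ G (subst (x ∊_) eq (∈⟦⟧⁺ G 2nd)) | ∈⟦⟧⁻ G (subst (y ∊_) eq (∈⟦⟧⁺ G 3rd))
   ... | here e | _ = contradiction (inj₁ e) ¬p
   ... | there _ | here e = contradiction (inj₂ e) ¬p
   ... | there 1st | there 1st = contradiction l (ℕ.<-irrefl refl)
   ... | there 1st | 3rd = refl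
   ... | 3rd | there 1st = contradiction l' (ℕ.<-asym l)
   ... | 3rd | 3rd = contradiction l (ℕ.<-irrefl refl)

  vertices : ∣ B ∣ ≡ suc (length (listing (adj? G w)))
  vertices = trans (sym (card B)) (count≡ _≡_ listing-unique
   (All.tabulate (λ x∈ w≡x → Adj⇒≢ G (listed⁻ x∈) w≡x) ∷ listing-unique)
   (λ {x} x∈ → x , [ here , (λ wx → there (listed⁺ wx)) ]′ (∈-nbhd⁻ G (listed⁻ x∈)) , refl)
   (λ { {x} (here e) → x , listed⁺ (∈-nbhd⁺ G (inj₁ e)) , refl ; {x} (there x∈) → x , listed⁺ (∈-nbhd⁺ G (inj₂ (listed⁻ x∈))) , refl })
   (λ _ _ e e' → trans e (sym e')) (λ _ _ e e' → trans (sym e) e'))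

 edges-cone : suc (length localEdges) ≡ length triangles + ∣ B ∣
 edges-cone = trans (cong suc (trans (listing-split local? spoked?) (cong₂ ℕ._+_ rims spokes)))
  (trans (sym (ℕ.+-suc (length triangles) _)) (cong (length triangles +_) (sym vertices)))

≐-trans : ∀ {n} {X Y Z : PartialGraph n} → X ≐ Y → Y ≐ Z → X ≐ Z
≐-trans (equal v e) (equal v' e') = equal
 (λ x → mk⇔ (Equivalence.to (v' x) ∘ Equivalence.to (v x)) (Equivalence.from (v x) ∘ Equivalence.from (v' x)))
 (λ x y → mk⇔ (Equivalence.to (e' x y) ∘ Equivalence.to (e x y)) (Equivalence.from (e x y) ∘ Equivalence.from (e' x y)))

isCycle-≐ : ∀ {n} {X Y : PartialGraph n} → Y ≐ X → IsCycle X → IsCycle Y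
isCycle-≐ e (c , cs , u , l , eq) = c , cs , u , l , ≐-trans e eq

isSolid-≐ : ∀ {n} {X Y : PartialGraph n} → Y ≐ X → IsSolid X → IsSolid Y
isSolid-≐ e (inj₁ (a , c , cs , u , l , N , N⊆ , l' , eq)) = inj₁ (a , c , cs , u , l , N , N⊆ , l' , ≐-trans e eq)
isSolid-≐ e (inj₂ (inj₁ (a , b , I , J , K , u , l , l' , l″ , eq))) = inj₂ (inj₁ (a , b , I , J , K , u , l , l' , l″ , ≐-trans e eq))
isSolid-≐ e (inj₂ (inj₂ (inj₁ (r , s , t , x , I , J , K , u , eq)))) = inj₂ (inj₂ (inj₁ (r , s , t , x , I , J , K , u , ≐-trans e eq)))
isSolid-≐ e (inj₂ (inj₂ (inj₂ (r , s , t , r' , s' , t' , I , J , K , u , eq)))) =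
 inj₂ (inj₂ (inj₂ (r , s , t , r' , s' , t' , I , J , K , u , ≐-trans e eq)))

restrict : ∀ {n} → Graph n → Subset n → Graph n
restrict G N = record
 { Adj = λ x y → Graph.Adj G x y × x ∊ N × y ∊ N
 ; adj? = λ x y → Graph.adj? G x y ×-dec (x Subset.∈? N) ×-dec (y Subset.∈? N)
 ; sym = λ (a , x∈ , y∈) → Graph.sym G a , y∈ , x∈
 ; irrefl = λ e (a , _) → Graph.irrefl G e a }

module _ {n : ℕ} (G : Graph n) (N : Subset n) where

 private
  induced-restrict : ∀ {T} → T ⊆ N → induced G T ≐ induced (restrict G N) T
  induced-restrict T⊆ = equal (λ _ → mk⇔ id id)
   (λ _ _ → mk⇔ (λ (x∈ , y∈ , a) → x∈ , y∈ , a , T⊆ x∈ , T⊆ y∈) (λ (x∈ , y∈ , a , _) → x∈ , y∈ , a))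

  cyc-in : ∀ {c} → Cyc (restrict G N) c → c ⊆ N
  cyc-in cyc x∈ = proj₁ (proj₂ (Two.xu (cyc-two (restrict G N) cyc x∈)))

  solid-in : ∀ {T} → Solid (restrict G N) T → T ⊆ N
  solid-in solid x∈ = let c , cyc , _ , x∈c = Sphere.cover (solid⇒sphere (restrict G N) solid) x∈ in cyc-in cyc x∈c

 restrict-solids : length (solidList (restrict G N)) ≤ length (solidsIn G N)
 restrict-solids = relation-count _≡_ {solidList (restrict G N)} listing-unique
  (λ {T} T∈ → let solid = listed⁻ T∈ in
   T , listed⁺ (isSolid-≐ (induced-restrict (λ x∈ → solid-in solid x∈)) solid , λ {_} x∈ → solid-in solid x∈) , refl)
  (λ _ _ e e' → trans e (sym e'))

 restrict-cycles : length (cycleList (restrict G N)) ≤ length (cyclesIn G N)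
 restrict-cycles = relation-count _≡_ {cycleList (restrict G N)} listing-unique
  (λ {c} c∈ → let cyc = listed⁻ c∈ in
   c , listed⁺ (isCycle-≐ (induced-restrict (λ x∈ → cyc-in cyc x∈)) cyc , λ {_} x∈ → cyc-in cyc x∈) , refl)
  (λ _ _ e e' → trans e (sym e'))

solid-nonempty : ∀ {n} (G : Graph n) {T} → Solid G T → ∃[ x ] x ∊ T
solid-nonempty G (inj₁ (a , _ , _ , _ , _ , _ , _ , _ , equal v _)) = a , Equivalence.from (v a) (inj₂ (inj₁ refl))
solid-nonempty G (inj₂ (inj₁ (a , _ , _ , _ , _ , _ , _ , _ , _ , equal v _))) = a , Equivalence.from (v a) (inj₁ (inj₁ 1st))
solid-nonempty G (inj₂ (inj₂ (inj₁ (t , _ , _ , _ , _ , _ , _ , _ , equal v _)))) = t , Equivalence.from (v t) (inj₁ (inj₁ (inj₁ 1st)))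
solid-nonempty G (inj₂ (inj₂ (inj₂ (t , _ , _ , _ , _ , _ , _ , _ , _ , _ , equal v _)))) = t , Equivalence.from (v t) (inj₁ (inj₁ (inj₁ (inj₁ 1st))))

K₄ : ∀ {m} (K : Graph m) {a b d e} → Adj K a b → Adj K a d → Adj K b d → Adj K a e → Adj K b e → Adj K d e →
 Solid K (_+v_ K (⟦_⟧ K (a ∷ b ∷ d ∷ [])) e)
K₄ K {a} {b} {d} {e} ab ad bd ae be de = hub⇒solid K record
 { cyc = triangle-cyc K ab ad bd ; q∉ = λ e∈ → apart (∈⟦⟧⁻ K e∈)
 ; s∈ = ∈⟦⟧⁺ K 1st ; t∈ = ∈⟦⟧⁺ K 2nd ; u∈ = ∈⟦⟧⁺ K 3rd
 ; qs = Adj-sym K ae ; qt = Adj-sym K be ; qu = Adj-sym K de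
 ; s≢t = Adj⇒≢ K ab ; s≢u = Adj⇒≢ K ad ; t≢u = Adj⇒≢ K bd ; T≡ = refl }
 where
 apart : e ∉ a ∷ b ∷ d ∷ []
 apart (here e≡) = Adj⇒≢ K ae (sym e≡)
 apart (there (here e≡)) = Adj⇒≢ K be (sym e≡)
 apart (there (there (here e≡))) = Adj⇒≢ K de (sym e≡)

module Clique {m : ℕ} (K : Graph m) (Z : Subset m) (clique : IsClique K Z) where

 clique-cycle : ∀ {c} → Cyc K c → c ⊆ Z → ∃[ a ] ∃[ b ] ∃[ d ] Adj K a b × Adj K a d × Adj K b d × c ≡ ⟦_⟧ K (a ∷ b ∷ d ∷ [])
 clique-cycle {c} cyc c⊆ = a , b , d , ab , ad , bd' , Subset.⊆-antisym
  (λ x∈ → ∈⟦⟧⁺ K (cyc-triangle K cyc a∈ b∈ d∈ ab ad bd' x∈)) (λ x∈ → back (∈⟦⟧⁻ K x∈))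
  where
  a : Fin m
  a = proj₁ (cyc-nonempty K cyc)
  a∈ : a ∊ c
  a∈ = proj₂ (cyc-nonempty K cyc)
  open Two (cyc-two K cyc a∈) renaming (u to b; w to d; u∈ to b∈; w∈ to d∈; xu to ab; xw to ad)
  bd' : Adj K b d
  bd' = clique b d (c⊆ b∈) (c⊆ d∈) u≢w
  back : ∀ {x} → x ∈ a ∷ b ∷ d ∷ [] → x ∊ c
  back 1st = a∈
  back 2nd = b∈
  back 3rd = d∈

 record FourSet (T : Subset m) : Set where
  field
   {a b d e} : Fin m
   ab : Adj K a b
   ad : Adj K a d
   bd : Adj K b d
   e∉ : e ∉ a ∷ b ∷ d ∷ []
   T≡ : T ≡ _+v_ K (⟦_⟧ K (a ∷ b ∷ d ∷ [])) e

 clique-solid : ∀ {T} → Solid K T → T ⊆ Z → FourSet T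
 clique-solid {T} solid T⊆ =
  let _ , x∈ = solid-nonempty K solid ; c , cyc , c⊆ , _ = Sphere.cover (solid⇒sphere K solid) x∈
      a , b , d , ab , ad , bd , c≡ = clique-cycle cyc (λ x∈ → T⊆ (c⊆ x∈)) in
  from-face cyc (λ x∈ → c⊆ x∈) ab ad bd c≡
  where
  from-face : ∀ {c a b d} → Cyc K c → c ⊆ T → Adj K a b → Adj K a d → Adj K b d → c ≡ ⟦_⟧ K (a ∷ b ∷ d ∷ []) → FourSet T
  from-face {c} {a} {b} {d} cyc c⊆ ab ad bd refl =
   let c' , c'∈ , c'≢ , _ = par-other _≟ₛ_ (λ c → mem c a ∧ mem c b)
        (cycs-unique K T) (∈-cycs K cyc (λ x∈ → c⊆ x∈))
        (cong₂ _∧_ (∈⇒mem (∈⟦⟧⁺ K 1st)) (∈⇒mem (∈⟦⟧⁺ K 2nd)))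
        (Sphere.closed (solid⇒sphere K solid) a b ab)
       cyc' , c'⊆ = All.lookup (cycs-in K T) c'∈
       e , e∈ , e∉ = outside-vertex K c {c'} (λ c'⊆c → c'≢ (cyc-antichain K cyc cyc' (λ x∈ → c'⊆c x∈))) in
   record { ab = ab ; ad = ad ; bd = bd ; e∉ = λ e∈c → e∉ (∈⟦⟧⁺ K e∈c) ; T≡ = fourth (c'⊆ e∈) e∉ }
   where
   fourth : ∀ {e} → e ∊ T → e ∉ₛ c → T ≡ _+v_ K c e
   fourth {e} e∈ e∉ = sym (solid-antichain K {c = c}
    (K₄ K ab ad bd (near 1st) (near 2nd) (near 3rd)) solid sub cyc (⊆+v K))
    where
    near : ∀ {x} → x ∈ a ∷ b ∷ d ∷ [] → Adj K x e
    near {x} x∈ = clique x e (T⊆ (c⊆ (∈⟦⟧⁺ K x∈))) (T⊆ e∈) λ { refl → e∉ (∈⟦⟧⁺ K x∈) }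
    sub : _+v_ K c e ⊆ T
    sub x∈ = [ (λ x∈c → c⊆ x∈c) , (λ { refl → e∈ }) ]′ (∈+v⁻ K x∈)

embed : ∀ {m n} (xs : List (Fin m)) (ys : List (Fin n)) → Unique xs → Unique ys → length xs ≤ length ys → Fin n →
 Σ (Fin m → Fin n) λ f → (∀ {x} → x ∈ xs → f x ∈ ys) × (∀ {x y} → x ∈ xs → y ∈ xs → f x ≡ f y → x ≡ y)
embed [] ys u u' l d = (λ _ → d) , (λ ()) , (λ ())
embed {m} {n} (a ∷ xs) (b ∷ ys) (a∉ ∷ u) (b∉ ∷ u') (s≤s l) d with embed xs ys u u' l d
... | f , into , inj = f' , into' , inj'
 where
 f' : Fin m → Fin n
 f' x with x ≟ a
 ... | yes _ = b
 ... | no _ = f x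
 into' : ∀ {x} → x ∈ a ∷ xs → f' x ∈ b ∷ ys
 into' {x} x∈ with x ≟ a
 into' x∈ | yes _ = here refl
 into' (here e) | no x≢a = contradiction e x≢a
 into' (there x∈) | no _ = there (into x∈)
 tail : ∀ {x} → x ∈ a ∷ xs → x ≢ a → x ∈ xs
 tail (here e) x≢a = contradiction e x≢a
 tail (there x∈) _ = x∈
 inj' : ∀ {x y} → x ∈ a ∷ xs → y ∈ a ∷ xs → f' x ≡ f' y → x ≡ y
 inj' {x} {y} x∈ y∈ eq with x ≟ a | y ≟ a
 ... | yes refl | yes refl = refl
 ... | yes _ | no y≢a = contradiction eq (All.lookup b∉ (into (tail y∈ y≢a)))
 ... | no x≢a | yes _ = contradiction (sym eq) (All.lookup b∉ (into (tail x∈ x≢a)))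
 ... | no x≢a | no y≢a = inj (tail x∈ x≢a) (tail y∈ y≢a) eq

module CliqueEmbedding {m n : ℕ} (K : Graph m) {Z : Subset m} (clique : IsClique K Z)
 (G : Graph n) {Z' : Subset n} (clique' : IsClique G Z')
 (f : Fin m → Fin n) (into : ∀ {x} → x ∊ Z → f x ∊ Z')
 (inj : ∀ {x y} → x ∊ Z → y ∊ Z → f x ≡ f y → x ≡ y) where

 open Clique K Z clique

 private
  adj : ∀ {x y} → x ∊ Z → y ∊ Z → x ≢ y → Adj G (f x) (f y)
  adj x∈ y∈ x≢y = clique' _ _ (into x∈) (into y∈) (x≢y ∘ inj x∈ y∈)

  image-injective : ∀ {T T'} → T ⊆ Z → T' ⊆ Z → image f T ≡ image f T' → T ⊆ T'
  image-injective {T} {T'} T⊆ T'⊆ eq {x} x∈ with ∈-image⁻ f T' (subst (f x ∊_) eq (∈-image⁺ f T x∈))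
  ... | y , y∈ , fy = subst (_∊ T') (inj (T'⊆ y∈) (T⊆ x∈) fy) y∈

  image-⟦⟧ : ∀ xs → image f (⟦_⟧ K xs) ≡ ⟦_⟧ G (map f xs)
  image-⟦⟧ xs = Subset.⊆-antisym
   (λ a∈ → let x , x∈ , e = ∈-image⁻ f (⟦_⟧ K xs) a∈ in ∈⟦⟧⁺ G (subst (_∈ map f xs) e (∈-map⁺ f (∈⟦⟧⁻ K x∈))))
   (λ a∈ → let x , x∈ , e = ∈-map⁻ f (∈⟦⟧⁻ G a∈) in subst (_∊ image f (⟦_⟧ K xs)) (sym e) (∈-image⁺ f (⟦_⟧ K xs) (∈⟦⟧⁺ K x∈)))

  image-+v : ∀ c e → image f (_+v_ K c e) ≡ _+v_ G (image f c) (f e)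
  image-+v c e = Subset.⊆-antisym to from
   where
   to : image f (_+v_ K c e) ⊆ _+v_ G (image f c) (f e)
   to a∈ with ∈-image⁻ f (_+v_ K c e) a∈
   ... | x , x∈ , refl with ∈+v⁻ K x∈
   ... | inj₁ x∈c = ⊆+v G (∈-image⁺ f c x∈c)
   ... | inj₂ refl = q∈+v G
   from : _+v_ G (image f c) (f e) ⊆ image f (_+v_ K c e)
   from a∈ with ∈+v⁻ G a∈
   ... | inj₂ refl = ∈-image⁺ f (_+v_ K c e) (q∈+v K)
   ... | inj₁ a∈c with ∈-image⁻ f c a∈c
   ... | x , x∈ , refl = ∈-image⁺ f (_+v_ K c e) (⊆+v K x∈)

 cycles-embed : length (cyclesIn K Z) ≤ length (cycleList G)
 cycles-embed = relation-count (λ c c' → c' ≡ image f c) listing-unique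
  (λ {c} c∈ → let cyc , c⊆ = listed⁻ c∈ ; a , b , d , ab , ad , bd , c≡ = clique-cycle cyc (λ x∈ → c⊆ x∈) in
   image f c , listed⁺ (triple ab ad bd c≡ (λ x∈ → c⊆ x∈)) , refl)
  (λ c∈ d∈ e e' → Subset.⊆-antisym (image-injective (λ x∈ → proj₂ (listed⁻ c∈) x∈) (λ x∈ → proj₂ (listed⁻ d∈) x∈) (trans (sym e) e'))
   (image-injective (λ x∈ → proj₂ (listed⁻ d∈) x∈) (λ x∈ → proj₂ (listed⁻ c∈) x∈) (trans (sym e') e)))
  where
  triple : ∀ {c a b d} → Adj K a b → Adj K a d → Adj K b d → c ≡ ⟦_⟧ K (a ∷ b ∷ d ∷ []) → c ⊆ Z → Cyc G (image f c)
  triple {a = a} {b} {d} ab ad bd refl c⊆ = subst (Cyc G) (sym (image-⟦⟧ (a ∷ b ∷ d ∷ [])))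
   (triangle-cyc G (adj a∈ b∈ (Adj⇒≢ K ab)) (adj a∈ d∈ (Adj⇒≢ K ad)) (adj b∈ d∈ (Adj⇒≢ K bd)))
   where
   a∈ : a ∊ Z
   a∈ = c⊆ (∈⟦⟧⁺ K 1st)
   b∈ : b ∊ Z
   b∈ = c⊆ (∈⟦⟧⁺ K 2nd)
   d∈ : d ∊ Z
   d∈ = c⊆ (∈⟦⟧⁺ K 3rd)

 solids-embed : length (solidsIn K Z) ≤ length (solidList G)
 solids-embed = relation-count (λ T T' → T' ≡ image f T) listing-unique
  (λ {T} T∈ → let solid , T⊆ = listed⁻ T∈ in
   image f T , listed⁺ (four (clique-solid solid (λ x∈ → T⊆ x∈)) (λ x∈ → T⊆ x∈)) , refl)
  (λ S∈ T∈ e e' → Subset.⊆-antisym (image-injective (λ x∈ → proj₂ (listed⁻ S∈) x∈) (λ x∈ → proj₂ (listed⁻ T∈) x∈) (trans (sym e) e'))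
   (image-injective (λ x∈ → proj₂ (listed⁻ T∈) x∈) (λ x∈ → proj₂ (listed⁻ S∈) x∈) (trans (sym e') e)))
  where
  four : ∀ {T} → FourSet T → T ⊆ Z → Solid G (image f T)
  four {T} record { a = a ; b = b ; d = d ; e = e ; ab = ab ; ad = ad ; bd = bd ; e∉ = e∉ ; T≡ = refl } T⊆ = subst (Solid G)
   (sym (trans (image-+v (⟦_⟧ K (a ∷ b ∷ d ∷ [])) e) (cong (λ c → _+v_ G c (f e)) (image-⟦⟧ (a ∷ b ∷ d ∷ [])))))
   (K₄ G (adj a∈ b∈ (Adj⇒≢ K ab)) (adj a∈ d∈ (Adj⇒≢ K ad)) (adj b∈ d∈ (Adj⇒≢ K bd))
    (adj a∈ e∈ λ { refl → e∉ 1st }) (adj b∈ e∈ λ { refl → e∉ 2nd })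
    (adj d∈ e∈ λ { refl → e∉ 3rd }))
   where
   a∈ : a ∊ Z
   a∈ = T⊆ (⊆+v K (∈⟦⟧⁺ K 1st))
   b∈ : b ∊ Z
   b∈ = T⊆ (⊆+v K (∈⟦⟧⁺ K 2nd))
   d∈ : d ∊ Z
   d∈ = T⊆ (⊆+v K (∈⟦⟧⁺ K 3rd))
   e∈ : e ∊ Z
   e∈ = T⊆ (q∈+v K)

AtLeast : ∀ {m n} → Graph m → Subset m → Graph n → Set
AtLeast K Z G = length (solidsIn K Z) ≤ length (solidList G) × length (cyclesIn K Z) ≤ length (cycleList G)

larger-clique : ∀ {m n} (K : Graph m) (Z : Subset m) (G : Graph n) (Z' : Subset n) →
 IsClique K Z → IsClique G Z' → ∣ Z ∣ ≤ ∣ Z' ∣ → AtLeast K Z G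
larger-clique {m} {n} K Z G Z' clique clique' l = go (Fin.any? (Subset._∈? Z'))
 where
 L : List (Fin m)
 L = listing (Subset._∈? Z)
 L' : List (Fin n)
 L' = listing (Subset._∈? Z')
 sizes : length L ≤ length L'
 sizes = ℕ.≤-trans (ℕ.≤-reflexive (card Z)) (ℕ.≤-trans l (ℕ.≤-reflexive (sym (card Z'))))
 nonempty : ∀ {x} → x ∊ Z → ∃[ y ] y ∊ Z'
 nonempty {x} x∈ = let y , y∈ = inhabited L L' (listed⁺ x∈) sizes in
  y , listed⁻ y∈
  where
  inhabited : ∀ (xs : List (Fin m)) (ys : List (Fin n)) → x ∈ xs → length xs ≤ length ys → ∃[ y ] y ∈ ys
  inhabited (_ ∷ _) (y ∷ _) _ _ = y , here refl
 into-clique : ∃[ d ] d ∊ Z' → AtLeast K Z G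
 into-clique (d , _) = E.solids-embed , E.cycles-embed
  where
  e : Σ (Fin m → Fin n) λ f → (∀ {x} → x ∈ L → f x ∈ L') × (∀ {x y} → x ∈ L → y ∈ L → f x ≡ f y → x ≡ y)
  e = embed L L' listing-unique listing-unique sizes d
  module E = CliqueEmbedding K clique G clique' (proj₁ e)
   (λ x∈ → listed⁻ (proj₁ (proj₂ e) (listed⁺ x∈))) (λ x∈ y∈ → proj₂ (proj₂ e) (listed⁺ x∈) (listed⁺ y∈))
 go : Dec (∃[ d ] d ∊ Z') → AtLeast K Z G
 go (yes d) = into-clique d
 go (no none) =
  relation-count (λ _ _ → ⊥) {solidsIn K Z} { solidList G} listing-unique (λ T∈ → let solid , T⊆ = listed⁻ T∈ in
   contradiction (nonempty (T⊆ (proj₂ (solid-nonempty K solid)))) none) (λ _ _ ()) ,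
  relation-count (λ _ _ → ⊥) {cyclesIn K Z} { cycleList G} listing-unique (λ c∈ → let cyc , c⊆ = listed⁻ c∈ in
   contradiction (nonempty (c⊆ (proj₂ (cyc-nonempty K cyc)))) none) (λ _ _ ())

sum-≤ : ∀ {a b c d a' b' c' d'} → a ≡ b + (c + d) → a' ≡ b' + (c' + d') → b ≤ b' → c ≤ c' → d ≤ d' → a ≤ a'
sum-≤ refl refl b≤ c≤ d≤ = ℕ.+-mono-≤ b≤ (ℕ.+-mono-≤ c≤ d≤)

image-size : ∀ {n m} (q : Fin n → Fin m) S → ∣ image q S ∣ ≤ ∣ S ∣
image-size q S = subst (_≤ ∣ S ∣) (card (image q S)) (subst (length (listing (Subset._∈? image q S)) ≤_) (card S)
 (relation-count (λ a x → q x ≡ a) listing-unique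
  (λ a∈ → let x , x∈ , e = ∈-image⁻ q S (listed⁻ a∈) in x , listed⁺ x∈ , e)
  (λ _ _ e e' → trans (sym e) e')))

module _ {n m : ℕ} {G : Graph n} {H : Graph m} {w : Fin n} {q : Fin n → Fin m} (F : Fold G H w q) where

 open Fold F

 private
  module CG = Cone G w
  module CH = Cone H (q w)

 triangles-fold : length CH.triangles ≤ length CG.triangles
 triangles-fold = relation-count (λ c c' → c ≡ image q c') {ys = CG.triangles} listing-unique
  (λ c∈ → let (cyc , c⊆) , w∈ = listed⁻ c∈ ; _ , _ , t = CH.triangle-at cyc (λ x∈ → c⊆ x∈) w∈ in lifted t)
  (λ _ _ e e' → trans e (sym e'))
  where
  lifted : ∀ {a b c} → CH.Triangle a b c → ∃[ c' ] c' ∈ CG.triangles × c ≡ image q c'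
  lifted {c = c} (wa , wb , ab , c≡) with adj⁻ ab
  ... | x , y , refl , refl , xy = ⟦_⟧ G (w ∷ x ∷ y ∷ []) ,
   listed⁺ ((triangle-cyc G (adj wa) (adj wb) xy , λ {_} z∈ → in-B (∈⟦⟧⁻ G z∈)) , ∈⟦⟧⁺ G 1st) ,
   trans c≡ (Subset.⊆-antisym (λ a∈ → to (∈⟦⟧⁻ H a∈)) from)
   where
   adj : ∀ {z} → Adj H (q w) (q z) → Adj G w z
   adj a = [ (λ { refl → contradiction refl (Adj⇒≢ H a) }) , id ]′ (∈-nbhd⁻ G (W⇒B (∈-nbhd⁺ H (inj₂ a))))
   in-B : ∀ {z} → z ∈ w ∷ x ∷ y ∷ [] → z ∊ B
   in-B 1st = ∈-nbhd⁺ G (inj₁ refl)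
   in-B 2nd = ∈-nbhd⁺ G (inj₂ (adj wa))
   in-B 3rd = ∈-nbhd⁺ G (inj₂ (adj wb))
   to : ∀ {a} → a ∈ q w ∷ q x ∷ q y ∷ [] → a ∊ image q (⟦_⟧ G (w ∷ x ∷ y ∷ []))
   to 1st = ∈-image⁺ q _ (∈⟦⟧⁺ G 1st)
   to 2nd = ∈-image⁺ q _ (∈⟦⟧⁺ G 2nd)
   to 3rd = ∈-image⁺ q _ (∈⟦⟧⁺ G 3rd)
   from : image q (⟦_⟧ G (w ∷ x ∷ y ∷ [])) ⊆ ⟦_⟧ H (q w ∷ q x ∷ q y ∷ [])
   from a∈ = let z , z∈ , e = ∈-image⁻ q (⟦_⟧ G (w ∷ x ∷ y ∷ [])) a∈ in
    ∈⟦⟧⁺ H (subst (_∈ q w ∷ q x ∷ q y ∷ []) e (∈-map⁺ q (∈⟦⟧⁻ G z∈)))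

 fold-≤ : AtLeast H CH.N (restrict G CG.N) →
  length (solidList H) ≤ length (solidList G) × length (cycleList H) ≤ length (cycleList G)
 fold-≤ (s , c) = sum-≤ hs gs (RelativeCount.solids≤ F) S≤ C≤ , sum-≤ hc gc (RelativeCount.cycles≤ F) C≤ triangles-fold
  where
  S≤ : length (solidsIn H CH.N) ≤ length (solidsIn G CG.N)
  S≤ = ℕ.≤-trans s (restrict-solids G CG.N)
  C≤ : length (cyclesIn H CH.N) ≤ length (cyclesIn G CG.N)
  C≤ = ℕ.≤-trans c (restrict-cycles G CG.N)
  hs : length (solidList H) ≡ length (relSolids H W) + (length (solidsIn H CH.N) + length (cyclesIn H CH.N))
  hs = trans (solids-relative H W) (cong (length (relSolids H W) +_) CH.solids-cone)
  gs : length (solidList G) ≡ length (relSolids G B) + (length (solidsIn G CG.N) + length (cyclesIn G CG.N))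
  gs = trans (solids-relative G B) (cong (length (relSolids G B) +_) CG.solids-cone)
  hc : length (cycleList H) ≡ length (relCycles H W) + (length (cyclesIn H CH.N) + length CH.triangles)
  hc = trans (cycles-relative H W) (cong (length (relCycles H W) +_) CH.cycles-cone)
  gc : length (cycleList G) ≡ length (relCycles G B) + (length (cyclesIn G CG.N) + length CG.triangles)
  gc = trans (cycles-relative G B) (cong (length (relCycles G B) +_) CG.cycles-cone)

Colouring : ∀ {n} → Graph n → ℕ → Set
Colouring {n} G j = Σ (Fin n → ℕ) λ c → (∀ x → c x < j) × (∀ {x y} → Graph.Adj G x y → c x ≢ c y)

module LocalColouring {n : ℕ} (G : Graph n) (w : Fin n) where

 N : Subset n
 N = Cone.N G w

 -- A proper colouring of the neighbours of w by representatives of the colour classes.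
 record ColourMap (q : Fin n → Fin n) : Set where
  field
   fixed : ∀ {x} → ¬ Adj G w x → q x ≡ x
   stays : ∀ {x} → Adj G w x → Adj G w (q x)
   proper : ∀ {x y} → Adj G w x → Adj G w y → Adj G x y → q x ≢ q y

  fibre : ∀ {x y} → q x ≡ q y → x ≡ y ⊎ (Adj G w x × Adj G w y)
  fibre {x} {y} e with adj? G w x | adj? G w y
  ... | yes wx | yes wy = inj₂ (wx , wy)
  ... | yes wx | no ¬wy = contradiction (subst (Adj G w) (trans e (fixed ¬wy)) (stays wx)) ¬wy
  ... | no ¬wx | yes wy = contradiction (subst (Adj G w) (trans (sym e) (fixed ¬wx)) (stays wy)) ¬wx
  ... | no ¬wx | no ¬wy = inj₁ (trans (sym (fixed ¬wx)) (trans e (fixed ¬wy)))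

 module _ {q : Fin n → Fin n} (cm : ColourMap q) where

  open ColourMap cm

  Joined : Fin n → Fin n → Set
  Joined a b = ∃[ u ] ∃[ v ] q u ≡ a × q v ≡ b × Adj G u v

  joined? : ∀ a b → Dec (Joined a b)
  joined? a b = Fin.any? λ u → Fin.any? λ v → (q u ≟ a) ×-dec (q v ≟ b) ×-dec adj? G u v

  quotient : Graph n
  quotient = record
   { Adj = Joined
   ; adj? = joined?
   ; sym = λ (u , v , e , e' , a) → v , u , e' , e , Adj-sym G a
   ; irrefl = λ { refl (u , v , e , e' , a) →
    [ (λ { refl → Adj⇒≢ G a refl }) , (λ (wu , wv) → proper wu wv a (trans e (sym e'))) ]′ (fibre (trans e (sym e'))) } }

  quotient-fold : (∀ {x y} → Adj G w x → Adj G w y → q x ≢ q y → Joined (q x) (q y)) → Fold G quotient w q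
  quotient-fold clique = record { adj⁺ = λ a → _ , _ , refl , refl , a ; adj⁻ = id ; fibre = fibre ; clique = clique }

  module _ {x y} (wx : Adj G w x) (wy : Adj G w y) (x≁y : q x ≢ q y) (apart : ¬ Joined (q x) (q y)) where

   private
    merge : Fin n → Fin n
    merge a with a ≟ q y
    ... | yes _ = q x
    ... | no _ = a

    merge-spec : ∀ a → (a ≡ q y × merge a ≡ q x) ⊎ (a ≢ q y × merge a ≡ a)
    merge-spec a with a ≟ q y
    ... | yes e = inj₁ (e , refl)
    ... | no a≢ = inj₂ (a≢ , refl)

   merged : ∃[ q' ] ColourMap q' × ∣ image q' N ∣ < ∣ image q N ∣
   merged = merge ∘ q , record { fixed = fixed' ; stays = stays' ; proper = proper' } ,
    ℕ.≤-<-trans (Subset.p⊆q⇒∣p∣≤∣q∣ {p = image (merge ∘ q) N} {q = image q N Subset.- q y} smaller)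
     (Subset.x∈p⇒∣p-x∣<∣p∣ (∈-image⁺ q N (Cone.adj⇒N G w wy)))
    where
    fixed' : ∀ {z} → ¬ Adj G w z → merge (q z) ≡ z
    fixed' {z} ¬wz with merge-spec (q z)
    ... | inj₁ (e , _) = contradiction (subst (Adj G w) (trans (sym e) (fixed ¬wz)) (stays wy)) ¬wz
    ... | inj₂ (_ , e) = trans e (fixed ¬wz)
    stays' : ∀ {z} → Adj G w z → Adj G w (merge (q z))
    stays' {z} wz with merge-spec (q z)
    ... | inj₁ (_ , e) = subst (Adj G w) (sym e) (stays wx)
    ... | inj₂ (_ , e) = subst (Adj G w) (sym e) (stays wz)
    proper' : ∀ {u v} → Adj G w u → Adj G w v → Adj G u v → merge (q u) ≢ merge (q v)
    proper' {u} {v} wu wv uv e with merge-spec (q u) | merge-spec (q v)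
    ... | inj₁ (e₁ , _) | inj₁ (e₂ , _) = proper wu wv uv (trans e₁ (sym e₂))
    ... | inj₁ (e₁ , m₁) | inj₂ (_ , m₂) = apart (v , u , trans (sym m₂) (trans (sym e) m₁) , e₁ , Adj-sym G uv)
    ... | inj₂ (_ , m₁) | inj₁ (e₂ , m₂) = apart (u , v , trans (sym m₁) (trans e m₂) , e₂ , uv)
    ... | inj₂ (_ , m₁) | inj₂ (_ , m₂) = proper wu wv uv (trans (sym m₁) (trans e m₂))
    smaller : image (merge ∘ q) N ⊆ image q N Subset.- q y
    smaller a∈ with ∈-image⁻ (merge ∘ q) N a∈
    ... | z , z∈ , refl with merge-spec (q z)
    ... | inj₁ (_ , e) = subst (_∊ image q N Subset.- q y) (sym e) (Subset.x∈p∧x≢y⇒x∈p-y (∈-image⁺ q N (Cone.adj⇒N G w wx)) x≁y)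
    ... | inj₂ (z≢ , e) = subst (_∊ image q N Subset.- q y) (sym e) (Subset.x∈p∧x≢y⇒x∈p-y (∈-image⁺ q N z∈) z≢)

 id-colours : ColourMap id
 id-colours = record { fixed = λ _ → refl ; stays = id ; proper = λ _ _ → Adj⇒≢ G }

 colouring⇒map : ∀ {j} → Colouring (restrict G N) j → ∃[ q ] ColourMap q × ∣ image q N ∣ ≤ j
 colouring⇒map {j} (c , c< , c≢) = q , record
  { fixed = q-fixed
  ; stays = λ {x} wx → subst (Adj G w) (sym (q-adj wx)) (proj₁ (choice-spec wx))
  ; proper = λ wx wy xy e → c≢ (xy , Cone.adj⇒N G w wx , Cone.adj⇒N G w wy)
   (trans (sym (proj₂ (choice-spec wx))) (trans (cong c (trans (sym (q-adj wx)) (trans e (q-adj wy)))) (proj₂ (choice-spec wy)))) } ,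
  subst (_≤ j) (card (image q N)) (subst (length L ≤_) (List.length-upTo j)
   (relation-count (λ a i → c a ≡ i) {ys = upTo j} listing-unique
    (λ {a} _ → c a , ∈-upTo⁺ (c< a) , refl)
    (λ a∈ b∈ e e' → trans (picked a∈) (trans (cong choice (trans e (sym e'))) (sym (picked b∈))))))
  where
  choice : ℕ → Fin n
  choice k with Fin.any? (λ y → adj? G w y ×-dec (c y ℕ.≟ k))
  ... | yes (y , _) = y
  ... | no _ = w
  choice-spec : ∀ {x} → Adj G w x → Adj G w (choice (c x)) × c (choice (c x)) ≡ c x
  choice-spec {x} wx with Fin.any? (λ y → adj? G w y ×-dec (c y ℕ.≟ c x))
  ... | yes (_ , p) = p
  ... | no none = contradiction (x , wx , refl) none
  q : Fin n → Fin n
  q x with adj? G w x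
  ... | yes _ = choice (c x)
  ... | no _ = x
  q-adj : ∀ {x} → Adj G w x → q x ≡ choice (c x)
  q-adj {x} wx with adj? G w x
  ... | yes _ = refl
  ... | no ¬wx = contradiction wx ¬wx
  q-fixed : ∀ {x} → ¬ Adj G w x → q x ≡ x
  q-fixed {x} ¬wx with adj? G w x
  ... | yes wx = contradiction wx ¬wx
  ... | no _ = refl
  L : List (Fin n)
  L = listing (Subset._∈? image q N)
  picked : ∀ {a} → a ∈ L → a ≡ choice (c a)
  picked {a} a∈ = let z , z∈ , e = ∈-image⁻ q N (listed⁻ a∈)
                      wz = Cone.N⇒adj G w z∈ ; a≡ = trans (sym e) (q-adj wz) in
   trans a≡ (cong choice (sym (trans (cong c a≡) (proj₂ (choice-spec wz)))))

nonisolated : ∀ {n} → Graph n → Subset n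
nonisolated G = Vec.tabulate λ x → does (Fin.any? (Graph.adj? G x))

∈-nonisolated⁺ : ∀ {n} (G : Graph n) {x y} → Graph.Adj G x y → x ∊ nonisolated G
∈-nonisolated⁺ G {x} {y} a = ∈-tabulate⁺ _ (dec-true (Fin.any? (Graph.adj? G x)) (y , a))

∈-nonisolated⁻ : ∀ {n} (G : Graph n) {x} → x ∊ nonisolated G → ∃[ y ] Graph.Adj G x y
∈-nonisolated⁻ G {x} x∈ = does-true (Fin.any? (Graph.adj? G x)) (∈-tabulate⁻ _ x∈)

-- In a disjoint union of complete graphs, colouring each vertex with the
-- number of its smaller neighbours uses no more colours than the largest of them has vertices.
module Cluster {n : ℕ} (G : Graph n) (cluster : ∀ {w x y} → Adj G w x → Adj G w y → x ≢ y → Adj G x y) where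

 below : Fin n → Subset n
 below x = Vec.tabulate λ y → does ((y Fin.<? x) ×-dec adj? G x y)

 ∈-below⁺ : ∀ {x y} → y Fin.< x → Adj G x y → y ∊ below x
 ∈-below⁺ {x} {y} l a = ∈-tabulate⁺ _ (dec-true ((y Fin.<? x) ×-dec adj? G x y) (l , a))

 ∈-below⁻ : ∀ {x y} → y ∊ below x → y Fin.< x × Adj G x y
 ∈-below⁻ {x} {y} y∈ = does-true ((y Fin.<? x) ×-dec adj? G x y) (∈-tabulate⁻ _ y∈)

 increasing : ∀ {x y} → x Fin.< y → Adj G x y → ∣ below x ∣ < ∣ below y ∣
 increasing {x} {y} l a = Subset.p⊂q⇒∣p∣<∣q∣ ((λ {z} z∈ → let z<x , xz = ∈-below⁻ {x} z∈ ; z<y = ℕ.<-trans z<x l in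
  ∈-below⁺ z<y (cluster a xz λ y≡z → ℕ.<-irrefl (cong Fin.toℕ (sym y≡z)) z<y)) ,
  x , ∈-below⁺ l (Adj-sym G a) , λ x∈ → ℕ.<-irrefl refl (proj₁ (∈-below⁻ {x} x∈)))

 ranks : ∀ {x y} → Adj G x y → ∣ below x ∣ ≢ ∣ below y ∣
 ranks {x} {y} a e with Fin.<-cmp x y
 ... | tri< l _ _ = ℕ.<-irrefl e (increasing l a)
 ... | tri≈ _ refl _ = Adj⇒≢ G a refl
 ... | tri> _ _ l = ℕ.<-irrefl (sym e) (increasing l (Adj-sym G a))

 clique : ∀ x → IsClique G (_+v_ G (below x) x)
 clique x y z y∈ z∈ y≢z with ∈+v⁻ G y∈ | ∈+v⁻ G z∈
 ... | inj₁ y∈b | inj₁ z∈b = cluster (proj₂ (∈-below⁻ {x} y∈b)) (proj₂ (∈-below⁻ {x} z∈b)) y≢z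
 ... | inj₁ y∈b | inj₂ refl = Adj-sym G (proj₂ (∈-below⁻ {x} y∈b))
 ... | inj₂ refl | inj₁ z∈b = proj₂ (∈-below⁻ {x} z∈b)
 ... | inj₂ refl | inj₂ refl = contradiction refl y≢z

 clique-size : ∀ x → ∣ below x ∣ < ∣ _+v_ G (below x) x ∣
 clique-size x = Subset.p⊂q⇒∣p∣<∣q∣ (⊆+v G , x , q∈+v G , λ x∈ → ℕ.<-irrefl refl (proj₁ (∈-below⁻ {x} x∈)))

 large-clique : ∀ {k} → (∀ j → Colouring G j → k ≤ j) → ∃[ Z ] IsClique G Z × k ≤ ∣ Z ∣
 large-clique {zero} forced = Subset.⊥ , (λ _ _ x∈ → contradiction x∈ Subset.∉⊥) , z≤n
 large-clique {suc k} forced with Fin.any? (λ x → k ℕ.≤? ∣ below x ∣)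
 ... | yes (x , l) = _+v_ G (below x) x , clique x , ℕ.≤-trans (s≤s l) (clique-size x)
 ... | no none = contradiction (forced k ((λ x → ∣ below x ∣) , (λ x → ℕ.≰⇒> λ l → none (x , l)) , ranks)) (ℕ.<-irrefl refl)

forced-counts : ∀ k {n} (G : Graph n) → ∣ nonisolated G ∣ < k → ∀ {m} (K : Graph m) (Z : Subset m) → IsClique K Z →
 (∀ j → Colouring G j → ∣ Z ∣ ≤ j) → AtLeast K Z G
forced-counts (suc k) {n} G (s≤s bound) K Z clique forced = go
 (Fin.any? λ w → Fin.any? λ x → Fin.any? λ y → adj? G w x ×-dec adj? G w y ×-dec ¬? (x ≟ y) ×-dec ¬? (adj? G x y))
 where
 Open : Set
 Open = ∃[ w ] ∃[ x ] ∃[ y ] Adj G w x × Adj G w y × x ≢ y × ¬ Adj G x y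

 compress : Open → AtLeast K Z G
 compress (w , x , y , wx , wy , x≢y , ¬xy) = decidable-stable
  ((length (solidsIn K Z) ℕ.≤? length (solidList G)) ×-dec (length (cyclesIn K Z) ℕ.≤? length (cycleList G)))
  λ fails → attempt fails (suc n) id id-colours (s≤s (Subset.∣p∣≤n (image id N)))
  where
  open LocalColouring G w

  with-minimal : ∀ q (cm : ColourMap q) → (∀ q' → ColourMap q' → ∣ image q N ∣ ≤ ∣ image q' N ∣) → AtLeast K Z G
  with-minimal q cm minimal = ℕ.≤-trans (proj₁ quotient-counts) (proj₁ folded-counts) , ℕ.≤-trans (proj₂ quotient-counts) (proj₂ folded-counts)
   where
   joined : ∀ {x y} → Adj G w x → Adj G w y → q x ≢ q y → Joined cm (q x) (q y)
   joined {x} {y} wx wy x≁y = decidable-stable (joined? cm (q x) (q y)) λ apart →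
    let q' , cm' , l = merged cm wx wy x≁y apart in ℕ.<⇒≱ l (minimal q' cm')
   H : Graph n
   H = quotient cm
   F : Fold G H w q
   F = quotient-fold cm joined
   collision : ∃[ u ] ∃[ v ] u ≢ v × q u ≡ q v × Adj G w u × Adj G w v
   collision with q x ≟ q y
   ... | yes e = x , y , x≢y , e , wx , wy
   ... | no x≁y with joined wx wy x≁y
   ... | u , v , e , e' , uv with u ≟ x | v ≟ y
   ... | yes refl | yes refl = contradiction uv ¬xy
   ... | no u≢x | _ = u , x , u≢x , e , [ (λ u≡x → contradiction u≡x u≢x) , id ]′ (ColourMap.fibre cm e)
   ... | yes _ | no v≢y = v , y , v≢y , e' , [ (λ v≡y → contradiction v≡y v≢y) , id ]′ (ColourMap.fibre cm e')
   fewer : ∣ nonisolated H ∣ < ∣ nonisolated G ∣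
   fewer = let u , v , u≢v , e , wu , wv = collision in
    ℕ.≤-<-trans (Subset.p⊆q⇒∣p∣≤∣q∣ {p = nonisolated H} {q = image q (nonisolated G Subset.- u)} (sub u≢v e wv))
     (ℕ.≤-<-trans (image-size q (nonisolated G Subset.- u)) (Subset.x∈p⇒∣p-x∣<∣p∣ (∈-nonisolated⁺ G (Adj-sym G wu))))
    where
    sub : ∀ {u v} → u ≢ v → q u ≡ q v → Adj G w v → nonisolated H ⊆ image q (nonisolated G Subset.- u)
    sub {u} {v} u≢v e wv a∈ with ∈-nonisolated⁻ H a∈
    ... | _ , z , _ , refl , _ , a with z ≟ u
    ... | no z≢u = ∈-image⁺ q _ (Subset.x∈p∧x≢y⇒x∈p-y (∈-nonisolated⁺ G a) z≢u)
    ... | yes refl = subst (_∊ image q (nonisolated G Subset.- u)) (sym e)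
     (∈-image⁺ q _ (Subset.x∈p∧x≢y⇒x∈p-y (∈-nonisolated⁺ G (Adj-sym G wv)) (≢-sym u≢v)))
   quotient-counts : AtLeast K Z H
   quotient-counts = forced-counts k H (ℕ.≤-trans fewer bound) K Z clique λ j (c , c< , c≢) →
    forced j (c ∘ q , c< ∘ q , λ a → c≢ (_ , _ , refl , refl , a))
   fewer' : ∣ nonisolated (restrict G N) ∣ < ∣ nonisolated G ∣
   fewer' = Subset.p⊂q⇒∣p∣<∣q∣ ((λ x∈ → ∈-nonisolated⁺ G (proj₁ (proj₂ (∈-nonisolated⁻ (restrict G N) x∈)))) ,
    w , ∈-nonisolated⁺ G wx , λ w∈ → Cone.w∉N G w (proj₁ (proj₂ (proj₂ (∈-nonisolated⁻ (restrict G N) w∈)))))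
   N⊆image : Cone.N H (q w) ⊆ image q N
   N⊆image a∈ with Cone.N⇒adj H (q w) a∈
   ... | u , v , e , refl , uv with Fold.fibre-w F e
   ... | refl = ∈-image⁺ q N (Cone.adj⇒N G w uv)
   folded-counts : length (solidList H) ≤ length (solidList G) × length (cycleList H) ≤ length (cycleList G)
   folded-counts = fold-≤ F (forced-counts k (restrict G N) (ℕ.≤-trans fewer' bound) H (Cone.N H (q w))
    (λ a b a∈ b∈ → Fold.W-clique F (Cone.N⊆B H (q w) a∈) (Cone.N⊆B H (q w) b∈))
    λ j col → let q' , cm' , l = colouring⇒map col in
     ℕ.≤-trans (Subset.p⊆q⇒∣p∣≤∣q∣ {p = Cone.N H (q w)} {q = image q N} N⊆image) (ℕ.≤-trans (minimal q' cm') l))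

  attempt : ¬ AtLeast K Z G → ∀ s q → ColourMap q → ∣ image q N ∣ < s → ⊥
  attempt fails (suc s) q cm (s≤s l) = fails (with-minimal q cm λ q' cm' → ℕ.≮⇒≥ λ l' → attempt fails s q' cm' (ℕ.≤-trans l' l))

 go : Dec Open → AtLeast K Z G
 go (yes found) = compress found
 go (no none)   = let Z' , clique' , l = Cluster.large-clique G (λ {w} {x} {y} wx wy x≢y →
                       decidable-stable (adj? G x y) λ ¬xy → none (w , x , y , wx , wy , x≢y , ¬xy)) forced in
  larger-clique K Z G Z' clique clique' l

edgeList : ∀ {n} → Graph n → List (Fin n × Fin n)
edgeList G = listing λ e → (proj₁ e Fin.<? proj₂ e) ×-dec adj? G (proj₁ e) (proj₂ e)

edges-relative : ∀ {n} (G : Graph n) w → length (edgeList G) ≡ length (relEdges G (closedNeighbourhood G w)) + length (Cone.localEdges G w)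
edges-relative G w = listing-split (λ e → (proj₁ e Fin.<? proj₂ e) ×-dec adj? G (proj₁ e) (proj₂ e))
 λ e → (proj₁ e Subset.∈? closedNeighbourhood G w) ×-dec (proj₂ e Subset.∈? closedNeighbourhood G w)

module _ {n : ℕ} (G : Graph n) where

 opaque
  unfolding solid? cyc?

  solids≡ : solids G ≡ solidList G
  solids≡ = listing≡ (solid? G)

  cycles≡ : inducedCycles G ≡ cycleList G
  cycles≡ = listing≡ (cyc? G)

 edges≡ : ∣E∣ G ≡ length (edgeList G)
 edges≡ = cong length (listing≡ λ e → (proj₁ e Fin.<? proj₂ e) ×-dec adj? G (proj₁ e) (proj₂ e))

record Composite {n m} (G : Graph n) (B : Subset n) (H : Graph m) (W : Subset m) (q : Fin n → Fin m) : Set where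
 field
  surjective : ∀ a → ∃[ x ] q x ≡ a
  fibre : ∀ {x y} → q x ≡ q y → x ≡ y ⊎ (x ∊ B × y ∊ B)
  adj⁺ : ∀ {x y} → Adj G x y → Adj H (q x) (q y)
  adj⁻ : ∀ {a b} → Adj H a b → ∃[ x ] ∃[ y ] q x ≡ a × q y ≡ b × Adj G x y
  image⁺ : ∀ {x} → x ∊ B → q x ∊ W
  image⁻ : ∀ {a} → a ∊ W → ∃[ x ] x ∊ B × q x ≡ a

contractions⇒composite : ∀ {n m} {G : Graph n} {B} {H : Graph m} {W} → Contractions G B H W → Σ (Fin n → Fin m) (Composite G B H W)
contractions⇒composite done = id , record
 { surjective = λ a → a , refl ; fibre = inj₁ ; adj⁺ = id ; adj⁻ = λ a → _ , _ , refl , refl , a ; image⁺ = id ; image⁻ = λ a∈ → _ , a∈ , refl }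
contractions⇒composite (step {G = G} {B} {u} {v} {H} {q} u∈ v∈ c cs) with contractions⇒composite cs
... | q' , comp = q' ∘ q , record
 { surjective = λ a → let b , e = C.surjective a ; x , e' = N.surjective b in x , trans (cong q' e') e
 ; fibre = λ e → [ identified , (λ (x∈ , y∈) → inj₂ (in-B x∈ , in-B y∈)) ]′ (C.fibre e)
 ; adj⁺ = λ {x} {y} a → C.adj⁺ (Equivalence.from (N.adjacency (q x) (q y)) (x , y , refl , refl , a))
 ; adj⁻       = λ a → let b , b' , e , e' , a' = C.adj⁻ a ; x , y , e₁ , e₂ , a″ = Equivalence.to (N.adjacency b b') a' in
  x , y , trans (cong q' e₁) e , trans (cong q' e₂) e' , a″
 ; image⁺ = C.image⁺ ∘ ∈-image⁺ q B
 ; image⁻     = λ a∈ → let b , b∈ , e = C.image⁻ a∈ ; x , x∈ , e' = ∈-image⁻ q B b∈ in x , x∈ , trans (cong q' e') e }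
 where
 module N = NonedgeContraction c
 module C = Composite comp
 identified : ∀ {x y} → q x ≡ q y → x ≡ y ⊎ (x ∊ B × y ∊ B)
 identified {x} {y} e with Equivalence.to (N.identified x y) e
 ... | inj₁ x≡y = inj₁ x≡y
 ... | inj₂ (inj₁ (refl , refl)) = inj₂ (u∈ , v∈)
 ... | inj₂ (inj₂ (refl , refl)) = inj₂ (v∈ , u∈)
 in-B : ∀ {x} → q x ∊ image q B → x ∊ B
 in-B x∈ with ∈-image⁻ q B x∈
 ... | z , z∈ , e = [ (λ { refl → z∈ }) , proj₂ ]′ (identified e)

module Compression {n m : ℕ} {G : Graph n} {w : Fin n} {H : Graph m} {W : Subset m} {q : Fin n → Fin m}
 (comp : Composite G (closedNeighbourhood G w) H W q) (clique : IsClique H W)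
 (forced : ∀ j → Colourable (induced G (closedNeighbourhood G w)) j → ∣ W ∣ ≤ j) where

 private
  module C = Composite comp
  module CG = Cone G w
  module CH = Cone H (q w)

 fold : Fold G H w q
 fold = record
  { adj⁺ = C.adj⁺ ; adj⁻ = C.adj⁻ ; fibre = fibre
  ; clique = λ wx wy → clique _ _ (C.image⁺ (∈-nbhd⁺ G (inj₂ wx))) (C.image⁺ (∈-nbhd⁺ G (inj₂ wy))) }
  where
  fibre : ∀ {x y} → q x ≡ q y → x ≡ y ⊎ (Adj G w x × Adj G w y)
  fibre {x} {y} e = [ inj₁ , (λ (x∈ , y∈) → go (∈-nbhd⁻ G x∈) (∈-nbhd⁻ G y∈)) ]′ (C.fibre e)
   where
   go : x ≡ w ⊎ Adj G w x → y ≡ w ⊎ Adj G w y → x ≡ y ⊎ (Adj G w x × Adj G w y)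
   go (inj₁ refl) (inj₁ refl) = inj₁ refl
   go (inj₁ refl) (inj₂ wy) = contradiction e (Adj⇒≢ H (C.adj⁺ wy))
   go (inj₂ wx) (inj₁ refl) = contradiction (sym e) (Adj⇒≢ H (C.adj⁺ wx))
   go (inj₂ wx) (inj₂ wy) = inj₂ (wx , wy)

 W≡ : W ≡ CH.B
 W≡ = Subset.⊆-antisym
  (λ a∈ → let x , x∈ , e = C.image⁻ a∈ in subst (_∊ CH.B) e (Fold.B⇒W fold x∈))
  (λ a∈ → let x , x∈ , e = Fold.W-lift fold a∈ in subst (_∊ W) e (C.image⁺ x∈))

 colours : ∀ j → Colouring (restrict G CG.N) j → ∣ CH.N ∣ ≤ j
 colours j (c , c< , c≢) = ℕ.≤-pred (ℕ.≤-trans (Subset.x∈p⇒∣p-x∣<∣p∣ {x = q w} {p = CH.B} (∈-nbhd⁺ H (inj₁ refl)))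
  (subst (λ U → ∣ U ∣ ≤ suc j) W≡ (forced (suc j) (c' , (λ x _ → c'< x) , λ x y (x∈ , y∈ , a) → proper (∈-nbhd⁻ G x∈) (∈-nbhd⁻ G y∈) a))))
  where
  c' : Fin n → ℕ
  c' x with x ≟ w
  ... | yes _ = j
  ... | no _ = c x
  c'< : ∀ x → c' x < suc j
  c'< x with x ≟ w
  ... | yes _ = ℕ.≤-refl
  ... | no _ = ℕ.m≤n⇒m≤1+n (c< x)
  proper : ∀ {x y} → x ≡ w ⊎ Adj G w x → y ≡ w ⊎ Adj G w y → Adj G x y → c' x ≢ c' y
  proper {x} {y} x∈ y∈ a with x ≟ w | y ≟ w
  ... | yes refl | yes refl = contradiction refl (Adj⇒≢ G a)
  ... | yes _ | no _ = λ e → ℕ.<-irrefl (sym e) (c< y)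
  ... | no _ | yes _ = λ e → ℕ.<-irrefl e (c< x)
  ... | no x≢w | no y≢w = c≢ (a , CG.adj⇒N ([ (λ e → contradiction e x≢w) , id ]′ x∈) , CG.adj⇒N ([ (λ e → contradiction e y≢w) , id ]′ y∈))

 local-solids : length (solidsIn H CH.N) ≤ length (solidsIn G CG.N)
 local-solids = ℕ.≤-trans (proj₁ (forced-counts (suc ∣ nonisolated (restrict G CG.N) ∣) (restrict G CG.N) ℕ.≤-refl H CH.N
  (λ a b a∈ b∈ → Fold.W-clique fold (CH.N⊆B a∈) (CH.N⊆B b∈)) colours)) (restrict-solids G CG.N)

 vertices : n + ∣ CH.B ∣ ≡ m + ∣ CG.B ∣
 vertices = regroup {length (out CG.B)} {length (out CH.B)} (split CG.B) (split CH.B) outer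
  where
  regroup : ∀ {o o' b b' n m} → n ≡ o + b → m ≡ o' + b' → o ≡ o' → n + b' ≡ m + b
  regroup {o} {b = b} {b'} refl refl refl = trans (ℕ.+-assoc o b b') (trans (cong (o +_) (ℕ.+-comm b b')) (sym (ℕ.+-assoc o b' b)))
  out : ∀ {k} → Subset k → List (Fin k)
  out S = listing λ x → ¬? (x Subset.∈? S)
  split : ∀ {k} (S : Subset k) → k ≡ length (out S) + ∣ S ∣
  split {k} S = trans (sym (Subset.∣⊤∣≡n k)) (trans (sym (card Subset.⊤)) (trans (listing-split (Subset._∈? Subset.⊤) (Subset._∈? S))
   (cong₂ ℕ._+_ (listing-≐ proj₂ (Subset.∈⊤ ,_)) (trans (listing-≐ proj₂ (Subset.∈⊤ ,_)) (card S)))))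
  outer : length (out CG.B) ≡ length (out CH.B)
  outer = count≡ (λ x a → q x ≡ a) listing-unique listing-unique
   (λ {x} x∈ → q x , listed⁺ (listed⁻ x∈ ∘ Fold.W⇒B fold) , refl)
   (λ {a} a∈ → let x , e = C.surjective a in x , listed⁺ (λ x∈ → listed⁻ a∈ (subst (_∊ CH.B) e (Fold.B⇒W fold x∈))) , e)
   (λ x∈ _ e e' → Fold.injective fold (listed⁻ x∈) (trans e (sym e')))
   (λ _ _ e e' → trans (sym e) e')

 counts : (length (solidList H) + length (edgeList H)) + (length (cycleList G) + n) ≤
  (length (solidList G) + length (edgeList G)) + (length (cycleList H) + m)
 counts = combine
  {s = length (relSolids G CG.B)} {length (relSolids H CH.B)} {length (relCycles G CG.B)} {length (relCycles H CH.B)}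
  {length (relEdges G CG.B)} {length (relEdges H CH.B)} {length (solidsIn G CG.N)} {length (solidsIn H CH.N)}
  {length (cyclesIn G CG.N)} {length (cyclesIn H CH.N)} {length CG.triangles} {length CH.triangles}
  (trans (solids-relative G CG.B) (cong (length (relSolids G CG.B) +_) CG.solids-cone))
  (trans (solids-relative H CH.B) (cong (length (relSolids H CH.B) +_) CH.solids-cone))
  (trans (cycles-relative G CG.B) (cong (length (relCycles G CG.B) +_) CG.cycles-cone))
  (trans (cycles-relative H CH.B) (cong (length (relCycles H CH.B) +_) CH.cycles-cone))
  (edges-relative G w) (edges-relative H (q w)) CG.edges-cone CH.edges-cone
  (RelativeCount.relative≤ fold) local-solids vertices
  where
  combine : ∀ {S S' C C' E E' s s' c c' r r' x x' y y' z z' b b' l l' n m} →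
   S ≡ s + (x + y) → S' ≡ s' + (x' + y') → C ≡ c + (y + z) → C' ≡ c' + (y' + z') →
   E ≡ r + l → E' ≡ r' + l' → suc l ≡ z + b → suc l' ≡ z' + b' →
   s' + (c + r') ≤ s + (c' + r) → x' ≤ x → n + b' ≡ m + b →
   (S' + E') + (C + n) ≤ (S + E) + (C' + m)
  combine {s = s} {s'} {c} {c'} {r} {r'} {x} {x'} {y} {y'} {z} {z'} {b} {b'} {l} {l'} {n} {m} refl refl refl refl refl refl el el' rel x≤ nb =
   ℕ.≤-pred (begin
    suc (((s' + (x' + y')) + (r' + l')) + ((c + (y + z)) + n))
   ≡⟨ solve 9 (λ s x y r l c y' z n → con 1 :+ (((s :+ (x :+ y)) :+ (r :+ l)) :+ ((c :+ (y' :+ z)) :+ n)) :=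
    (s :+ (c :+ r)) :+ x :+ ((y :+ y') :+ (z :+ (n :+ (con 1 :+ l))))) refl s' x' y' r' l' c y z n ⟩
    (s' + (c + r')) + x' + ((y' + y) + (z + (n + suc l')))
   ≡⟨ cong (λ k → (s' + (c + r')) + x' + ((y' + y) + (z + k)))
    (trans (cong (n +_) (trans el' (ℕ.+-comm z' b'))) (trans (sym (ℕ.+-assoc n b' z')) (cong (_+ z') nb))) ⟩
    (s' + (c + r')) + x' + ((y' + y) + (z + ((m + b) + z')))
   ≤⟨ ℕ.+-monoˡ-≤ _ (ℕ.+-mono-≤ rel x≤) ⟩
    (s + (c' + r)) + x + ((y' + y) + (z + ((m + b) + z')))
   ≡⟨ solve 10 (λ s c r x y' y z m b z' → (s :+ (c :+ r)) :+ x :+ ((y' :+ y) :+ (z :+ ((m :+ b) :+ z'))) :=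
    (s :+ (c :+ r)) :+ x :+ ((y' :+ y) :+ (z' :+ (m :+ (z :+ b))))) refl s c' r x y' y z m b z' ⟩
    (s + (c' + r)) + x + ((y' + y) + (z' + (m + (z + b))))
   ≡⟨ cong (λ k → (s + (c' + r)) + x + ((y' + y) + (z' + (m + k)))) (sym el) ⟩
    (s + (c' + r)) + x + ((y' + y) + (z' + (m + suc l)))
   ≡⟨ solve 9 (λ s x y r l c y' z n → (s :+ (c :+ r)) :+ x :+ ((y' :+ y) :+ (z :+ (n :+ (con 1 :+ l)))) :=
    con 1 :+ (((s :+ (x :+ y)) :+ (r :+ l)) :+ ((c :+ (y' :+ z)) :+ n))) refl s x y r l c' y' z' m ⟩
    suc (((s + (x + y)) + (r + l)) + ((c' + (y' + z')) + m)) ∎)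
   where
   open ℕ.≤-Reasoning
   open NaturalSolver.+-*-Solver

alternating-≤ : ∀ {s c e v s' c' e' v'} → (s' + e') + (c + v) ≤ (s + e) + (c' + v') →
 pos s' ℤ.- pos c' ℤ.+ pos e' ℤ.- pos v' ℤ.≤ pos s ℤ.- pos c ℤ.+ pos e ℤ.- pos v
alternating-≤ {s} {c} {e} {v} {s'} {c'} {e'} {v'} l = ℤ.≤-trans (ℤ.≤-reflexive (sort s' c' e' v'))
 (ℤ.≤-trans (cross {s + e} {c + v} {s' + e'} {c' + v'} l) (ℤ.≤-reflexive (sym (sort s c e v))))
 where
 sort : ∀ s c e v → pos s ℤ.- pos c ℤ.+ pos e ℤ.- pos v ≡ pos (s + e) ℤ.- pos (c + v)
 sort s c e v = solve 4 (λ s c e v → s :- c :+ e :- v := (s :+ e) :- (c :+ v)) refl (pos s) (pos c) (pos e) (pos v)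
  where open IntegerSolver.+-*-Solver
 cross : ∀ {a b a' b'} → a' + b ≤ a + b' → pos a' ℤ.- pos b' ℤ.≤ pos a ℤ.- pos b
 cross {a} {b} {a'} {b'} l = begin
  pos a' ℤ.- pos b'
  ≡⟨ trans (ℤ.m-n≡m⊖n a' b') (sym (ℤ.+-cancelˡ-⊖ b a' b')) ⟩
   (b + a') ℤ.⊖ (b + b')
  ≤⟨ ℤ.⊖-monoˡ-≤ (b + b') (ℕ.≤-trans (ℕ.≤-reflexive (ℕ.+-comm b a')) (ℕ.≤-trans l (ℕ.≤-reflexive (ℕ.+-comm a b')))) ⟩
   (b' + a) ℤ.⊖ (b + b')
  ≡⟨ trans (cong ((b' + a) ℤ.⊖_) (ℕ.+-comm b b')) (trans (ℤ.+-cancelˡ-⊖ b' a b) (sym (ℤ.m-n≡m⊖n a b))) ⟩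
   pos a ℤ.- pos b ∎
  where open ℤ.≤-Reasoning

theorem4p3p1 :
 ∀ {n : ℕ} (G : Graph n) → Connected G → (w : Fin n) →
 ∀ {m : ℕ} (H : Graph m) → IsVertexCompression G w H →
 ℶ³ H ℤ.≤ ℶ³ G
theorem4p3p1 {n} G _ w {m} H (W , cs , clique , _ , forced) =
 alternating-≤ {length (solids G)} {length (inducedCycles G)} {∣E∣ G} {n} {length (solids H)} {length (inducedCycles H)} {∣E∣ H} {m}
  (goal (Compression.counts (proj₂ (contractions⇒composite cs)) clique forced))
 where
 goal : (length (solidList H) + length (edgeList H)) + (length (cycleList G) + n) ≤
  (length (solidList G) + length (edgeList G)) + (length (cycleList H) + m) →
  (length (solids H) + ∣E∣ H) + (length (inducedCycles G) + n) ≤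
  (length (solids G) + ∣E∣ G) + (length (inducedCycles H) + m)
 goal = subst id (sym (cong₂ _≤_ (both H G) (both G H)))
  where
  both : ∀ {k l} (K : Graph k) (L : Graph l) → (length (solids K) + ∣E∣ K) + (length (inducedCycles L) + l) ≡
   (length (solidList K) + length (edgeList K)) + (length (cycleList L) + l)
  both {l = l} K L = cong₂ _+_ (cong₂ _+_ (cong length (solids≡ K)) (edges≡ K)) (cong (λ z → length z + l) (cycles≡ L))
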